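{- For all $n,k \in \mathbb{N}$ with $k \ge 2$ and every $\mu \vdash n$, \[ \lim_{q\to\infty} p_{k,\mu}(q) = \lim_{q\to\infty} p^\Box_{k,\mu}(q) = \frac{1}{z_\mu}, \] the limits taken over prime powers $q$.
   Context: For a prime power $q$, the cycle type of $g \in \mathrm{GL}_n\mathbb{F}_q$ is the partition of $n$ formed by the degrees of the irreducible factors (with multiplicity) of its characteristic polynomial, in weakly decreasing order; $\mathcal{T}_\mu(q)$ is the set of elements of cycle type $\mu$, so $\mathcal{T}_{(n)}(q)$ is the set of regular elliptic elements (irreducible characteristic polynomial). $g$ is regular semisimple if its characteristic polynomial has no repeated irreducible factor; $\mathcal{T}^\Box_\mu(q)$ is the set of regular semisimple elements of cycle type $\mu$. Define $p_{k,\mu}(q) = \#\{(t_1,\ldots,t_k)\in\mathcal{T}_{(n)}(q)^k : t_1\cdots t_k \in \mathcal{T}_\mu(q)\} / \#\mathcal{T}_{(n)}(q)^k$ and $p^\Box_{k,\mu}(q) = \#\{(t_1,\ldots,t_k)\in\mathcal{T}_{(n)}(q)^k : t_1\cdots t_k \in \mathcal{T}^\Box_\mu(q)\} / \#\mathcal{T}_{(n)}(q)^k$. $z_\mu = \prod_{i\ge1} i^{m_i(\mu)} m_i(\mu)!$, with $m_i(\mu)$ the multiplicity of $i$ in $\mu$. -}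

module Defs where

open import Level using (0ℓ)
open import Data.Bool using (Bool; true; false; if_then_else_; not; _∧_)
open import Data.Nat as ℕ using (ℕ; zero; suc; _≡ᵇ_; _≤ᵇ_; _≤_; _!; _^_)
open import Data.Fin as Fin using (Fin; punchIn; toℕ)
open import Data.List as List using (List; []; _∷_; [_]; _++_; map; concatMap; foldr; length; upTo; allFin; filterᵇ; reverse)
open import Data.List.Relation.Unary.All using (All)
open import Data.List.Relation.Unary.Unique.Propositional using (Unique)
open import Data.List.Relation.Unary.Linked using (Linked)
open import Data.List.Membership.Propositional using (_∈_)
open import Data.Vec.Functional using () renaming (_∷_ to _∷ᶠ_)
open import Data.Product using (Σ; ∃; _×_; _,_)
open import Data.Integer using (+_)
open import Data.Rational as ℚ using (ℚ; 0ℚ; ∣_∣; _-_)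
open import Relation.Nullary using (¬_; does)
open import Relation.Binary using (DecidableEquality)
open import Relation.Binary.PropositionalEquality using (_≡_)
open import Algebra.Structures using (IsCommutativeRing)
import Data.List.Properties as LP
open import Data.Nat.ListAction using (sum)
open import Data.Bool.ListAction using (all; any)

record FiniteField : Set₁ where
  field
    Carrier  : Set
    _+_ _*_  : Carrier → Carrier → Carrier
    neg      : Carrier → Carrier
    0# 1#    : Carrier
    isCommutativeRing : IsCommutativeRing _≡_ _+_ _*_ neg 0# 1#
    0≢1      : ¬ (0# ≡ 1#)
    inverse  : ∀ x → ¬ (x ≡ 0#) → ∃ λ y → (x * y) ≡ 1#
    _≟_      : DecidableEquality Carrier
    elements : List Carrier
    complete : ∀ x → x ∈ elements
    unique   : Unique elements

  card : ℕ
  card = length elements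

allFuns : {A : Set} (m : ℕ) → List A → List (Fin m → A)
allFuns zero    xs = [ (λ ()) ]
allFuns (suc m) xs = concatMap (λ x → map (λ f → x ∷ᶠ f) (allFuns m xs)) xs

countᵇ : {A : Set} → (A → Bool) → List A → ℕ
countᵇ p xs = length (filterᵇ p xs)

oneTo : ℕ → List ℕ
oneTo n = map suc (upTo n)

isEven : ℕ → Bool
isEven zero          = true
isEven (suc zero)    = false
isEven (suc (suc n)) = isEven n

detWith : {R : Set} → (R → R → R) → (R → R → R) → (R → R) → R → R →
          (n : ℕ) → (Fin n → Fin n → R) → R
detWith _⊕_ _⊗_ neg z o zero    M = o
detWith _⊕_ _⊗_ neg z o (suc n) M =
  foldr (λ j acc → sgn j ((M Fin.zero j) ⊗ detWith _⊕_ _⊗_ neg z o n (λ r c → M (Fin.suc r) (punchIn j c))) ⊕ acc)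
        z (allFin (suc n))
  where
  sgn : Fin (suc n) → _ → _
  sgn j x = if isEven (toℕ j) then x else neg x

IsPartition : ℕ → List ℕ → Set
IsPartition n μ = (sum μ ≡ n) × All (1 ≤_) μ × Linked (λ a b → b ≤ a) μ

mult : ℕ → List ℕ → ℕ
mult i μ = countᵇ (λ x → x ≡ᵇ i) μ

-- z_μ = ∏_{i ≥ 1} i^{m_i} m_i!   (factors with i > sum μ are 1)
z : List ℕ → ℕ
z μ = foldr (λ i acc → (i ^ mult i μ) ℕ.* ((mult i μ) !) ℕ.* acc) 1 (oneTo (sum μ))

-- rational a / b, with the (unused) convention a / 0 = 0
frac : ℕ → ℕ → ℚ
frac a zero    = 0ℚ
frac a (suc b) = (+ a) ℚ./ suc b

module FF (F : FiniteField) where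
  open FiniteField F

  Mat : ℕ → Set
  Mat n = Fin n → Fin n → Carrier

  -- polynomials: coefficient lists, constant term first
  Poly : Set
  Poly = List Carrier

  _⊕_ : Poly → Poly → Poly
  []      ⊕ q       = q
  (a ∷ p) ⊕ []      = a ∷ p
  (a ∷ p) ⊕ (b ∷ q) = (a + b) ∷ (p ⊕ q)

  _⊗_ : Poly → Poly → Poly
  []      ⊗ q = []
  (a ∷ p) ⊗ q = map (a *_) q ⊕ (0# ∷ (p ⊗ q))

  negP : Poly → Poly
  negP = map neg

  _^P_ : Poly → ℕ → Poly
  f ^P zero  = [ 1# ]
  f ^P suc m = f ⊗ (f ^P m)

  strip : Poly → Poly
  strip []      = []
  strip (a ∷ p) = cons a (strip p)
    where
    cons : Carrier → Poly → Poly
    cons a [] = if does (a ≟ 0#) then [] else [ a ]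
    cons a (b ∷ q) = a ∷ b ∷ q

  _≐_ : Poly → Poly → Bool
  p ≐ q = does (LP.≡-dec _≟_ (strip p) (strip q))

  allLists : ℕ → List Poly
  allLists zero    = [ [] ]
  allLists (suc d) = concatMap (λ x → map (x ∷_) (allLists d)) elements

  monics : ℕ → List Poly
  monics d = map (_++ [ 1# ]) (allLists d)

  -- f divides g (for g ≠ 0 a quotient has at most length g coefficients)
  _∣?_ : Poly → Poly → Bool
  f ∣? g = any (λ h → (f ⊗ h) ≐ g) (allLists (length g))

  -- a monic polynomial f of degree d ≥ 1 is irreducible iff no monic
  -- polynomial of degree e with 1 ≤ e < d divides it
  irreducible : ℕ → Poly → Bool
  irreducible d f = all (λ e → all (λ g → not (g ∣? f)) (monics e)) (oneTo (d ℕ.∸ 1))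

  -- multiplicity of f in g, for g of degree ≤ n
  multiplicity : ℕ → Poly → Poly → ℕ
  multiplicity n f g = countᵇ (λ m → (f ^P m) ∣? g) (oneTo n)

  det : (n : ℕ) → Mat n → Carrier
  det = detWith _+_ _*_ neg 0# 1#

  detP : (n : ℕ) → (Fin n → Fin n → Poly) → Poly
  detP = detWith _⊕_ _⊗_ negP [] [ 1# ]

  charpoly : (n : ℕ) → Mat n → Poly
  charpoly n A = detP n (λ i j → (if does (i Fin.≟ j) then 0# ∷ 1# ∷ [] else []) ⊕ negP [ A i j ])

  invertible : (n : ℕ) → Mat n → Bool
  invertible n A = not (does (det n A ≟ 0#))

  allMats : (n : ℕ) → List (Mat n)
  allMats n = allFuns n (allFuns n elements)

  GL : (n : ℕ) → List (Mat n)
  GL n = filterᵇ (invertible n) (allMats n)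

  _·_ : {n : ℕ} → Mat n → Mat n → Mat n
  _·_ {n} A B i j = foldr (λ l acc → (A i l * B l j) + acc) 0# (allFin n)

  I : {n : ℕ} → Mat n
  I i j = if does (i Fin.≟ j) then 1# else 0#

  factorCount : (n : ℕ) → Mat n → ℕ → ℕ
  factorCount n A d =
    sum (map (λ f → if irreducible d f then multiplicity n f (charpoly n A) else 0) (monics d))

  inT : (n : ℕ) → List ℕ → Mat n → Bool
  inT n μ A = invertible n A ∧ all (λ d → factorCount n A d ≡ᵇ mult d μ) (oneTo n)

  regularSemisimple : (n : ℕ) → Mat n → Bool
  regularSemisimple n A =
    all (λ d → all (λ f → not (irreducible d f) Data.Bool.∨ (multiplicity n f (charpoly n A) ≤ᵇ 1)) (monics d)) (oneTo n)

  inT□ : (n : ℕ) → List ℕ → Mat n → Bool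
  inT□ n μ A = inT n μ A ∧ regularSemisimple n A

  elliptic : (n : ℕ) → List (Mat n)
  elliptic n = filterᵇ (inT n [ n ]) (allMats n)

  prodTuple : {n k : ℕ} → (Fin k → Mat n) → Mat n
  prodTuple {n} {k} t = foldr (λ i acc → t i · acc) I (allFin k)

  tuples : (n k : ℕ) → List (Fin k → Mat n)
  tuples n k = allFuns k (elliptic n)

  p : (k : ℕ) (n : ℕ) → List ℕ → ℚ
  p k n μ = frac (countᵇ (λ t → inT n μ (prodTuple t)) (tuples n k)) (length (tuples n k))

  p□ : (k : ℕ) (n : ℕ) → List ℕ → ℚ
  p□ k n μ = frac (countᵇ (λ t → inT□ n μ (prodTuple t)) (tuples n k)) (length (tuples n k))

-- lim_{q → ∞} f(F_q) = L, over finite fields (i.e. over prime powers q)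

LimitAsQ→∞ : (FiniteField → ℚ) → ℚ → Set₁
LimitAsQ→∞ f L = ∀ (ε : ℚ) → 0ℚ ℚ.< ε →
  ∃ λ (Q : ℕ) → ∀ (F : FiniteField) → Q ≤ FiniteField.card F → ∣ f F - L ∣ ℚ.< ε

-- Let T be the set of regular elliptic elements of GL_n, φ = n·1_T − 1, ψ the indicator of a set X of invertible
-- matrices, and H invertible. The deviation n·#{(t , s) ∈ T² : t s H ∈ X} − #T·#X equals Σ φ(t) 1_T(s) ψ(t s H).
-- Replace t by D_v t, where D_v adds to the first row the combination v of the other rows, and average over v:
-- Cauchy–Schwarz removes 1_T and ψ and leaves the autocorrelations Σ_t φ(t) φ(D_u t). For all but a proportion O(1/q)
-- of the matrices t, the first row of t and the first column of its other rows parametrise bijectively the pairs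
-- (charpoly t , charpoly (D_u t)) of monic polynomials with equal constant terms, so the autocorrelations are small
-- because irreducible polynomials are equidistributed over the nonzero constant terms. The exceptional matrices are
-- zeros of a determinant, counted by restricting it to the lines through one matrix where it is 1.
-- Hence t₁ ⋯ t_k is equidistributed, uniformly in t₃ , … , t_k, and #X is found by counting polynomials by
-- factorisation type: if S_μ is the number of monic polynomials of type μ and N_d that of irreducible polynomials of
-- degree d, then m_d(μ) S_μ = N_d S_{μ∖d} + O(q^{n-1}), where d N_d = q^d + O(q^{d-1}).
module Submission where

-- Left multiplication by `D_v` has determinant 1, so it fixes the constant term of the
-- characteristic polynomial; this is why pairs with equal constant terms appear and why irreducible
-- polynomials are counted constant term by constant term. Autocorrelations are controlled only on
-- average over `v`: for `n ≥ 2` the one at `v = 0` is a sum of squares and does not decay.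
-- Cauchy-Schwarz needs one factor `t` to carry the shear, which commutes with right multiplication
-- by `s H`, and a second factor `s` to turn `t s H` into a free variable; this is where `k ≥ 2`
-- enters. It saves a factor `q` on the square of the deviation, so the relative error is of order
-- `q^(-1/2)` and the threshold for `q` is quadratic in the required precision. Implied constants
-- must not depend on the field, so the exceptional matrices are cut out by one integer polynomial
-- determined by `n` alone. Estimates are inequalities with denominators cleared; rational numbers
-- enter only in the last step.

-- Finite sums in a commutative semiring.

module Sums where

  open import Level using (Level)
  open import Algebra.Bundles using (CommutativeSemiring)
  open import Data.Nat using (ℕ; suc)
  open import Data.Fin using (Fin; zero; suc)
  open import Data.List using (List; []; _∷_; _++_; map; concatMap; foldr; allFin)
  open import Data.List.Properties using (map-tabulate)
  open import Data.List.Membership.Propositional using (_∈_)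
  open import Data.List.Relation.Unary.Any using (here; there)
  open import Data.List.Relation.Binary.Permutation.Propositional using (_↭_)
  import Data.List.Relation.Binary.Permutation.Propositional as P
  open import Function using (_∘_; id)
  open import Relation.Binary.PropositionalEquality as ≡ using (_≡_; refl; cong)

  module Sum {c ℓ : Level} (R : CommutativeSemiring c ℓ) where
    open CommutativeSemiring R renaming (Carrier to C) hiding (zero)
    open import Relation.Binary.Reasoning.Setoid setoid
    open import Algebra.Properties.CommutativeSemigroup +-commutativeSemigroup using (interchange; x∙yz≈y∙xz)

    ∑ : {A : Set} → List A → (A → C) → C
    ∑ xs f = foldr (λ x acc → f x + acc) 0# xs

    ∑-cong∈ : {A : Set} (xs : List A) {f g : A → C} → (∀ x → x ∈ xs → f x ≈ g x) → ∑ xs f ≈ ∑ xs g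
    ∑-cong∈ []       e = CommutativeSemiring.refl R
    ∑-cong∈ (x ∷ xs) e = +-cong (e x (here ≡.refl)) (∑-cong∈ xs (λ y y∈ → e y (there y∈)))

    ∑-cong : {A : Set} (xs : List A) {f g : A → C} → (∀ x → f x ≈ g x) → ∑ xs f ≈ ∑ xs g
    ∑-cong xs e = ∑-cong∈ xs (λ x _ → e x)

    ∑-zero : {A : Set} (xs : List A) → ∑ xs (λ _ → 0#) ≈ 0#
    ∑-zero []       = CommutativeSemiring.refl R
    ∑-zero (x ∷ xs) = CommutativeSemiring.trans R (+-identityˡ _) (∑-zero xs)

    ∑-+ : {A : Set} (xs : List A) (f g : A → C) → ∑ xs (λ x → f x + g x) ≈ ∑ xs f + ∑ xs g
    ∑-+ []       f g = CommutativeSemiring.sym R (+-identityˡ _)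
    ∑-+ (x ∷ xs) f g = begin
      (f x + g x) + ∑ xs (λ y → f y + g y) ≈⟨ +-congˡ (∑-+ xs f g) ⟩
      (f x + g x) + (∑ xs f + ∑ xs g)      ≈⟨ interchange _ _ _ _ ⟩
      (f x + ∑ xs f) + (g x + ∑ xs g)      ∎

    ∑-*ˡ : {A : Set} (xs : List A) (a : C) (f : A → C) → ∑ xs (λ x → a * f x) ≈ a * ∑ xs f
    ∑-*ˡ []       a f = CommutativeSemiring.sym R (zeroʳ a)
    ∑-*ˡ (x ∷ xs) a f = begin
      a * f x + ∑ xs (λ y → a * f y) ≈⟨ +-congˡ (∑-*ˡ xs a f) ⟩
      a * f x + a * ∑ xs f           ≈⟨ distribˡ a _ _ ⟨
      a * (f x + ∑ xs f)             ∎

    ∑-*ʳ : {A : Set} (xs : List A) (a : C) (f : A → C) → ∑ xs (λ x → f x * a) ≈ ∑ xs f * a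
    ∑-*ʳ xs a f = begin
      ∑ xs (λ x → f x * a) ≈⟨ ∑-cong xs (λ x → *-comm (f x) a) ⟩
      ∑ xs (λ x → a * f x) ≈⟨ ∑-*ˡ xs a f ⟩
      a * ∑ xs f           ≈⟨ *-comm a _ ⟩
      ∑ xs f * a           ∎

    ∑-swap : {A B : Set} (xs : List A) (ys : List B) (f : A → B → C) →
             ∑ xs (λ x → ∑ ys (f x)) ≈ ∑ ys (λ y → ∑ xs (λ x → f x y))
    ∑-swap []       ys f = CommutativeSemiring.sym R (∑-zero ys)
    ∑-swap (x ∷ xs) ys f = begin
      ∑ ys (f x) + ∑ xs (λ x → ∑ ys (f x))            ≈⟨ +-congˡ (∑-swap xs ys f) ⟩
      ∑ ys (f x) + ∑ ys (λ y → ∑ xs (λ x → f x y))    ≈⟨ ∑-+ ys _ _ ⟨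
      ∑ ys (λ y → f x y + ∑ xs (λ x → f x y))         ∎

    ∑-++ : {A : Set} (xs ys : List A) (f : A → C) → ∑ (xs ++ ys) f ≈ ∑ xs f + ∑ ys f
    ∑-++ []       ys f = CommutativeSemiring.sym R (+-identityˡ _)
    ∑-++ (x ∷ xs) ys f = CommutativeSemiring.trans R (+-congˡ (∑-++ xs ys f)) (CommutativeSemiring.sym R (+-assoc _ _ _))

    ∑-map : {A B : Set} (h : A → B) (xs : List A) (f : B → C) → ∑ (map h xs) f ≡ ∑ xs (f ∘ h)
    ∑-map h []       f = ≡.refl
    ∑-map h (x ∷ xs) f = cong (f (h x) +_) (∑-map h xs f)

    ∑-concatMap : {A B : Set} (h : A → List B) (xs : List A) (f : B → C) →
                  ∑ (concatMap h xs) f ≈ ∑ xs (λ x → ∑ (h x) f)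
    ∑-concatMap h []       f = CommutativeSemiring.refl R
    ∑-concatMap h (x ∷ xs) f = CommutativeSemiring.trans R (∑-++ (h x) (concatMap h xs) f) (+-congˡ (∑-concatMap h xs f))

    ∑-↭ : {A : Set} {xs ys : List A} (f : A → C) → xs ↭ ys → ∑ xs f ≈ ∑ ys f
    ∑-↭ f P.refl          = CommutativeSemiring.refl R
    ∑-↭ f (P.prep x p)    = +-congˡ (∑-↭ f p)
    ∑-↭ f (P.swap x y p)  = CommutativeSemiring.trans R (x∙yz≈y∙xz _ _ _) (+-congˡ (+-congˡ (∑-↭ f p)))
    ∑-↭ f (P.trans p q)   = CommutativeSemiring.trans R (∑-↭ f p) (∑-↭ f q)

    ∑-allFin-suc : (n : ℕ) (f : Fin (suc n) → C) → ∑ (allFin (suc n)) f ≡ f zero + ∑ (allFin n) (f ∘ suc)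
    ∑-allFin-suc n f = cong (f zero +_) (≡.trans (cong (λ l → ∑ l f) (≡.sym (map-tabulate id suc))) (∑-map suc (allFin n) f))

-- Enumerated finite types and change of variables in sums.

module Finite where

  open import Level using (Level)
  open import Algebra.Bundles using (CommutativeSemiring)
  open import Data.Nat using (ℕ; zero; suc; _+_; _*_; _^_; _≤_; z≤n; s≤s)
  import Data.Nat.Properties as ℕₚ
  open import Data.List using (List; []; _∷_; _++_; map; length; cartesianProductWith)
  open import Data.List.Properties using (length-++; length-map)
  open import Data.List.Membership.Propositional using (_∈_)
  open import Data.List.Membership.Propositional.Properties using (∈-map⁺; ∈-map⁻; ∈-∃++; ∈-++⁻; ∈-++⁺ˡ; ∈-++⁺ʳ; ∈-cartesianProductWith⁺)
  open import Data.List.Membership.Propositional.Properties.WithK using (unique∧set⇒bag)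
  open import Data.List.Relation.Binary.BagAndSetEquality using (∼bag⇒↭)
  open import Data.List.Relation.Binary.Permutation.Propositional using (_↭_)
  open import Data.List.Relation.Unary.All as All using ([]; _∷_)
  open import Data.List.Relation.Unary.AllPairs using ([]; _∷_)
  open import Data.List.Relation.Unary.Any using (here; there)
  open import Data.List.Relation.Unary.Unique.Propositional using (Unique)
  open import Data.List.Relation.Unary.Unique.Propositional.Properties using (map⁺; cartesianProductWith⁺)
  open import Data.Product using (∃; _,_)
  open import Data.Sum using (inj₁; inj₂)
  open import Data.Vec as Vec using (Vec; []; _∷_)
  import Data.Vec.Properties as Vecₚ
  open import Function using (_∘_; mk⇔)
  open import Relation.Binary using (DecidableEquality)
  open import Relation.Binary.PropositionalEquality using (_≡_; refl; sym; trans; cong; cong₂; subst)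
  open import Relation.Nullary using (yes; no; contradiction)
  open Sums

  -- A complete list without duplicates is determined up to permutation, so a sum over `list`
  -- depends on the type only. Decidable equality supplies point masses and the pigeonhole
  -- principle.
  record Enum (A : Set) : Set where
    field
      list     : List A
      complete : ∀ x → x ∈ list
      unique   : Unique list
      _≟_      : DecidableEquality A

    size : ℕ
    size = length list

  open Enum

  length-cartesianProductWith : {A B C : Set} (f : A → B → C) (xs : List A) (ys : List B) →
    length (cartesianProductWith f xs ys) ≡ length xs * length ys
  length-cartesianProductWith f []       ys = refl
  length-cartesianProductWith f (x ∷ xs) ys =
    trans (length-++ (map (f x) ys)) (cong₂ _+_ (length-map (f x) ys) (length-cartesianProductWith f xs ys))

  Vecs : {A : Set} → Enum A → (n : ℕ) → Enum (Vec A n)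
  Vecs E zero = record
    { list = [] ∷ [] ; complete = λ { [] → here refl } ; unique = [] ∷ [] ; _≟_ = Vecₚ.≡-dec (_≟_ E) }
  Vecs E (suc n) = record
    { list     = cartesianProductWith _∷_ (list E) (list (Vecs E n))
    ; complete = λ { (x ∷ xs) → ∈-cartesianProductWith⁺ _∷_ (complete E x) (complete (Vecs E n) xs) }
    ; unique   = cartesianProductWith⁺ _∷_ Vecₚ.∷-injective (unique E) (unique (Vecs E n))
    ; _≟_      = Vecₚ.≡-dec (_≟_ E)
    }

  size-Vecs : {A : Set} (E : Enum A) (n : ℕ) → size (Vecs E n) ≡ size E ^ n
  size-Vecs E zero    = refl
  size-Vecs E (suc n) = trans (length-cartesianProductWith _∷_ (list E) (list (Vecs E n))) (cong (size E *_) (size-Vecs E n))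

  -- The head `y` occurs in `xs`; deleting that occurrence keeps the tail of `ys` inside, because
  -- `y` does not recur there.
  unique-⊆⇒length≤ : {A : Set} (ys xs : List A) → Unique ys → (∀ {y} → y ∈ ys → y ∈ xs) → length ys ≤ length xs
  unique-⊆⇒length≤ []       xs _        _ = z≤n
  unique-⊆⇒length≤ (y ∷ ys) xs (y∉ ∷ u) ⊆xs with ∈-∃++ (⊆xs (here refl))
  ... | as , bs , refl = begin
    suc (length ys)              ≤⟨ s≤s (unique-⊆⇒length≤ ys (as ++ bs) u ⊆as++bs) ⟩
    suc (length (as ++ bs))      ≡⟨ cong suc (length-++ as) ⟩
    suc (length as + length bs)  ≡⟨ ℕₚ.+-suc (length as) (length bs) ⟨
    length as + suc (length bs)  ≡⟨ length-++ as ⟨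
    length (as ++ y ∷ bs)        ∎
    where
    open ℕₚ.≤-Reasoning
    ⊆as++bs : ∀ {x} → x ∈ ys → x ∈ as ++ bs
    ⊆as++bs {x} x∈ with ∈-++⁻ as (⊆xs (there x∈))
    ... | inj₁ x∈as         = ∈-++⁺ˡ x∈as
    ... | inj₂ (here refl)  = contradiction refl (All.lookup y∉ x∈)
    ... | inj₂ (there x∈bs) = ∈-++⁺ʳ as x∈bs

  open import Data.List.Membership.DecPropositional using () renaming (_∈?_ to mem?)

  -- Pigeonhole: a missed `b`, put in front of the image list, would give a list without duplicates
  -- that is longer than the enumeration of `B`.
  injective⇒surjective : {A B : Set} (E : Enum A) (E′ : Enum B) → size E ≡ size E′ →
    (σ : A → B) → (∀ {x y} → σ x ≡ σ y → x ≡ y) → ∀ b → ∃ λ a → σ a ≡ b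
  injective⇒surjective E E′ eq σ inj b with mem? (_≟_ E′) b (map σ (list E))
  ... | yes b∈ = let a , _ , e = ∈-map⁻ σ b∈ in a , sym e
  ... | no b∉ = contradiction
    (unique-⊆⇒length≤ (b ∷ map σ (list E)) (list E′)
      (All.tabulate (λ { x∈ refl → b∉ x∈ }) ∷ map⁺ inj (unique E)) (λ {y} _ → complete E′ y))
    (λ le → ℕₚ.1+n≰n (subst (λ l → suc l ≤ size E′) (trans (length-map σ (list E)) eq) le))

  injective⇒↭ : {A B : Set} (E : Enum A) (E′ : Enum B) → size E ≡ size E′ →
    (σ : A → B) → (∀ {x y} → σ x ≡ σ y → x ≡ y) → map σ (list E) ↭ list E′
  injective⇒↭ E E′ eq σ inj = ∼bag⇒↭ (unique∧set⇒bag (map⁺ inj (unique E)) (unique E′)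
    (λ {b} → mk⇔ (λ _ → complete E′ b) (λ _ → mem b)))
    where
    mem : ∀ b → b ∈ map σ (list E)
    mem b with injective⇒surjective E E′ eq σ inj b
    ... | a , refl = ∈-map⁺ σ (complete E a)

  module Reindex {c ℓ : Level} (R : CommutativeSemiring c ℓ) where
    open CommutativeSemiring R renaming (Carrier to C; trans to ≈-trans; sym to ≈-sym) using (_≈_; reflexive; +-cong)
    open Sum R

    ∑-cartesianProductWith : {A B D : Set} (h : A → B → D) (xs : List A) (ys : List B) (f : D → C) →
      ∑ (cartesianProductWith h xs ys) f ≈ ∑ xs (λ x → ∑ ys (λ y → f (h x y)))
    ∑-cartesianProductWith h []       ys f = CommutativeSemiring.refl R
    ∑-cartesianProductWith h (x ∷ xs) ys f = ≈-trans (∑-++ (map (h x) ys) _ f)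
      (+-cong (reflexive (∑-map (h x) ys f)) (∑-cartesianProductWith h xs ys f))

    ∑-Vecs-suc : {A : Set} (E : Enum A) (n : ℕ) (f : Vec A (suc n) → C) →
      ∑ (list (Vecs E (suc n))) f ≈ ∑ (list E) (λ x → ∑ (list (Vecs E n)) (λ v → f (x ∷ v)))
    ∑-Vecs-suc E n = ∑-cartesianProductWith _∷_ (list E) (list (Vecs E n))

    ∑-injective : {A B : Set} (E : Enum A) (E′ : Enum B) → size E ≡ size E′ →
      (σ : A → B) → (∀ {x y} → σ x ≡ σ y → x ≡ y) → (f : B → C) → ∑ (list E) (f ∘ σ) ≈ ∑ (list E′) f
    ∑-injective E E′ eq σ inj f = ≈-trans (reflexive (sym (∑-map σ (list E) f))) (∑-↭ f (injective⇒↭ E E′ eq σ inj))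

    -- A left inverse makes `σ` injective, and finiteness does the rest.
    ∑-bijective : {A : Set} (E : Enum A) (σ τ : A → A) → (∀ x → τ (σ x) ≡ x) → (f : A → C) →
      ∑ (list E) (f ∘ σ) ≈ ∑ (list E) f
    ∑-bijective E σ τ inv = ∑-injective E E refl σ (λ {x} {y} e → trans (sym (inv x)) (trans (cong τ e) (inv y)))

-- Counting with indicator functions.

module Counting where

  open import Data.Bool using (Bool; true; false; if_then_else_; _∧_)
  open import Data.Bool.ListAction using (all; any)
  open import Data.Nat hiding (_≟_)
  open import Data.Nat.Properties hiding (_≟_)
  open import Data.Nat.ListAction using (sum)
  open import Data.List using (List; []; _∷_; map; length; upTo; applyUpTo)
  open import Data.List.Properties using (map-applyUpTo; length-map; length-upTo)
  open import Data.List.Membership.Propositional using (_∈_)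
  open import Data.List.Membership.Propositional.Properties using (∈-map⁺; ∈-map⁻; ∈-upTo⁺; ∈-upTo⁻)
  open import Data.List.Relation.Unary.All as All using ()
  open import Data.List.Relation.Unary.AllPairs using (_∷_)
  open import Data.List.Relation.Unary.Any using (here; there)
  open import Data.List.Relation.Unary.Unique.Propositional using (Unique)
  import Data.List.Relation.Unary.Unique.Propositional.Properties as Uniqueₚ
  open import Data.Product using (∃; _×_; _,_)
  open import Data.Vec using (_∷_)
  open import Function using (_∘_; id)
  open import Relation.Binary.PropositionalEquality using (_≡_; _≢_; refl; sym; trans; cong; cong₂; module ≡-Reasoning)
  open import Relation.Nullary using (does; yes; no; contradiction)
  open import Defs using (countᵇ; oneTo)
  open Sums
  open Finite
  open Enum

  open Sum +-*-commutativeSemiring public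
  open Reindex +-*-commutativeSemiring public

  𝟙 : Bool → ℕ
  𝟙 true  = 1
  𝟙 false = 0

  𝟙≤1 : ∀ b → 𝟙 b ≤ 1
  𝟙≤1 true  = s≤s z≤n
  𝟙≤1 false = z≤n

  𝟙-∧ : ∀ a b → 𝟙 (a ∧ b) ≡ 𝟙 a * 𝟙 b
  𝟙-∧ true  b = sym (+-identityʳ _)
  𝟙-∧ false b = refl

  𝟙-if : ∀ b n → (if b then n else 0) ≡ 𝟙 b * n
  𝟙-if true  n = sym (+-identityʳ n)
  𝟙-if false n = refl

  countᵇ≡∑ : {A : Set} (p : A → Bool) (xs : List A) → countᵇ p xs ≡ ∑ xs (𝟙 ∘ p)
  countᵇ≡∑ p [] = refl
  countᵇ≡∑ p (x ∷ xs) with p x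
  ... | true  = cong suc (countᵇ≡∑ p xs)
  ... | false = countᵇ≡∑ p xs

  sum-map≡∑ : {A : Set} (f : A → ℕ) (xs : List A) → sum (map f xs) ≡ ∑ xs f
  sum-map≡∑ f []       = refl
  sum-map≡∑ f (x ∷ xs) = cong (f x +_) (sum-map≡∑ f xs)

  ∑-mono∈ : {A : Set} (xs : List A) {f g : A → ℕ} → (∀ x → x ∈ xs → f x ≤ g x) → ∑ xs f ≤ ∑ xs g
  ∑-mono∈ []       e = z≤n
  ∑-mono∈ (x ∷ xs) e = +-mono-≤ (e x (here refl)) (∑-mono∈ xs (λ y y∈ → e y (there y∈)))

  ∑-mono : {A : Set} (xs : List A) {f g : A → ℕ} → (∀ x → f x ≤ g x) → ∑ xs f ≤ ∑ xs g
  ∑-mono xs e = ∑-mono∈ xs (λ x _ → e x)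

  ∑-const : {A : Set} (xs : List A) (c : ℕ) → ∑ xs (λ _ → c) ≡ length xs * c
  ∑-const []       c = refl
  ∑-const (x ∷ xs) c = cong (c +_) (∑-const xs c)

  ∑-1 : {A : Set} (xs : List A) → ∑ xs (λ _ → 1) ≡ length xs
  ∑-1 xs = trans (∑-const xs 1) (*-identityʳ _)

  ∑-≡0 : {A : Set} (xs : List A) {f : A → ℕ} → (∀ x → x ∈ xs → f x ≡ 0) → ∑ xs f ≡ 0
  ∑-≡0 xs e = trans (∑-cong∈ xs e) (∑-zero xs)

  ∑-unique : {A : Set} (xs : List A) → Unique xs → (a : A) (f : A → ℕ) → a ∈ xs → (∀ x → x ≢ a → f x ≡ 0) → ∑ xs f ≡ f a
  ∑-unique (x ∷ xs) (x∉ ∷ u) a f (here refl) e =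
    trans (cong (f x +_) (∑-≡0 xs (λ y y∈ → e y (λ y≡x → All.lookup x∉ y∈ (sym y≡x))))) (+-identityʳ _)
  ∑-unique (x ∷ xs) (x∉ ∷ u) a f (there a∈) e =
    cong₂ _+_ (e x (All.lookup x∉ a∈)) (∑-unique xs u a f a∈ e)

  module _ {A : Set} (E : Enum A) where

    ∑-point : (a : A) (f : A → ℕ) → (∀ x → x ≢ a → f x ≡ 0) → ∑ (list E) f ≡ f a
    ∑-point a f = ∑-unique (list E) (unique E) a f (complete E a)

    𝟙-≟-refl : ∀ a → 𝟙 (does (_≟_ E a a)) ≡ 1
    𝟙-≟-refl a with _≟_ E a a
    ... | yes _ = refl
    ... | no ¬p = contradiction refl ¬p

    𝟙-≟-≢ : ∀ {a b} → a ≢ b → 𝟙 (does (_≟_ E a b)) ≡ 0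
    𝟙-≟-≢ {a} {b} ne with _≟_ E a b
    ... | yes e = contradiction e ne
    ... | no _  = refl

    ∑-δ : (a : A) (f : A → ℕ) → ∑ (list E) (λ x → 𝟙 (does (_≟_ E a x)) * f x) ≡ f a
    ∑-δ a f = trans (∑-point a _ (λ x ne → cong (_* f x) (𝟙-≟-≢ (ne ∘ sym)))) (trans (cong (_* f a) (𝟙-≟-refl a)) (*-identityˡ _))

  -- The hypotheses say that the fibre of `σ` over `a` has exactly `𝟙 (χ a)` points. Writing the
  -- indicator as a sum of point masses over `b` and exchanging the sums gives the claim.
  ∑-image : {A B : Set} (E : Enum A) (E′ : Enum B) (σ : B → A) → (∀ {x y} → σ x ≡ σ y → x ≡ y) →
    (χ : A → Bool) → (∀ b → χ (σ b) ≡ true) → (∀ a → χ a ≡ true → ∃ λ b → σ b ≡ a) →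
    (X : A → ℕ) → ∑ (list E) (λ a → 𝟙 (χ a) * X a) ≡ ∑ (list E′) (X ∘ σ)
  ∑-image E E′ σ inj χ into onto X = begin
    ∑ (list E) (λ a → 𝟙 (χ a) * X a)
      ≡⟨ ∑-cong (list E) (λ a → cong (_* X a) (fibre a)) ⟨
    ∑ (list E) (λ a → ∑ (list E′) (λ b → 𝟙 (does (_≟_ E (σ b) a))) * X a)
      ≡⟨ ∑-cong (list E) (λ a → sym (∑-*ʳ (list E′) (X a) _)) ⟩
    ∑ (list E) (λ a → ∑ (list E′) (λ b → 𝟙 (does (_≟_ E (σ b) a)) * X a))
      ≡⟨ ∑-swap (list E) (list E′) _ ⟩
    ∑ (list E′) (λ b → ∑ (list E) (λ a → 𝟙 (does (_≟_ E (σ b) a)) * X a))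
      ≡⟨ ∑-cong (list E′) (λ b → ∑-δ E (σ b) X) ⟩
    ∑ (list E′) (X ∘ σ) ∎
    where
    open ≡-Reasoning
    outside : ∀ a → χ a ≡ false → ∀ b → 𝟙 (does (_≟_ E (σ b) a)) ≡ 0
    outside a χ≡ b = 𝟙-≟-≢ E (λ { refl → contradiction (trans (sym (into b)) χ≡) (λ ()) })
    fibre : ∀ a → ∑ (list E′) (λ b → 𝟙 (does (_≟_ E (σ b) a))) ≡ 𝟙 (χ a)
    fibre a with χ a in χ≡
    ... | false = ∑-≡0 (list E′) (λ b _ → outside a χ≡ b)
    ... | true with onto a χ≡
    ...   | b , refl = trans (∑-point E′ b _ (λ x ne → 𝟙-≟-≢ E (ne ∘ inj))) (𝟙-≟-refl E (σ b))

  all-true : {A : Set} (p : A → Bool) (xs : List A) → all p xs ≡ true → ∀ {x} → x ∈ xs → p x ≡ true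
  all-true p (x ∷ xs) e x∈ with p x in px | x∈
  ... | true  | here refl = px
  ... | true  | there y∈  = all-true p xs e y∈

  all-intro : {A : Set} (p : A → Bool) (xs : List A) → (∀ x → x ∈ xs → p x ≡ true) → all p xs ≡ true
  all-intro p []       e = refl
  all-intro p (x ∷ xs) e rewrite e x (here refl) = all-intro p xs (λ y y∈ → e y (there y∈))

  all-false : {A : Set} (p : A → Bool) (xs : List A) → all p xs ≡ false → ∃ λ x → x ∈ xs × p x ≡ false
  all-false p (x ∷ xs) e with p x in px
  ... | false = x , here refl , px
  ... | true  = let y , y∈ , py = all-false p xs e in y , there y∈ , py

  any-intro : {A : Set} (p : A → Bool) (xs : List A) → ∀ {x} → x ∈ xs → p x ≡ true → any p xs ≡ true
  any-intro p (x ∷ xs) (here refl) e rewrite e = refl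
  any-intro p (x ∷ xs) (there x∈) e with p x
  ... | true  = refl
  ... | false = any-intro p xs x∈ e

  any-true : {A : Set} (p : A → Bool) (xs : List A) → any p xs ≡ true → ∃ λ x → x ∈ xs × p x ≡ true
  any-true p (x ∷ xs) e with p x in px
  ... | true  = x , here refl , px
  ... | false = let y , y∈ , py = any-true p xs e in y , there y∈ , py

  all-cong : {A : Set} {p p′ : A → Bool} (xs : List A) → (∀ x → p x ≡ p′ x) → all p xs ≡ all p′ xs
  all-cong []       e = refl
  all-cong (x ∷ xs) e = cong₂ _∧_ (e x) (all-cong xs e)

  ∈-oneTo⁺ : ∀ {m n} → 1 ≤ m → m ≤ n → m ∈ oneTo n
  ∈-oneTo⁺ {suc m} (s≤s z≤n) (s≤s m≤n) = ∈-map⁺ suc (∈-upTo⁺ (s≤s m≤n))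

  ∈-oneTo⁻ : ∀ {m n} → m ∈ oneTo n → 1 ≤ m × m ≤ n
  ∈-oneTo⁻ m∈ with ∈-map⁻ suc m∈
  ... | k , k∈ , refl = s≤s z≤n , ∈-upTo⁻ k∈

  length-oneTo : ∀ n → length (oneTo n) ≡ n
  length-oneTo n = trans (length-map suc (upTo n)) (length-upTo n)

  ∑-oneTo-suc : ∀ n (f : ℕ → ℕ) → ∑ (oneTo (suc n)) f ≡ f 1 + ∑ (oneTo n) (f ∘ suc)
  ∑-oneTo-suc n f = cong (f 1 +_) (trans (cong (λ l → ∑ l f) lists) (∑-map suc (oneTo n) f))
    where
    lists : map suc (applyUpTo suc n) ≡ map suc (oneTo n)
    lists = cong (map suc) (sym (map-applyUpTo id suc n))

  ∑-oneTo-snoc : ∀ n (f : ℕ → ℕ) → ∑ (oneTo (suc n)) f ≡ ∑ (oneTo n) f + f (suc n)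
  ∑-oneTo-snoc zero    f = +-identityʳ (f 1)
  ∑-oneTo-snoc (suc n) f = trans (∑-oneTo-suc (suc n) f) (trans (cong (f 1 +_) (∑-oneTo-snoc n (f ∘ suc)))
    (trans (sym (+-assoc (f 1) _ _)) (cong (_+ f (suc (suc n))) (sym (∑-oneTo-suc n f)))))

  -- Allows the cutoff in a valuation to change: powers of too large a degree divide nothing and
  -- contribute zero.
  ∑-oneTo-extend : ∀ n k (f : ℕ → ℕ) → (∀ m → n < m → f m ≡ 0) → ∑ (oneTo (k + n)) f ≡ ∑ (oneTo n) f
  ∑-oneTo-extend n zero    f e = refl
  ∑-oneTo-extend n (suc k) f e = trans (∑-oneTo-snoc (k + n) f)
    (trans (cong₂ _+_ (∑-oneTo-extend n k f e) (e (suc (k + n)) (s≤s (m≤n+m n k)))) (+-identityʳ _))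

  Unique-oneTo : ∀ n → Unique (oneTo n)
  Unique-oneTo n = Uniqueₚ.map⁺ suc-injective
    (Uniqueₚ.upTo⁺ n)

-- The polynomial ring over a finite field.

module Polynomials where

  open import Level using (0ℓ)
  open import Algebra.Bundles using (CommutativeRing; CommutativeSemigroup)
  open import Data.Nat as ℕ using (ℕ; zero; suc)
  open import Data.List using ([]; _∷_; [_]; map)
  open import Data.Product using (_,_)
  open import Relation.Binary using (IsEquivalence; Setoid)
  open import Relation.Binary.PropositionalEquality as ≡ using (_≡_; cong; cong₂)
  open import Defs

  module Poly (F : FiniteField) where
    open FiniteField F
    open FF F using (Poly; _⊕_; _⊗_; negP; _^P_)

    𝔽 : CommutativeRing 0ℓ 0ℓ
    𝔽 = record { isCommutativeRing = isCommutativeRing }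

    module 𝔽 = CommutativeRing 𝔽
    open 𝔽 using (+-comm; +-assoc; +-identityˡ; +-identityʳ; *-comm; *-assoc; zeroˡ; zeroʳ; distribˡ; distribʳ; -‿inverseˡ; -‿inverseʳ; *-identityˡ; *-identityʳ)

    coeff : Poly → ℕ → Carrier
    coeff []      k       = 0#
    coeff (a ∷ p) zero    = a
    coeff (a ∷ p) (suc k) = coeff p k

    infix 4 _≈_
    -- Coefficient lists that differ by trailing zeros represent the same polynomial. The record
    -- keeps `p` and `q` recoverable from the type, which the unfolded statement about `coeff` would
    -- not.
    record _≈_ (p q : Poly) : Set where
      constructor mk
      field at : ∀ k → coeff p k ≡ coeff q k
    open _≈_ public

    ≈-isEquivalence : IsEquivalence _≈_
    ≈-isEquivalence = record
      { refl  = mk (λ _ → ≡.refl)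
      ; sym   = λ e → mk (λ k → ≡.sym (at e k))
      ; trans = λ e f → mk (λ k → ≡.trans (at e k) (at f k))
      }

    ≈-setoid : Setoid 0ℓ 0ℓ
    ≈-setoid = record { isEquivalence = ≈-isEquivalence }

    open IsEquivalence ≈-isEquivalence renaming (refl to ≈-refl; sym to ≈-sym; trans to ≈-trans) public
    open import Relation.Binary.Reasoning.Setoid ≈-setoid

    scale : Carrier → Poly → Poly
    scale a = map (a *_)

    ∷-cong : ∀ {a b p q} → a ≡ b → p ≈ q → a ∷ p ≈ b ∷ q
    ∷-cong e f = mk λ { zero → e ; (suc k) → at f k }

    0∷[]≈[] : ∀ {a p} → a ≡ 0# → p ≈ [] → a ∷ p ≈ []
    0∷[]≈[] e f = mk λ { zero → e ; (suc k) → at f k }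

    tail-≈ : ∀ {a b p q} → a ∷ p ≈ b ∷ q → p ≈ q
    tail-≈ e = mk λ k → at e (suc k)

    tail-≈[] : ∀ {a p} → a ∷ p ≈ [] → p ≈ []
    tail-≈[] e = mk λ k → at e (suc k)

    coeff-⊕ : ∀ p q k → coeff (p ⊕ q) k ≡ coeff p k + coeff q k
    coeff-⊕ []      q       k       = ≡.sym (+-identityˡ _)
    coeff-⊕ (a ∷ p) []      k       = ≡.sym (+-identityʳ _)
    coeff-⊕ (a ∷ p) (b ∷ q) zero    = ≡.refl
    coeff-⊕ (a ∷ p) (b ∷ q) (suc k) = coeff-⊕ p q k

    coeff-scale : ∀ a p k → coeff (scale a p) k ≡ a * coeff p k
    coeff-scale a []      k       = ≡.sym (zeroʳ a)
    coeff-scale a (b ∷ p) zero    = ≡.refl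
    coeff-scale a (b ∷ p) (suc k) = coeff-scale a p k

    coeff-negP : ∀ p k → coeff (negP p) k ≡ neg (coeff p k)
    coeff-negP []      k       = ≡.trans (≡.sym (-‿inverseʳ 0#)) (+-identityˡ (neg 0#))
    coeff-negP (b ∷ p) zero    = ≡.refl
    coeff-negP (b ∷ p) (suc k) = coeff-negP p k

    ⊕-cong : ∀ {p p′ q q′} → p ≈ p′ → q ≈ q′ → p ⊕ q ≈ p′ ⊕ q′
    ⊕-cong {p} {p′} {q} {q′} e f = mk λ k →
      ≡.trans (coeff-⊕ p q k) (≡.trans (cong₂ _+_ (at e k) (at f k)) (≡.sym (coeff-⊕ p′ q′ k)))

    ⊕-assoc : ∀ p q r → (p ⊕ q) ⊕ r ≈ p ⊕ (q ⊕ r)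
    ⊕-assoc p q r = mk λ k → ≡.trans (coeff-⊕ (p ⊕ q) r k) (≡.trans (cong (_+ coeff r k) (coeff-⊕ p q k))
      (≡.trans (+-assoc _ _ _) (≡.sym (≡.trans (coeff-⊕ p (q ⊕ r) k) (cong (coeff p k +_) (coeff-⊕ q r k))))))

    ⊕-comm : ∀ p q → p ⊕ q ≈ q ⊕ p
    ⊕-comm p q = mk λ k → ≡.trans (coeff-⊕ p q k) (≡.trans (+-comm _ _) (≡.sym (coeff-⊕ q p k)))

    ⊕-identityˡ : ∀ p → [] ⊕ p ≈ p
    ⊕-identityˡ p = ≈-refl

    ⊕-identityʳ : ∀ p → p ⊕ [] ≈ p
    ⊕-identityʳ p = ⊕-comm p []

    negP-cong : ∀ {p q} → p ≈ q → negP p ≈ negP q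
    negP-cong {p} {q} e = mk λ k → ≡.trans (coeff-negP p k) (≡.trans (cong neg (at e k)) (≡.sym (coeff-negP q k)))

    ⊕-inverseʳ : ∀ p → p ⊕ negP p ≈ []
    ⊕-inverseʳ p = mk λ k → ≡.trans (coeff-⊕ p (negP p) k) (≡.trans (cong (coeff p k +_) (coeff-negP p k)) (-‿inverseʳ _))

    ⊕-inverseˡ : ∀ p → negP p ⊕ p ≈ []
    ⊕-inverseˡ p = ≈-trans (⊕-comm (negP p) p) (⊕-inverseʳ p)

    ⊕-commutativeSemigroup : CommutativeSemigroup 0ℓ 0ℓ
    ⊕-commutativeSemigroup = record
      { _∙_ = _⊕_
      ; isCommutativeSemigroup = record
        { isSemigroup = record { isMagma = record { isEquivalence = ≈-isEquivalence ; ∙-cong = ⊕-cong } ; assoc = ⊕-assoc }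
        ; comm = ⊕-comm } }

    open import Algebra.Properties.CommutativeSemigroup ⊕-commutativeSemigroup using (interchange; x∙yz≈y∙xz)

    scale-cong : ∀ {a b p q} → a ≡ b → p ≈ q → scale a p ≈ scale b q
    scale-cong {a} {b} {p} {q} e f = mk λ k →
      ≡.trans (coeff-scale a p k) (≡.trans (cong₂ _*_ e (at f k)) (≡.sym (coeff-scale b q k)))

    scale-⊕ : ∀ a p q → scale a (p ⊕ q) ≈ scale a p ⊕ scale a q
    scale-⊕ a p q = mk λ k → ≡.trans (coeff-scale a (p ⊕ q) k) (≡.trans (cong (a *_) (coeff-⊕ p q k))
      (≡.trans (distribˡ _ _ _) (≡.sym (≡.trans (coeff-⊕ (scale a p) (scale a q) k) (cong₂ _+_ (coeff-scale a p k) (coeff-scale a q k))))))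

    scale-+ : ∀ a b p → scale (a + b) p ≈ scale a p ⊕ scale b p
    scale-+ a b p = mk λ k → ≡.trans (coeff-scale (a + b) p k) (≡.trans (distribʳ _ _ _)
      (≡.sym (≡.trans (coeff-⊕ (scale a p) (scale b p) k) (cong₂ _+_ (coeff-scale a p k) (coeff-scale b p k)))))

    scale-scale : ∀ a b p → scale a (scale b p) ≈ scale (a * b) p
    scale-scale a b p = mk λ k → ≡.trans (coeff-scale a (scale b p) k) (≡.trans (cong (a *_) (coeff-scale b p k))
      (≡.trans (≡.sym (*-assoc _ _ _)) (≡.sym (coeff-scale (a * b) p k))))

    scale-0 : ∀ p → scale 0# p ≈ []
    scale-0 p = mk λ k → ≡.trans (coeff-scale 0# p k) (zeroˡ _)

    scale-1 : ∀ p → scale 1# p ≈ p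
    scale-1 p = mk λ k → ≡.trans (coeff-scale 1# p k) (*-identityˡ _)

    0∷-⊕ : ∀ p q → 0# ∷ (p ⊕ q) ≈ (0# ∷ p) ⊕ (0# ∷ q)
    0∷-⊕ p q = ∷-cong (≡.sym (+-identityˡ 0#)) ≈-refl

    ⊗-zeroʳ : ∀ p → p ⊗ [] ≈ []
    ⊗-zeroʳ []      = ≈-refl
    ⊗-zeroʳ (a ∷ p) = 0∷[]≈[] ≡.refl (⊗-zeroʳ p)

    ⊗-congʳ : ∀ p {q q′} → q ≈ q′ → p ⊗ q ≈ p ⊗ q′
    ⊗-congʳ []      e = ≈-refl
    ⊗-congʳ (a ∷ p) e = ⊕-cong (scale-cong ≡.refl e) (∷-cong ≡.refl (⊗-congʳ p e))

    -- Mirror image of the recursion defining `_⊗_`, which runs over the left factor; commutativity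
    -- is the comparison of the two recursions.
    ⊗-∷ʳ : ∀ p b q → p ⊗ (b ∷ q) ≈ scale b p ⊕ (0# ∷ (p ⊗ q))
    ⊗-∷ʳ []      b q = ≈-sym (0∷[]≈[] ≡.refl ≈-refl)
    ⊗-∷ʳ (a ∷ p) b q = ∷-cong (cong (_+ 0#) (*-comm a b))
      (≈-trans (⊕-cong {p = scale a q} ≈-refl (⊗-∷ʳ p b q)) (x∙yz≈y∙xz (scale a q) (scale b p) (0# ∷ (p ⊗ q))))

    ⊗-comm : ∀ p q → p ⊗ q ≈ q ⊗ p
    ⊗-comm []      q = ≈-sym (⊗-zeroʳ q)
    ⊗-comm (a ∷ p) q = ≈-trans (⊕-cong ≈-refl (∷-cong ≡.refl (⊗-comm p q))) (≈-sym (⊗-∷ʳ q a p))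

    ⊗-cong : ∀ {p p′ q q′} → p ≈ p′ → q ≈ q′ → p ⊗ q ≈ p′ ⊗ q′
    ⊗-cong {p} {p′} {q} {q′} e f = begin
      p ⊗ q   ≈⟨ ⊗-congʳ p f ⟩
      p ⊗ q′  ≈⟨ ⊗-comm p q′ ⟩
      q′ ⊗ p  ≈⟨ ⊗-congʳ q′ e ⟩
      q′ ⊗ p′ ≈⟨ ⊗-comm q′ p′ ⟩
      p′ ⊗ q′ ∎

    ⊗-congˡ : ∀ q {p p′} → p ≈ p′ → p ⊗ q ≈ p′ ⊗ q
    ⊗-congˡ q {p} {p′} e = ⊗-cong {p} {p′} {q} {q} e ≈-refl

    ⊗-distribʳ : ∀ r p q → (p ⊕ q) ⊗ r ≈ (p ⊗ r) ⊕ (q ⊗ r)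
    ⊗-distribʳ r []      q       = ≈-refl
    ⊗-distribʳ r (a ∷ p) []      = ≈-sym (⊕-identityʳ _)
    ⊗-distribʳ r (a ∷ p) (b ∷ q) = begin
      scale (a + b) r ⊕ (0# ∷ ((p ⊕ q) ⊗ r))
        ≈⟨ ⊕-cong (scale-+ a b r) (≈-trans (∷-cong ≡.refl (⊗-distribʳ r p q)) (0∷-⊕ (p ⊗ r) (q ⊗ r))) ⟩
      (scale a r ⊕ scale b r) ⊕ ((0# ∷ (p ⊗ r)) ⊕ (0# ∷ (q ⊗ r)))
        ≈⟨ interchange (scale a r) (scale b r) (0# ∷ (p ⊗ r)) (0# ∷ (q ⊗ r)) ⟩
      (scale a r ⊕ (0# ∷ (p ⊗ r))) ⊕ (scale b r ⊕ (0# ∷ (q ⊗ r))) ∎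

    ⊗-distribˡ : ∀ r p q → r ⊗ (p ⊕ q) ≈ (r ⊗ p) ⊕ (r ⊗ q)
    ⊗-distribˡ r p q = begin
      r ⊗ (p ⊕ q)       ≈⟨ ⊗-comm r (p ⊕ q) ⟩
      (p ⊕ q) ⊗ r       ≈⟨ ⊗-distribʳ r p q ⟩
      (p ⊗ r) ⊕ (q ⊗ r) ≈⟨ ⊕-cong (⊗-comm p r) (⊗-comm q r) ⟩
      (r ⊗ p) ⊕ (r ⊗ q) ∎

    scale-⊗ : ∀ a p q → scale a p ⊗ q ≈ scale a (p ⊗ q)
    scale-⊗ a []      q = ≈-refl
    scale-⊗ a (b ∷ p) q = begin
      scale (a * b) q ⊕ (0# ∷ (scale a p ⊗ q))
        ≈⟨ ⊕-cong (≈-sym (scale-scale a b q)) (∷-cong (≡.sym (zeroʳ a)) (scale-⊗ a p q)) ⟩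
      scale a (scale b q) ⊕ scale a (0# ∷ (p ⊗ q))  ≈⟨ scale-⊕ a (scale b q) (0# ∷ (p ⊗ q)) ⟨
      scale a (scale b q ⊕ (0# ∷ (p ⊗ q)))          ∎

    0∷-⊗ : ∀ p q → (0# ∷ p) ⊗ q ≈ 0# ∷ (p ⊗ q)
    0∷-⊗ p q = ⊕-cong (scale-0 q) ≈-refl

    ⊗-assoc : ∀ p q r → (p ⊗ q) ⊗ r ≈ p ⊗ (q ⊗ r)
    ⊗-assoc []      q r = ≈-refl
    ⊗-assoc (a ∷ p) q r = begin
      (scale a q ⊕ (0# ∷ (p ⊗ q))) ⊗ r          ≈⟨ ⊗-distribʳ r (scale a q) (0# ∷ (p ⊗ q)) ⟩
      (scale a q ⊗ r) ⊕ ((0# ∷ (p ⊗ q)) ⊗ r)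
        ≈⟨ ⊕-cong (scale-⊗ a q r) (≈-trans (0∷-⊗ (p ⊗ q) r) (∷-cong ≡.refl (⊗-assoc p q r))) ⟩
      scale a (q ⊗ r) ⊕ (0# ∷ (p ⊗ (q ⊗ r)))    ∎

    ⊗-identityˡ : ∀ p → [ 1# ] ⊗ p ≈ p
    ⊗-identityˡ p = ≈-trans (⊕-cong (scale-1 p) (0∷[]≈[] ≡.refl ≈-refl)) (⊕-identityʳ p)

    ⊗-identityʳ : ∀ p → p ⊗ [ 1# ] ≈ p
    ⊗-identityʳ p = ≈-trans (⊗-comm p [ 1# ]) (⊗-identityˡ p)

    𝔽[X] : CommutativeRing 0ℓ 0ℓ
    𝔽[X] = record
      { Carrier = Poly ; _≈_ = _≈_ ; _+_ = _⊕_ ; _*_ = _⊗_ ; -_ = negP ; 0# = [] ; 1# = [ 1# ]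
      ; isCommutativeRing = record
        { isRing = record
          { +-isAbelianGroup = record
            { isGroup = record
              { isMonoid = record
                { isSemigroup = record
                  { isMagma = record { isEquivalence = ≈-isEquivalence ; ∙-cong = ⊕-cong }
                  ; assoc = ⊕-assoc }
                ; identity = ⊕-identityˡ , ⊕-identityʳ }
              ; inverse = ⊕-inverseˡ , ⊕-inverseʳ
              ; ⁻¹-cong = negP-cong }
            ; comm = ⊕-comm }
          ; *-cong = ⊗-cong
          ; *-assoc = ⊗-assoc
          ; *-identity = ⊗-identityˡ , ⊗-identityʳ
          ; distrib = ⊗-distribˡ , ⊗-distribʳ }
        ; *-comm = ⊗-comm } }

-- Determinants over a commutative ring.

module Determinants where

  open import Level using (0ℓ)
  open import Algebra.Bundles using (CommutativeRing)
  open import Data.Bool using (true; false; if_then_else_; not)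
  open import Data.Nat using (ℕ; zero; suc)
  open import Data.Fin as Fin using (Fin; zero; suc; punchIn; toℕ)
  open import Data.Fin.Properties using (suc-injective)
  open import Data.List using (List; []; _∷_; allFin)
  open import Function using (_∘_)
  open import Relation.Binary.PropositionalEquality as ≡ using (_≡_; _≢_; cong)
  open import Relation.Nullary using (does; yes; no; contradiction)
  open import Defs
  open Sums

  isEven-suc : ∀ n → isEven (suc n) ≡ not (isEven n)
  isEven-suc zero          = ≡.refl
  isEven-suc (suc zero)    = ≡.refl
  isEven-suc (suc (suc n)) = isEven-suc n

  upd : {A : Set} {n : ℕ} → Fin n → A → (Fin n → A) → Fin n → A
  upd zero    w M zero    = w
  upd zero    w M (suc r) = M (suc r)
  upd (suc i) w M zero    = M zero
  upd (suc i) w M (suc r) = upd i w (M ∘ suc) r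

  upd-at : {A : Set} {n : ℕ} (i : Fin n) (w : A) (M : Fin n → A) → upd i w M i ≡ w
  upd-at zero    w M = ≡.refl
  upd-at (suc i) w M = upd-at i w (M ∘ suc)

  upd-other : {A : Set} {n : ℕ} (i k : Fin n) (w : A) (M : Fin n → A) → k ≢ i → upd i w M k ≡ M k
  upd-other zero    zero    w M ne = contradiction ≡.refl ne
  upd-other zero    (suc k) w M ne = ≡.refl
  upd-other (suc i) zero    w M ne = ≡.refl
  upd-other (suc i) (suc k) w M ne = upd-other i k w (M ∘ suc) (ne ∘ cong suc)

  upd-self : {A : Set} {n : ℕ} (i : Fin n) (M : Fin n → A) → ∀ r → upd i (M i) M r ≡ M r
  upd-self zero    M zero    = ≡.refl
  upd-self zero    M (suc r) = ≡.refl
  upd-self (suc i) M zero    = ≡.refl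
  upd-self (suc i) M (suc r) = upd-self i (M ∘ suc) r

  upd-map : {A B : Set} {n : ℕ} (h : A → B) (i : Fin n) (w : A) (M : Fin n → A) →
            ∀ r → h (upd i w M r) ≡ upd i (h w) (h ∘ M) r
  upd-map h zero    w M zero    = ≡.refl
  upd-map h zero    w M (suc r) = ≡.refl
  upd-map h (suc i) w M zero    = ≡.refl
  upd-map h (suc i) w M (suc r) = upd-map h i w (M ∘ suc) r

  upd-upd : {A : Set} {n : ℕ} (i k : Fin n) (x y : A) (M : Fin n → A) → k ≢ i →
            ∀ r → upd i x (upd k y M) r ≡ upd k y (upd i x M) r
  upd-upd zero    zero    x y M ne r       = contradiction ≡.refl ne
  upd-upd zero    (suc k) x y M ne zero    = ≡.refl
  upd-upd zero    (suc k) x y M ne (suc r) = ≡.refl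
  upd-upd (suc i) zero    x y M ne zero    = ≡.refl
  upd-upd (suc i) zero    x y M ne (suc r) = ≡.refl
  upd-upd (suc i) (suc k) x y M ne zero    = ≡.refl
  upd-upd (suc i) (suc k) x y M ne (suc r) = upd-upd i k x y (M ∘ suc) (ne ∘ cong suc) r

  module Det (R : CommutativeRing 0ℓ 0ℓ) where
    open CommutativeRing R renaming (Carrier to C) hiding (zero)
    open import Algebra.Properties.Ring ring using (-‿distribˡ-*; -‿distribʳ-*; -‿involutive; -0#≈0#; -‿+-comm)
    open import Algebra.Properties.Group +-group using (inverseʳ-unique)
    open import Relation.Binary.Reasoning.Setoid setoid
    open Sum commutativeSemiring

    det : (n : ℕ) → (Fin n → Fin n → C) → C
    det = detWith _+_ _*_ -_ 0# 1#

    sg : ℕ → C → C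
    sg j x = if isEven j then x else - x

    sg-cong : ∀ j {x y} → x ≈ y → sg j x ≈ sg j y
    sg-cong j e with isEven j
    ... | true  = e
    ... | false = -‿cong e

    sg-suc : ∀ j x → sg (suc j) x ≈ - sg j x
    sg-suc j x rewrite isEven-suc j with isEven j
    ... | true  = refl
    ... | false = sym (-‿involutive x)

    sg-* : ∀ j a x → a * sg j x ≈ sg j (a * x)
    sg-* j a x with isEven j
    ... | true  = refl
    ... | false = sym (-‿distribʳ-* a x)

    sg-+ : ∀ j x y → sg j (x + y) ≈ sg j x + sg j y
    sg-+ j x y with isEven j
    ... | true  = refl
    ... | false = sym (-‿+-comm x y)

    sg-0 : ∀ j → sg j 0# ≈ 0#
    sg-0 j with isEven j
    ... | true  = refl
    ... | false = -0#≈0#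

    sg-zero : ∀ j {x} → x ≈ 0# → sg j x ≈ 0#
    sg-zero j e = trans (sg-cong j e) (sg-0 j)

    sg-comm : ∀ j k x → sg j (sg k x) ≈ sg k (sg j x)
    sg-comm j k x with isEven j | isEven k
    ... | true  | true  = refl
    ... | true  | false = refl
    ... | false | true  = refl
    ... | false | false = refl

    sg-∑ : {A : Set} (xs : List A) (j : ℕ) (f : A → C) → sg j (∑ xs f) ≈ ∑ xs (λ x → sg j (f x))
    sg-∑ []       j f = sg-0 j
    sg-∑ (x ∷ xs) j f = trans (sg-+ j _ _) (+-congˡ (sg-∑ xs j f))

    ∑-≈0 : {A : Set} (xs : List A) {f : A → C} → (∀ x → f x ≈ 0#) → ∑ xs f ≈ 0#
    ∑-≈0 xs e = trans (∑-cong xs e) (∑-zero xs)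

    ∑-single : (n : ℕ) (j : Fin n) (f : Fin n → C) → (∀ i → i ≢ j → f i ≈ 0#) → ∑ (allFin n) f ≈ f j
    ∑-single (suc n) zero f e = trans (reflexive (∑-allFin-suc n f))
      (trans (+-congˡ (∑-≈0 (allFin n) (λ i → e (suc i) (λ ())))) (+-identityʳ _))
    ∑-single (suc n) (suc j) f e = trans (reflexive (∑-allFin-suc n f))
      (trans (+-cong (e zero (λ ())) (∑-single n j (f ∘ suc) (λ i ne → e (suc i) (ne ∘ suc-injective)))) (+-identityˡ _))

    det-cong : ∀ n {M N : Fin n → Fin n → C} → (∀ i j → M i j ≈ N i j) → det n M ≈ det n N
    det-cong zero    e = refl
    det-cong (suc n) e = ∑-cong (allFin (suc n)) (λ j → sg-cong (toℕ j)
      (*-cong (e zero j) (det-cong n (λ r c → e (suc r) (punchIn j c)))))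

    -- Apart from the common corner term, both expansions become double sums over the minors `D i j`
    -- with rows 0, `suc i` and columns 0, `suc j` deleted. Induction expands each row minor along
    -- its first column, and `rearrange` reconciles the signs.
    det-expandColumn : ∀ n (M : Fin (suc n) → Fin (suc n) → C) →
      det (suc n) M ≈ ∑ (allFin (suc n)) (λ i → sg (toℕ i) (M i zero * det n (λ r c → M (punchIn i r) (suc c))))
    det-expandColumn zero    M = refl
    det-expandColumn (suc n) M = begin
      det (suc (suc n)) M ≈⟨ reflexive (∑-allFin-suc (suc n) rowTerm) ⟩
      rowTerm zero + ∑ (allFin (suc n)) (rowTerm ∘ suc) ≈⟨ +-congˡ tails ⟩
      colTerm zero + ∑ (allFin (suc n)) (colTerm ∘ suc) ≈⟨ reflexive (∑-allFin-suc (suc n) colTerm) ⟨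
      ∑ (allFin (suc (suc n))) colTerm ∎
      where
      rowTerm colTerm : Fin (suc (suc n)) → C
      rowTerm j = sg (toℕ j) (M zero j * det (suc n) (λ r c → M (suc r) (punchIn j c)))
      colTerm i = sg (toℕ i) (M i zero * det (suc n) (λ r c → M (punchIn i r) (suc c)))
      D : Fin (suc n) → Fin (suc n) → C
      D i j = det n (λ r c → M (suc (punchIn i r)) (suc (punchIn j c)))
      rearrange : ∀ i j a b d → sg (suc j) (a * sg i (b * d)) ≈ sg (suc i) (b * sg j (a * d))
      rearrange i j a b d = begin
        sg (suc j) (a * sg i (b * d))  ≈⟨ sg-cong (suc j) (sg-* i a _) ⟩
        sg (suc j) (sg i (a * (b * d))) ≈⟨ sg-suc j _ ⟩
        - sg j (sg i (a * (b * d)))    ≈⟨ -‿cong (sg-comm j i _) ⟩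
        - sg i (sg j (a * (b * d)))    ≈⟨ -‿cong (sg-cong i (sg-cong j (trans (sym (*-assoc a b d)) (trans (*-congʳ (*-comm a b)) (*-assoc b a d))))) ⟩
        - sg i (sg j (b * (a * d)))    ≈⟨ sg-suc i _ ⟨
        sg (suc i) (sg j (b * (a * d))) ≈⟨ sg-cong (suc i) (sg-* j b _) ⟨
        sg (suc i) (b * sg j (a * d))  ∎
      tails : ∑ (allFin (suc n)) (rowTerm ∘ suc) ≈ ∑ (allFin (suc n)) (colTerm ∘ suc)
      tails = begin
        ∑ (allFin (suc n)) (rowTerm ∘ suc)
          ≈⟨ ∑-cong (allFin (suc n)) (λ j → trans
               (sg-cong (suc (toℕ j)) (trans (*-congˡ (det-expandColumn n (λ r c → M (suc r) (punchIn (suc j) c)))) (sym (∑-*ˡ (allFin (suc n)) _ _))))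
               (sg-∑ (allFin (suc n)) (suc (toℕ j)) _)) ⟩
        ∑ (allFin (suc n)) (λ j → ∑ (allFin (suc n)) (λ i → sg (suc (toℕ j)) (M zero (suc j) * sg (toℕ i) (M (suc i) zero * D i j))))
          ≈⟨ ∑-swap (allFin (suc n)) (allFin (suc n)) _ ⟩
        ∑ (allFin (suc n)) (λ i → ∑ (allFin (suc n)) (λ j → sg (suc (toℕ j)) (M zero (suc j) * sg (toℕ i) (M (suc i) zero * D i j))))
          ≈⟨ ∑-cong (allFin (suc n)) (λ i → trans
               (∑-cong (allFin (suc n)) (λ j → rearrange (toℕ i) (toℕ j) (M zero (suc j)) (M (suc i) zero) (D i j)))
               (trans (sym (sg-∑ (allFin (suc n)) (suc (toℕ i)) _)) (sg-cong (suc (toℕ i)) (∑-*ˡ (allFin (suc n)) _ _)))) ⟩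
        ∑ (allFin (suc n)) (colTerm ∘ suc) ∎

    det-transpose : ∀ n (M : Fin n → Fin n → C) → det n (λ i j → M j i) ≈ det n M
    det-transpose zero    M = refl
    det-transpose (suc n) M = trans
      (∑-cong (allFin (suc n)) (λ j → sg-cong (toℕ j) (*-congˡ (det-transpose n (λ r c → M (punchIn j r) (suc c))))))
      (sym (det-expandColumn n M))

    record IsLinear {m : ℕ} (f : (Fin m → C) → C) : Set where
      field
        lin-cong : ∀ {u v} → (∀ c → u c ≈ v c) → f u ≈ f v
        lin-+    : ∀ u v → f (λ c → u c + v c) ≈ f u + f v
        lin-*    : ∀ a u → f (λ c → a * u c) ≈ a * f u

      lin-0 : f (λ _ → 0#) ≈ 0#
      lin-0 = trans (lin-cong (λ c → sym (zeroˡ 0#))) (trans (lin-* 0# (λ _ → 0#)) (zeroˡ _))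

      lin-neg : ∀ u → f (λ c → - u c) ≈ - f u
      lin-neg u = inverseʳ-unique (f u) _ (trans (sym (lin-+ u (λ c → - u c))) (trans (lin-cong (λ c → -‿inverseʳ (u c))) lin-0))

      lin-∑ : {A : Set} (xs : List A) (a : A → C) (u : A → Fin m → C) →
              f (λ c → ∑ xs (λ x → a x * u x c)) ≈ ∑ xs (λ x → a x * f (u x))
      lin-∑ []       a u = lin-0
      lin-∑ (x ∷ xs) a u = trans (lin-+ (λ c → a x * u x c) _) (+-cong (lin-* (a x) (u x)) (lin-∑ xs a u))
    open IsLinear public

    det-linear : ∀ n (i : Fin n) (M : Fin n → Fin n → C) → IsLinear (λ w → det n (upd i w M))
    det-linear (suc n) zero M = record
      { lin-cong = λ e → ∑-cong (allFin (suc n)) (λ j → sg-cong (toℕ j) (*-congʳ (e j)))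
      ; lin-+ = λ u v → trans
          (∑-cong (allFin (suc n)) (λ j → trans (sg-cong (toℕ j) (distribʳ _ (u j) (v j))) (sg-+ (toℕ j) _ _)))
          (∑-+ (allFin (suc n)) _ _)
      ; lin-* = λ a u → trans
          (∑-cong (allFin (suc n)) (λ j → trans (sg-cong (toℕ j) (*-assoc a (u j) _)) (sym (sg-* (toℕ j) a _))))
          (∑-*ˡ (allFin (suc n)) a _)
      }
    det-linear (suc n) (suc i) M = record
      { lin-cong = λ e → ∑-cong (allFin (suc n)) (λ j → sg-cong (toℕ j) (*-congˡ
          (trans (minor≈ j _) (trans (lin-cong (L j) (λ c → e (punchIn j c))) (sym (minor≈ j _))))))
      ; lin-+ = λ u v → trans
          (∑-cong (allFin (suc n)) (λ j → trans (sg-cong (toℕ j) (trans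
             (*-congˡ (trans (minor≈ j _) (trans (lin-+ (L j) (u ∘ punchIn j) (v ∘ punchIn j)) (sym (+-cong (minor≈ j u) (minor≈ j v))))))
             (distribˡ (M zero j) _ _))) (sg-+ (toℕ j) _ _)))
          (∑-+ (allFin (suc n)) _ _)
      ; lin-* = λ a u → trans
          (∑-cong (allFin (suc n)) (λ j → trans (sg-cong (toℕ j) (trans
             (*-congˡ (trans (minor≈ j _) (trans (lin-* (L j) a (u ∘ punchIn j)) (*-congˡ (sym (minor≈ j u))))))
             (trans (sym (*-assoc (M zero j) a _)) (trans (*-congʳ (*-comm (M zero j) a)) (*-assoc a (M zero j) _)))))
             (sym (sg-* (toℕ j) a _))))
          (∑-*ˡ (allFin (suc n)) a _)
      }
      where
      minorM : Fin (suc n) → Fin n → Fin n → C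
      minorM j r c = M (suc r) (punchIn j c)
      L : ∀ j → IsLinear (λ w → det n (upd i w (minorM j)))
      L j = det-linear n i (minorM j)
      minor≈ : ∀ j w → det n (λ r c → upd i w (M ∘ suc) r (punchIn j c)) ≈ det n (upd i (w ∘ punchIn j) (minorM j))
      minor≈ j w = det-cong n (λ r c → reflexive (cong (λ g → g c) (upd-map (_∘ punchIn j) i w (M ∘ suc) r)))

    det-alternating : ∀ n (M : Fin n → Fin n → C) (i k : Fin n) → i ≢ k → (∀ c → M i c ≈ M k c) → det n M ≈ 0#
    -- Expand along the first column: the first two terms have equal entries and equal minors but
    -- opposite signs, and every other minor still contains both equal rows.
    det-alternating₀₁ : ∀ n (M : Fin (suc (suc n)) → Fin (suc (suc n)) → C) →
      (∀ c → M zero c ≈ M (suc zero) c) → det (suc (suc n)) M ≈ 0#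
    -- Equal rows 0 and `k + 2` are brought together by polarisation. As a function `g` of rows 1
    -- and `k + 2` the determinant is bilinear and vanishes on the diagonal by the case of smaller
    -- size, hence is antisymmetric; exchanging these two rows produces a matrix whose rows 0 and 1
    -- agree.
    det-alternating₀ : ∀ n (M : Fin (suc n) → Fin (suc n) → C) (k : Fin n) →
      (∀ c → M zero c ≈ M (suc k) c) → det (suc n) M ≈ 0#

    det-alternating (suc n) M zero    zero    ne e = contradiction ≡.refl ne
    det-alternating (suc n) M zero    (suc k) ne e = det-alternating₀ n M k e
    det-alternating (suc n) M (suc i) zero    ne e = det-alternating₀ n M i (λ c → sym (e c))
    det-alternating (suc n) M (suc i) (suc k) ne e = ∑-≈0 (allFin (suc n)) (λ j → sg-zero (toℕ j)
      (trans (*-congˡ (det-alternating n (λ r c → M (suc r) (punchIn j c)) i k (ne ∘ cong suc) (λ c → e (punchIn j c)))) (zeroʳ _)))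

    det-alternating₀₁ n M e = begin
      det (suc (suc n)) M ≈⟨ det-expandColumn (suc n) M ⟩
      ∑ (allFin (suc (suc n))) t ≈⟨ reflexive (∑-allFin-suc (suc n) t) ⟩
      t zero + ∑ (allFin (suc n)) (t ∘ suc) ≈⟨ +-congˡ (reflexive (∑-allFin-suc n (λ i → t (suc i)))) ⟩
      t zero + (t (suc zero) + ∑ (allFin n) (λ i → t (suc (suc i)))) ≈⟨ +-congˡ (+-congˡ (∑-≈0 (allFin n) (rest n M e))) ⟩
      t zero + (t (suc zero) + 0#) ≈⟨ +-congˡ (+-identityʳ _) ⟩
      t zero + t (suc zero)
        ≈⟨ +-congˡ (-‿cong (*-cong (sym (e zero)) (det-cong (suc n) {λ r c → M (punchIn (suc zero) r) (suc c)} {λ r c → M (suc r) (suc c)}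
             (λ { zero c → e (suc c) ; (suc r) c → refl })))) ⟩
      t zero + - t zero ≈⟨ -‿inverseʳ _ ⟩
      0# ∎
      where
      t : Fin (suc (suc n)) → C
      t i = sg (toℕ i) (M i zero * det (suc n) (λ r c → M (punchIn i r) (suc c)))
      rest : ∀ n (M : Fin (suc (suc n)) → Fin (suc (suc n)) → C) → (∀ c → M zero c ≈ M (suc zero) c) → (i : Fin n) →
        sg (toℕ (suc (suc i))) (M (suc (suc i)) zero * det (suc n) (λ r c → M (punchIn (suc (suc i)) r) (suc c))) ≈ 0#
      rest (suc n) M e i = sg-zero (toℕ (suc (suc i)))
        (trans (*-congˡ (det-alternating₀₁ n (λ r c → M (punchIn (suc (suc i)) r) (suc c)) (λ c → e (suc c)))) (zeroʳ _))

    det-alternating₀ (suc n) M zero    e = det-alternating₀₁ n M e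
    det-alternating₀ (suc n) M (suc k) e = begin
      det (suc (suc n)) M        ≈⟨ sym (+-identityʳ _) ⟩
      det (suc (suc n)) M + 0#   ≈⟨ +-cong restore (sym g-swapped) ⟩
      g w u + g u w              ≈⟨ antisymmetric ⟩
      0#                         ∎
      where
      u w : Fin (suc (suc n)) → C
      u = M zero
      w = M (suc zero)
      one k+2 : Fin (suc (suc n))
      one = suc zero
      k+2 = suc (suc k)
      g : (x y : Fin (suc (suc n)) → C) → C
      g x y = det (suc (suc n)) (upd k+2 y (upd one x M))
      right : ∀ x → IsLinear (g x)
      right x = det-linear (suc (suc n)) k+2 (upd one x M)
      flip : ∀ x y → g x y ≈ det (suc (suc n)) (upd one x (upd k+2 y M))
      flip x y = det-cong (suc (suc n)) (λ r c → reflexive (cong (λ h → h c) (upd-upd k+2 one y x M (λ ()) r)))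
      left-+ : ∀ x x′ y → g (λ c → x c + x′ c) y ≈ g x y + g x′ y
      left-+ x x′ y = trans (flip (λ c → x c + x′ c) y) (trans (lin-+ (det-linear (suc (suc n)) one (upd k+2 y M)) x x′) (sym (+-cong (flip x y) (flip x′ y))))
      g-diag : ∀ x → g x x ≈ 0#
      g-diag x = ∑-≈0 (allFin (suc (suc n))) (λ j → sg-zero (toℕ j)
        (trans (*-congˡ (det-alternating₀ n (λ r c → upd k+2 x (upd one x M) (suc r) (punchIn j c)) k
          (λ c → sym (reflexive (cong (λ h → h (punchIn j c)) (upd-at k+2 x (upd one x M))))))) (zeroʳ _)))
      g-swapped : g u w ≈ 0#
      g-swapped = det-alternating₀₁ n (upd k+2 w (upd one u M)) (λ c → refl)
      antisymmetric : g w u + g u w ≈ 0#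
      antisymmetric = begin
        g w u + g u w                        ≈⟨ +-cong (sym (+-identityˡ _)) (sym (+-identityʳ _)) ⟩
        (0# + g w u) + (g u w + 0#)          ≈⟨ +-cong (+-congʳ (sym (g-diag w))) (+-congˡ (sym (g-diag u))) ⟩
        (g w w + g w u) + (g u w + g u u)    ≈⟨ +-cong (lin-+ (right w) w u) (lin-+ (right u) w u) ⟨
        g w (λ c → w c + u c) + g u (λ c → w c + u c) ≈⟨ left-+ w u (λ c → w c + u c) ⟨
        g (λ c → w c + u c) (λ c → w c + u c) ≈⟨ g-diag (λ c → w c + u c) ⟩
        0# ∎
      restore : det (suc (suc n)) M ≈ g w u
      restore = det-cong (suc (suc n)) lemma
        where
        at-k+2 : ∀ {r : Fin (suc (suc n))} → r ≡ k+2 → ∀ c → M r c ≈ upd k+2 u (upd one w M) r c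
        at-k+2 ≡.refl c = trans (sym (e c)) (sym (reflexive (cong (λ h → h c) (upd-at k+2 u (upd one w M)))))
        lemma : ∀ r c → M r c ≈ upd k+2 u (upd one w M) r c
        lemma r c with r Fin.≟ k+2
        ... | yes r≡ = at-k+2 r≡ c
        ... | no r≢  = reflexive (cong (λ h → h c) (≡.sym (≡.trans (upd-other k+2 r u (upd one w M) r≢) (upd-self one M r))))

    -- Once row `j` is replaced by the combination, linearity leaves one determinant per `i`, and
    -- all but `i = j` have a repeated row.
    det-rowCombination : ∀ n (j : Fin n) (M : Fin n → Fin n → C) (a : Fin n → C) →
      det n (upd j (λ c → ∑ (allFin n) (λ i → a i * M i c)) M) ≈ a j * det n M
    det-rowCombination n j M a = begin
      det n (upd j (λ c → ∑ (allFin n) (λ i → a i * M i c)) M) ≈⟨ lin-∑ (det-linear n j M) (allFin n) a M ⟩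
      ∑ (allFin n) (λ i → a i * det n (upd j (M i) M)) ≈⟨ ∑-single n j _ off-diagonal ⟩
      a j * det n (upd j (M j) M) ≈⟨ *-congˡ (det-cong n (λ r c → reflexive (cong (λ h → h c) (upd-self j M r)))) ⟩
      a j * det n M ∎
      where
      off-diagonal : ∀ i → i ≢ j → a i * det n (upd j (M i) M) ≈ 0#
      off-diagonal i ne = trans (*-congˡ (det-alternating n (upd j (M i) M) i j ne
        (λ c → reflexive (cong (λ h → h c) (≡.trans (upd-other j i (M i) M ne) (≡.sym (upd-at j (M i) M))))))) (zeroʳ _)

    -- Replacing row `j` by a vanishing combination gives determinant zero, which by
    -- `det-rowCombination` is `a j * det n M`. It takes the place of the adjugate matrix in both
    -- later proofs of injectivity.
    det-injective : ∀ n (M : Fin n → Fin n → C) (a : Fin n → C) →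
      (∀ c → ∑ (allFin n) (λ i → a i * M i c) ≈ 0#) → ∀ j → a j * det n M ≈ 0#
    det-injective n M a e j = trans (sym (det-rowCombination n j M a))
      (trans (lin-cong (det-linear n j M) e) (lin-0 (det-linear n j M)))

    identity : {n : ℕ} → Fin n → Fin n → C
    identity i j = if does (i Fin.≟ j) then 1# else 0#

    identity-off : ∀ {n} (i j : Fin n) → i ≢ j → identity i j ≡ 0#
    identity-off i j ne with i Fin.≟ j
    ... | yes i≡j = contradiction i≡j ne
    ... | no _    = ≡.refl

    identity-diag : ∀ {n} (i : Fin n) → identity i i ≡ 1#
    identity-diag i with i Fin.≟ i
    ... | yes _  = ≡.refl
    ... | no i≢i = contradiction ≡.refl i≢i

    det-identity : ∀ n → det n identity ≈ 1#
    det-identity zero    = refl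
    det-identity (suc n) = begin
      det (suc n) identity ≈⟨ ∑-single (suc n) zero _ off ⟩
      1# * det n identity ≈⟨ *-identityˡ _ ⟩
      det n identity ≈⟨ det-identity n ⟩
      1# ∎
      where
      off : ∀ j → j ≢ zero → sg (toℕ j) (identity {suc n} zero j * det n (λ r c → identity (suc r) (punchIn j c))) ≈ 0#
      off j ne = sg-zero (toℕ j) (trans (*-congʳ (reflexive (identity-off zero j (ne ∘ ≡.sym)))) (zeroˡ _))

    det-neg : ∀ n (M : Fin n → Fin n → C) → det n (λ i j → - M i j) ≈ sg n (det n M)
    det-neg zero    M = refl
    det-neg (suc n) M = begin
      ∑ (allFin (suc n)) (λ j → sg (toℕ j) (- M zero j * det n (λ r c → - M (suc r) (punchIn j c))))
        ≈⟨ ∑-cong (allFin (suc n)) (λ j → trans (sg-cong (toℕ j) (begin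
             - M zero j * det n (λ r c → - M (suc r) (punchIn j c)) ≈⟨ *-congˡ (det-neg n _) ⟩
             - M zero j * sg n (D j)    ≈⟨ -‿distribˡ-* _ _ ⟨
             - (M zero j * sg n (D j))  ≈⟨ -‿cong (sg-* n _ _) ⟩
             - sg n (M zero j * D j)    ≈⟨ sg-suc n _ ⟨
             sg (suc n) (M zero j * D j) ∎)) (sg-comm (toℕ j) (suc n) _)) ⟩
      ∑ (allFin (suc n)) (λ j → sg (suc n) (sg (toℕ j) (M zero j * D j))) ≈⟨ sg-∑ (allFin (suc n)) (suc n) _ ⟨
      sg (suc n) (det (suc n) M) ∎
      where
      D : Fin (suc n) → C
      D j = det n (λ r c → M (suc r) (punchIn j c))

-- Degrees, monic polynomials and division with remainder.

module Degrees where

  open import Algebra.Bundles using (CommutativeRing)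
  open import Data.Bool using (true; false)
  open import Data.Nat as ℕ using (ℕ; zero; suc; _≤_; _<_; z≤n; s≤s)
  import Data.Nat.Properties as ℕₚ
  open import Data.List using (List; []; _∷_; [_]; _++_; map; concat; concatMap; length; cartesianProductWith)
  open import Data.List.Properties using (map-concatMap; map-∘; map-cong; ≡-dec)
  open import Data.List.Membership.Propositional using (_∈_)
  open import Data.List.Membership.Propositional.Properties using (∈-map⁺)
  open import Data.Product using (∃; ∃₂; _×_; _,_)
  open import Data.Sum using (_⊎_; inj₁; inj₂)
  open import Data.Vec using (Vec; []; _∷_; toList)
  open import Relation.Binary using (tri<; tri≈; tri>)
  open import Relation.Binary.PropositionalEquality as ≡ using (_≡_; refl; sym; trans; cong; cong₂; subst)
  open import Relation.Nullary using (¬_; yes; no; contradiction)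
  open import Defs
  open Finite
  open Counting using (any-intro; any-true)
  open Polynomials

  concatMap≡cartesianProductWith : {A B C : Set} (f : A → B → C) (xs : List A) (ys : List B) →
    concatMap (λ x → map (f x) ys) xs ≡ cartesianProductWith f xs ys
  concatMap≡cartesianProductWith f []       ys = refl
  concatMap≡cartesianProductWith f (x ∷ xs) ys = cong (map (f x) ys ++_) (concatMap≡cartesianProductWith f xs ys)

  module Degree (F : FiniteField) where
    open FiniteField F
    open FF F using (Poly; _⊕_; _⊗_; negP; _^P_; strip; _≐_; allLists; monics; _∣?_)
    open Poly F
    open 𝔽 using (zeroˡ; zeroʳ; +-identityˡ; +-identityʳ; *-identityˡ; *-comm; *-assoc; -‿inverseʳ)
    open import Relation.Binary.Reasoning.Setoid ≈-setoid
    open import Algebra.Properties.CommutativeSemigroup ⊕-commutativeSemigroup using (interchange)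

    -- Degree below `n`, kept as a bound: the zero polynomial needs no special case and trailing
    -- zeros do no harm.
    Vanish : Poly → ℕ → Set
    Vanish p n = ∀ k → n ≤ k → coeff p k ≡ 0#

    record Monic (p : Poly) (n : ℕ) : Set where
      constructor monic
      field
        lead   : coeff p n ≡ 1#
        vanish : Vanish p (suc n)
    open Monic public

    Vanish-cong : ∀ {p q n} → p ≈ q → Vanish p n → Vanish q n
    Vanish-cong e v k le = trans (sym (at e k)) (v k le)

    Monic-cong : ∀ {p q n} → p ≈ q → Monic p n → Monic q n
    Monic-cong e (monic l v) = monic (trans (sym (at e _)) l) (Vanish-cong e v)

    Vanish-0 : ∀ {p} → Vanish p 0 → p ≈ []
    Vanish-0 v = mk (λ k → v k z≤n)

    Vanish-[] : ∀ {p n} → p ≈ [] → Vanish p n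
    Vanish-[] e k _ = at e k

    Vanish-length : ∀ p → Vanish p (length p)
    Vanish-length []      k le = refl
    Vanish-length (a ∷ p) (suc k) (s≤s le) = Vanish-length p k le

    Vanish-weaken : ∀ p {m n} → m ≤ n → Vanish p m → Vanish p n
    Vanish-weaken p m≤n v k n≤k = v k (ℕₚ.≤-trans m≤n n≤k)

    Vanish-⊕ : ∀ p q {n} → Vanish p n → Vanish q n → Vanish (p ⊕ q) n
    Vanish-⊕ p q v w k le = trans (coeff-⊕ p q k) (trans (cong₂ _+_ (v k le) (w k le)) (+-identityˡ 0#))

    Vanish-scale : ∀ a p {n} → Vanish p n → Vanish (scale a p) n
    Vanish-scale a p v k le = trans (coeff-scale a p k) (trans (cong (a *_) (v k le)) (zeroʳ a))

    neg-0 : neg 0# ≡ 0#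
    neg-0 = trans (sym (+-identityˡ _)) (-‿inverseʳ 0#)

    Vanish-neg : ∀ p {n} → Vanish p n → Vanish (negP p) n
    Vanish-neg p v k le = trans (coeff-negP p k) (trans (cong neg (v k le)) neg-0)

    Vanish-lower : ∀ p {n} → Vanish p (suc n) → coeff p n ≡ 0# → Vanish p n
    Vanish-lower p {n} v e k le with n ℕ.≟ k
    ... | yes refl = e
    ... | no ne    = v k (ℕₚ.≤∧≢⇒< le ne)

    Vanish-∷ : ∀ {a p n} → Vanish p n → Vanish (a ∷ p) (suc n)
    Vanish-∷ v (suc k) (s≤s le) = v k le

    constant-⊗ : ∀ c {p} q → p ≈ [] → (c ∷ p) ⊗ q ≈ scale c q
    constant-⊗ c q e = ≈-trans (⊕-cong ≈-refl (0∷[]≈[] refl (⊗-congˡ q e))) (⊕-identityʳ (scale c q))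

    coeff-⊗-top : ∀ p q a b → Vanish p (suc a) → Vanish q (suc b) → coeff (p ⊗ q) (a ℕ.+ b) ≡ coeff p a * coeff q b
    coeff-⊗-top []      q a       b v w = sym (zeroˡ _)
    coeff-⊗-top (c ∷ p) q zero    b v w = trans (at (constant-⊗ c {p} q (mk (λ k → v (suc k) (s≤s z≤n)))) b) (coeff-scale c q b)
    coeff-⊗-top (c ∷ p) q (suc a) b v w = trans (coeff-⊕ (scale c q) (0# ∷ (p ⊗ q)) (suc (a ℕ.+ b)))
      (trans (cong₂ _+_ (Vanish-scale c q w (suc (a ℕ.+ b)) (s≤s (ℕₚ.m≤n+m b a)))
                        (coeff-⊗-top p q a b (λ k le → v (suc k) (s≤s le)) w))
             (+-identityˡ _))

    Vanish-⊗ : ∀ p q a b → Vanish p (suc a) → Vanish q (suc b) → Vanish (p ⊗ q) (suc (a ℕ.+ b))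
    Vanish-⊗ []      q a       b v w k le = refl
    Vanish-⊗ (c ∷ p) q zero    b v w k le =
      trans (at (constant-⊗ c {p} q (mk (λ k → v (suc k) (s≤s z≤n)))) k) (Vanish-scale c q w k le)
    Vanish-⊗ (c ∷ p) q (suc a) b v w (suc k) (s≤s le) = trans (coeff-⊕ (scale c q) (0# ∷ (p ⊗ q)) (suc k))
      (trans (cong₂ _+_ (Vanish-scale c q w (suc k) (s≤s (ℕₚ.≤-trans (ℕₚ.m≤n+m b (suc a)) le)))
                        (Vanish-⊗ p q a b (λ k le → v (suc k) (s≤s le)) w k le))
             (+-identityˡ _))

    Monic-⊗ : ∀ {p q a b} → Monic p a → Monic q b → Monic (p ⊗ q) (a ℕ.+ b)
    Monic-⊗ {p} {q} {a} {b} (monic l v) (monic m w) = monic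
      (trans (coeff-⊗-top p q a b v w) (trans (cong₂ _*_ l m) (*-identityˡ 1#)))
      (Vanish-⊗ p q a b v w)

    Monic-1 : Monic [ 1# ] 0
    Monic-1 = monic refl (λ { (suc k) _ → refl })

    Monic-0⇒≈1 : ∀ {p} → Monic p 0 → p ≈ [ 1# ]
    Monic-0⇒≈1 (monic l v) = mk λ { zero → l ; (suc k) → v (suc k) (s≤s z≤n) }

    Monic-^ : ∀ {p d} m → Monic p d → Monic (p ^P m) (m ℕ.* d)
    Monic-^ zero    M = Monic-1
    Monic-^ (suc m) M = Monic-⊗ M (Monic-^ m M)

    Monic⇒≉0 : ∀ {p n} → Monic p n → ¬ p ≈ []
    Monic⇒≉0 (monic l v) e = 0≢1 (trans (sym (at e _)) l)

    Monic-unique : ∀ {p m n} → Monic p m → Monic p n → m ≡ n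
    Monic-unique {p} {m} {n} (monic l v) (monic l′ v′) with ℕₚ.<-cmp m n
    ... | tri< m<n _ _ = contradiction (trans (sym (v n m<n)) l′) 0≢1
    ... | tri≈ _ e _   = e
    ... | tri> _ _ n<m = contradiction (trans (sym (v′ m n<m)) l) 0≢1

    coeffs : ∀ n → Poly → Vec Carrier n
    coeffs zero    p       = []
    coeffs (suc n) []      = 0# ∷ coeffs n []
    coeffs (suc n) (a ∷ p) = a ∷ coeffs n p

    coeffs-[] : ∀ n → toList (coeffs n []) ≈ []
    coeffs-[] zero    = ≈-refl
    coeffs-[] (suc n) = 0∷[]≈[] refl (coeffs-[] n)

    toList-coeffs : ∀ n p → Vanish p n → toList (coeffs n p) ≈ p
    toList-coeffs zero    p       v = ≈-sym (Vanish-0 v)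
    toList-coeffs (suc n) []      v = coeffs-[] (suc n)
    toList-coeffs (suc n) (a ∷ p) v = ∷-cong refl (toList-coeffs n p (λ k le → v (suc k) (s≤s le)))

    coeffs-cong : ∀ n {p q} → p ≈ q → coeffs n p ≡ coeffs n q
    coeffs-cong zero    e = refl
    coeffs-cong (suc n) {[]}    {[]}    e = refl
    coeffs-cong (suc n) {[]}    {b ∷ q} e = cong₂ _∷_ (at e 0) (coeffs-cong n (≈-sym (tail-≈[] (≈-sym e))))
    coeffs-cong (suc n) {a ∷ p} {[]}    e = cong₂ _∷_ (at e 0) (coeffs-cong n (tail-≈[] e))
    coeffs-cong (suc n) {a ∷ p} {b ∷ q} e = cong₂ _∷_ (at e 0) (coeffs-cong n (tail-≈ e))

    coeffs-++ : ∀ n (v : Vec Carrier n) q → coeffs n (toList v ++ q) ≡ v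
    coeffs-++ zero    []      q = refl
    coeffs-++ (suc n) (a ∷ v) q = cong (a ∷_) (coeffs-++ n v q)

    -- The vector holds the lower coefficients, so vectors of length `n` enumerate the monic
    -- polynomials of degree `n` without repetition.
    mon : ∀ {n} → Vec Carrier n → Poly
    mon v = toList v ++ [ 1# ]

    Monic-mon : ∀ {n} (v : Vec Carrier n) → Monic (mon v) n
    Monic-mon []      = Monic-1
    Monic-mon (a ∷ v) = let monic l w = Monic-mon v in monic l (Vanish-∷ w)

    mon-coeffs : ∀ {n p} → Monic p n → mon (coeffs n p) ≈ p
    mon-coeffs {zero}  {p}     M = ≈-sym (Monic-0⇒≈1 M)
    mon-coeffs {suc n} {[]}    (monic l _) = contradiction l 0≢1
    mon-coeffs {suc n} {a ∷ p} (monic l v) = ∷-cong refl (mon-coeffs (monic l (λ k le → v (suc k) (s≤s le))))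

    coeffs-mon : ∀ {n} (v : Vec Carrier n) → coeffs n (mon v) ≡ v
    coeffs-mon v = coeffs-++ _ v [ 1# ]

    mon-injective : ∀ {n} {u v : Vec Carrier n} → mon u ≈ mon v → u ≡ v
    mon-injective {n} {u} {v} e = trans (sym (coeffs-mon u)) (trans (coeffs-cong n e) (coeffs-mon v))

    𝔼 : Enum Carrier
    𝔼 = record { list = elements ; complete = complete ; unique = unique ; _≟_ = _≟_ }

    -- Ties the lists used in the definitions to enumerated vectors, over which sums can be
    -- reindexed.
    allLists≡ : ∀ n → allLists n ≡ map toList (Enum.list (Vecs 𝔼 n))
    allLists≡ zero    = refl
    allLists≡ (suc n) rewrite allLists≡ n = trans
      (cong concat (map-cong (λ x → trans (sym (map-∘ vs)) (map-∘ vs)) elements))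
      (trans (sym (map-concatMap toList (λ x → map (x ∷_) vs) elements))
             (cong (map toList) (concatMap≡cartesianProductWith _∷_ elements vs)))
      where
      vs = Enum.list (Vecs 𝔼 n)

    monics≡ : ∀ n → monics n ≡ map mon (Enum.list (Vecs 𝔼 n))
    monics≡ n = trans (cong (map (_++ [ 1# ])) (allLists≡ n)) (sym (map-∘ (Enum.list (Vecs 𝔼 n))))

    strip-≈ : ∀ p → strip p ≈ p
    strip-≈ []      = ≈-refl
    strip-≈ (a ∷ p) with strip p | strip-≈ p
    ... | b ∷ q | e = ∷-cong refl e
    ... | []    | e with a ≟ 0#
    ...   | yes a≡0 = ≈-sym (0∷[]≈[] a≡0 (≈-sym e))
    ...   | no _    = ∷-cong refl e

    strip-[] : ∀ p → p ≈ [] → strip p ≡ []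
    strip-[] []      e = refl
    strip-[] (a ∷ p) e with strip p | strip-[] p (tail-≈[] e)
    ... | .[] | refl with a ≟ 0#
    ...   | yes _  = refl
    ...   | no a≢0 = contradiction (at e 0) a≢0

    strip-cong : ∀ p q → p ≈ q → strip p ≡ strip q
    strip-cong []      q       e = sym (strip-[] q (≈-sym e))
    strip-cong (a ∷ p) []      e = strip-[] (a ∷ p) e
    strip-cong (a ∷ p) (b ∷ q) e with strip p | strip q | strip-cong p q (tail-≈ e) | at e 0
    ... | []    | .[]      | refl | refl = refl
    ... | c ∷ r | .(c ∷ r) | refl | refl = refl

    ≐⇒≈ : ∀ p q → (p ≐ q) ≡ true → p ≈ q
    ≐⇒≈ p q e with ≡-dec _≟_ (strip p) (strip q)
    ... | yes s = ≈-trans (≈-sym (strip-≈ p)) (subst (_≈ q) (sym s) (strip-≈ q))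
    ... | no _ with () ← e

    ≈⇒≐ : ∀ p q → p ≈ q → (p ≐ q) ≡ true
    ≈⇒≐ p q e with ≡-dec _≟_ (strip p) (strip q)
    ... | yes _ = refl
    ... | no ¬s = contradiction (strip-cong p q e) ¬s

    infix 4 _∣_
    record _∣_ (f g : Poly) : Set where
      constructor divides
      field
        quotient : Poly
        equality : f ⊗ quotient ≈ g

    -- The bound given by the length of `h` is lowered one step at a time: as `f` is monic, the top
    -- coefficient of `h` is also a coefficient of `f ⊗ h`, and that one vanishes.
    Vanish-quotient : ∀ {f d} h m → Monic f d → Vanish (f ⊗ h) (d ℕ.+ m) → Vanish h m
    Vanish-quotient {f} {d} h m M v = descend (length h) (Vanish-weaken h (ℕₚ.m≤m+n (length h) m) (Vanish-length h))
      where
      descend : ∀ j → Vanish h (j ℕ.+ m) → Vanish h m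
      descend zero    w = w
      descend (suc j) w = descend j (Vanish-lower h w (trans (sym (*-identityˡ _)) (trans (cong (_* coeff h (j ℕ.+ m)) (sym (lead M)))
        (trans (sym (coeff-⊗-top f h d (j ℕ.+ m) (vanish M) w)) (v (d ℕ.+ (j ℕ.+ m)) (ℕₚ.+-monoʳ-≤ d (ℕₚ.m≤n+m m j)))))))

    ⊗≈[]⇒≈[] : ∀ {f d h} → Monic f d → f ⊗ h ≈ [] → h ≈ []
    ⊗≈[]⇒≈[] {h = h} M e = Vanish-0 (Vanish-quotient h 0 M (Vanish-[] e))

    open import Algebra.Properties.Ring (CommutativeRing.ring 𝔽[X]) public
      using (-‿distribʳ-*; -‿distribˡ-*; x∙y⁻¹≈ε⇒x≈y)

    ⊗-cancelˡ : ∀ {f d h h′} → Monic f d → f ⊗ h ≈ f ⊗ h′ → h ≈ h′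
    ⊗-cancelˡ {f} {d} {h} {h′} M e = x∙y⁻¹≈ε⇒x≈y h h′ (⊗≈[]⇒≈[] M (begin
      f ⊗ (h ⊕ negP h′)         ≈⟨ ⊗-distribˡ f h (negP h′) ⟩
      (f ⊗ h) ⊕ (f ⊗ negP h′)   ≈⟨ ⊕-cong e (≈-sym (-‿distribʳ-* f h′)) ⟩
      (f ⊗ h′) ⊕ negP (f ⊗ h′)  ≈⟨ ⊕-inverseʳ (f ⊗ h′) ⟩
      []                        ∎))

    Monic-quotient : ∀ {f g h d n} → Monic f d → Monic g n → f ⊗ h ≈ g → ∃ λ e → d ℕ.+ e ≡ n × Monic h e
    Monic-quotient {f} {g} {h} {d} {n} M N e with d ℕ.≤? n
    ... | no d≰n = contradiction
      (≈-trans (≈-sym e) (≈-trans (⊗-congʳ f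
        (Vanish-0 (Vanish-quotient h 0 M (Vanish-cong (≈-sym e) (Vanish-weaken g (ℕₚ.≤-trans (ℕₚ.≰⇒> d≰n) (ℕₚ.m≤m+n d 0)) (vanish N))))))
        (⊗-zeroʳ f)))
      (Monic⇒≉0 N)
    ... | yes d≤n with ℕₚ.m≤n⇒∃[o]m+o≡n d≤n
    ...   | k , refl = k , refl , monic
      (trans (sym (*-identityˡ _)) (trans (cong (_* coeff h k) (sym (lead M)))
        (trans (sym (coeff-⊗-top f h d k (vanish M) w)) (trans (at e (d ℕ.+ k)) (lead N))))) w
      where
      w : Vanish h (suc k)
      w = Vanish-quotient h (suc k) M (Vanish-cong (≈-sym e) (Vanish-weaken g (ℕₚ.≤-reflexive (sym (ℕₚ.+-suc d k))) (vanish N)))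

    ∣?-sound : ∀ f g → (f ∣? g) ≡ true → f ∣ g
    ∣?-sound f g e = let h , _ , eq = any-true (λ h → (f ⊗ h) ≐ g) (allLists (length g)) e in divides h (≐⇒≈ (f ⊗ h) g eq)

    -- The search visits only lists of length exactly `length g`. A quotient by a monic `f` has no
    -- higher coefficients, so padding or truncating it to this length does not change the
    -- polynomial.
    ∣?-complete : ∀ {f d} g → Monic f d → f ∣ g → (f ∣? g) ≡ true
    ∣?-complete {f} {d} g M (divides h e) = any-intro (λ h → (f ⊗ h) ≐ g) (allLists (length g))
      (subst (h′ ∈_) (sym (allLists≡ (length g))) (∈-map⁺ toList (Enum.complete (Vecs 𝔼 (length g)) (coeffs (length g) h))))
      (≈⇒≐ (f ⊗ h′) g (≈-trans (⊗-congʳ f (toList-coeffs (length g) h small)) e))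
      where
      h′ = toList (coeffs (length g) h)
      small : Vanish h (length g)
      small = Vanish-quotient h (length g) M (Vanish-cong (≈-sym e) (Vanish-weaken g (ℕₚ.m≤n+m (length g) d) (Vanish-length g)))

    ∣-cong : ∀ {f f′ g g′} → f ≈ f′ → g ≈ g′ → f ∣ g → f′ ∣ g′
    ∣-cong ef eg (divides h e) = divides h (≈-trans (⊗-congˡ h (≈-sym ef)) (≈-trans e eg))

    ∣-trans : ∀ {f g h} → f ∣ g → g ∣ h → f ∣ h
    ∣-trans {f} (divides x e) (divides y e′) =
      divides (x ⊗ y) (≈-trans (≈-sym (⊗-assoc f x y)) (≈-trans (⊗-congˡ y e) e′))

    ∣-⊗ʳ : ∀ {f g} h → f ∣ g → f ∣ g ⊗ h
    ∣-⊗ʳ {f} h (divides x e) = divides (x ⊗ h) (≈-trans (≈-sym (⊗-assoc f x h)) (⊗-congˡ h e))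

    ∣-⊗ˡ : ∀ {f} h {g} → f ∣ g → f ∣ h ⊗ g
    ∣-⊗ˡ h {g} d = ∣-cong ≈-refl (⊗-comm g h) (∣-⊗ʳ h d)

    ∣-⊕ : ∀ {f g h} → f ∣ g → f ∣ h → f ∣ g ⊕ h
    ∣-⊕ {f} (divides x e) (divides y e′) = divides (x ⊕ y) (≈-trans (⊗-distribˡ f x y) (⊕-cong e e′))

    ∣-neg : ∀ {f g} → f ∣ g → f ∣ negP g
    ∣-neg {f} (divides x e) = divides (negP x) (≈-trans (≈-sym (-‿distribʳ-* f x)) (negP-cong e))

    ∣?-cong : ∀ {f d} g g′ → Monic f d → g ≈ g′ → (f ∣? g) ≡ (f ∣? g′)
    ∣?-cong {f} g g′ M e with f ∣? g in eq | f ∣? g′ in eq′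
    ... | true  | true  = refl
    ... | false | false = refl
    ... | true  | false = trans (sym (∣?-complete g′ M (∣-cong ≈-refl e (∣?-sound f g eq)))) eq′
    ... | false | true  = trans (sym eq) (∣?-complete g M (∣-cong ≈-refl (≈-sym e) (∣?-sound f g′ eq′)))

    -- Recursion on the coefficients: if `g` leaves remainder `r`, then `c ∷ g` leaves `c ∷ r`,
    -- whose degree may reach `d`; subtracting `t` times `f` removes that coefficient.
    division : ∀ {f d} → Monic f d → ∀ g → ∃₂ λ k r → (f ⊗ k) ⊕ r ≈ g × Vanish r d
    division {f} {d} M []      = [] , [] , ≈-trans (⊕-identityʳ _) (⊗-zeroʳ f) , λ _ _ → refl
    division {f} {d} M (c ∷ g) with division M g
    ... | k , r , e , v = t ∷ k , r′ , eq , Vanish-lower r′ w w-top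
      where
      s = c ∷ r
      t = coeff s d
      r′ = s ⊕ negP (scale t f)
      w : Vanish r′ (suc d)
      w = Vanish-⊕ s (negP (scale t f)) (Vanish-∷ v) (Vanish-neg (scale t f) (Vanish-scale t f (vanish M)))
      w-top : coeff r′ d ≡ 0#
      w-top = trans (coeff-⊕ s (negP (scale t f)) d) (trans (cong (t +_) (trans (coeff-negP (scale t f) d)
        (cong neg (trans (coeff-scale t f d) (trans (cong (t *_) (lead M)) (𝔽.*-identityʳ t)))))) (-‿inverseʳ t))
      eq : (f ⊗ (t ∷ k)) ⊕ r′ ≈ c ∷ g
      eq = begin
        (f ⊗ (t ∷ k)) ⊕ r′ ≈⟨ ⊕-cong (⊗-∷ʳ f t k) (⊕-comm s (negP (scale t f))) ⟩
        (scale t f ⊕ (0# ∷ (f ⊗ k))) ⊕ (negP (scale t f) ⊕ s)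
          ≈⟨ interchange (scale t f) (0# ∷ (f ⊗ k)) (negP (scale t f)) s ⟩
        (scale t f ⊕ negP (scale t f)) ⊕ ((0# ∷ (f ⊗ k)) ⊕ s) ≈⟨ ⊕-cong (⊕-inverseʳ (scale t f)) (∷-cong (+-identityˡ c) e) ⟩
        c ∷ g ∎

    -- A nonzero remainder is rescaled to be monic, so that the Euclidean algorithm stays among the
    -- monic polynomials to which irreducibility refers.
    normalise : ∀ r n → Vanish r n → r ≈ [] ⊎ ∃₂ λ e c → e < n × Monic (scale c r) e
    normalise r zero    v = inj₁ (Vanish-0 v)
    normalise r (suc n) v with coeff r n ≟ 0#
    ... | no ne = let c , e = inverse _ ne in
      inj₂ (n , c , s≤s ℕₚ.≤-refl , monic (trans (coeff-scale c r n) (trans (*-comm c _) e)) (Vanish-scale c r v))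
    ... | yes e with normalise r n (Vanish-lower r v e)
    ...   | inj₁ r≈[]               = inj₁ r≈[]
    ...   | inj₂ (e , c , e<n , M)  = inj₂ (e , c , ℕₚ.m<n⇒m<1+n e<n , M)

-- Irreducible polynomials, valuations and degrees of irreducible factors.

module Factorization where

  open import Data.Bool using (Bool; true; false; not)
  open import Data.Bool.ListAction using (all)
  open import Data.Nat as ℕ using (ℕ; zero; suc; _≤_; _<_; z≤n; s≤s; _≡ᵇ_)
  import Data.Nat.Properties as ℕₚ
  open import Data.List using ([_])
  open import Data.List.Membership.Propositional using (_∈_)
  open import Data.List.Membership.Propositional.Properties using (∈-map⁺; ∈-map⁻)
  open import Data.Product using (∃; ∃₂; _×_; _,_; proj₁; proj₂)
  open import Data.Sum using (_⊎_; inj₁; inj₂)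
  open import Data.Vec using (Vec)
  open import Function using (_∘_)
  open import Relation.Binary.PropositionalEquality as ≡ using (_≡_; _≢_; refl; sym; trans; cong; cong₂; subst)
  open import Relation.Nullary using (¬_; does; yes; no; contradiction)
  open import Defs
  open Finite
  open Counting
  open Polynomials
  open Degrees

  open Enum using (list)

  𝟙-≡ᵇ-≢ : ∀ {m n} → m ≢ n → 𝟙 (m ≡ᵇ n) ≡ 0
  𝟙-≡ᵇ-≢ {m} {n} ne with m ≡ᵇ n in eq
  ... | true  = contradiction (ℕₚ.≡ᵇ⇒≡ m n (subst Data.Bool.T (sym eq) _)) ne
  ... | false = refl

  𝟙-≡ᵇ-refl : ∀ n → 𝟙 (n ≡ᵇ n) ≡ 1
  𝟙-≡ᵇ-refl zero    = refl
  𝟙-≡ᵇ-refl (suc n) = 𝟙-≡ᵇ-refl n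

  module Factor (F : FiniteField) where
    open FiniteField F using (Carrier; 1#)
    open FF F using (Poly; _⊕_; _⊗_; negP; _^P_; monics; _∣?_; irreducible; multiplicity)
    open Poly F
    open Degree F

    record Irr (P : Poly) (d : ℕ) : Set where
      field
        positive   : 1 ≤ d
        isMonic    : Monic P d
        no-divisor : ∀ {g e} → 1 ≤ e → e < d → Monic g e → ¬ g ∣ P
    open Irr public

    irreducible⇒Irr : ∀ {d P} → 1 ≤ d → Monic P d → irreducible d P ≡ true → Irr P d
    irreducible⇒Irr {suc d} {P} 1≤d M irr = record { positive = 1≤d ; isMonic = M ; no-divisor = none }
      where
      none : ∀ {g e} → 1 ≤ e → e < suc d → Monic g e → ¬ g ∣ P
      none {g} {e} 1≤e (s≤s e≤d) N g∣P
        with all-true (λ g → not (g ∣? P)) (monics e)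
               (all-true (λ e → all (λ g → not (g ∣? P)) (monics e)) (oneTo d) irr (∈-oneTo⁺ 1≤e e≤d))
               (subst (mon (coeffs e g) ∈_) (sym (monics≡ e)) (∈-map⁺ mon (Enum.complete (Vecs 𝔼 e) (coeffs e g))))
      ... | not-divides rewrite ∣?-complete P (Monic-mon (coeffs e g)) (∣-cong (≈-sym (mon-coeffs N)) ≈-refl g∣P)
        with () ← not-divides

    reducible⇒divisor : ∀ d P → irreducible d P ≡ false → ∃₂ λ e (u : Vec Carrier e) → 1 ≤ e × e < d × mon u ∣ P
    reducible⇒divisor (suc d) P red with all-false (λ e → all (λ g → not (g ∣? P)) (monics e)) (oneTo d) red
    ... | e , e∈ , red′ with all-false (λ g → not (g ∣? P)) (monics e) red′
    ... | g , g∈ , div with g ∣? P in eq | ∈-map⁻ mon (subst (g ∈_) (monics≡ e) g∈)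
    ... | true | u , _ , refl = e , u , proj₁ (∈-oneTo⁻ e∈) , s≤s (proj₂ (∈-oneTo⁻ e∈)) , ∣?-sound g P eq

    ∣-⊕-cancelˡ : ∀ {f} g h → f ∣ g → f ∣ g ⊕ h → f ∣ h
    ∣-⊕-cancelˡ g h f∣g f∣g⊕h = ∣-cong ≈-refl
      (≈-trans (≈-sym (⊕-assoc (negP g) g h)) (⊕-cong (⊕-inverseˡ g) (≈-refl {h}))) (∣-⊕ (∣-neg f∣g) f∣g⊕h)

    ∣-scale : ∀ {f} c g → f ∣ g → f ∣ scale c g
    ∣-scale {f} c g (divides h e) = divides (scale c h)
      (≈-trans (⊗-comm f (scale c h)) (≈-trans (scale-⊗ c h f) (scale-cong refl (≈-trans (⊗-comm h f) e))))

    ∣-multiple : ∀ f g → f ∣ f ⊗ g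
    ∣-multiple f g = divides g ≈-refl

    module _ {P : Poly} {d : ℕ} (irr : Irr P d) where

      ∣-cancel-scaledRemainder : ∀ c r h k g → g ⊕ r ≈ k → P ∣ g ⊗ h → P ∣ k ⊗ h → P ∣ scale c r ⊗ h
      ∣-cancel-scaledRemainder c r h k g e P∣gh P∣kh = ∣-cong ≈-refl (≈-sym (scale-⊗ c r h)) (∣-scale c (r ⊗ h)
        (∣-⊕-cancelˡ (g ⊗ h) (r ⊗ h) P∣gh (∣-cong ≈-refl (≈-trans (⊗-congˡ h (≈-sym e)) (⊗-distribʳ h g r)) P∣kh)))

      -- The Euclidean algorithm without Bézout coefficients. If `r` is not constant, divide `P` by
      -- `r`: the remainder is nonzero by irreducibility, has smaller degree, and its product with
      -- `h` is again divisible by `P`. `b` bounds the recursion.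
      ∣-cancel-lowDegree : ∀ b {r e} h → e < b → e < d → Monic r e → P ∣ r ⊗ h → P ∣ h
      ∣-cancel-lowDegree (suc b) {r} {zero}  h _ _ M P∣rh =
        ∣-cong ≈-refl (≈-trans (⊗-congˡ h (Monic-0⇒≈1 M)) (⊗-identityˡ h)) P∣rh
      ∣-cancel-lowDegree (suc b) {r} {suc e} h (s≤s e<b) e<d M P∣rh with division M P
      ... | k , r′ , eq , v with normalise r′ (suc e) v
      ...   | inj₁ r′≈[] = contradiction
                (divides k (≈-trans (≈-sym (⊕-identityʳ (r ⊗ k))) (≈-trans (⊕-cong (≈-refl {r ⊗ k}) (≈-sym r′≈[])) eq)))
                (no-divisor irr (s≤s z≤n) e<d M)
      ...   | inj₂ (e′ , c , e′<e , M′) = ∣-cancel-lowDegree b h (ℕₚ.<-≤-trans e′<e e<b) (ℕₚ.<-trans e′<e e<d) M′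
                (∣-cancel-scaledRemainder c r′ h P (r ⊗ k) eq
                  (∣-cong ≈-refl (≈-trans (≈-sym (⊗-assoc k r h)) (⊗-congˡ h (⊗-comm k r))) (∣-⊗ˡ k P∣rh))
                  (∣-multiple P h))

      -- Only the remainder of `g` modulo `P` matters; if nonzero, it has degree below `d` and can
      -- be cancelled.
      prime : ∀ g h → P ∣ g ⊗ h → P ∣ g ⊎ P ∣ h
      prime g h P∣gh with division (isMonic irr) g
      ... | k , r , eq , v with normalise r d v
      ...   | inj₁ r≈[] = inj₁ (divides k (≈-trans (≈-sym (⊕-identityʳ (P ⊗ k))) (≈-trans (⊕-cong (≈-refl {P ⊗ k}) (≈-sym r≈[])) eq)))
      ...   | inj₂ (e , c , e<d , M) = inj₂ (∣-cancel-lowDegree d h e<d e<d M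
                (∣-cancel-scaledRemainder c r h g (P ⊗ k) eq (∣-⊗ʳ h (∣-multiple P k)) P∣gh))

    Irr-∣⇒≈ : ∀ {P Q d e} → Irr P d → Irr Q e → P ∣ Q → P ≈ Q
    Irr-∣⇒≈ {P} {Q} {d} irrP irrQ P∣Q@(divides h eq) with Monic-quotient (isMonic irrP) (isMonic irrQ) eq
    ... | zero  , refl , M = ≈-trans (≈-sym (⊗-identityʳ P)) (≈-trans (⊗-congʳ P (≈-sym (Monic-0⇒≈1 M))) eq)
    ... | suc k , refl , M = contradiction P∣Q
      (no-divisor irrQ (positive irrP) (ℕₚ.m<m+n d (s≤s z≤n)) (isMonic irrP))

    ^-∣-cancel : ∀ {P d} m g → Monic P d → P ^P (suc m) ∣ P ⊗ g → P ^P m ∣ g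
    ^-∣-cancel {P} m g M (divides h e) = divides h (⊗-cancelˡ M (≈-trans (≈-sym (⊗-assoc P (P ^P m) h)) e))

    ^-∣-extend : ∀ P m {g} → P ^P m ∣ g → P ^P (suc m) ∣ P ⊗ g
    ^-∣-extend P m (divides h e) = divides h (≈-trans (⊗-assoc P (P ^P m) h) (⊗-congʳ P e))

    -- Powers are stripped off one at a time: primality moves one factor `P` from `Q ⊗ g` into `g`,
    -- where it cancels.
    ^-∣-coprime : ∀ {P Q d e} → Irr P d → Irr Q e → ¬ P ≈ Q → ∀ m g → P ^P m ∣ Q ⊗ g → P ^P m ∣ g
    ^-∣-coprime irrP irrQ P≉Q zero    g _ = divides g (⊗-identityˡ g)
    ^-∣-coprime {P} {Q} irrP irrQ P≉Q (suc m) g Pᵐ∣Qg with prime irrP Q g (∣-trans (∣-multiple P (P ^P m)) Pᵐ∣Qg)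
    ... | inj₁ P∣Q = contradiction (Irr-∣⇒≈ irrP irrQ P∣Q) P≉Q
    ... | inj₂ (divides g′ e) = ∣-cong ≈-refl e (^-∣-extend P m (^-∣-coprime irrP irrQ P≉Q m g′
      (^-∣-cancel m (Q ⊗ g′) (isMonic irrP) (∣-cong ≈-refl rearrange Pᵐ∣Qg))))
      where
      rearrange : Q ⊗ g ≈ P ⊗ (Q ⊗ g′)
      rearrange = ≈-trans (⊗-congʳ Q (≈-sym e)) (≈-trans (≈-sym (⊗-assoc Q P g′))
        (≈-trans (⊗-congˡ g′ (⊗-comm Q P)) (⊗-assoc P Q g′)))

    ∣?-iff : ∀ {f f′ g g′ d d′} → Monic f d → Monic f′ d′ → (f ∣ g → f′ ∣ g′) → (f′ ∣ g′ → f ∣ g) → (f ∣? g) ≡ (f′ ∣? g′)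
    ∣?-iff {f} {f′} {g} {g′} M M′ to from with f ∣? g in eq | f′ ∣? g′ in eq′
    ... | true  | true  = refl
    ... | false | false = refl
    ... | true  | false = trans (sym (∣?-complete g′ M′ (to (∣?-sound f g eq)))) eq′
    ... | false | true  = trans (sym eq) (∣?-complete g M (from (∣?-sound f′ g′ eq′)))

    ∣?-largeDegree : ∀ {f g d n} → Monic f d → Monic g n → n < d → (f ∣? g) ≡ false
    ∣?-largeDegree {f} {g} M N n<d with f ∣? g in eq
    ... | false = refl
    ... | true with ∣?-sound f g eq
    ...   | divides h e with Monic-quotient M N e
    ...     | k , refl , _ = contradiction n<d (ℕₚ.≤⇒≯ (ℕₚ.m≤m+n _ k))

    -- The exponent of `P` in `g` as a number of dividing powers, correct once `N` reaches the
    -- exponent. In this form a sum of exponents becomes a count of multiples.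
    valuation : ℕ → Poly → Poly → ℕ
    valuation N P g = ∑ (oneTo N) (λ m → 𝟙 ((P ^P m) ∣? g))

    valuation-cong : ∀ N {P d g g′} → Monic P d → g ≈ g′ → valuation N P g ≡ valuation N P g′
    valuation-cong N M e = ∑-cong (oneTo N) (λ m → cong 𝟙 (∣?-cong _ _ (Monic-^ m M) e))

    valuation-coprime : ∀ N {P Q d e} g → Irr P d → Irr Q e → ¬ P ≈ Q → valuation N P (Q ⊗ g) ≡ valuation N P g
    valuation-coprime N {P} {Q} g irrP irrQ P≉Q = ∑-cong (oneTo N) (λ m → cong 𝟙
      (∣?-iff (Monic-^ m (isMonic irrP)) (Monic-^ m (isMonic irrP)) (^-∣-coprime irrP irrQ P≉Q m g) (∣-⊗ˡ Q)))

    -- Multiplication by `P` shifts the powers by one. The highest power in the range is lost in the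
    -- shift, but it does not divide `g` for reasons of degree; this uses `n < N`.
    valuation-self : ∀ N {P d g n} → 1 ≤ d → Monic P d → Monic g n → n < N → valuation N P (P ⊗ g) ≡ valuation N P g ℕ.+ 1
    valuation-self (suc N) {P} {d} {g} {n} 1≤d M G n<N = begin
      valuation (suc N) P (P ⊗ g)
        ≡⟨ ∑-oneTo-suc N _ ⟩
      𝟙 ((P ^P 1) ∣? (P ⊗ g)) ℕ.+ ∑ (oneTo N) (λ m → 𝟙 ((P ^P suc m) ∣? (P ⊗ g)))
        ≡⟨ cong₂ ℕ._+_
             (cong 𝟙 (∣?-complete (P ⊗ g) (Monic-^ 1 M) (∣-cong (≈-sym (⊗-identityʳ P)) ≈-refl (∣-multiple P g))))
             (∑-cong (oneTo N) (λ m → cong 𝟙 (∣?-iff (Monic-^ (suc m) M) (Monic-^ m M) (^-∣-cancel m g M) (^-∣-extend P m)))) ⟩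
      1 ℕ.+ valuation N P g
        ≡⟨ ℕₚ.+-comm 1 _ ⟩
      valuation N P g ℕ.+ 1
        ≡⟨ cong (ℕ._+ 1) (trans (∑-oneTo-snoc N _) (trans (cong (valuation N P g ℕ.+_) (cong 𝟙 too-large)) (ℕₚ.+-identityʳ _))) ⟨
      valuation (suc N) P g ℕ.+ 1 ∎
      where
      open ≡.≡-Reasoning
      too-large : ((P ^P suc N) ∣? g) ≡ false
      too-large = ∣?-largeDegree (Monic-^ (suc N) M) G
        (ℕₚ.<-≤-trans n<N (ℕₚ.≤-trans (ℕₚ.≤-reflexive (sym (ℕₚ.*-identityʳ (suc N)))) (ℕₚ.*-monoʳ-≤ (suc N) 1≤d)))

    factors : ℕ → ℕ → Poly → ℕ
    factors N d f = ∑ (list (Vecs 𝔼 d)) (λ v → 𝟙 (irreducible d (mon v)) ℕ.* valuation N (mon v) f)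

    factors-cong : ∀ N d {f g} → f ≈ g → factors N d f ≡ factors N d g
    factors-cong N d e = ∑-cong (list (Vecs 𝔼 d)) (λ v → cong (𝟙 (irreducible d (mon v)) ℕ.*_) (valuation-cong N (Monic-mon v) e))

    factors-largeDegree : ∀ N {d f n} → Monic f n → n < d → factors N d f ≡ 0
    factors-largeDegree N {d} {f} M n<d = ∑-≡0 (list (Vecs 𝔼 d)) (λ v _ →
      trans (cong (𝟙 (irreducible d (mon v)) ℕ.*_) (∑-≡0 (oneTo N) (λ m m∈ → cong 𝟙
        (∣?-largeDegree (Monic-^ m (Monic-mon v)) M (ℕₚ.<-≤-trans n<d (ℕₚ.m≤n*m d m {{ℕ.>-nonZero (proj₁ (∈-oneTo⁻ m∈))}}))))))
      (ℕₚ.*-zeroʳ (𝟙 (irreducible d (mon v)))))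

    -- Among the irreducible polynomials of degree `d` only `mon u` itself changes valuation, and it
    -- occurs only for `d` equal to its degree.
    factors-⊗ : ∀ N {d e g n} (u : Vec Carrier e) → 1 ≤ d → 1 ≤ e → irreducible e (mon u) ≡ true → Monic g n → n < N →
                factors N d (mon u ⊗ g) ≡ factors N d g ℕ.+ 𝟙 (d ≡ᵇ e)
    factors-⊗ N {d} {e} {g} {n} u 1≤d 1≤e irr G n<N with d ℕ.≟ e
    ... | no d≢e = trans (∑-cong (list (Vecs 𝔼 d)) same) (trans (sym (ℕₚ.+-identityʳ _)) (cong (factors N d g ℕ.+_) (sym (𝟙-≡ᵇ-≢ d≢e))))
      where
      same : ∀ v → 𝟙 (irreducible d (mon v)) ℕ.* valuation N (mon v) (mon u ⊗ g) ≡ 𝟙 (irreducible d (mon v)) ℕ.* valuation N (mon v) g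
      same v with irreducible d (mon v) in irrv
      ... | false = refl
      ... | true  = cong (ℕ._+ 0) (valuation-coprime N g (irreducible⇒Irr 1≤d (Monic-mon v) irrv) (irreducible⇒Irr 1≤e (Monic-mon u) irr)
                      (λ eq → d≢e (Monic-unique (Monic-cong eq (Monic-mon v)) (Monic-mon u))))
    ... | yes refl = begin
      factors N d (mon u ⊗ g)
        ≡⟨ ∑-cong (list (Vecs 𝔼 d)) step ⟩
      ∑ (list (Vecs 𝔼 d)) (λ v → 𝟙 (irreducible d (mon v)) ℕ.* valuation N (mon v) g ℕ.+ 𝟙 (does (Enum._≟_ (Vecs 𝔼 d) u v)) ℕ.* 1)
        ≡⟨ ∑-+ (list (Vecs 𝔼 d)) _ _ ⟩
      factors N d g ℕ.+ ∑ (list (Vecs 𝔼 d)) (λ v → 𝟙 (does (Enum._≟_ (Vecs 𝔼 d) u v)) ℕ.* 1)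
        ≡⟨ cong (factors N d g ℕ.+_) (∑-δ (Vecs 𝔼 d) u (λ _ → 1)) ⟩
      factors N d g ℕ.+ 1
        ≡⟨ cong (factors N d g ℕ.+_) (𝟙-≡ᵇ-refl d) ⟨
      factors N d g ℕ.+ 𝟙 (d ≡ᵇ d) ∎
      where
      open ≡.≡-Reasoning
      step : ∀ v → 𝟙 (irreducible d (mon v)) ℕ.* valuation N (mon v) (mon u ⊗ g)
                 ≡ 𝟙 (irreducible d (mon v)) ℕ.* valuation N (mon v) g ℕ.+ 𝟙 (does (Enum._≟_ (Vecs 𝔼 d) u v)) ℕ.* 1
      step v with Enum._≟_ (Vecs 𝔼 d) u v
      step v | yes refl rewrite irr = trans (ℕₚ.+-identityʳ _)
        (trans (valuation-self N 1≤d (Monic-mon u) G n<N) (cong (ℕ._+ 1) (sym (ℕₚ.+-identityʳ _))))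
      step v | no u≢v with irreducible d (mon v) in irrv
      ... | false = refl
      ... | true  = trans (cong (ℕ._+ 0) (valuation-coprime N g (irreducible⇒Irr 1≤d (Monic-mon v) irrv) (irreducible⇒Irr 1≤e (Monic-mon u) irr)
                      (λ eq → u≢v (mon-injective (≈-sym eq))))) (sym (ℕₚ.+-identityʳ _))

    irreducibleFactor : ∀ b {f n} → n < b → 1 ≤ n → Monic f n →
      ∃₂ λ e (u : Vec Carrier e) → 1 ≤ e × irreducible e (mon u) ≡ true × mon u ∣ f
    irreducibleFactor (suc b) {f} {n} (s≤s n≤b) 1≤n M with irreducible n (mon (coeffs n f)) in irr
    ... | true  = n , coeffs n f , 1≤n , irr , divides [ 1# ] (≈-trans (⊗-identityʳ _) (mon-coeffs M))
    ... | false with reducible⇒divisor n (mon (coeffs n f)) irr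
    ...   | e , u , 1≤e , e<n , u∣f with irreducibleFactor b (ℕₚ.<-≤-trans e<n n≤b) 1≤e (Monic-mon u)
    ...     | e′ , u′ , 1≤e′ , irr′ , u′∣u = e′ , u′ , 1≤e′ , irr′ , ∣-trans u′∣u (∣-cong ≈-refl (mon-coeffs M) u∣f)

    -- Additivity of degrees, by splitting off one irreducible factor at a time. The cutoffs `N` and
    -- `M` are independent of `n` so that the induction applies to the quotient; `b` bounds the
    -- recursion.
    ∑-factors : ∀ b {f n N M} → n < b → Monic f n → n ≤ N → n ≤ M → ∑ (oneTo M) (λ d → d ℕ.* factors N d f) ≡ n
    ∑-factors (suc b) {f} {zero}  {N} {M} _ Mf _ _ = ∑-≡0 (oneTo M) (λ d d∈ →
      trans (cong (d ℕ.*_) (factors-largeDegree N Mf (proj₁ (∈-oneTo⁻ d∈)))) (ℕₚ.*-zeroʳ d))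
    ∑-factors (suc b) {f} {suc n} {N} {M} (s≤s n<b) Mf n≤N n≤M with irreducibleFactor (suc (suc n)) ℕₚ.≤-refl (s≤s z≤n) Mf
    ... | e , u , 1≤e , irr , divides g eq with Monic-quotient (Monic-mon u) Mf eq
    ... | k , e+k≡n , G = begin
      ∑ (oneTo M) (λ d → d ℕ.* factors N d f)
        ≡⟨ ∑-cong∈ (oneTo M) (λ d d∈ → trans (cong (d ℕ.*_) (trans (factors-cong N d (≈-sym eq))
             (factors-⊗ N u (proj₁ (∈-oneTo⁻ d∈)) 1≤e irr G (ℕₚ.<-≤-trans k<n n≤N)))) (ℕₚ.*-distribˡ-+ d _ _)) ⟩
      ∑ (oneTo M) (λ d → d ℕ.* factors N d g ℕ.+ d ℕ.* 𝟙 (d ≡ᵇ e))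
        ≡⟨ ∑-+ (oneTo M) _ _ ⟩
      ∑ (oneTo M) (λ d → d ℕ.* factors N d g) ℕ.+ ∑ (oneTo M) (λ d → d ℕ.* 𝟙 (d ≡ᵇ e))
        ≡⟨ cong₂ ℕ._+_ (∑-factors b (ℕₚ.<-≤-trans k<n n<b) G (ℕₚ.≤-trans (ℕₚ.<⇒≤ k<n) n≤N) (ℕₚ.≤-trans (ℕₚ.<⇒≤ k<n) n≤M))
             (trans (∑-unique (oneTo M) (Unique-oneTo M) e _ (∈-oneTo⁺ 1≤e (ℕₚ.≤-trans (subst (e ≤_) e+k≡n (ℕₚ.m≤m+n e k)) n≤M))
                (λ x ne → trans (cong (x ℕ.*_) (𝟙-≡ᵇ-≢ ne)) (ℕₚ.*-zeroʳ x))) (trans (cong (e ℕ.*_) (𝟙-≡ᵇ-refl e)) (ℕₚ.*-identityʳ e))) ⟩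
      k ℕ.+ e ≡⟨ trans (ℕₚ.+-comm k e) e+k≡n ⟩
      suc n ∎
      where
      open ≡.≡-Reasoning
      k<n : k < suc n
      k<n = subst (k <_) e+k≡n (ℕₚ.m<n+m k 1≤e)

    -- Multiplication by the monic `Q` is injective with the multiples of `Q` as its image, so sums
    -- over multiples become sums over cofactors.
    ∑-multiples : ∀ {Q e} k → Monic Q e → (X : Poly → ℕ) → (∀ {f g} → f ≈ g → X f ≡ X g) →
      ∑ (list (Vecs 𝔼 (e ℕ.+ k))) (λ v → 𝟙 (Q ∣? mon v) ℕ.* X (mon v)) ≡ ∑ (list (Vecs 𝔼 k)) (λ w → X (Q ⊗ mon w))
    ∑-multiples {Q} {e} k M X X-cong = trans
      (∑-image (Vecs 𝔼 (e ℕ.+ k)) (Vecs 𝔼 k) σ σ-injective (λ v → Q ∣? mon v)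
        (λ w → ∣?-complete (mon (σ w)) M (∣-cong ≈-refl (≈-sym (mon-σ w)) (∣-multiple Q (mon w)))) onto (X ∘ mon))
      (∑-cong (list (Vecs 𝔼 k)) (λ w → X-cong (mon-σ w)))
      where
      σ : Vec Carrier k → Vec Carrier (e ℕ.+ k)
      σ w = coeffs (e ℕ.+ k) (Q ⊗ mon w)
      mon-σ : ∀ w → mon (σ w) ≈ Q ⊗ mon w
      mon-σ w = mon-coeffs (Monic-⊗ M (Monic-mon w))
      σ-injective : ∀ {u w} → σ u ≡ σ w → u ≡ w
      σ-injective {u} {w} eq = mon-injective (⊗-cancelˡ M (≈-trans (≈-sym (mon-σ u)) (subst (λ v → mon v ≈ Q ⊗ mon w) (sym eq) (mon-σ w))))
      onto : ∀ v → (Q ∣? mon v) ≡ true → ∃ λ w → σ w ≡ v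
      onto v Q∣v with ∣?-sound Q (mon v) Q∣v
      ... | divides h eq with Monic-quotient M (Monic-mon v) eq
      ...   | k′ , e+k′≡e+k , H with ℕₚ.+-cancelˡ-≡ e k′ k e+k′≡e+k
      ...     | refl = coeffs k h , mon-injective (≈-trans (mon-σ (coeffs k h)) (≈-trans (⊗-congʳ Q (mon-coeffs H)) eq))

-- Error terms uniform in the field.

module Asymptotics where

  open import Data.Nat
  open import Data.Nat.Properties
  open import Data.Nat.Tactic.RingSolver using (solve-∀)
  open import Data.List using (List; []; _∷_)
  open import Data.List.Membership.Propositional using (_∈_)
  open import Data.List.Membership.Propositional.Properties using (∈-length)
  open import Data.List.Relation.Unary.Any using (here; there)
  open import Relation.Binary.PropositionalEquality using (_≡_; refl; sym; trans; cong; cong₂; module ≡-Reasoning)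
  open import Defs using (FiniteField)
  open Counting using (∑)

  ∣-∣-+-≤ : ∀ a b c d → ∣ a + b - c + d ∣ ≤ ∣ a - c ∣ + ∣ b - d ∣
  ∣-∣-+-≤ a b c d = begin
    ∣ a + b - c + d ∣                     ≤⟨ ∣-∣-triangle (a + b) (c + b) (c + d) ⟩
    ∣ a + b - c + b ∣ + ∣ c + b - c + d ∣ ≡⟨ cong₂ _+_ (trans (cong₂ ∣_-_∣ (+-comm a b) (+-comm c b)) (∣m+n-m+o∣≡∣n-o∣ b a c)) (∣m+n-m+o∣≡∣n-o∣ c b d) ⟩
    ∣ a - c ∣ + ∣ b - d ∣                 ∎
    where open ≤-Reasoning

  ∣-∣-*-≤ : ∀ a b c d → ∣ a * b - c * d ∣ ≤ ∣ a - c ∣ * b + c * ∣ b - d ∣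
  ∣-∣-*-≤ a b c d = begin
    ∣ a * b - c * d ∣                     ≤⟨ ∣-∣-triangle (a * b) (c * b) (c * d) ⟩
    ∣ a * b - c * b ∣ + ∣ c * b - c * d ∣ ≡⟨ cong₂ _+_ (*-distribʳ-∣-∣ b a c) (*-distribˡ-∣-∣ c b d) ⟨
    ∣ a - c ∣ * b + c * ∣ b - d ∣         ∎
    where open ≤-Reasoning

  ∣-∣-∑-≤ : {A : Set} (xs : List A) (f g : A → ℕ) → ∣ ∑ xs f - ∑ xs g ∣ ≤ ∑ xs (λ x → ∣ f x - g x ∣)
  ∣-∣-∑-≤ []       f g = z≤n
  ∣-∣-∑-≤ (x ∷ xs) f g = ≤-trans (∣-∣-+-≤ (f x) (∑ xs f) (g x) (∑ xs g)) (+-monoʳ-≤ ∣ f x - g x ∣ (∣-∣-∑-≤ xs f g))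

  -- With equal totals an error in one part is an error of the same size in the other. In this way a
  -- summand of top degree is estimated through all the others.
  ∣-∣-complement : ∀ a a′ {b d} → a + b ≡ a′ + d → ∣ b - d ∣ ≡ ∣ a - a′ ∣
  ∣-∣-complement a a′ {b} {d} e = begin
    ∣ b - d ∣             ≡⟨ ∣m+n-m+o∣≡∣n-o∣ a b d ⟨
    ∣ a + b - a + d ∣     ≡⟨ cong (λ x → ∣ x - a + d ∣) e ⟩
    ∣ a′ + d - a + d ∣    ≡⟨ cong₂ ∣_-_∣ (+-comm a′ d) (+-comm a d) ⟩
    ∣ d + a′ - d + a ∣    ≡⟨ ∣m+n-m+o∣≡∣n-o∣ d a′ a ⟩
    ∣ a′ - a ∣            ≡⟨ ∣-∣-comm a′ a ⟩
    ∣ a - a′ ∣            ∎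
    where open ≡-Reasoning

  Family : Set₁
  Family = FiniteField → ℕ

  q : Family
  q = FiniteField.card

  q-positive : ∀ F → 1 ≤ q F
  q-positive F = ∈-length (FiniteField.complete F (FiniteField.0# F))

  q^-positive : ∀ F n → 1 ≤ q F ^ n
  q^-positive F n = m^n>0 (q F) {{>-nonZero (q-positive F)}} n

  infix 4 _=O_ _~[_]_

  -- X =O N says X = O(q^{N-1}), with the implied constant independent of the field.
  record _=O_ (X : Family) (N : ℕ) : Set₁ where
    constructor bound
    field
      constant : ℕ
      bounded  : ∀ F → q F * X F ≤ constant * q F ^ N

  record _~[_]_ (X : Family) (N : ℕ) (Y : Family) : Set₁ where
    constructor near
    field difference : (λ F → ∣ X F - Y F ∣) =O N
  open _~[_]_ public

  O-≤ : ∀ {X Y : Family} {N : ℕ} → (∀ F → X F ≤ Y F) → Y =O N → X =O N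
  O-≤ le (bound C b) = bound C (λ F → ≤-trans (*-monoʳ-≤ (q F) (le F)) (b F))

  O-+ : ∀ {X Y : Family} {N : ℕ} → X =O N → Y =O N → (λ F → X F + Y F) =O N
  O-+ {X} {Y} {N} (bound C b) (bound D c) = bound (C + D) (λ F → begin
    q F * (X F + Y F)             ≡⟨ *-distribˡ-+ (q F) _ _ ⟩
    q F * X F + q F * Y F         ≤⟨ +-mono-≤ (b F) (c F) ⟩
    C * q F ^ N + D * q F ^ N     ≡⟨ *-distribʳ-+ (q F ^ N) C D ⟨
    (C + D) * q F ^ N             ∎)
    where open ≤-Reasoning

  O-0 : ∀  {N : ℕ} → (λ _ → 0) =O N
  O-0 = bound 0 (λ F → ≤-reflexive (*-zeroʳ (q F)))

  O-* : ∀ {X Y : Family} {N M : ℕ} → X =O N → (D : ℕ) → (∀ F → Y F ≤ D * q F ^ M) → (λ F → X F * Y F) =O (N + M)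
  O-* {X} {Y} {N} {M} (bound C b) D c = bound (C * D) (λ F → begin
    q F * (X F * Y F)             ≡⟨ *-assoc (q F) (X F) (Y F) ⟨
    q F * X F * Y F               ≤⟨ *-mono-≤ (b F) (c F) ⟩
    C * q F ^ N * (D * q F ^ M)   ≡⟨ rearrange C (q F ^ N) D (q F ^ M) ⟩
    C * D * (q F ^ N * q F ^ M)   ≡⟨ cong (C * D *_) (^-distribˡ-+-* (q F) N M) ⟨
    C * D * q F ^ (N + M)         ∎)
    where
    open ≤-Reasoning
    rearrange : ∀ a b c d → a * b * (c * d) ≡ a * c * (b * d)
    rearrange = solve-∀

  O-const* : ∀ {X N} (c : ℕ) → X =O N → (λ F → c * X F) =O N
  O-const* {X} {N} c (bound C b) = bound (c * C) (λ F → begin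
    q F * (c * X F)   ≡⟨ rearrange (q F) c (X F) ⟩
    c * (q F * X F)   ≤⟨ *-monoʳ-≤ c (b F) ⟩
    c * (C * q F ^ N) ≡⟨ *-assoc c C _ ⟨
    c * C * q F ^ N   ∎)
    where
    open ≤-Reasoning
    rearrange : ∀ a b c → a * (b * c) ≡ b * (a * c)
    rearrange = solve-∀

  O-cong-exponent : ∀ {X : Family} {N M : ℕ} → N ≡ M → X =O N → X =O M
  O-cong-exponent refl o = o

  O-∑ : ∀ {N} (js : List ℕ) (X : ℕ → Family) → (∀ j → j ∈ js → X j =O N) → (λ F → ∑ js (λ j → X j F)) =O N
  O-∑ []       X o = O-0
  O-∑ (j ∷ js) X o = O-+ (o j (here refl)) (O-∑ js X (λ i i∈ → o i (there i∈)))

  ~-reflexive : ∀ {X Y : Family} {N : ℕ} → (∀ F → X F ≡ Y F) → X ~[ N ] Y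
  ~-reflexive {X} {Y} e = near (O-≤ (λ F → ≤-reflexive (m≡n⇒∣m-n∣≡0 (e F))) O-0)

  ~-sym : ∀ {X Y : Family} {N : ℕ} → X ~[ N ] Y → Y ~[ N ] X
  ~-sym {X} {Y} (near s) = near (O-≤ (λ F → ≤-reflexive (∣-∣-comm (Y F) (X F))) s)

  ~-trans : ∀ {X Y Z : Family} {N : ℕ} → X ~[ N ] Y → Y ~[ N ] Z → X ~[ N ] Z
  ~-trans {X} {Y} {Z} (near s) (near t) = near (O-≤ (λ F → ∣-∣-triangle (X F) (Y F) (Z F)) (O-+ s t))

  ~-∑ : ∀ {N} (js : List ℕ) (X Y : ℕ → Family) → (∀ j → j ∈ js → X j ~[ N ] Y j) →
        (λ F → ∑ js (λ j → X j F)) ~[ N ] (λ F → ∑ js (λ j → Y j F))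
  ~-∑ js X Y o = near (O-≤ (λ F → ∣-∣-∑-≤ js (λ j → X j F) (λ j → Y j F)) (O-∑ js (λ j F → ∣ X j F - Y j F ∣) (λ j j∈ → difference (o j j∈))))

  ~-+O : ∀ {X E : Family} {N : ℕ} → E =O N → (λ F → X F + E F) ~[ N ] X
  ~-+O {X} {E} o = near (O-≤ (λ F → ≤-reflexive (trans (∣-∣-comm (X F + E F) (X F)) (∣m-m+n∣≡n (X F) (E F)))) o)

  ~-const* : ∀ {X Y N} (c : ℕ) → X ~[ N ] Y → (λ F → c * X F) ~[ N ] (λ F → c * Y F)
  ~-const* {X} {Y} c (near s) = near (O-≤ (λ F → ≤-reflexive (sym (*-distribˡ-∣-∣ c (X F) (Y F)))) (O-const* c s))

  ~-*ʳ : ∀ {X X′ Y : Family} {N M : ℕ} → X ~[ N ] X′ → (D : ℕ) → (∀ F → Y F ≤ D * q F ^ M) → (λ F → X F * Y F) ~[ N + M ] (λ F → X′ F * Y F)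
  ~-*ʳ {X} {X′} {Y} (near s) D b = near (O-≤ (λ F → ≤-reflexive (sym (*-distribʳ-∣-∣ (Y F) (X F) (X′ F)))) (O-* {Y = Y} s D b))

  ~-* : ∀ {X X′ Y Y′ : Family} {N M : ℕ} → X ~[ N ] X′ → Y ~[ M ] Y′ → (D D′ : ℕ) → (∀ F → Y F ≤ D * q F ^ M) → (∀ F → X′ F ≤ D′ * q F ^ N) →
        (λ F → X F * Y F) ~[ N + M ] (λ F → X′ F * Y′ F)
  ~-* {X} {X′} {Y} {Y′} {N} {M} (near s) (near t) D D′ b c = near (O-≤ (λ F → ∣-∣-*-≤ (X F) (Y F) (X′ F) (Y′ F))
    (O-+ (O-* {Y = Y} s D b) (O-cong-exponent (+-comm M N) (O-≤ (λ F → ≤-reflexive (*-comm (X′ F) ∣ Y F - Y′ F ∣)) (O-* {Y = X′} t D′ c)))))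

  ~-subtract : ∀ {A A′ B D : Family} {N : ℕ} → (∀ F → A F + B F ≡ A′ F + D F) → A ~[ N ] A′ → B ~[ N ] D
  ~-subtract {A} {A′} {B} {D} e (near s) = near (O-≤ (λ F → ≤-reflexive (∣-∣-complement (A F) (A′ F) (e F))) s)

-- Exact identities and bounds for counts of monic polynomials.

module PolynomialCounts where

  open import Data.Bool using (Bool; true; false; not; _∨_; T)
  open import Data.Bool.ListAction using (all)
  open import Data.Nat as ℕ using (ℕ; zero; suc; _≤_; _<_; z≤n; s≤s; _≡ᵇ_; _≤ᵇ_; _^_)
  import Data.Nat.Properties as ℕₚ
  open import Data.Nat.Tactic.RingSolver using (solve-∀)
  open import Data.Nat.ListAction using (sum)
  open import Data.List using (List; []; _∷_; [_])
  open import Data.List.Membership.Propositional using (_∈_)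
  open import Data.List.Membership.Propositional.Properties using (∈-map⁻; ∈-length)
  open import Data.List.Relation.Unary.Any using (here; there)
  open import Data.Product using (_×_; _,_; proj₁; proj₂)
  open import Data.Vec using (Vec; []; _∷_)
  open import Function using (_∘_)
  open import Relation.Binary.PropositionalEquality as ≡ using (_≡_; _≢_; refl; sym; trans; cong; cong₂; subst)
  open import Relation.Nullary using (does; yes; no; contradiction)
  open import Defs
  open Finite
  open Counting
  open Polynomials
  open Degrees
  open Factorization

  open Enum using (list)

  𝟙-guard : ∀ b {m n} → (b ≡ true → m ≡ n) → 𝟙 b ℕ.* m ≡ 𝟙 b ℕ.* n
  𝟙-guard true  e = cong (1 ℕ.*_) (e refl)
  𝟙-guard false e = refl

  bool-iff : ∀ {a b} → (a ≡ true → b ≡ true) → (b ≡ true → a ≡ true) → a ≡ b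
  bool-iff {true}  {true}  f g = refl
  bool-iff {false} {false} f g = refl
  bool-iff {true}  {false} f g = sym (f refl)
  bool-iff {false} {true}  f g = g refl

  ≡ᵇ-true : ∀ {m n} → m ≡ n → (m ≡ᵇ n) ≡ true
  ≡ᵇ-true {zero}  refl = refl
  ≡ᵇ-true {suc m} refl = ≡ᵇ-true {m} refl

  ≡ᵇ-sound : ∀ m n → (m ≡ᵇ n) ≡ true → m ≡ n
  ≡ᵇ-sound m n e = ℕₚ.≡ᵇ⇒≡ m n (subst T (sym e) _)

  ≡ᵇ-sym : ∀ m n → (m ≡ᵇ n) ≡ (n ≡ᵇ m)
  ≡ᵇ-sym zero    zero    = refl
  ≡ᵇ-sym zero    (suc n) = refl
  ≡ᵇ-sym (suc m) zero    = refl
  ≡ᵇ-sym (suc m) (suc n) = ≡ᵇ-sym m n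

  mult-∷ : ∀ i d μ → mult i (d ∷ μ) ≡ 𝟙 (d ≡ᵇ i) ℕ.+ mult i μ
  mult-∷ i d μ with d ≡ᵇ i
  ... | true  = refl
  ... | false = refl

  mult-large : ∀ i μ → sum μ < i → mult i μ ≡ 0
  mult-large i []      _  = refl
  mult-large i (d ∷ μ) lt = trans (mult-∷ i d μ) (cong₂ ℕ._+_
    (𝟙-≡ᵇ-≢ (ℕₚ.<⇒≢ (ℕₚ.≤-<-trans (ℕₚ.m≤m+n d (sum μ)) lt)))
    (mult-large i μ (ℕₚ.≤-<-trans (ℕₚ.m≤n+m (sum μ) d) lt)))

  module Count (F : FiniteField) where
    open FiniteField F using (Carrier; 0#; 1#; _*_; _≟_; elements; inverse; card)
    open FF F using (Poly; _⊗_; _^P_; monics; _∣?_; irreducible; multiplicity)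
    open Poly F
    open Degree F
    open Factor F
    open ≡.≡-Reasoning

    private q = card

    instance
      q-nonZero : ℕ.NonZero q
      q-nonZero = ℕ.>-nonZero (∈-length (FiniteField.complete F 0#))

    vecs : ∀ n → List (Vec Carrier n)
    vecs n = list (Vecs 𝔼 n)

    ∑-vecs-const : ∀ n c → ∑ (vecs n) (λ _ → c) ≡ q ^ n ℕ.* c
    ∑-vecs-const n c = trans (∑-const (vecs n) c) (cong (ℕ._* c) (size-Vecs 𝔼 n))

    ∑-vecs-1 : ∀ n → ∑ (vecs n) (λ _ → 1) ≡ q ^ n
    ∑-vecs-1 n = trans (∑-vecs-const n 1) (ℕₚ.*-identityʳ _)

    multiples : Poly → ℕ → ℕ
    multiples Q n = ∑ (vecs n) (λ f → 𝟙 (Q ∣? mon f))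

    multiples-bound : ∀ {Q e} n → Monic Q e → q ^ e ℕ.* multiples Q n ≤ q ^ n
    multiples-bound {Q} {e} n M with e ℕ.≤? n
    ... | no e≰n = ℕₚ.≤-trans (ℕₚ.≤-reflexive (trans (cong (q ^ e ℕ.*_) (∑-≡0 (vecs n) (λ f _ →
            cong 𝟙 (∣?-largeDegree M (Monic-mon f) (ℕₚ.≰⇒> e≰n))))) (ℕₚ.*-zeroʳ (q ^ e)))) z≤n
    ... | yes e≤n with ℕₚ.m≤n⇒∃[o]m+o≡n e≤n
    ...   | k , refl = ℕₚ.≤-reflexive (trans (cong (q ^ e ℕ.*_) (begin
            multiples Q (e ℕ.+ k) ≡⟨ ∑-cong (vecs (e ℕ.+ k)) (λ f → ℕₚ.*-identityʳ (𝟙 (Q ∣? mon f))) ⟨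
            ∑ (vecs (e ℕ.+ k)) (λ f → 𝟙 (Q ∣? mon f) ℕ.* 1) ≡⟨ ∑-multiples k M (λ _ → 1) (λ _ → refl) ⟩
            ∑ (vecs k) (λ _ → 1) ≡⟨ ∑-vecs-1 k ⟩
            q ^ k ∎)) (sym (ℕₚ.^-distribˡ-+-* q e k)))

    irr : ∀ {d} → Vec Carrier d → ℕ
    irr {d} v = 𝟙 (irreducible d (mon v))

    irreducibles : ℕ → ℕ
    irreducibles d = ∑ (vecs d) irr

    -- Pairs (f , Pʲ) with Pʲ ∣ f are counted in two ways: simple collects j = 1 and excess collects j ≥ 2.
    simple : ℕ → ℕ → (Poly → ℕ) → ℕ
    simple d k X = ∑ (vecs d) (λ v → irr v ℕ.* ∑ (vecs k) (λ w → X (mon v ⊗ mon w)))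

    excess : ℕ → ℕ → (Poly → ℕ) → ℕ
    excess n d X = ∑ (vecs d) (λ v → irr v ℕ.* ∑ (oneTo n) (λ m → ∑ (vecs (suc n)) (λ f → 𝟙 ((mon v ^P suc m) ∣? mon f) ℕ.* X (mon f))))

    weighted : ℕ → ℕ → (Poly → ℕ) → ℕ
    weighted n d X = ∑ (vecs n) (λ f → X (mon f) ℕ.* factors n d (mon f))

    -- Exchange the sum over `f` with the sums over irreducible `P` and over its powers; for the
    -- first power the multiples are parametrised by cofactors of degree `k`. The weight `X` is
    -- later 1, a prescribed constant term, or a cycle type.
    weighted-split : ∀ d k (X : Poly → ℕ) → (∀ {f g} → f ≈ g → X f ≡ X g) →
      weighted (suc d ℕ.+ k) (suc d) X ≡ simple (suc d) k X ℕ.+ excess (d ℕ.+ k) (suc d) X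
    weighted-split d k X X-cong = begin
      ∑ (vecs n) (λ f → X (mon f) ℕ.* ∑ (vecs (suc d)) (λ v → irr v ℕ.* valuation n (mon v) (mon f)))
        ≡⟨ ∑-cong (vecs n) (λ f → trans (sym (∑-*ˡ (vecs (suc d)) (X (mon f)) _))
             (∑-cong (vecs (suc d)) (λ v → exchange (X (mon f)) (irr v) (valuation n (mon v) (mon f))))) ⟩
      ∑ (vecs n) (λ f → ∑ (vecs (suc d)) (λ v → irr v ℕ.* (valuation n (mon v) (mon f) ℕ.* X (mon f))))
        ≡⟨ ∑-swap (vecs n) (vecs (suc d)) _ ⟩
      ∑ (vecs (suc d)) (λ v → ∑ (vecs n) (λ f → irr v ℕ.* (valuation n (mon v) (mon f) ℕ.* X (mon f))))
        ≡⟨ ∑-cong (vecs (suc d)) (λ v → trans (∑-*ˡ (vecs n) (irr v) _) (trans (cong (irr v ℕ.*_) (per v)) (ℕₚ.*-distribˡ-+ (irr v) _ _))) ⟩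
      ∑ (vecs (suc d)) (λ v → irr v ℕ.* ∑ (vecs k) (λ w → X (mon v ⊗ mon w)) ℕ.+
        irr v ℕ.* ∑ (oneTo (d ℕ.+ k)) (λ m → ∑ (vecs n) (λ f → 𝟙 ((mon v ^P suc m) ∣? mon f) ℕ.* X (mon f))))
        ≡⟨ ∑-+ (vecs (suc d)) _ _ ⟩
      simple (suc d) k X ℕ.+ excess (d ℕ.+ k) (suc d) X ∎
      where
      n = suc d ℕ.+ k
      exchange : ∀ a b c → a ℕ.* (b ℕ.* c) ≡ b ℕ.* (c ℕ.* a)
      exchange = solve-∀
      per : ∀ v → ∑ (vecs n) (λ f → valuation n (mon v) (mon f) ℕ.* X (mon f)) ≡
        ∑ (vecs k) (λ w → X (mon v ⊗ mon w)) ℕ.+ ∑ (oneTo (d ℕ.+ k)) (λ m → ∑ (vecs n) (λ f → 𝟙 ((mon v ^P suc m) ∣? mon f) ℕ.* X (mon f)))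
      per v = begin
        ∑ (vecs n) (λ f → valuation n (mon v) (mon f) ℕ.* X (mon f))
          ≡⟨ ∑-cong (vecs n) (λ f → sym (∑-*ʳ (oneTo n) (X (mon f)) (λ m → 𝟙 ((mon v ^P m) ∣? mon f)))) ⟩
        ∑ (vecs n) (λ f → ∑ (oneTo n) (λ m → 𝟙 ((mon v ^P m) ∣? mon f) ℕ.* X (mon f)))
          ≡⟨ ∑-swap (vecs n) (oneTo n) _ ⟩
        ∑ (oneTo n) (λ m → ∑ (vecs n) (λ f → 𝟙 ((mon v ^P m) ∣? mon f) ℕ.* X (mon f)))
          ≡⟨ ∑-oneTo-suc (d ℕ.+ k) _ ⟩
        ∑ (vecs n) (λ f → 𝟙 ((mon v ^P 1) ∣? mon f) ℕ.* X (mon f)) ℕ.+ rest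
          ≡⟨ cong (ℕ._+ rest) (∑-multiples k (Monic-cong (≈-sym (⊗-identityʳ (mon v))) (Monic-mon v)) X X-cong) ⟩
        ∑ (vecs k) (λ w → X ((mon v ^P 1) ⊗ mon w)) ℕ.+ rest
          ≡⟨ cong (ℕ._+ rest) (∑-cong (vecs k) (λ w → X-cong (⊗-congˡ (mon w) (⊗-identityʳ (mon v))))) ⟩
        ∑ (vecs k) (λ w → X (mon v ⊗ mon w)) ℕ.+ rest ∎
        where
        rest = ∑ (oneTo (d ℕ.+ k)) (λ m → ∑ (vecs n) (λ f → 𝟙 ((mon v ^P suc m) ∣? mon f) ℕ.* X (mon f)))

    simple-1 : ∀ d k → simple d k (λ _ → 1) ≡ irreducibles d ℕ.* q ^ k
    simple-1 d k = trans (∑-cong (vecs d) (λ v → cong (irr v ℕ.*_) (∑-vecs-1 k))) (∑-*ʳ (vecs d) (q ^ k) irr)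

    irr*-≤ : ∀ {d} (v : Vec Carrier d) n → irr v ℕ.* n ≤ n
    irr*-≤ {d} v n = ℕₚ.≤-trans (ℕₚ.*-monoˡ-≤ n (𝟙≤1 (irreducible d (mon v)))) (ℕₚ.≤-reflexive (ℕₚ.*-identityˡ n))

    excess-mono : ∀ n d {X Y : Poly → ℕ} → (∀ f → X f ≤ Y f) → excess n d X ≤ excess n d Y
    excess-mono n d le = ∑-mono (vecs d) (λ v → ℕₚ.*-monoʳ-≤ (irr v) (∑-mono (oneTo n) (λ m → ∑-mono (vecs (suc n)) (λ f →
      ℕₚ.*-monoʳ-≤ (𝟙 ((mon v ^P suc m) ∣? mon f)) (le (mon f))))))

    ∑-excess : {A : Set} (xs : List A) → ∀ n d (X : A → Poly → ℕ) → ∑ xs (λ a → excess n d (X a)) ≡ excess n d (λ f → ∑ xs (λ a → X a f))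
    ∑-excess xs n d X = trans (∑-swap xs (vecs d) _) (∑-cong (vecs d) (λ v → trans (∑-*ˡ xs (irr v) _) (cong (irr v ℕ.*_)
      (trans (∑-swap xs (oneTo n) _) (∑-cong (oneTo n) (λ m → trans (∑-swap xs (vecs (suc n)) _) (∑-cong (vecs (suc n)) (λ f →
        ∑-*ˡ xs (𝟙 ((mon v ^P suc m) ∣? mon f)) (λ a → X a (mon f))))))))))

    -- There are at most `q ^ d` polynomials `P`, and each of the `n` powers considered has degree
    -- at least `d + 1`, leaving at most `q ^ suc n / q ^ (d + 1)` multiples. The factor `q` gained
    -- over the trivial bound makes repeated factors negligible.
    excess-bound : ∀ n d → 1 ≤ d → q ℕ.* excess n d (λ _ → 1) ≤ n ℕ.* q ^ suc n
    excess-bound n d 1≤d = ℕₚ.*-cancelˡ-≤ (q ^ d) {{ℕₚ.m^n≢0 q d}} (R.begin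
      q ^ d ℕ.* (q ℕ.* excess n d (λ _ → 1))
        R.≤⟨ ℕₚ.*-monoʳ-≤ (q ^ d) (ℕₚ.*-monoʳ-≤ q (∑-mono (vecs d) (λ v → irr*-≤ v _))) ⟩
      q ^ d ℕ.* (q ℕ.* ∑ (vecs d) (λ v → ∑ (oneTo n) (λ m → ∑ (vecs (suc n)) (λ f → 𝟙 ((mon v ^P suc m) ∣? mon f) ℕ.* 1))))
        R.≡⟨ trans (sym (ℕₚ.*-assoc (q ^ d) q _)) (trans (cong (q ^ d ℕ.* q ℕ.*_) (∑-cong (vecs d) (λ v → ∑-cong (oneTo n) (λ m →
               ∑-cong (vecs (suc n)) (λ f → ℕₚ.*-identityʳ (𝟙 ((mon v ^P suc m) ∣? mon f))))))) (sym (∑-*ˡ (vecs d) (q ^ d ℕ.* q) _))) ⟩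
      ∑ (vecs d) (λ v → q ^ d ℕ.* q ℕ.* ∑ (oneTo n) (λ m → multiples (mon v ^P suc m) (suc n)))
        R.≤⟨ ∑-mono (vecs d) per ⟩
      ∑ (vecs d) (λ v → n ℕ.* q ^ suc n) R.≡⟨ ∑-vecs-const d _ ⟩
      q ^ d ℕ.* (n ℕ.* q ^ suc n) R.∎)
      where
      module R = ℕₚ.≤-Reasoning
      per : ∀ v → q ^ d ℕ.* q ℕ.* ∑ (oneTo n) (λ m → multiples (mon v ^P suc m) (suc n)) ≤ n ℕ.* q ^ suc n
      per v = R.begin
        q ^ d ℕ.* q ℕ.* ∑ (oneTo n) (λ m → multiples (mon v ^P suc m) (suc n)) R.≡⟨ ∑-*ˡ (oneTo n) (q ^ d ℕ.* q) _ ⟨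
        ∑ (oneTo n) (λ m → q ^ d ℕ.* q ℕ.* multiples (mon v ^P suc m) (suc n)) R.≤⟨ ∑-mono∈ (oneTo n) (λ m m∈ →
          ℕₚ.≤-trans (ℕₚ.*-monoˡ-≤ (multiples (mon v ^P suc m) (suc n)) (bigger m (proj₁ (∈-oneTo⁻ m∈))))
                     (multiples-bound (suc n) (Monic-^ (suc m) (Monic-mon v)))) ⟩
        ∑ (oneTo n) (λ m → q ^ suc n) R.≡⟨ trans (∑-const (oneTo n) _) (cong (ℕ._* q ^ suc n) (length-oneTo n)) ⟩
        n ℕ.* q ^ suc n R.∎
        where
        bigger : ∀ m → 1 ≤ m → q ^ d ℕ.* q ≤ q ^ (suc m ℕ.* d)
        bigger m 1≤m = R.begin
          q ^ d ℕ.* q        R.≡⟨ ℕₚ.*-comm (q ^ d) q ⟩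
          q ^ suc d          R.≤⟨ ℕₚ.^-monoʳ-≤ q (ℕₚ.≤-trans (ℕₚ.≤-reflexive (ℕₚ.+-comm 1 d))
                                  (ℕₚ.+-monoʳ-≤ d (ℕₚ.≤-trans 1≤d (ℕₚ.m≤n*m d m {{ℕ.>-nonZero 1≤m}})))) ⟩
          q ^ (suc m ℕ.* d)  R.∎

    -- Each `f` contributes `X f` times the total degree of its irreducible factors, which is `n`.
    -- For `X = 1` this plays the part of the identity `∑_(d ∣ n) d N_d = q ^ n`.
    ∑-weighted : ∀ n (X : Poly → ℕ) → ∑ (oneTo n) (λ d → d ℕ.* weighted n d X) ≡ ∑ (vecs n) (X ∘ mon) ℕ.* n
    ∑-weighted n X = begin
      ∑ (oneTo n) (λ d → d ℕ.* weighted n d X)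
        ≡⟨ ∑-cong (oneTo n) (λ d → trans (sym (∑-*ˡ (vecs n) d _)) (∑-cong (vecs n) (λ f → exchange d (X (mon f)) (factors n d (mon f))))) ⟩
      ∑ (oneTo n) (λ d → ∑ (vecs n) (λ f → X (mon f) ℕ.* (d ℕ.* factors n d (mon f))))
        ≡⟨ ∑-swap (oneTo n) (vecs n) _ ⟩
      ∑ (vecs n) (λ f → ∑ (oneTo n) (λ d → X (mon f) ℕ.* (d ℕ.* factors n d (mon f))))
        ≡⟨ ∑-cong (vecs n) (λ f → trans (∑-*ˡ (oneTo n) (X (mon f)) _)
             (cong (X (mon f) ℕ.*_) (∑-factors (suc n) ℕₚ.≤-refl (Monic-mon f) ℕₚ.≤-refl ℕₚ.≤-refl))) ⟩
      ∑ (vecs n) (λ f → X (mon f) ℕ.* n) ≡⟨ ∑-*ʳ (vecs n) n _ ⟩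
      ∑ (vecs n) (X ∘ mon) ℕ.* n ∎
      where
      exchange : ∀ a b c → a ℕ.* (b ℕ.* c) ≡ b ℕ.* (a ℕ.* c)
      exchange = solve-∀

    unit : Carrier → ℕ
    unit c = 𝟙 (not (does (c ≟ 0#)))

    unit≤1 : ∀ c → unit c ≤ 1
    unit≤1 c = 𝟙≤1 (not (does (c ≟ 0#)))

    unit+zero : ∀ c → unit c ℕ.+ 𝟙 (does (0# ≟ c)) ≡ 1
    unit+zero c with c ≟ 0# | 0# ≟ c
    ... | yes _ | yes _ = refl
    ... | no _  | no _  = refl
    ... | yes e | no ne = contradiction (sym e) ne
    ... | no ne | yes e = contradiction (sym e) ne

    ∑-δ1 : ∀ c → ∑ elements (λ x → 𝟙 (does (c ≟ x))) ≡ 1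
    ∑-δ1 c = trans (∑-cong elements (λ x → sym (ℕₚ.*-identityʳ _))) (∑-δ 𝔼 c (λ _ → 1))

    ∑-unit : ∑ elements unit ℕ.+ 1 ≡ q
    ∑-unit = trans (cong (∑ elements unit ℕ.+_) (sym (∑-δ1 0#)))
      (trans (sym (∑-+ elements unit _)) (trans (∑-cong elements unit+zero) (∑-1 elements)))

    ∑-constantTerm : ∀ n (g : Carrier → ℕ) → ∑ (vecs (suc n)) (λ w → g (coeff (mon w) 0)) ≡ q ^ n ℕ.* ∑ elements g
    ∑-constantTerm n g = trans (∑-Vecs-suc 𝔼 n _) (trans (∑-cong elements (λ x → ∑-vecs-const n (g x))) (∑-*ˡ elements (q ^ n) g))

    constant : Carrier → Poly → ℕ
    constant c f = 𝟙 (does (c ≟ coeff f 0))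

    constant-cong : ∀ c {f g} → f ≈ g → constant c f ≡ constant c g
    constant-cong c e = cong (λ x → 𝟙 (does (c ≟ x))) (at e 0)

    ∑-constant : ∀ n c → ∑ (vecs (suc n)) (λ w → constant c (mon w)) ≡ q ^ n
    ∑-constant n c = trans (∑-constantTerm n (λ x → 𝟙 (does (c ≟ x)))) (trans (cong (q ^ n ℕ.*_) (∑-δ1 c)) (ℕₚ.*-identityʳ _))

    coeff₀-⊗ : ∀ f g → coeff (f ⊗ g) 0 ≡ coeff f 0 * coeff g 0
    coeff₀-⊗ []      g = sym (𝔽.zeroˡ _)
    coeff₀-⊗ (a ∷ f) g = trans (coeff-⊕ (scale a g) _ 0) (trans (𝔽.+-identityʳ _) (coeff-scale a g 0))

    solutions : ∀ a c → c ≢ 0# → ∑ elements (λ b → 𝟙 (does (c ≟ (a * b)))) ≡ unit a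
    solutions a c c≢0 with a ≟ 0#
    ... | yes refl = ∑-≡0 elements (λ b _ → 𝟙-≟-≢ 𝔼 (λ e → c≢0 (trans e (𝔽.zeroˡ b))))
    ... | no a≢0 with inverse a a≢0
    ...   | a⁻¹ , aa⁻¹≡1 = trans (∑-point 𝔼 (a⁻¹ * c) _ (λ b ne → 𝟙-≟-≢ 𝔼 (λ e → ne (begin
              b               ≡⟨ 𝔽.*-identityˡ b ⟨
              1# * b          ≡⟨ cong (_* b) (trans (sym aa⁻¹≡1) (𝔽.*-comm a a⁻¹)) ⟩
              (a⁻¹ * a) * b   ≡⟨ 𝔽.*-assoc a⁻¹ a b ⟩
              a⁻¹ * (a * b)   ≡⟨ cong (a⁻¹ *_) e ⟨
              a⁻¹ * c         ∎))))
            (trans (cong (λ x → 𝟙 (does (c ≟ x))) (begin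
              a * (a⁻¹ * c)   ≡⟨ 𝔽.*-assoc a a⁻¹ c ⟨
              (a * a⁻¹) * c   ≡⟨ cong (_* c) aa⁻¹≡1 ⟩
              1# * c          ≡⟨ 𝔽.*-identityˡ c ⟩
              c               ∎)) (𝟙-≟-refl 𝔼 c))

    irreducibleUnits : ℕ → ℕ
    irreducibleUnits d = ∑ (vecs d) (λ v → irr v ℕ.* unit (coeff (mon v) 0))

    -- If `P(0) ≠ 0`, the cofactor, of degree at least 1, must have constant term `c / P(0)`, which
    -- leaves `q ^ k` choices; `P(0) = 0` is impossible. The outcome is the same for all `c`.
    simple-constant : ∀ d k c → c ≢ 0# → simple d (suc k) (constant c) ≡ irreducibleUnits d ℕ.* q ^ k
    simple-constant d k c c≢0 = trans (∑-cong (vecs d) per) (∑-*ʳ (vecs d) (q ^ k) _)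
      where
      per : ∀ v → irr v ℕ.* ∑ (vecs (suc k)) (λ w → constant c (mon v ⊗ mon w)) ≡ irr v ℕ.* unit (coeff (mon v) 0) ℕ.* q ^ k
      per v = trans (cong (irr v ℕ.*_) (begin
        ∑ (vecs (suc k)) (λ w → constant c (mon v ⊗ mon w))
          ≡⟨ ∑-cong (vecs (suc k)) (λ w → cong (λ x → 𝟙 (does (c ≟ x))) (coeff₀-⊗ (mon v) (mon w))) ⟩
        ∑ (vecs (suc k)) (λ w → 𝟙 (does (c ≟ (coeff (mon v) 0 * coeff (mon w) 0))))
          ≡⟨ ∑-constantTerm k (λ x → 𝟙 (does (c ≟ (coeff (mon v) 0 * x)))) ⟩
        q ^ k ℕ.* ∑ elements (λ b → 𝟙 (does (c ≟ (coeff (mon v) 0 * b))))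
          ≡⟨ cong (q ^ k ℕ.*_) (solutions (coeff (mon v) 0) c c≢0) ⟩
        q ^ k ℕ.* unit (coeff (mon v) 0) ≡⟨ ℕₚ.*-comm (q ^ k) _ ⟩
        unit (coeff (mon v) 0) ℕ.* q ^ k ∎)) (sym (ℕₚ.*-assoc (irr v) _ _))

    irreducibles-split : ∀ d → irreducibleUnits (suc d) ≤ irreducibles (suc d) × irreducibles (suc d) ≤ irreducibleUnits (suc d) ℕ.+ q ^ d
    irreducibles-split d =
      ∑-mono (vecs (suc d)) (λ v → ℕₚ.≤-trans (ℕₚ.*-monoʳ-≤ (irr v) (unit≤1 _)) (ℕₚ.≤-reflexive (ℕₚ.*-identityʳ _))) ,
      ℕₚ.≤-trans (∑-mono (vecs (suc d)) per) (ℕₚ.≤-reflexive (trans (∑-+ (vecs (suc d)) _ _) (cong (irreducibleUnits (suc d) ℕ.+_) (∑-constant d 0#))))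
      where
      per : ∀ v → irr v ≤ irr v ℕ.* unit (coeff (mon v) 0) ℕ.+ constant 0# (mon v)
      per v = ℕₚ.≤-trans (ℕₚ.≤-reflexive (trans (sym (ℕₚ.*-identityʳ (irr v))) (trans (cong (irr v ℕ.*_) (sym (unit+zero (coeff (mon v) 0)))) (ℕₚ.*-distribˡ-+ (irr v) _ _))))
        (ℕₚ.+-monoʳ-≤ (irr v ℕ.* unit (coeff (mon v) 0)) (irr*-≤ v _))

    hasType : ℕ → List ℕ → Poly → Bool
    hasType n μ f = all (λ d → factors n d f ≡ᵇ mult d μ) (oneTo n)

    hasType-cong : ∀ n μ {f g} → f ≈ g → hasType n μ f ≡ hasType n μ g
    hasType-cong n μ e = all-cong (oneTo n) (λ d → cong (_≡ᵇ mult d μ) (factors-cong n d e))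

    types : ℕ → List ℕ → ℕ
    types n μ = ∑ (vecs n) (λ f → 𝟙 (hasType n μ (mon f)))

    valuation-extend : ∀ j {P d g k} → 1 ≤ d → Monic P d → Monic g k → valuation (j ℕ.+ k) P g ≡ valuation k P g
    valuation-extend j {P} {d} {g} {k} 1≤d M G = ∑-oneTo-extend k j _ (λ m k<m → cong 𝟙
      (∣?-largeDegree (Monic-^ m M) G (ℕₚ.<-≤-trans k<m (ℕₚ.m≤m*n m d {{ℕ.>-nonZero 1≤d}}))))

    factors-extend : ∀ j d {g k} → 1 ≤ d → Monic g k → factors (j ℕ.+ k) d g ≡ factors k d g
    factors-extend j d 1≤d G = ∑-cong (vecs d) (λ v → cong (irr v ℕ.*_) (valuation-extend j 1≤d (Monic-mon v) G))

    -- Removing the factor `mon v` lowers the count in its own degree only, as removing a part does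
    -- for the partition. Since `sum μ` is the degree `k`, both counts vanish in degrees above `k`,
    -- which reconciles the two ranges of degrees.
    hasType-⊗ : ∀ d μ {k} → sum μ ≡ k → (v : Vec Carrier (suc d)) → irreducible (suc d) (mon v) ≡ true → (w : Vec Carrier k) →
      hasType (suc d ℕ.+ k) (suc d ∷ μ) (mon v ⊗ mon w) ≡ hasType k μ (mon w)
    hasType-⊗ d μ {k} sum≡ v irr-v w = bool-iff
      (λ h → all-intro _ (oneTo k) (λ i i∈ → let 1≤i , i≤k = ∈-oneTo⁻ i∈ in ≡ᵇ-true (proj₁ (reduce i 1≤i)
        (≡ᵇ-sound _ _ (all-true _ (oneTo n) h (∈-oneTo⁺ 1≤i (ℕₚ.≤-trans i≤k (ℕₚ.m≤n+m k (suc d)))))))))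
      (λ h → all-intro _ (oneTo n) (λ i i∈ → let 1≤i , i≤n = ∈-oneTo⁻ i∈ in ≡ᵇ-true (proj₂ (reduce i 1≤i) (small h i 1≤i))))
      where
      n = suc d ℕ.+ k
      small : hasType k μ (mon w) ≡ true → ∀ i → 1 ≤ i → factors k i (mon w) ≡ mult i μ
      small h i 1≤i with i ℕ.≤? k
      ... | yes i≤k = ≡ᵇ-sound _ _ (all-true _ (oneTo k) h (∈-oneTo⁺ 1≤i i≤k))
      ... | no i≰k  = trans (factors-largeDegree k (Monic-mon w) (ℕₚ.≰⇒> i≰k))
                            (sym (mult-large i μ (subst (_< i) (sym sum≡) (ℕₚ.≰⇒> i≰k))))
      left : ∀ i → 1 ≤ i → factors n i (mon v ⊗ mon w) ≡ factors k i (mon w) ℕ.+ 𝟙 (i ≡ᵇ suc d)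
      left i 1≤i = trans (factors-⊗ n v 1≤i (s≤s z≤n) irr-v (Monic-mon w) (s≤s (ℕₚ.m≤n+m k d)))
        (cong (ℕ._+ 𝟙 (i ≡ᵇ suc d)) (factors-extend (suc d) i 1≤i (Monic-mon w)))
      right : ∀ i → mult i (suc d ∷ μ) ≡ mult i μ ℕ.+ 𝟙 (i ≡ᵇ suc d)
      right i = trans (mult-∷ i (suc d) μ) (trans (ℕₚ.+-comm _ (mult i μ)) (cong (λ b → mult i μ ℕ.+ 𝟙 b) (≡ᵇ-sym (suc d) i)))
      reduce : ∀ i → 1 ≤ i → (factors n i (mon v ⊗ mon w) ≡ mult i (suc d ∷ μ) → factors k i (mon w) ≡ mult i μ) ×
                             (factors k i (mon w) ≡ mult i μ → factors n i (mon v ⊗ mon w) ≡ mult i (suc d ∷ μ))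
      reduce i 1≤i = (λ e → ℕₚ.+-cancelʳ-≡ _ _ _ (trans (sym (left i 1≤i)) (trans e (right i)))) ,
                     (λ e → trans (left i 1≤i) (trans (cong (ℕ._+ 𝟙 (i ≡ᵇ suc d)) e) (sym (right i))))

    -- Counts, with multiplicity, the pairs of a polynomial of type `suc d ∷ μ` and an irreducible
    -- factor of degree `suc d`: the type fixes the number of such factors, and removing a first
    -- copy leaves type `μ`.
    types-split : ∀ d μ k → sum μ ≡ k →
      mult (suc d) (suc d ∷ μ) ℕ.* types (suc d ℕ.+ k) (suc d ∷ μ) ≡
      irreducibles (suc d) ℕ.* types k μ ℕ.+ excess (d ℕ.+ k) (suc d) (λ f → 𝟙 (hasType (suc d ℕ.+ k) (suc d ∷ μ) f))
    types-split d μ k sum≡ = begin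
      mult (suc d) (suc d ∷ μ) ℕ.* types n (suc d ∷ μ)
        ≡⟨ trans (ℕₚ.*-comm _ (types n (suc d ∷ μ))) (sym (∑-*ʳ (vecs n) (mult (suc d) (suc d ∷ μ)) _)) ⟩
      ∑ (vecs n) (λ f → X (mon f) ℕ.* mult (suc d) (suc d ∷ μ)) ≡⟨ ∑-cong (vecs n) same ⟩
      weighted n (suc d) X ≡⟨ weighted-split d k X (λ e → cong 𝟙 (hasType-cong n (suc d ∷ μ) e)) ⟩
      simple (suc d) k X ℕ.+ excess (d ℕ.+ k) (suc d) X
        ≡⟨ cong (ℕ._+ excess (d ℕ.+ k) (suc d) X) (trans (∑-cong (vecs (suc d)) reduce) (∑-*ʳ (vecs (suc d)) (types k μ) irr)) ⟩
      irreducibles (suc d) ℕ.* types k μ ℕ.+ excess (d ℕ.+ k) (suc d) X ∎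
      where
      n = suc d ℕ.+ k
      X : Poly → ℕ
      X f = 𝟙 (hasType n (suc d ∷ μ) f)
      same : ∀ f → X (mon f) ℕ.* mult (suc d) (suc d ∷ μ) ≡ X (mon f) ℕ.* factors n (suc d) (mon f)
      same f = 𝟙-guard (hasType n (suc d ∷ μ) (mon f)) (λ h → sym (≡ᵇ-sound _ _ (all-true _ (oneTo n) h (∈-oneTo⁺ (s≤s z≤n) (ℕₚ.m≤m+n (suc d) k)))))
      reduce : ∀ v → irr v ℕ.* ∑ (vecs k) (λ w → X (mon v ⊗ mon w)) ≡ irr v ℕ.* types k μ
      reduce v = 𝟙-guard (irreducible (suc d) (mon v)) (λ irr-v → ∑-cong (vecs k) (λ w → cong 𝟙 (hasType-⊗ d μ sum≡ v irr-v w)))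

    -- One irreducible factor of degree `suc n` exhausts the degree, so `factors` is 0 or 1 here,
    -- and in the second case all lower counts vanish. Sums of `factors` in the top degree therefore
    -- count irreducible polynomials exactly.
    hasType-[n] : ∀ {f} n → Monic f (suc n) → 𝟙 (hasType (suc n) [ suc n ] f) ≡ factors (suc n) (suc n) f
    hasType-[n] {f} n M with hasType (suc n) [ suc n ] f in h
    ... | true  = sym (trans (≡ᵇ-sound _ _ (all-true _ (oneTo (suc n)) h (∈-oneTo⁺ (s≤s z≤n) ℕₚ.≤-refl)))
                        (trans (mult-∷ (suc n) (suc n) []) (cong (ℕ._+ 0) (𝟙-≡ᵇ-refl (suc n)))))
    ... | false with factors (suc n) (suc n) f in top
    ...   | zero  = refl
    ...   | suc j = contradiction (trans (sym h) (all-intro _ (oneTo (suc n)) (λ d d∈ → ≡ᵇ-true (agrees d d∈)))) (λ ())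
      where
      total : ∑ (oneTo n) (λ d → d ℕ.* factors (suc n) d f) ℕ.+ suc n ℕ.* suc j ≡ suc n
      total = trans (cong (λ x → ∑ (oneTo n) (λ d → d ℕ.* factors (suc n) d f) ℕ.+ suc n ℕ.* x) (sym top))
        (trans (sym (∑-oneTo-snoc n _)) (∑-factors (suc (suc n)) ℕₚ.≤-refl M ℕₚ.≤-refl ℕₚ.≤-refl))
      j≡0 : j ≡ 0
      j≡0 = ℕₚ.n≤0⇒n≡0 (ℕₚ.≤-pred (ℕₚ.*-cancelˡ-≤ (suc n) (ℕₚ.≤-trans (ℕₚ.≤-trans (ℕₚ.m≤n+m _ _) (ℕₚ.≤-reflexive total)) (ℕₚ.≤-reflexive (sym (ℕₚ.*-identityʳ (suc n)))))))
      rest≡0 : ∑ (oneTo n) (λ d → d ℕ.* factors (suc n) d f) ≡ 0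
      rest≡0 = ℕₚ.+-cancelʳ-≡ (suc n ℕ.* suc j) _ 0 (trans total (trans (sym (ℕₚ.*-identityʳ (suc n))) (cong (λ x → suc n ℕ.* suc x) (sym j≡0))))
      term≡0 : {A : Set} (xs : List A) (g : A → ℕ) → ∑ xs g ≡ 0 → ∀ {x} → x ∈ xs → g x ≡ 0
      term≡0 (x ∷ xs) g e (here refl) = ℕₚ.m+n≡0⇒m≡0 (g x) e
      term≡0 (x ∷ xs) g e (there y∈)  = term≡0 xs g (ℕₚ.m+n≡0⇒n≡0 (g x) e) y∈
      agrees : ∀ d → d ∈ oneTo (suc n) → factors (suc n) d f ≡ mult d [ suc n ]
      agrees d d∈ with d ℕ.≟ suc n
      ... | yes refl = trans top (trans (cong suc j≡0) (sym (trans (mult-∷ (suc n) (suc n) []) (cong (ℕ._+ 0) (𝟙-≡ᵇ-refl (suc n))))))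
      ... | no d≢ = let 1≤d , d≤ = ∈-oneTo⁻ d∈ in trans
        (ℕₚ.*-cancelˡ-≡ _ 0 d {{ℕ.>-nonZero 1≤d}} (trans (term≡0 (oneTo n) _ rest≡0 (∈-oneTo⁺ 1≤d (ℕₚ.≤-pred (ℕₚ.≤∧≢⇒< d≤ d≢)))) (sym (ℕₚ.*-zeroʳ d))))
        (sym (trans (mult-∷ d (suc n) []) (cong (ℕ._+ 0) (𝟙-≡ᵇ-≢ (d≢ ∘ sym)))))

    squareFree : ℕ → Poly → Bool
    squareFree n g = all (λ d → all (λ f → not (irreducible d f) ∨ (multiplicity n f g ≤ᵇ 1)) (monics d)) (oneTo n)

    squareFree-cong : ∀ n {f g} → f ≈ g → squareFree n f ≡ squareFree n g
    squareFree-cong n {f} {g} e = all-cong (oneTo n) (λ d → bool-iff (transfer e d) (transfer (≈-sym e) d))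
      where
      transfer : ∀ {f g} → f ≈ g → ∀ d → all (λ P → not (irreducible d P) ∨ (multiplicity n P f ≤ᵇ 1)) (monics d) ≡ true →
                 all (λ P → not (irreducible d P) ∨ (multiplicity n P g ≤ᵇ 1)) (monics d) ≡ true
      transfer {f} {g} e d h = all-intro _ (monics d) (λ P P∈ → trans (cong (λ x → not (irreducible d P) ∨ (x ≤ᵇ 1)) (sym (same P P∈))) (all-true _ (monics d) h P∈))
        where
        same : ∀ P → P ∈ monics d → multiplicity n P f ≡ multiplicity n P g
        same P P∈ with ∈-map⁻ mon (subst (P ∈_) (monics≡ d) P∈)
        ... | v , _ , refl = trans (countᵇ≡∑ (λ m → (mon v ^P m) ∣? f) (oneTo n))
          (trans (valuation-cong n (Monic-mon v) e) (sym (countᵇ≡∑ (λ m → (mon v ^P m) ∣? g) (oneTo n))))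

    -- A polynomial that is not square-free is divisible by at least two powers of some irreducible
    -- `P`, and the one beyond the first is counted by `excess`.
    nonSquareFree-bound : ∀ n → ∑ (vecs (suc n)) (λ f → 𝟙 (not (squareFree (suc n) (mon f)))) ≤ ∑ (oneTo (suc n)) (λ d → excess n d (λ _ → 1))
    nonSquareFree-bound n = ℕₚ.≤-trans (∑-mono (vecs (suc n)) per) (ℕₚ.≤-reflexive rearrange)
      where
      S : ∀ {d} → Vec Carrier d → Vec Carrier (suc n) → ℕ
      S v f = ∑ (oneTo n) (λ m → 𝟙 ((mon v ^P suc m) ∣? mon f) ℕ.* 1)
      term≤∑ : {A : Set} (xs : List A) (g : A → ℕ) → ∀ {x} → x ∈ xs → g x ≤ ∑ xs g
      term≤∑ (x ∷ xs) g (here refl) = ℕₚ.m≤m+n (g x) _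
      term≤∑ (x ∷ xs) g (there y∈)  = ℕₚ.≤-trans (term≤∑ xs g y∈) (ℕₚ.m≤n+m _ (g x))
      valuation-S : ∀ {d} (v : Vec Carrier d) f → multiplicity (suc n) (mon v) (mon f) ≡ 𝟙 ((mon v ^P 1) ∣? mon f) ℕ.+ S v f
      valuation-S v f = trans (countᵇ≡∑ (λ m → (mon v ^P m) ∣? mon f) (oneTo (suc n)))
        (trans (∑-oneTo-suc n (λ m → 𝟙 ((mon v ^P m) ∣? mon f))) (cong (𝟙 ((mon v ^P 1) ∣? mon f) ℕ.+_)
        (∑-cong (oneTo n) (λ m → sym (ℕₚ.*-identityʳ (𝟙 ((mon v ^P suc m) ∣? mon f)))))))
      per : ∀ f → 𝟙 (not (squareFree (suc n) (mon f))) ≤ ∑ (oneTo (suc n)) (λ d → ∑ (vecs d) (λ v → irr v ℕ.* S v f))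
      per f with squareFree (suc n) (mon f) in sf
      ... | true  = z≤n
      ... | false with all-false _ (oneTo (suc n)) sf
      ...   | d , d∈ , sf′ with all-false _ (monics d) sf′
      ...     | P , P∈ , sf″ with ∈-map⁻ mon (subst (P ∈_) (monics≡ d) P∈)
      ...       | v , v∈ , refl = ℕₚ.≤-trans square-divides (ℕₚ.≤-trans (term≤∑ (vecs d) _ v∈) (term≤∑ (oneTo (suc n)) _ d∈))
        where
        square-divides : 1 ≤ irr v ℕ.* S v f
        square-divides with irreducible d (mon v)
        ... | true with multiplicity (suc n) (mon v) (mon f) ≤ᵇ 1 in le
        ...   | false = ℕₚ.≤-trans (ℕₚ.≤-pred (ℕₚ.≤-trans
            (ℕₚ.≤-trans (ℕₚ.≰⇒> (λ m≤1 → subst T le (ℕₚ.≤⇒≤ᵇ m≤1))) (ℕₚ.≤-reflexive (valuation-S v f)))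
            (ℕₚ.+-monoˡ-≤ (S v f) (𝟙≤1 _)))) (ℕₚ.≤-reflexive (sym (ℕₚ.*-identityˡ _)))
      rearrange : ∑ (vecs (suc n)) (λ f → ∑ (oneTo (suc n)) (λ d → ∑ (vecs d) (λ v → irr v ℕ.* S v f))) ≡ ∑ (oneTo (suc n)) (λ d → excess n d (λ _ → 1))
      rearrange = trans (∑-swap (vecs (suc n)) (oneTo (suc n)) _) (∑-cong (oneTo (suc n)) (λ d → trans (∑-swap (vecs (suc n)) (vecs d) _)
        (∑-cong (vecs d) (λ v → trans (∑-*ˡ (vecs (suc n)) (irr v) _) (cong (irr v ℕ.*_) (∑-swap (vecs (suc n)) (oneTo n) _))))))

-- Asymptotics for irreducible polynomials and for factorisation types.

module PolynomialAsymptotics where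

  open import Data.Bool using (true; false; not)
  open import Data.Nat hiding (_≟_)
  open import Data.Nat.Properties hiding (_≟_)
  open import Data.Nat.Tactic.RingSolver using (solve-∀)
  open import Data.Nat.ListAction using (sum)
  open import Data.List using (List; []; _∷_; [_]; _++_; foldr; upTo; map)
  open import Data.List.Properties using (upTo-∷ʳ; map-++; foldr-++)
  open import Data.List.Membership.Propositional using (_∈_)
  open import Data.List.Relation.Unary.All as All using (All; []; _∷_)
  open import Data.List.Relation.Unary.AllPairs using ([]; _∷_)
  open import Data.List.Relation.Unary.Any using (here; there)
  open import Data.List.Relation.Unary.Unique.Propositional using (Unique)
  open import Data.Product using (_,_; proj₁; proj₂)
  open import Function using (_∘_)
  open import Relation.Binary.PropositionalEquality using (_≡_; _≢_; refl; sym; trans; cong; cong₂; subst; module ≡-Reasoning)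
  open import Relation.Nullary using (¬_; does; yes; no; contradiction)
  open import Defs
  open Finite
  open Counting
  open Polynomials
  open Degrees
  open Factorization
  open PolynomialCounts
  open Asymptotics

  excess-O : ∀ n d → 1 ≤ d → (λ F → Count.excess F n d (λ _ → 1)) =O suc n
  excess-O n d 1≤d = bound n (λ F → Count.excess-bound F n d 1≤d)

  q^-O : ∀ n → (λ F → q F ^ n) =O suc n
  q^-O n = bound 1 (λ F → ≤-reflexive (sym (*-identityˡ _)))

  1*q^ : ∀ n F → q F ^ n ≤ 1 * q F ^ n
  1*q^ n F = ≤-reflexive (sym (*-identityˡ _))

  weighted~ : ∀ i k → (λ F → suc i * Count.irreducibles F (suc i)) ~[ suc i ] (λ F → q F ^ suc i) →
    (λ F → suc i * Count.weighted F (suc i + k) (suc i) (λ _ → 1)) ~[ suc i + k ] (λ F → q F ^ (suc i + k))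
  weighted~ i k irr~ = ~-trans (~-reflexive split) (~-trans
    (~-+O {X = λ F → suc i * Count.irreducibles F (suc i) * q F ^ k} (O-const* (suc i) (excess-O (i + k) (suc i) (s≤s z≤n))))
    (~-trans (~-*ʳ {Y = λ F → q F ^ k} irr~ 1 (1*q^ k)) (~-reflexive (λ F → sym (^-distribˡ-+-* (q F) (suc i) k)))))
    where
    split : ∀ F → suc i * Count.weighted F (suc i + k) (suc i) (λ _ → 1)
                ≡ suc i * Count.irreducibles F (suc i) * q F ^ k + suc i * Count.excess F (i + k) (suc i) (λ _ → 1)
    split F = trans (cong (suc i *_) (trans (Count.weighted-split F i k (λ _ → 1) (λ _ → refl))
        (cong (_+ Count.excess F (i + k) (suc i) (λ _ → 1)) (Count.simple-1 F (suc i) k))))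
      (trans (*-distribˡ-+ (suc i) (Count.irreducibles F (suc i) * q F ^ k) _) (cong (_+ suc i * Count.excess F (i + k) (suc i) (λ _ → 1)) (sym (*-assoc (suc i) (Count.irreducibles F (suc i)) (q F ^ k)))))

  weighted-top : ∀ F n X → (∀ {f g} → Poly._≈_ F f g → X f ≡ X g) →
    Count.weighted F (suc n) (suc n) X ≡ Count.simple F (suc n) 0 X + Count.excess F n (suc n) X
  weighted-top F n X X-cong = subst (λ t → Count.weighted F (suc t) (suc n) X ≡ Count.simple F (suc n) 0 X + Count.excess F t (suc n) X)
    (+-identityʳ n) (Count.weighted-split F n 0 X X-cong)

  -- No Möbius inversion: by `∑-weighted` the terms of degrees 1 to `n + 1` add up to
  -- `(n + 1) q ^ (n + 1)`, and by induction each of the first `n` is `q ^ (n + 1)` up to lower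
  -- order. Hence so is the last, which is `n + 1` times the number sought, up to `excess`. `b`
  -- bounds the strong induction.
  irreducibles~ : ∀ b d → d < b → (λ F → suc d * Count.irreducibles F (suc d)) ~[ suc d ] (λ F → q F ^ suc d)
  irreducibles~ (suc b) n (s≤s n≤b) = ~-trans (~-sym (~-+O {X = λ F → suc n * Count.irreducibles F (suc n)} (O-const* (suc n) (excess-O n (suc n) (s≤s z≤n)))))
    (~-subtract total (~-∑ (oneTo n) W (λ _ F → q F ^ suc n) each))
    where
    W : ℕ → Family
    W i F = i * Count.weighted F (suc n) i (λ _ → 1)
    each : ∀ i → i ∈ oneTo n → W i ~[ suc n ] (λ F → q F ^ suc n)
    each zero    i∈ = contradiction (proj₁ (∈-oneTo⁻ i∈)) (λ ())
    each (suc i) i∈ = go (m≤n⇒∃[o]m+o≡n (proj₂ (∈-oneTo⁻ i∈)))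
      where
      go : _ → W (suc i) ~[ suc n ] (λ F → q F ^ suc n)
      go (k , e) = subst (λ t → (λ F → suc i * Count.weighted F (suc t) (suc i) (λ _ → 1)) ~[ suc t ] (λ F → q F ^ suc t))
        (trans (+-suc i k) e)
        (weighted~ i (suc k) (irreducibles~ b i (≤-trans (proj₂ (∈-oneTo⁻ i∈)) n≤b)))
    total : ∀ F → ∑ (oneTo n) (λ i → W i F) + (suc n * Count.irreducibles F (suc n) + suc n * Count.excess F n (suc n) (λ _ → 1))
                ≡ ∑ (oneTo n) (λ i → q F ^ suc n) + q F ^ suc n
    total F = begin
      ∑ (oneTo n) (λ i → W i F) + (suc n * Count.irreducibles F (suc n) + suc n * Count.excess F n (suc n) (λ _ → 1))
        ≡⟨ cong (∑ (oneTo n) (λ i → W i F) +_) (trans (sym (*-distribˡ-+ (suc n) (Count.irreducibles F (suc n)) _)) (cong (suc n *_)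
             (sym (trans (weighted-top F n (λ _ → 1) (λ _ → refl)) (cong (_+ Count.excess F n (suc n) (λ _ → 1))
               (trans (Count.simple-1 F (suc n) 0) (*-identityʳ (Count.irreducibles F (suc n))))))))) ⟩
      ∑ (oneTo n) (λ i → W i F) + W (suc n) F ≡⟨ ∑-oneTo-snoc n (λ i → W i F) ⟨
      ∑ (oneTo (suc n)) (λ i → W i F) ≡⟨ Count.∑-weighted F (suc n) (λ _ → 1) ⟩
      ∑ (Count.vecs F (suc n)) (λ _ → 1) * suc n ≡⟨ cong (_* suc n) (Count.∑-vecs-1 F (suc n)) ⟩
      q F ^ suc n * suc n ≡⟨ trans (*-comm (q F ^ suc n) (suc n)) (+-comm (q F ^ suc n) (n * q F ^ suc n)) ⟩
      n * q F ^ suc n + q F ^ suc n ≡⟨ cong (_+ q F ^ suc n) (trans (∑-const (oneTo n) _) (cong (_* q F ^ suc n) (length-oneTo n))) ⟨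
      ∑ (oneTo n) (λ i → q F ^ suc n) + q F ^ suc n ∎
      where open ≡-Reasoning

  irreducibleUnits~ : ∀ d → (λ F → suc d * Count.irreducibleUnits F (suc d)) ~[ suc d ] (λ F → q F ^ suc d)
  irreducibleUnits~ d = ~-trans (~-const* (suc d) (near (O-≤ gap (q^-O d)))) (irreducibles~ (suc d) d ≤-refl)
    where
    gap : ∀ F → ∣ Count.irreducibleUnits F (suc d) - Count.irreducibles F (suc d) ∣ ≤ q F ^ d
    gap F = let lower , upper = Count.irreducibles-split F d in
      ≤-trans (≤-reflexive (m≤n⇒∣m-n∣≡n∸m lower)) (≤-trans (∸-monoˡ-≤ (Count.irreducibleUnits F (suc d)) upper)
        (≤-reflexive (m+n∸m≡n (Count.irreducibleUnits F (suc d)) (q F ^ d))))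

  module _ (F : FiniteField) where
    open FiniteField F using (Carrier; 0#; _≟_; elements)
    open Count F
    open Degree F using (𝔼)

    unit-guard : ∀ c {m n} → (c ≢ 0# → m ≤ n) → unit c * m ≤ unit c * n
    unit-guard c le with c ≟ 0#
    ... | yes _  = z≤n
    ... | no c≢0 = +-monoˡ-≤ 0 (le c≢0)

    unit*-≤ : ∀ c n → unit c * n ≤ n
    unit*-≤ c n = ≤-trans (*-monoˡ-≤ n (unit≤1 c)) (≤-reflexive (*-identityˡ n))

    ∑-excess-constant : ∀ n d → ∑ elements (λ c → excess n d (constant c)) ≤ excess n d (λ _ → 1)
    ∑-excess-constant n d = ≤-trans (≤-reflexive (∑-excess elements n d constant)) (excess-mono n d (λ f → ≤-reflexive
      (trans (∑-point 𝔼 (Poly.coeff F f 0) (λ c → constant c f) (λ c → 𝟙-≟-≢ 𝔼)) (𝟙-≟-refl 𝔼 (Poly.coeff F f 0)))))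

  -- Only the total over c is controlled: for a single c the solutions P of P(0)ʲ = c may outweigh q^{m-1}.
  constantDeviation : ℕ → ℕ → ℕ → Family
  constantDeviation i n m F = ∑ elements (λ c → unit c * ∣ i * weighted n i (constant c) - q F ^ m ∣)
    where
    open FiniteField F using (elements)
    open Count F

  -- A factor of less than full degree leaves a cofactor with a free constant term, so
  -- `simple-constant` gives the same main term for every `c ≠ 0`. Each `f` has a single constant
  -- term, so the contributions of repeated factors add up over `c` to at most the unrestricted
  -- `excess`.
  lowerDeviation-O : ∀ i k → constantDeviation (suc i) (suc i + suc k) (i + suc k) =O (suc i + suc k)
  lowerDeviation-O i k = O-≤ estimate (O-+
    (O-* {X = Δ} {Y = λ F → q F ^ suc k} (difference (irreducibleUnits~ i)) 1 (1*q^ (suc k)))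
    (O-const* (suc i) (excess-O (i + suc k) (suc i) (s≤s z≤n))))
    where
    Δ : Family
    Δ F = ∣ suc i * Count.irreducibleUnits F (suc i) - q F ^ suc i ∣
    estimate : ∀ F → constantDeviation (suc i) (suc i + suc k) (i + suc k) F ≤ Δ F * q F ^ suc k + suc i * Count.excess F (i + suc k) (suc i) (λ _ → 1)
    estimate F = begin
      ∑ elements (λ c → unit c * ∣ suc i * weighted (suc i + suc k) (suc i) (constant c) - Q ^ (i + suc k) ∣)
        ≤⟨ ∑-mono elements (λ c → ≤-trans (unit-guard F c (each c)) (unit*-≤ F c _)) ⟩
      ∑ elements (λ c → Δ F * Q ^ k + suc i * excess (i + suc k) (suc i) (constant c)) ≡⟨ ∑-+ elements _ _ ⟩
      ∑ elements (λ c → Δ F * Q ^ k) + ∑ elements (λ c → suc i * excess (i + suc k) (suc i) (constant c))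
        ≡⟨ cong₂ _+_ (trans (∑-const elements _) (rearrange Q (Δ F) (Q ^ k))) (∑-*ˡ elements (suc i) _) ⟩
      Δ F * Q ^ suc k + suc i * ∑ elements (λ c → excess (i + suc k) (suc i) (constant c))
        ≤⟨ +-monoʳ-≤ (Δ F * Q ^ suc k) (*-monoʳ-≤ (suc i) (∑-excess-constant F (i + suc k) (suc i))) ⟩
      Δ F * Q ^ suc k + suc i * excess (i + suc k) (suc i) (λ _ → 1) ∎
      where
      open ≤-Reasoning
      open FiniteField F using (Carrier; 0#; elements)
      open Count F
      Q = q F
      rearrange : ∀ a b c → a * (b * c) ≡ b * (a * c)
      rearrange = solve-∀
      each : ∀ c → c ≢ 0# → ∣ suc i * weighted (suc i + suc k) (suc i) (constant c) - Q ^ (i + suc k) ∣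
                            ≤ Δ F * Q ^ k + suc i * excess (i + suc k) (suc i) (constant c)
      each c c≢0 = begin
        ∣ suc i * weighted (suc i + suc k) (suc i) (constant c) - Q ^ (i + suc k) ∣
          ≡⟨ cong₂ ∣_-_∣ (begin-equality
               suc i * weighted (suc i + suc k) (suc i) (constant c)
                 ≡⟨ cong (suc i *_) (trans (weighted-split i (suc k) (constant c) (constant-cong c)) (cong (_+ ex) (simple-constant (suc i) k c c≢0))) ⟩
               suc i * (irreducibleUnits (suc i) * Q ^ k + ex) ≡⟨ *-distribˡ-+ (suc i) _ ex ⟩
               suc i * (irreducibleUnits (suc i) * Q ^ k) + suc i * ex ≡⟨ cong (_+ suc i * ex) (*-assoc (suc i) (irreducibleUnits (suc i)) (Q ^ k)) ⟨
               suc i * irreducibleUnits (suc i) * Q ^ k + suc i * ex ∎)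
               (trans (cong (Q ^_) (+-suc i k)) (trans (^-distribˡ-+-* Q (suc i) k) (sym (+-identityʳ _)))) ⟩
        ∣ suc i * irreducibleUnits (suc i) * Q ^ k + suc i * ex - Q ^ suc i * Q ^ k + 0 ∣
          ≤⟨ ∣-∣-+-≤ (suc i * irreducibleUnits (suc i) * Q ^ k) (suc i * ex) (Q ^ suc i * Q ^ k) 0 ⟩
        ∣ suc i * irreducibleUnits (suc i) * Q ^ k - Q ^ suc i * Q ^ k ∣ + ∣ suc i * ex - 0 ∣
          ≡⟨ cong₂ _+_ (sym (*-distribʳ-∣-∣ (Q ^ k) (suc i * irreducibleUnits (suc i)) (Q ^ suc i))) (∣-∣-identityʳ (suc i * ex)) ⟩
        Δ F * Q ^ k + suc i * ex ∎
        where ex = excess (i + suc k) (suc i) (constant c)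

  -- In the top degree no cofactor is left whose constant term could be adjusted. But for each `c`
  -- the weighted counts over all degrees have the known total `(n + 1) q ^ n`, so the top deviation
  -- is at most the sum of the lower ones.
  topDeviation-O : ∀ n → constantDeviation (suc n) (suc n) n =O suc n
  topDeviation-O n = O-≤ estimate (O-∑ (oneTo n) (λ i → constantDeviation i (suc n) n) each)
    where
    each : ∀ i → i ∈ oneTo n → constantDeviation i (suc n) n =O suc n
    each zero    i∈ = contradiction (proj₁ (∈-oneTo⁻ i∈)) (λ ())
    each (suc i) i∈ = go (m≤n⇒∃[o]m+o≡n (proj₂ (∈-oneTo⁻ i∈)))
      where
      go : _ → constantDeviation (suc i) (suc n) n =O suc n
      go (k , e) = subst (λ t → constantDeviation (suc i) (suc t) t =O suc t) (trans (+-suc i k) e) (lowerDeviation-O i k)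
    estimate : ∀ F → constantDeviation (suc n) (suc n) n F ≤ ∑ (oneTo n) (λ i → constantDeviation i (suc n) n F)
    estimate F = begin
      ∑ elements (λ c → unit c * ∣ suc n * weighted (suc n) (suc n) (constant c) - Q ^ n ∣)
        ≤⟨ ∑-mono elements (λ c → *-monoʳ-≤ (unit c) (complement c)) ⟩
      ∑ elements (λ c → unit c * ∑ (oneTo n) (λ i → ∣ i * weighted (suc n) i (constant c) - Q ^ n ∣))
        ≡⟨ ∑-cong elements (λ c → sym (∑-*ˡ (oneTo n) (unit c) _)) ⟩
      ∑ elements (λ c → ∑ (oneTo n) (λ i → unit c * ∣ i * weighted (suc n) i (constant c) - Q ^ n ∣))
        ≡⟨ ∑-swap elements (oneTo n) _ ⟩
      ∑ (oneTo n) (λ i → constantDeviation i (suc n) n F) ∎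
      where
      open ≤-Reasoning
      open FiniteField F using (elements)
      open Count F
      Q = q F
      complement : ∀ c → ∣ suc n * weighted (suc n) (suc n) (constant c) - Q ^ n ∣ ≤ ∑ (oneTo n) (λ i → ∣ i * weighted (suc n) i (constant c) - Q ^ n ∣)
      complement c = ≤-trans (≤-reflexive (∣-∣-complement (∑ (oneTo n) (λ i → i * weighted (suc n) i (constant c))) (∑ (oneTo n) (λ _ → Q ^ n)) total))
        (∣-∣-∑-≤ (oneTo n) _ _)
        where
        total : ∑ (oneTo n) (λ i → i * weighted (suc n) i (constant c)) + suc n * weighted (suc n) (suc n) (constant c) ≡ ∑ (oneTo n) (λ _ → Q ^ n) + Q ^ n
        total = trans (sym (∑-oneTo-snoc n (λ i → i * weighted (suc n) i (constant c)))) (trans (∑-weighted (suc n) (constant c))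
          (trans (cong (_* suc n) (∑-constant n c)) (trans (*-comm (Q ^ n) (suc n)) (trans (+-comm (Q ^ n) (n * Q ^ n))
            (cong (_+ Q ^ n) (sym (trans (∑-const (oneTo n) _) (cong (_* Q ^ n) (length-oneTo n)))))))))

  -- By `hasType-[n]` this is, for `c ≠ 0`, the number of irreducible polynomials of degree `n + 1`
  -- with constant term `c`.
  cyclicRow : ∀ F → ℕ → FiniteField.Carrier F → ℕ
  cyclicRow F n c = Count.unit F c * Count.weighted F (suc n) (suc n) (Count.constant F c)

  ∑-unit-q : ∀ F m → ∑ (FiniteField.elements F) (λ c → Count.unit F c * m) + m ≡ q F * m
  ∑-unit-q F m = trans (cong₂ _+_ (∑-*ʳ (FiniteField.elements F) m (Count.unit F)) (sym (*-identityˡ m)))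
    (trans (sym (*-distribʳ-+ m (∑ (FiniteField.elements F) (Count.unit F)) 1)) (cong (_* m) (Count.∑-unit F)))

  ∑-cyclicRow~ : ∀ n → (λ F → suc n * ∑ (FiniteField.elements F) (cyclicRow F n)) ~[ suc n ] (λ F → q F ^ suc n)
  ∑-cyclicRow~ n = ~-trans (near (O-≤ estimate (topDeviation-O n)))
    (~-trans (~-sym (~-+O {X = λ F → ∑ (FiniteField.elements F) (λ c → Count.unit F c * q F ^ n)} (q^-O n))) (~-reflexive (λ F → ∑-unit-q F (q F ^ n))))
    where
    estimate : ∀ F → ∣ suc n * ∑ (FiniteField.elements F) (cyclicRow F n) - ∑ (FiniteField.elements F) (λ c → Count.unit F c * q F ^ n) ∣
             ≤ constantDeviation (suc n) (suc n) n F
    estimate F = begin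
      ∣ suc n * ∑ elements (cyclicRow F n) - ∑ elements (λ c → unit c * Q ^ n) ∣
        ≡⟨ cong (λ x → ∣ x - ∑ elements (λ c → unit c * Q ^ n) ∣) (sym (∑-*ˡ elements (suc n) (cyclicRow F n))) ⟩
      ∣ ∑ elements (λ c → suc n * cyclicRow F n c) - ∑ elements (λ c → unit c * Q ^ n) ∣ ≤⟨ ∣-∣-∑-≤ elements _ _ ⟩
      ∑ elements (λ c → ∣ suc n * cyclicRow F n c - unit c * Q ^ n ∣)
        ≡⟨ ∑-cong elements (λ c → trans (cong (λ x → ∣ x - unit c * Q ^ n ∣) (rearrange (suc n) (unit c) _)) (sym (*-distribˡ-∣-∣ (unit c) _ _))) ⟩
      constantDeviation (suc n) (suc n) n F ∎
      where
      open ≤-Reasoning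
      open FiniteField F using (elements)
      open Count F
      Q = q F
      rearrange : ∀ a b c → a * (b * c) ≡ b * (a * c)
      rearrange = solve-∀

  weighted-constant-≤ : ∀ F n c → Count.weighted F (suc n) (suc n) (Count.constant F c) ≤ q F ^ n
  weighted-constant-≤ F n c = ≤-trans (∑-mono (vecs (suc n)) (λ f → ≤-trans
      (*-monoʳ-≤ (constant c (mon f)) (≤-trans (≤-reflexive (sym (hasType-[n] n (Monic-mon f)))) (𝟙≤1 _))) (≤-reflexive (*-identityʳ _))))
    (≤-reflexive (∑-constant n c))
    where
    open Count F
    open Degree F

  -- A difference of squares is at most the deviation of one row times a trivial bound. A row has at
  -- most `q ^ n` elements, whence the factor `suc n * q ^ n + q ^ n`. Control of the total
  -- deviation over `c` therefore suffices.
  ∑-cyclicRow²~ : ∀ n → (λ F → suc n * suc n * ∑ (FiniteField.elements F) (λ c → cyclicRow F n c * cyclicRow F n c)) ~[ suc n + n ] (λ F → q F ^ (suc n + n))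
  ∑-cyclicRow²~ n = ~-trans (near (O-≤ estimate (O-* {Y = λ F → suc (suc n) * q F ^ n} (topDeviation-O n) (suc (suc n)) (λ F → ≤-refl))))
    (~-trans (~-sym (~-+O {X = λ F → ∑ (FiniteField.elements F) (λ c → Count.unit F c * (q F ^ n * q F ^ n))}
        (O-≤ (λ F → ≤-reflexive (sym (^-distribˡ-+-* (q F) n n))) (q^-O (n + n)))))
      (~-reflexive (λ F → trans (∑-unit-q F (q F ^ n * q F ^ n)) (cong (q F *_) (sym (^-distribˡ-+-* (q F) n n))))))
    where
    estimate : ∀ F → ∣ suc n * suc n * ∑ (FiniteField.elements F) (λ c → cyclicRow F n c * cyclicRow F n c)
                       - ∑ (FiniteField.elements F) (λ c → Count.unit F c * (q F ^ n * q F ^ n)) ∣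
             ≤ constantDeviation (suc n) (suc n) n F * (suc (suc n) * q F ^ n)
    estimate F = begin
      ∣ suc n * suc n * ∑ elements (λ c → cyclicRow F n c * cyclicRow F n c) - ∑ elements (λ c → unit c * (Q ^ n * Q ^ n)) ∣
        ≡⟨ cong (λ x → ∣ x - ∑ elements (λ c → unit c * (Q ^ n * Q ^ n)) ∣) (sym (∑-*ˡ elements (suc n * suc n) _)) ⟩
      ∣ ∑ elements (λ c → suc n * suc n * (cyclicRow F n c * cyclicRow F n c)) - ∑ elements (λ c → unit c * (Q ^ n * Q ^ n)) ∣
        ≤⟨ ∣-∣-∑-≤ elements _ _ ⟩
      ∑ elements (λ c → ∣ suc n * suc n * (cyclicRow F n c * cyclicRow F n c) - unit c * (Q ^ n * Q ^ n) ∣)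
        ≤⟨ ∑-mono elements each ⟩
      ∑ elements (λ c → unit c * ∣ suc n * N c - Q ^ n ∣ * (suc (suc n) * Q ^ n)) ≡⟨ ∑-*ʳ elements (suc (suc n) * Q ^ n) _ ⟩
      constantDeviation (suc n) (suc n) n F * (suc (suc n) * Q ^ n) ∎
      where
      open ≤-Reasoning
      open FiniteField F using (Carrier; elements)
      open Count F
      Q = q F
      N : Carrier → ℕ
      N c = weighted (suc n) (suc n) (constant c)
      unit-idempotent : ∀ c → unit c * unit c ≡ unit c
      unit-idempotent c = idem (not (does (FiniteField._≟_ F c (FiniteField.0# F))))
        where
        idem : ∀ b → 𝟙 b * 𝟙 b ≡ 𝟙 b
        idem true  = refl
        idem false = refl
      rearrange : ∀ s u a → s * s * (u * a * (u * a)) ≡ u * u * (s * a * (s * a))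
      rearrange = solve-∀
      each : ∀ c → ∣ suc n * suc n * (cyclicRow F n c * cyclicRow F n c) - unit c * (Q ^ n * Q ^ n) ∣ ≤ unit c * ∣ suc n * N c - Q ^ n ∣ * (suc (suc n) * Q ^ n)
      each c = begin
        ∣ suc n * suc n * (cyclicRow F n c * cyclicRow F n c) - unit c * (Q ^ n * Q ^ n) ∣
          ≡⟨ cong (λ x → ∣ x - unit c * (Q ^ n * Q ^ n) ∣) (trans (rearrange (suc n) (unit c) (N c)) (cong (_* (suc n * N c * (suc n * N c))) (unit-idempotent c))) ⟩
        ∣ unit c * (suc n * N c * (suc n * N c)) - unit c * (Q ^ n * Q ^ n) ∣ ≡⟨ *-distribˡ-∣-∣ (unit c) _ _ ⟨
        unit c * ∣ suc n * N c * (suc n * N c) - Q ^ n * Q ^ n ∣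
          ≤⟨ *-monoʳ-≤ (unit c) (∣-∣-*-≤ (suc n * N c) (suc n * N c) (Q ^ n) (Q ^ n)) ⟩
        unit c * (δ * (suc n * N c) + Q ^ n * δ)
          ≤⟨ *-monoʳ-≤ (unit c) (+-monoˡ-≤ (Q ^ n * δ) (*-monoʳ-≤ δ (*-monoʳ-≤ (suc n) (weighted-constant-≤ F n c)))) ⟩
        unit c * (δ * (suc n * Q ^ n) + Q ^ n * δ) ≡⟨ collect (unit c) δ n (Q ^ n) ⟩
        unit c * δ * (suc (suc n) * Q ^ n) ∎
        where
        δ = ∣ suc n * N c - Q ^ n ∣
        collect : ∀ u d n x → u * (d * (suc n * x) + x * d) ≡ u * d * (suc (suc n) * x)
        collect = solve-∀

  -- `z` with the list of part sizes left free, so that partitions of different numbers can be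
  -- compared over a common list.
  zOver : List ℕ → List ℕ → ℕ
  zOver is μ = foldr (λ i acc → (i ^ mult i μ) * ((mult i μ) !) * acc) 1 is

  zOver-absent : ∀ is d μ → ¬ d ∈ is → zOver is (d ∷ μ) ≡ zOver is μ
  zOver-absent []       d μ d∉ = refl
  zOver-absent (i ∷ is) d μ d∉ = cong₂ (λ m r → (i ^ m) * (m !) * r)
    (trans (mult-∷ i d μ) (cong (_+ mult i μ) (𝟙-≡ᵇ-≢ (λ e → d∉ (here e))))) (zOver-absent is d μ (d∉ ∘ there))

  zOver-present : ∀ is d μ → Unique is → d ∈ is → zOver is (d ∷ μ) ≡ d * mult d (d ∷ μ) * zOver is μ
  zOver-present (i ∷ is) .i μ (i∉ ∷ u) (here refl) = begin
    (i ^ mult i (i ∷ μ)) * (mult i (i ∷ μ) !) * zOver is (i ∷ μ)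
      ≡⟨ cong₂ (λ m r → (i ^ m) * (m !) * r) mult-suc (zOver-absent is i μ (λ i∈ → All.lookup i∉ i∈ refl)) ⟩
    (i ^ suc m) * (suc m !) * zOver is μ ≡⟨ rearrange i (i ^ m) (suc m) (m !) (zOver is μ) ⟩
    i * suc m * ((i ^ m) * (m !) * zOver is μ) ≡⟨ cong (λ x → i * x * ((i ^ m) * (m !) * zOver is μ)) mult-suc ⟨
    i * mult i (i ∷ μ) * zOver (i ∷ is) μ ∎
    where
    open ≡-Reasoning
    m = mult i μ
    mult-suc : mult i (i ∷ μ) ≡ suc m
    mult-suc = trans (mult-∷ i i μ) (cong (_+ m) (𝟙-≡ᵇ-refl i))
    rearrange : ∀ a b c d e → a * b * (c * d) * e ≡ a * c * (b * d * e)
    rearrange = solve-∀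
  zOver-present (i ∷ is) d μ (i∉ ∷ u) (there d∈) = begin
    (i ^ mult i (d ∷ μ)) * (mult i (d ∷ μ) !) * zOver is (d ∷ μ)
      ≡⟨ cong₂ (λ m r → (i ^ m) * (m !) * r) (trans (mult-∷ i d μ) (cong (_+ mult i μ) (𝟙-≡ᵇ-≢ (λ e → All.lookup i∉ d∈ (sym e))))) (zOver-present is d μ u d∈) ⟩
    (i ^ mult i μ) * (mult i μ !) * (d * mult d (d ∷ μ) * zOver is μ) ≡⟨ rearrange ((i ^ mult i μ) * (mult i μ !)) (d * mult d (d ∷ μ)) (zOver is μ) ⟩
    d * mult d (d ∷ μ) * zOver (i ∷ is) μ ∎
    where
    open ≡-Reasoning
    rearrange : ∀ a b c → a * (b * c) ≡ b * (a * c)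
    rearrange = solve-∀

  zOver-extend : ∀ j n μ → sum μ ≤ n → zOver (oneTo (j + n)) μ ≡ zOver (oneTo n) μ
  zOver-extend zero    n μ le = refl
  zOver-extend (suc j) n μ le = begin
    zOver (oneTo (suc (j + n))) μ ≡⟨ cong (λ l → zOver l μ) (trans (cong (map suc) (sym (upTo-∷ʳ (j + n)))) (map-++ suc (upTo (j + n)) _)) ⟩
    zOver (oneTo (j + n) ++ [ suc (j + n) ]) μ ≡⟨ foldr-++ _ 1 (oneTo (j + n)) [ suc (j + n) ] ⟩
    foldr (λ i acc → (i ^ mult i μ) * ((mult i μ) !) * acc) (zOver [ suc (j + n) ] μ) (oneTo (j + n))
      ≡⟨ cong (λ x → foldr (λ i acc → (i ^ mult i μ) * ((mult i μ) !) * acc) x (oneTo (j + n)))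
           (cong (λ m → (suc (j + n) ^ m) * (m !) * 1) (mult-large (suc (j + n)) μ (s≤s (≤-trans le (m≤n+m n j))))) ⟩
    zOver (oneTo (j + n)) μ ≡⟨ zOver-extend j n μ le ⟩
    zOver (oneTo n) μ ∎
    where open ≡-Reasoning

  -- With `i = suc d`, a new part raises the multiplicity from `r` to `r + 1`, which multiplies
  -- `i ^ r * r !` by `i * (r + 1)`; sizes beyond `sum μ` contribute 1 to `z μ`.
  z-∷ : ∀ d μ → z (suc d ∷ μ) ≡ suc d * mult (suc d) (suc d ∷ μ) * z μ
  z-∷ d μ = trans (zOver-present (oneTo (suc d + sum μ)) (suc d) μ (Unique-oneTo _) (∈-oneTo⁺ (s≤s z≤n) (m≤m+n (suc d) (sum μ))))
    (cong (suc d * mult (suc d) (suc d ∷ μ) *_) (zOver-extend (suc d) (sum μ) μ ≤-refl))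

  z-positive : ∀ μ → All (1 ≤_) μ → 1 ≤ z μ
  z-positive []          []        = s≤s z≤n
  z-positive (suc d ∷ μ) (_ ∷ pos) = subst (1 ≤_) (sym (z-∷ d μ)) (*-mono-≤ (*-mono-≤ {1} {suc d} (s≤s z≤n)
    (≤-trans (m≤m+n 1 (mult (suc d) μ)) (≤-reflexive (sym (trans (mult-∷ (suc d) (suc d) μ) (cong (_+ mult (suc d) μ) (𝟙-≡ᵇ-refl (suc d)))))))) (z-positive μ pos))

  types-≤ : ∀ n μ F → Count.types F n μ ≤ q F ^ n
  types-≤ n μ F = ≤-trans (∑-mono (Count.vecs F n) (λ f → 𝟙≤1 _)) (≤-reflexive (Count.∑-vecs-1 F n))

  -- Induction on the parts: by `types-split` a new part multiplies the count by the number of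
  -- irreducible polynomials of its degree over its new multiplicity, which is the recursion `z-∷`
  -- for the reciprocal.
  types~ : ∀ μ → All (1 ≤_) μ → (λ F → z μ * Count.types F (sum μ) μ) ~[ sum μ ] (λ F → q F ^ sum μ)
  types~ []          []        = ~-reflexive (λ F → refl)
  types~ (suc d ∷ μ) (_ ∷ pos) = ~-trans (~-reflexive split) (~-trans
    (~-+O {X = λ F → suc d * Count.irreducibles F (suc d) * (z μ * Count.types F k μ)}
      (O-const* (suc d * z μ) (O-≤ (λ F → Count.excess-mono F (d + k) (suc d) (λ f → 𝟙≤1 (Count.hasType F (suc d + k) (suc d ∷ μ) f))) (excess-O (d + k) (suc d) (s≤s z≤n)))))
    (~-trans (~-* {Y = λ F → z μ * Count.types F k μ} (irreducibles~ (suc d) d ≤-refl) (types~ μ pos) (z μ) 1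
        (λ F → *-monoʳ-≤ (z μ) (types-≤ k μ F)) (1*q^ (suc d)))
      (~-reflexive (λ F → sym (^-distribˡ-+-* (q F) (suc d) k)))))
    where
    k = sum μ
    split : ∀ F → z (suc d ∷ μ) * Count.types F (suc d + k) (suc d ∷ μ)
                ≡ suc d * Count.irreducibles F (suc d) * (z μ * Count.types F k μ)
                  + suc d * z μ * Count.excess F (d + k) (suc d) (λ f → 𝟙 (Count.hasType F (suc d + k) (suc d ∷ μ) f))
    split F = trans (cong (_* Count.types F (suc d + k) (suc d ∷ μ)) (z-∷ d μ)) (trans (pull (suc d) (mult (suc d) (suc d ∷ μ)) (z μ) _)
      (trans (cong (suc d * z μ *_) (Count.types-split F d μ k refl)) (expand (suc d) (z μ) (Count.irreducibles F (suc d)) (Count.types F k μ) _)))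
      where
      pull : ∀ a b c t → a * b * c * t ≡ a * c * (b * t)
      pull = solve-∀
      expand : ∀ a c i t e → a * c * (i * t + e) ≡ a * i * (c * t) + a * c * e
      expand = solve-∀

  unitTypes : ∀ n μ → Family
  unitTypes n μ F = ∑ (Count.vecs F n) (λ f → Count.unit F (Poly.coeff F (Degree.mon F f) 0) * 𝟙 (Count.hasType F n μ (Degree.mon F f)))

  unitSquareFreeTypes : ∀ n μ → Family
  unitSquareFreeTypes n μ F = ∑ (Count.vecs F n) (λ f →
    Count.unit F (Poly.coeff F (Degree.mon F f) 0) * 𝟙 (Count.hasType F n μ (Degree.mon F f)) * 𝟙 (Count.squareFree F n (Degree.mon F f)))

  -- Only polynomials with constant term 0 are lost, and there are `q ^ n` of those.
  unitTypes~ : ∀ n μ → All (1 ≤_) μ → sum μ ≡ suc n → (λ F → z μ * unitTypes (suc n) μ F) ~[ suc n ] (λ F → q F ^ suc n)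
  unitTypes~ n μ pos sum≡ = ~-trans (~-const* (z μ) (near (O-≤ gap (q^-O n))))
    (subst (λ t → (λ F → z μ * Count.types F t μ) ~[ t ] (λ F → q F ^ t)) sum≡ (types~ μ pos))
    where
    gap : ∀ F → ∣ unitTypes (suc n) μ F - Count.types F (suc n) μ ∣ ≤ q F ^ n
    gap F = ≤-trans (∣-∣-∑-≤ (vecs (suc n)) _ _) (≤-trans (∑-mono (vecs (suc n)) each) (≤-reflexive (∑-constant n (FiniteField.0# F))))
      where
      open Count F
      open Degree F using (mon)
      open Poly F using (coeff)
      each : ∀ f → ∣ unit (coeff (mon f) 0) * 𝟙 (hasType (suc n) μ (mon f)) - 𝟙 (hasType (suc n) μ (mon f)) ∣ ≤ constant (FiniteField.0# F) (mon f)
      each f = lemma (unit (coeff (mon f) 0)) (constant (FiniteField.0# F) (mon f)) (hasType (suc n) μ (mon f)) (unit+zero (coeff (mon f) 0))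
        where
        lemma : ∀ u c b → u + c ≡ 1 → ∣ u * 𝟙 b - 𝟙 b ∣ ≤ c
        lemma zero          c b e = ≤-trans (𝟙≤1 b) (≤-reflexive (sym e))
        lemma (suc zero)    c b e = ≤-trans (≤-reflexive (m≡n⇒∣m-n∣≡0 (*-identityˡ (𝟙 b)))) z≤n
        lemma (suc (suc u)) c b ()

  unitSquareFreeTypes~ : ∀ n μ → All (1 ≤_) μ → sum μ ≡ suc n → (λ F → z μ * unitSquareFreeTypes (suc n) μ F) ~[ suc n ] (λ F → q F ^ suc n)
  unitSquareFreeTypes~ n μ pos sum≡ = ~-trans (~-const* (z μ) (near (O-≤ gap
      (O-∑ (oneTo (suc n)) (λ d F → Count.excess F n d (λ _ → 1)) (λ d d∈ → excess-O n d (proj₁ (∈-oneTo⁻ d∈)))))))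
    (unitTypes~ n μ pos sum≡)
    where
    gap : ∀ F → ∣ unitSquareFreeTypes (suc n) μ F - unitTypes (suc n) μ F ∣ ≤ ∑ (oneTo (suc n)) (λ d → Count.excess F n d (λ _ → 1))
    gap F = ≤-trans (∣-∣-∑-≤ (vecs (suc n)) _ _) (≤-trans (∑-mono (vecs (suc n)) each) (nonSquareFree-bound n))
      where
      open Count F
      open Degree F using (mon)
      open Poly F using (coeff)
      each : ∀ f → ∣ unit (coeff (mon f) 0) * 𝟙 (hasType (suc n) μ (mon f)) * 𝟙 (squareFree (suc n) (mon f))
                     - unit (coeff (mon f) 0) * 𝟙 (hasType (suc n) μ (mon f)) ∣ ≤ 𝟙 (not (squareFree (suc n) (mon f)))
      each f = lemma (squareFree (suc n) (mon f)) (*-mono-≤ (unit≤1 (coeff (mon f) 0)) (𝟙≤1 (hasType (suc n) μ (mon f))))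
        where
        lemma : ∀ {x} b → x ≤ 1 → ∣ x * 𝟙 b - x ∣ ≤ 𝟙 (not b)
        lemma {x} true  le = ≤-reflexive (m≡n⇒∣m-n∣≡0 (*-identityʳ x))
        lemma {x} false le = ≤-trans (≤-reflexive (cong (λ y → ∣ y - x ∣) (*-zeroʳ x))) le

-- Zeros of integer polynomials in matrix entries over a finite field.

module SchwartzZippel where

  open import Data.Bool using (true; false; if_then_else_)
  open import Data.Fin as Fin using (Fin; zero; suc; punchIn; toℕ)
  open import Data.Nat as ℕ using (ℕ; zero; suc; _≤_; z≤n; s≤s)
  import Data.Nat.Properties as ℕₚ
  open import Data.List using (List; []; _∷_; [_]; length; foldr; allFin)
  open import Data.List.Properties using (length-map)
  open import Data.Product using (∃; _×_; _,_; uncurry)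
  open import Data.Vec using (Vec; lookup; tabulate)
  open import Data.Vec.Properties using (lookup∘tabulate; tabulate∘lookup; tabulate-cong)
  open import Function using (_∘_)
  open import Relation.Binary.PropositionalEquality as ≡ using (_≡_; _≢_; refl; sym; trans; cong; cong₂; subst)
  open import Relation.Nullary using (¬_; does; yes; no; contradiction)
  open import Defs
  open Finite
  open Counting
  open Polynomials
  open Degrees
  open PolynomialCounts

  mat : {A : Set} {a b : ℕ} → Vec (Vec A b) a → Fin a → Fin b → A
  mat R i j = lookup (lookup R i) j

  tab : {A : Set} {a b : ℕ} → (Fin a → Fin b → A) → Vec (Vec A b) a
  tab f = tabulate (λ i → tabulate (f i))

  mat-tab : {A : Set} {a b : ℕ} (f : Fin a → Fin b → A) → ∀ i j → mat (tab f) i j ≡ f i j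
  mat-tab f i j = trans (cong (λ v → lookup v j) (lookup∘tabulate (λ i → tabulate (f i)) i)) (lookup∘tabulate (f i) j)

  lookup-injective : {A : Set} {n : ℕ} {u v : Vec A n} → (∀ i → lookup u i ≡ lookup v i) → u ≡ v
  lookup-injective {u = u} {v} e = trans (sym (tabulate∘lookup u)) (trans (tabulate-cong e) (tabulate∘lookup v))

  mat-injective : {A : Set} {a b : ℕ} {R S : Vec (Vec A b) a} → (∀ i j → mat R i j ≡ mat S i j) → R ≡ S
  mat-injective e = lookup-injective (λ i → lookup-injective (e i))

  -- Integer polynomials in the variables X; their size bounds their degree along lines over every field.
  data Term (X : Set) : Set where
    var   : X → Term X
    `0 `1 : Term X
    _`+_  : Term X → Term X → Term X
    _`*_  : Term X → Term X → Term X
    `-_   : Term X → Term X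

  size : {X : Set} → Term X → ℕ
  -- On a line a variable becomes `ρ x + δ x X`, with two coefficients; `size` bounds the number of
  -- coefficients, one more than the degree.
  size (var x)  = 2
  size `0       = 0
  size `1       = 1
  size (s `+ t) = size s ℕ.+ size t
  size (s `* t) = size s ℕ.+ size t
  size (`- t)   = size t

  -- Stated for bare operations because one source is the type of terms, which satisfies no ring
  -- laws before evaluation.
  detWith-homo : {A B : Set} {_⊕_ _⊗_ : A → A → A} {neg : A → A} {z o : A} {_⊕′_ _⊗′_ : B → B → B} {neg′ : B → B} {z′ o′ : B} →
    (h : A → B) → (∀ x y → h (x ⊕ y) ≡ h x ⊕′ h y) → (∀ x y → h (x ⊗ y) ≡ h x ⊗′ h y) → (∀ x → h (neg x) ≡ neg′ (h x)) → h z ≡ z′ → h o ≡ o′ →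
    ∀ n M → h (detWith _⊕_ _⊗_ neg z o n M) ≡ detWith _⊕′_ _⊗′_ neg′ z′ o′ n (λ i j → h (M i j))
  detWith-homo h h⊕ h⊗ hneg hz ho zero    M = ho
  detWith-homo {A} {B} {_⊕_} {_⊗_} {neg} {z} {o} {_⊕′_} {_⊗′_} {neg′} {z′} {o′} h h⊕ h⊗ hneg hz ho (suc n) M = go (allFin (suc n))
    where
    term : Fin (suc n) → A
    term j = if isEven (toℕ j) then M zero j ⊗ detWith _⊕_ _⊗_ neg z o n (λ r c → M (suc r) (punchIn j c))
             else neg (M zero j ⊗ detWith _⊕_ _⊗_ neg z o n (λ r c → M (suc r) (punchIn j c)))
    term′ : Fin (suc n) → B
    term′ j = if isEven (toℕ j) then h (M zero j) ⊗′ detWith _⊕′_ _⊗′_ neg′ z′ o′ n (λ r c → h (M (suc r) (punchIn j c)))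
              else neg′ (h (M zero j) ⊗′ detWith _⊕′_ _⊗′_ neg′ z′ o′ n (λ r c → h (M (suc r) (punchIn j c))))
    product : ∀ j → h (M zero j ⊗ detWith _⊕_ _⊗_ neg z o n (λ r c → M (suc r) (punchIn j c)))
                  ≡ h (M zero j) ⊗′ detWith _⊕′_ _⊗′_ neg′ z′ o′ n (λ r c → h (M (suc r) (punchIn j c)))
    product j = trans (h⊗ _ _) (cong (h (M zero j) ⊗′_) (detWith-homo h h⊕ h⊗ hneg hz ho n (λ r c → M (suc r) (punchIn j c))))
    h-term : ∀ j → h (term j) ≡ term′ j
    h-term j with isEven (toℕ j)
    ... | true  = product j
    ... | false = trans (hneg _) (cong neg′ (product j))
    go : ∀ js → h (foldr (λ j acc → term j ⊕ acc) z js) ≡ foldr (λ j acc → term′ j ⊕′ acc) z′ js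
    go []       = hz
    go (j ∷ js) = trans (h⊕ _ _) (cong₂ _⊕′_ (h-term j) (go js))

  detWith-cong : {A : Set} (_⊕_ _⊗_ : A → A → A) (neg : A → A) (z o : A) (n : ℕ) {M N : Fin n → Fin n → A} →
    (∀ i j → M i j ≡ N i j) → detWith _⊕_ _⊗_ neg z o n M ≡ detWith _⊕_ _⊗_ neg z o n N
  detWith-cong _⊕_ _⊗_ neg z o zero    e = refl
  detWith-cong _⊕_ _⊗_ neg z o (suc n) {M} {N} e = go (allFin (suc n))
    where
    minors : ∀ j → detWith _⊕_ _⊗_ neg z o n (λ r c → M (suc r) (punchIn j c)) ≡ detWith _⊕_ _⊗_ neg z o n (λ r c → N (suc r) (punchIn j c))
    minors j = detWith-cong _⊕_ _⊗_ neg z o n (λ r c → e (suc r) (punchIn j c))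
    go : ∀ js → foldr (λ j acc → (if isEven (toℕ j) then M zero j ⊗ detWith _⊕_ _⊗_ neg z o n (λ r c → M (suc r) (punchIn j c))
                                  else neg (M zero j ⊗ detWith _⊕_ _⊗_ neg z o n (λ r c → M (suc r) (punchIn j c)))) ⊕ acc) z js
              ≡ foldr (λ j acc → (if isEven (toℕ j) then N zero j ⊗ detWith _⊕_ _⊗_ neg z o n (λ r c → N (suc r) (punchIn j c))
                                  else neg (N zero j ⊗ detWith _⊕_ _⊗_ neg z o n (λ r c → N (suc r) (punchIn j c)))) ⊕ acc) z js
    go []       = refl
    go (j ∷ js) = cong₂ _⊕_ (cong (λ x → if isEven (toℕ j) then x else neg x) (cong₂ _⊗_ (e zero j) (minors j))) (go js)

  module Lines (F : FiniteField) where
    open FiniteField F hiding (unique; complete)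
    open FF F using (Poly; _⊕_; _⊗_; negP)
    open Poly F
    open Degree F using (𝔼; neg-0)
    open Count F using (unit; ∑-unit)
    open 𝔽 using (+-comm; +-assoc; +-identityˡ; +-identityʳ; *-comm; *-assoc; zeroˡ; zeroʳ; distribˡ; distribʳ; *-identityˡ; *-identityʳ; -‿inverseˡ; -‿inverseʳ; commutativeSemiring; ring)
    open import Algebra.Properties.Ring ring using (-‿distribʳ-*; -‿+-comm)
    open import Algebra.Solver.Ring.NaturalCoefficients.Default commutativeSemiring using (solve; _:=_; _:+_; _:*_; con)
    open ≡.≡-Reasoning

    eval : Poly → Carrier → Carrier
    eval []      x = 0#
    eval (a ∷ p) x = a + (x * eval p x)

    eval-⊕ : ∀ p s x → eval (p ⊕ s) x ≡ eval p x + eval s x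
    eval-⊕ []      s       x = sym (+-identityˡ _)
    eval-⊕ (a ∷ p) []      x = sym (+-identityʳ _)
    eval-⊕ (a ∷ p) (b ∷ s) x = trans (cong (λ y → (a + b) + (x * y)) (eval-⊕ p s x))
      (solve 5 (λ a b x y z → (a :+ b) :+ (x :* (y :+ z)) := (a :+ x :* y) :+ (b :+ x :* z)) refl a b x (eval p x) (eval s x))

    eval-scale : ∀ c p x → eval (scale c p) x ≡ c * eval p x
    eval-scale c []      x = sym (zeroʳ c)
    eval-scale c (a ∷ p) x = trans (cong (λ y → (c * a) + (x * y)) (eval-scale c p x))
      (solve 4 (λ c a x y → c :* a :+ x :* (c :* y) := c :* (a :+ x :* y)) refl c a x (eval p x))

    eval-⊗ : ∀ p s x → eval (p ⊗ s) x ≡ eval p x * eval s x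
    eval-⊗ []      s x = sym (zeroˡ _)
    eval-⊗ (a ∷ p) s x = trans (eval-⊕ (scale a s) (0# ∷ (p ⊗ s)) x)
      (trans (cong₂ _+_ (eval-scale a s x) (trans (+-identityˡ _) (cong (x *_) (eval-⊗ p s x))))
      (solve 4 (λ a x y z → a :* z :+ x :* (y :* z) := (a :+ x :* y) :* z) refl a x (eval p x) (eval s x)))

    eval-neg : ∀ p x → eval (negP p) x ≡ neg (eval p x)
    eval-neg []      x = sym neg-0
    eval-neg (a ∷ p) x = trans (cong (λ y → neg a + (x * y)) (eval-neg p x))
      (trans (cong (neg a +_) (sym (-‿distribʳ-* x (eval p x)))) (-‿+-comm a _))

    -- Synthetic division: the coefficients of the quotient of `a ∷ p` by `X - c` are the Horner
    -- values at `c`, while `a` enters only the remainder `eval (a ∷ p) c`.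
    quotientByRoot : Carrier → Poly → Poly
    quotientByRoot c []      = []
    quotientByRoot c (b ∷ p) = eval (b ∷ p) c ∷ quotientByRoot c p

    length-quotientByRoot : ∀ c p → length (quotientByRoot c p) ≡ length p
    length-quotientByRoot c []      = refl
    length-quotientByRoot c (b ∷ p) = cong suc (length-quotientByRoot c p)

    -- Stated with x = d + c, so that it is a semiring identity.
    eval-quotientByRoot : ∀ a p d c → eval (a ∷ p) (d + c) ≡ (d * eval (quotientByRoot c p) (d + c)) + eval (a ∷ p) c
    eval-quotientByRoot a []      d c = solve 3 (λ a d c → a :+ (d :+ c) :* con 0 := d :* con 0 :+ (a :+ c :* con 0)) refl a d c
    eval-quotientByRoot a (b ∷ p) d c = trans (cong (λ y → a + ((d + c) * y)) (eval-quotientByRoot b p d c))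
      (solve 5 (λ a d c t e → a :+ (d :+ c) :* (d :* t :+ e) := d :* (e :+ (d :+ c) :* t) :+ (a :+ c :* e)) refl
        a d c (eval (quotientByRoot c p) (d + c)) (eval (b ∷ p) c))

    no-zero-divisors : ∀ {x y} → x ≢ 0# → x * y ≡ 0# → y ≡ 0#
    no-zero-divisors {x} {y} x≢0 e with inverse x x≢0
    ... | x⁻¹ , xx⁻¹≡1 = begin
      y               ≡⟨ *-identityˡ y ⟨
      1# * y          ≡⟨ cong (_* y) (trans (sym xx⁻¹≡1) (*-comm x x⁻¹)) ⟩
      (x⁻¹ * x) * y   ≡⟨ *-assoc x⁻¹ x y ⟩
      x⁻¹ * (x * y)   ≡⟨ cong (x⁻¹ *_) e ⟩
      x⁻¹ * 0#        ≡⟨ zeroʳ x⁻¹ ⟩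
      0#              ∎

    [x-c]+c : ∀ x c → (x + neg c) + c ≡ x
    [x-c]+c x c = trans (+-assoc x (neg c) c) (trans (cong (x +_) (-‿inverseˡ c)) (+-identityʳ x))

    isZero : Carrier → ℕ
    isZero x = 𝟙 (does (x ≟ 0#))

    isZero-≢ : ∀ {x} → x ≢ 0# → isZero x ≡ 0
    isZero-≢ {x} ne with x ≟ 0#
    ... | yes e = contradiction e ne
    ... | no _  = refl

    -- Split off `X - c` at a root `c`. A point `b` with nonzero value witnesses non-triviality and
    -- passes to the quotient; it also excludes polynomials that vanish as functions.
    roots-≤ : ∀ k p b → length p ≤ k → eval p b ≢ 0# → ∑ elements (λ x → isZero (eval p x)) ≤ k
    roots-≤ k       []      b le ne = contradiction refl ne
    roots-≤ (suc k) (a ∷ p) b (s≤s le) ne with ∑ elements (λ x → isZero (eval (a ∷ p) x)) in count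
    ... | zero  = z≤n
    ... | suc _ = subst (_≤ suc k) count bounded
      where
      root : ∃ λ c → eval (a ∷ p) c ≡ 0#
      root = find elements (λ e → contradiction (trans (sym count) e) (λ ()))
        where
        find : ∀ xs → ¬ ∑ xs (λ x → isZero (eval (a ∷ p) x)) ≡ 0 → ∃ λ c → eval (a ∷ p) c ≡ 0#
        find []       ne = contradiction refl ne
        find (x ∷ xs) ne with eval (a ∷ p) x ≟ 0#
        ... | yes e = x , e
        ... | no _  = find xs ne
      bounded : ∑ elements (λ x → isZero (eval (a ∷ p) x)) ≤ suc k
      bounded with root
      ... | c , c-root = ℕₚ.≤-trans (∑-mono elements split) (ℕₚ.≤-trans (ℕₚ.≤-reflexive (∑-+ elements _ _))
        (ℕₚ.+-mono-≤ (ℕₚ.≤-reflexive one) (roots-≤ k s b (subst (_≤ k) (sym (length-quotientByRoot c p)) le) s-nonzero)))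
        where
        s = quotientByRoot c p
        one : ∑ elements (λ x → 𝟙 (does (c ≟ x))) ≡ 1
        one = trans (∑-point 𝔼 c _ (λ x ne → 𝟙-≟-≢ 𝔼 (ne ∘ sym))) (𝟙-≟-refl 𝔼 c)
        factored : ∀ x → eval (a ∷ p) x ≡ (x + neg c) * eval s x
        factored x = begin
          eval (a ∷ p) x                       ≡⟨ cong (eval (a ∷ p)) ([x-c]+c x c) ⟨
          eval (a ∷ p) ((x + neg c) + c)       ≡⟨ eval-quotientByRoot a p (x + neg c) c ⟩
          ((x + neg c) * eval s ((x + neg c) + c)) + eval (a ∷ p) c ≡⟨ cong₂ (λ y z → ((x + neg c) * eval s y) + z) ([x-c]+c x c) c-root ⟩
          ((x + neg c) * eval s x) + 0#        ≡⟨ +-identityʳ _ ⟩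
          (x + neg c) * eval s x               ∎
        s-nonzero : eval s b ≢ 0#
        s-nonzero e = ne (trans (factored b) (trans (cong ((b + neg c) *_) e) (zeroʳ _)))
        split : ∀ x → isZero (eval (a ∷ p) x) ≤ 𝟙 (does (c ≟ x)) ℕ.+ isZero (eval s x)
        split x with c ≟ x
        ... | yes _ = ℕₚ.≤-trans (𝟙≤1 _) (s≤s z≤n)
        ... | no c≢x with eval s x ≟ 0#
        ...   | yes _ = 𝟙≤1 _
        ...   | no ne′ = ℕₚ.≤-reflexive (isZero-≢ (λ e → ne′ (no-zero-divisors
                  (λ x-c≡0 → c≢x (trans (sym (+-identityˡ c)) (trans (cong (_+ c) (sym x-c≡0)) ([x-c]+c x c))))
                  (trans (sym (factored x)) e))))

    ⟦_⟧ : {X : Set} → Term X → (X → Carrier) → Carrier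
    ⟦ var x ⟧  ρ = ρ x
    ⟦ `0 ⟧     ρ = 0#
    ⟦ `1 ⟧     ρ = 1#
    ⟦ s `+ t ⟧ ρ = ⟦ s ⟧ ρ + ⟦ t ⟧ ρ
    ⟦ s `* t ⟧ ρ = ⟦ s ⟧ ρ * ⟦ t ⟧ ρ
    ⟦ `- t ⟧   ρ = neg (⟦ t ⟧ ρ)

    ⟦⟧-cong : {X : Set} (t : Term X) {ρ σ : X → Carrier} → (∀ x → ρ x ≡ σ x) → ⟦ t ⟧ ρ ≡ ⟦ t ⟧ σ
    ⟦⟧-cong (var x)  e = e x
    ⟦⟧-cong `0       e = refl
    ⟦⟧-cong `1       e = refl
    ⟦⟧-cong (s `+ t) e = cong₂ _+_ (⟦⟧-cong s e) (⟦⟧-cong t e)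
    ⟦⟧-cong (s `* t) e = cong₂ _*_ (⟦⟧-cong s e) (⟦⟧-cong t e)
    ⟦⟧-cong (`- t)   e = cong neg (⟦⟧-cong t e)

    line : {X : Set} → Term X → (ρ δ : X → Carrier) → Poly
    line (var x)  ρ δ = ρ x ∷ δ x ∷ []
    line `0       ρ δ = []
    line `1       ρ δ = [ 1# ]
    line (s `+ t) ρ δ = line s ρ δ ⊕ line t ρ δ
    line (s `* t) ρ δ = line s ρ δ ⊗ line t ρ δ
    line (`- t)   ρ δ = negP (line t ρ δ)

    length-⊕ : ∀ p s {k} → length p ≤ k → length s ≤ k → length (p ⊕ s) ≤ k
    length-⊕ []      s       le le′ = le′
    length-⊕ (a ∷ p) []      le le′ = le
    length-⊕ (a ∷ p) (b ∷ s) (s≤s le) (s≤s le′) = s≤s (length-⊕ p s le le′)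

    length-⊗ : ∀ p s → length (p ⊗ s) ≤ length p ℕ.+ length s
    length-⊗ []      s = z≤n
    length-⊗ (a ∷ p) s = length-⊕ (scale a s) (0# ∷ (p ⊗ s))
      (ℕₚ.≤-trans (ℕₚ.≤-reflexive (length-map (a *_) s)) (ℕₚ.m≤n+m (length s) (suc (length p)))) (s≤s (length-⊗ p s))

    length-line : {X : Set} (t : Term X) (ρ δ : X → Carrier) → length (line t ρ δ) ≤ size t
    length-line (var x)  ρ δ = ℕₚ.≤-refl
    length-line `0       ρ δ = z≤n
    length-line `1       ρ δ = ℕₚ.≤-refl
    length-line (s `+ t) ρ δ = length-⊕ (line s ρ δ) (line t ρ δ)
      (ℕₚ.≤-trans (length-line s ρ δ) (ℕₚ.m≤m+n (size s) (size t))) (ℕₚ.≤-trans (length-line t ρ δ) (ℕₚ.m≤n+m (size t) (size s)))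
    length-line (s `* t) ρ δ = ℕₚ.≤-trans (length-⊗ (line s ρ δ) (line t ρ δ)) (ℕₚ.+-mono-≤ (length-line s ρ δ) (length-line t ρ δ))
    length-line (`- t)   ρ δ = ℕₚ.≤-trans (ℕₚ.≤-reflexive (length-map neg (line t ρ δ))) (length-line t ρ δ)

    eval-line : {X : Set} (t : Term X) (ρ δ : X → Carrier) → ∀ x → eval (line t ρ δ) x ≡ ⟦ t ⟧ (λ v → ρ v + (x * δ v))
    eval-line (var v)  ρ δ x = cong (λ y → ρ v + (x * y)) (trans (cong (δ v +_) (zeroʳ x)) (+-identityʳ _))
    eval-line `0       ρ δ x = refl
    eval-line `1       ρ δ x = trans (cong (1# +_) (zeroʳ x)) (+-identityʳ _)
    eval-line (s `+ t) ρ δ x = trans (eval-⊕ (line s ρ δ) (line t ρ δ) x) (cong₂ _+_ (eval-line s ρ δ x) (eval-line t ρ δ x))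
    eval-line (s `* t) ρ δ x = trans (eval-⊗ (line s ρ δ) (line t ρ δ) x) (cong₂ _*_ (eval-line s ρ δ x) (eval-line t ρ δ x))
    eval-line (`- t)   ρ δ x = trans (eval-neg (line t ρ δ) x) (cong neg (eval-line t ρ δ x))

    +-cancelˡ : ∀ a {x y} → a + x ≡ a + y → x ≡ y
    +-cancelˡ a {x} {y} e = trans (sym (undo x)) (trans (cong (neg a +_) e) (undo y))
      where
      undo : ∀ x → neg a + (a + x) ≡ x
      undo x = trans (sym (+-assoc (neg a) a x)) (trans (cong (_+ x) (-‿inverseˡ a)) (+-identityˡ x))

    *-cancelˡ : ∀ {a x y} → a ≢ 0# → a * x ≡ a * y → x ≡ y
    *-cancelˡ {a} {x} {y} a≢0 e = trans (sym ([x-c]+c x y)) (trans (cong (_+ y) (no-zero-divisors a≢0 (begin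
      a * (x + neg y)            ≡⟨ distribˡ a x (neg y) ⟩
      (a * x) + (a * neg y)      ≡⟨ cong₂ _+_ e (sym (-‿distribʳ-* a y)) ⟩
      (a * y) + neg (a * y)      ≡⟨ -‿inverseʳ (a * y) ⟩
      0# ∎))) (+-identityˡ y))

    Mats : ∀ a b → List (Vec (Vec Carrier b) a)
    Mats a b = Enum.list (Vecs (Vecs 𝔼 b) a)

    zeros : {a b : ℕ} → Term (Fin a × Fin b) → ℕ
    zeros {a} {b} t = ∑ (Mats a b) (λ R → isZero (⟦ t ⟧ (uncurry (mat R))))

    module _ {a b : ℕ} (t : Term (Fin a × Fin b)) (R₀ : Fin a → Fin b → Carrier) (nonzero : ⟦ t ⟧ (uncurry R₀) ≢ 0#) where

      move : Carrier → Vec (Vec Carrier b) a → Vec (Vec Carrier b) a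
      move x S = tab (λ i j → R₀ i j + (x * mat S i j))

      move-injective : ∀ {x} → x ≢ 0# → ∀ {S S′} → move x S ≡ move x S′ → S ≡ S′
      move-injective {x} x≢0 {S} {S′} e = mat-injective (λ i j → *-cancelˡ x≢0 (+-cancelˡ (R₀ i j)
        (trans (sym (mat-tab (λ i j → R₀ i j + (x * mat S i j)) i j)) (trans (cong (λ R → mat R i j) e) (mat-tab (λ i j → R₀ i j + (x * mat S′ i j)) i j)))))

      along : Vec (Vec Carrier b) a → Poly
      along S = line t (uncurry R₀) (uncurry (mat S))

      along-move : ∀ x S → eval (along S) x ≡ ⟦ t ⟧ (uncurry (mat (move x S)))
      along-move x S = trans (eval-line t _ _ x) (⟦⟧-cong t (λ (i , j) → sym (mat-tab (λ i j → R₀ i j + (x * mat S i j)) i j)))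

      along-0 : ∀ S → eval (along S) 0# ≢ 0#
      along-0 S e = nonzero (trans (sym (trans (eval-line t _ _ 0#) (⟦⟧-cong t (λ (i , j) →
        trans (cong (R₀ i j +_) (zeroˡ (mat S i j))) (+-identityʳ _))))) e)

      -- Every line through R₀ meets the zero locus at most size t times, and for x ≠ 0 the
      -- points R₀ + x S run over all matrices as S does.
      zeros-bound : card ℕ.* zeros t ≤ suc (size t) ℕ.* length (Mats a b)
      zeros-bound = R.begin
        -- `q` is the number of nonzero `x` plus 1. The extra 1 is bounded trivially and accounts
        -- for the `suc` in the constant.
        card ℕ.* zeros t R.≡⟨ cong (ℕ._* zeros t) ∑-unit ⟨
        (∑ elements unit ℕ.+ 1) ℕ.* zeros t R.≡⟨ trans (ℕₚ.*-distribʳ-+ (zeros t) (∑ elements unit) 1) (ℕₚ.+-comm (∑ elements unit ℕ.* zeros t) _) ⟩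
        1 ℕ.* zeros t ℕ.+ ∑ elements unit ℕ.* zeros t
          R.≤⟨ ℕₚ.+-mono-≤ trivial (ℕₚ.≤-trans (ℕₚ.≤-reflexive (sym (∑-*ʳ elements (zeros t) unit))) lines) ⟩
        length (Mats a b) ℕ.+ size t ℕ.* length (Mats a b) R.∎
        where
        module R = ℕₚ.≤-Reasoning
        trivial : 1 ℕ.* zeros t ≤ length (Mats a b)
        trivial = ℕₚ.≤-trans (ℕₚ.≤-reflexive (ℕₚ.*-identityˡ _)) (ℕₚ.≤-trans (∑-mono (Mats a b) (λ R → 𝟙≤1 _)) (ℕₚ.≤-reflexive (∑-1 (Mats a b))))
        reparametrise : ∀ x → unit x ℕ.* zeros t ≤ ∑ (Mats a b) (λ S → isZero (eval (along S) x))
        reparametrise x with x ≟ 0#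
        ... | yes _  = z≤n
        ... | no x≢0 = ℕₚ.≤-reflexive (trans (ℕₚ.*-identityˡ _) (trans
          (sym (∑-injective (Vecs (Vecs 𝔼 b) a) (Vecs (Vecs 𝔼 b) a) refl (move x) (move-injective x≢0) (λ R → isZero (⟦ t ⟧ (uncurry (mat R))))))
          (∑-cong (Mats a b) (λ S → cong isZero (sym (along-move x S))))))
        lines : ∑ elements (λ x → unit x ℕ.* zeros t) ≤ size t ℕ.* length (Mats a b)
        lines = R.begin
          ∑ elements (λ x → unit x ℕ.* zeros t) R.≤⟨ ∑-mono elements reparametrise ⟩
          ∑ elements (λ x → ∑ (Mats a b) (λ S → isZero (eval (along S) x))) R.≡⟨ ∑-swap elements (Mats a b) _ ⟩
          ∑ (Mats a b) (λ S → ∑ elements (λ x → isZero (eval (along S) x)))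
            R.≤⟨ ∑-mono (Mats a b) (λ S → roots-≤ (size t) (along S) 0# (length-line t _ _) (along-0 S)) ⟩
          ∑ (Mats a b) (λ S → size t) R.≡⟨ trans (∑-const (Mats a b) (size t)) (ℕₚ.*-comm (length (Mats a b)) (size t)) ⟩
          size t ℕ.* length (Mats a b) R.∎

-- The characteristic polynomial as a function of the first row and of the first column.

module CharacteristicPolynomials where

  open import Algebra.Bundles using (CommutativeRing)
  import Algebra.Properties.Group
  open import Data.Bool using (Bool; true; false; if_then_else_)
  open import Data.Fin as Fin using (Fin; zero; suc; punchIn; toℕ; inject₁)
  import Data.Fin.Properties as Finₚ
  open import Data.Fin.Induction using (<-weakInduction; >-weakInduction)
  open import Data.Nat as ℕ using (ℕ; zero; suc; _<_; _∸_; s≤s)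
  import Data.Nat.Properties as ℕₚ
  open import Data.List using (List; []; _∷_; [_]; map; allFin)
  open import Data.List.Properties using (map-∘)
  open import Data.Product using (_×_; _,_; uncurry; proj₁; proj₂)
  open import Function using (_∘_)
  open import Relation.Binary using (tri<; tri≈; tri>)
  open import Relation.Binary.PropositionalEquality as ≡ using (_≡_; _≢_; refl; sym; trans; cong; cong₂; subst)
  open import Relation.Nullary using (does; yes; no; contradiction)
  open import Defs
  open Sums
  open Polynomials
  open Determinants
  open Degrees
  open SchwartzZippel

  does-sym : ∀ {n} (i j : Fin n) → does (i Fin.≟ j) ≡ does (j Fin.≟ i)
  does-sym i j with i Fin.≟ j | j Fin.≟ i
  ... | yes _ | yes _ = refl
  ... | no _  | no _  = refl
  ... | yes e | no ne = contradiction (sym e) ne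
  ... | no ne | yes e = contradiction (sym e) ne

  does-≢ : ∀ {n} {i j : Fin n} → i ≢ j → does (i Fin.≟ j) ≡ false
  does-≢ {i = i} {j} ne with i Fin.≟ j
  ... | yes e = contradiction e ne
  ... | no _  = refl

  does-refl : ∀ {n} (i : Fin n) → does (i Fin.≟ i) ≡ true
  does-refl i with i Fin.≟ i
  ... | yes _ = refl
  ... | no ne = contradiction refl ne

  pad : {A : Set} {a b : ℕ} → A → (Fin a → Fin b → A) → Fin (suc a) → Fin b → A
  pad o P zero    j = o
  pad o P (suc i) j = P i j

  joinColumn : {A : Set} {m n : ℕ} → (Fin m → A) → (Fin m → Fin n → A) → Fin m → Fin (suc n) → A
  joinColumn a R i zero    = a i
  joinColumn a R i (suc j) = R i j

  -- The discriminant below as a term: terms do not mention the field, so their sizes bound exceptional sets uniformly in F.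
  module DiscriminantTerm (m : ℕ) where

    T : Set
    T = Term (Fin m × Fin (suc m))

    addT : List T → List T → List T
    addT []      q       = q
    addT (a ∷ p) []      = a ∷ p
    addT (a ∷ p) (b ∷ q) = (a `+ b) ∷ addT p q

    mulT : List T → List T → List T
    mulT []      q = []
    mulT (a ∷ p) q = addT (map (a `*_) q) (`0 ∷ mulT p q)

    negT : List T → List T
    negT = map `-_

    coeffT : List T → ℕ → T
    coeffT []      k       = `0
    coeffT (a ∷ p) zero    = a
    coeffT (a ∷ p) (suc k) = coeffT p k

    pencilT : Fin m → Fin (suc m) → List T
    pencilT i j = addT (if does (suc i Fin.≟ j) then `0 ∷ `1 ∷ [] else []) (negT [ var (i , j) ])

    rowT : Fin (suc m) → Fin (suc m) → List T
    rowT j c = if does (j Fin.≟ c) then [ `1 ] else []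

    cofactorT : Fin (suc m) → List T
    cofactorT j = detWith addT mulT negT [] [ `1 ] (suc m) (upd zero (rowT j) (pad [] pencilT))

    discriminantT : T
    discriminantT = detWith _`+_ _`*_ `-_ `0 `1 (suc m) (λ j k → coeffT (cofactorT j) (m ∸ toℕ k))

  module Pencil (F : FiniteField) where
    open FiniteField F hiding (unique; complete)
    open FF F using (Poly; _⊕_; _⊗_; negP; det; detP; charpoly)
    open Poly F
    open Degree F
    open Lines F using (⟦_⟧; no-zero-divisors; +-cancelˡ)
    module DF = Det 𝔽
    module DP = Det 𝔽[X]
    module Σ𝔽 = Sum (CommutativeRing.commutativeSemiring 𝔽)
    module ΣP = Sum (CommutativeRing.commutativeSemiring 𝔽[X])
    open 𝔽 using (zeroˡ; zeroʳ; +-identityˡ; +-identityʳ; *-identityˡ; *-identityʳ; *-comm; -‿inverseʳ)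
    open import Algebra.Properties.Ring 𝔽.ring using (-‿involutive)
    module Groupₚ = Algebra.Properties.Group 𝔽.+-group
    open import Algebra.Properties.Group (CommutativeRing.+-group 𝔽[X]) using (∙-cancelˡ; ∙-cancelʳ)
    open import Relation.Binary.Reasoning.Setoid ≈-setoid

    x : Poly
    x = 0# ∷ 1# ∷ []

    x-⊗ : ∀ p → x ⊗ p ≈ 0# ∷ p
    x-⊗ p = ⊕-cong {q′ = 0# ∷ p} (scale-0 p) (∷-cong refl (⊗-identityˡ p))

    coeff-x-⊗ : ∀ p k → coeff (x ⊗ p) (suc k) ≡ coeff p k
    coeff-x-⊗ p k = at (x-⊗ p) (suc k)

    constant-≈ : ∀ a b → [ a ] ⊗ [ b ] ≈ [ a * b ]
    constant-≈ a b = ∷-cong (+-identityʳ _) ≈-refl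

    coeff-constant-⊗ : ∀ a p k → coeff ([ a ] ⊗ p) k ≡ a * coeff p k
    coeff-constant-⊗ a p k = trans (at (constant-⊗ a p ≈-refl) k) (coeff-scale a p k)

    coeff-∑ : {A : Set} (xs : List A) (f : A → Poly) → ∀ k → coeff (ΣP.∑ xs f) k ≡ Σ𝔽.∑ xs (λ y → coeff (f y) k)
    coeff-∑ []       f k = refl
    coeff-∑ (y ∷ ys) f k = trans (coeff-⊕ (f y) _ k) (cong (coeff (f y) k +_) (coeff-∑ ys f k))

    ∑-constant : {A : Set} (xs : List A) (f : A → Carrier) → ΣP.∑ xs (λ y → [ f y ]) ≈ [ Σ𝔽.∑ xs f ]
    ∑-constant []       f = ≈-sym (0∷[]≈[] refl ≈-refl)
    ∑-constant (y ∷ ys) f = ⊕-cong {p = [ f y ]} ≈-refl (∑-constant ys f)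

    coeff-sg : ∀ j p k → coeff (DP.sg j p) k ≡ DF.sg j (coeff p k)
    coeff-sg j p k with isEven j
    ... | true  = refl
    ... | false = coeff-negP p k

    Vanish-sg : ∀ j p {n} → Vanish p n → Vanish (DP.sg j p) n
    Vanish-sg j p v with isEven j
    ... | true  = v
    ... | false = Vanish-neg p v

    Vanish-∑ : {A : Set} (xs : List A) (f : A → Poly) {n : ℕ} → (∀ y → Vanish (f y) n) → Vanish (ΣP.∑ xs f) n
    Vanish-∑ []       f v k le = refl
    Vanish-∑ (y ∷ ys) f v = Vanish-⊕ (f y) _ (v y) (Vanish-∑ ys f v)

    coeff₀-det : ∀ n (M : Fin n → Fin n → Poly) → coeff (DP.det n M) 0 ≡ DF.det n (λ i j → coeff (M i j) 0)
    coeff₀-det n M = detWith-homo (λ p → coeff p 0) (λ p s → coeff-⊕ p s 0) coeff₀-⊗ (λ p → coeff-negP p 0) refl refl n M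
      where
      coeff₀-⊗ : ∀ p s → coeff (p ⊗ s) 0 ≡ coeff p 0 * coeff s 0
      coeff₀-⊗ []      s = sym (zeroˡ _)
      coeff₀-⊗ (a ∷ p) s = trans (coeff-⊕ (scale a s) _ 0) (trans (+-identityʳ _) (coeff-scale a s 0))

    det-degree : ∀ n (M : Fin n → Fin n → Poly) → (∀ i j → Vanish (M i j) 2) →
      Vanish (DP.det n M) (suc n) × coeff (DP.det n M) n ≡ DF.det n (λ i j → coeff (M i j) 1)
    det-degree zero    M v = (λ { (suc k) _ → refl }) , refl
    det-degree (suc n) M v =
      Vanish-∑ (allFin (suc n)) (λ j → DP.sg (toℕ j) (M zero j ⊗ D j)) (λ j → Vanish-sg (toℕ j) (M zero j ⊗ D j) (Vanish-⊗ (M zero j) (D j) 1 n (v zero j) (proj₁ (minors j)))) ,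
      trans (coeff-∑ (allFin (suc n)) (λ j → DP.sg (toℕ j) (M zero j ⊗ D j)) (suc n)) (Σ𝔽.∑-cong (allFin (suc n)) (λ j →
        trans (coeff-sg (toℕ j) (M zero j ⊗ D j) (suc n)) (cong (DF.sg (toℕ j))
          (trans (coeff-⊗-top (M zero j) (D j) 1 n (v zero j) (proj₁ (minors j))) (cong (coeff (M zero j) 1 *_) (proj₂ (minors j)))))))
      where
      D : Fin (suc n) → Poly
      D j = DP.det n (λ r c → M (suc r) (punchIn j c))
      minors : ∀ j → Vanish (D j) (suc n) × coeff (D j) n ≡ DF.det n (λ r c → coeff (M (suc r) (punchIn j c)) 1)
      minors j = det-degree n (λ r c → M (suc r) (punchIn j c)) (λ r c → v (suc r) (punchIn j c))

    entry : Bool → Carrier → Poly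
    entry b a = (if b then 0# ∷ 1# ∷ [] else []) ⊕ negP [ a ]

    Vanish-entry : ∀ b a → Vanish (entry b a) 2
    Vanish-entry true  a (suc (suc k)) _ = refl
    Vanish-entry false a (suc (suc k)) _ = refl
    Vanish-entry true  a (suc zero) (s≤s ())
    Vanish-entry false a (suc zero) (s≤s ())

    coeff₀-entry : ∀ b a → coeff (entry b a) 0 ≡ neg a
    coeff₀-entry true  a = +-identityˡ (neg a)
    coeff₀-entry false a = refl

    coeff₁-entry : ∀ b a → coeff (entry b a) 1 ≡ (if b then 1# else 0#)
    coeff₁-entry true  a = refl
    coeff₁-entry false a = refl

    Monic-charpoly : ∀ n A → Monic (charpoly n A) n
    Monic-charpoly n A = let v , top = det-degree n _ (λ i j → Vanish-entry (does (i Fin.≟ j)) (A i j)) in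
      monic (trans top (trans (DF.det-cong n (λ i j → coeff₁-entry (does (i Fin.≟ j)) (A i j))) (DF.det-identity n))) v

    coeff₀-charpoly : ∀ n A → coeff (charpoly n A) 0 ≡ DF.sg n (det n A)
    coeff₀-charpoly n A = trans (coeff₀-det n _) (trans (DF.det-cong n (λ i j → coeff₀-entry (does (i Fin.≟ j)) (A i j))) (DF.det-neg n A))

    charpoly-cong : ∀ n {A B} → (∀ i j → A i j ≡ B i j) → charpoly n A ≡ charpoly n B
    charpoly-cong n e = detWith-cong _⊕_ _⊗_ negP [] [ 1# ] n (λ i j → cong (entry (does (i Fin.≟ j))) (e i j))

    module _ {m : ℕ} where

      pencil : (Fin m → Fin (suc m) → Carrier) → Fin m → Fin (suc m) → Poly
      pencil R i j = entry (does (suc i Fin.≟ j)) (R i j)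

      -- The lower rows are those of the characteristic matrix `x - A`, the first row `w` is free.
      -- Being linear in `w`, it encodes all cofactors of the first row.
      cofactor : (Fin m → Fin (suc m) → Carrier) → (Fin (suc m) → Poly) → Poly
      cofactor R w = DP.det (suc m) (upd zero w (pad [] (pencil R)))

      cofactor-linear : ∀ R → DP.IsLinear (cofactor R)
      cofactor-linear R = DP.det-linear (suc m) zero (pad [] (pencil R))

      L : (Fin m → Fin (suc m) → Carrier) → (Fin (suc m) → Carrier) → Poly
      L R w = cofactor R (λ j → [ w j ])

      basisRow : Fin (suc m) → Fin (suc m) → Poly
      basisRow i j = if does (i Fin.≟ j) then [ 1# ] else []

      xBasisRow : Fin (suc m) → Fin (suc m) → Poly
      xBasisRow i j = if does (i Fin.≟ j) then x else []

      xBasisRow-≈ : ∀ i j → xBasisRow i j ≈ x ⊗ basisRow i j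
      xBasisRow-≈ i j with does (i Fin.≟ j)
      ... | true  = ≈-sym (⊗-identityʳ x)
      ... | false = ≈-sym (⊗-zeroʳ x)

      cofactor-xBasisRow : ∀ R i → cofactor R (xBasisRow i) ≈ x ⊗ cofactor R (basisRow i)
      cofactor-xBasisRow R i = ≈-trans (DP.lin-cong (cofactor-linear R) (xBasisRow-≈ i)) (DP.lin-* (cofactor-linear R) x (basisRow i))

      cofactor-pencilRow : ∀ R i → cofactor R (pencil R i) ≈ []
      cofactor-pencilRow R i = DP.det-alternating (suc m) (upd zero (pencil R i) (pad [] (pencil R))) zero (suc i) (λ ()) (λ c → ≈-refl)

      expandRow : ∀ (w : Fin (suc m) → Carrier) c → [ w c ] ≈ ΣP.∑ (allFin (suc m)) (λ j → [ w j ] ⊗ basisRow j c)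
      expandRow w c = ≈-sym (≈-trans (DP.∑-single (suc m) c _ off) diagonal)
        where
        off : ∀ i → i ≢ c → [ w i ] ⊗ basisRow i c ≈ []
        off i ne rewrite does-≢ ne = ⊗-zeroʳ [ w i ]
        diagonal : [ w c ] ⊗ basisRow c c ≈ [ w c ]
        diagonal rewrite does-refl c = ⊗-identityʳ [ w c ]

      L-expand : ∀ R w → L R w ≈ ΣP.∑ (allFin (suc m)) (λ j → [ w j ] ⊗ cofactor R (basisRow j))
      L-expand R w = ≈-trans (DP.lin-cong (cofactor-linear R) (expandRow w)) (DP.lin-∑ (cofactor-linear R) (allFin (suc m)) (λ j → [ w j ]) basisRow)

      L-difference : ∀ R {u w} → L R u ≈ L R w → L R (λ j → u j + neg (w j)) ≈ []
      L-difference R {u} {w} e = ≈-trans (DP.lin-+ (cofactor-linear R) (λ j → [ u j ]) (λ j → negP [ w j ]))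
        (≈-trans (⊕-cong e (DP.lin-neg (cofactor-linear R) (λ j → [ w j ]))) (⊕-inverseʳ (L R w)))

      L-+ : ∀ R u w → L R (λ j → u j + w j) ≈ L R u ⊕ L R w
      L-+ R u w = DP.lin-+ (cofactor-linear R) (λ j → [ u j ]) (λ j → [ w j ])

      -- The first row of `x - A` is `x e₀ - r`, so for fixed lower rows the characteristic
      -- polynomial is affine in the first row `r` with linear part `- L R`.
      charpoly+L : ∀ A → charpoly (suc m) A ⊕ L (A ∘ suc) (A zero) ≈ cofactor (A ∘ suc) (xBasisRow zero)
      charpoly+L A = begin
        charpoly (suc m) A ⊕ L R r ≈⟨ ⊕-cong {q = L R r} asCofactor ≈-refl ⟩
        cofactor R (λ j → xBasisRow zero j ⊕ negP [ r j ]) ⊕ L R r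
          ≈⟨ ⊕-cong {q = L R r} (≈-trans (DP.lin-+ (cofactor-linear R) (xBasisRow zero) (λ j → negP [ r j ]))
               (⊕-cong {p = cofactor R (xBasisRow zero)} ≈-refl (DP.lin-neg (cofactor-linear R) (λ j → [ r j ])))) ≈-refl ⟩
        (cofactor R (xBasisRow zero) ⊕ negP (L R r)) ⊕ L R r ≈⟨ ⊕-assoc (cofactor R (xBasisRow zero)) (negP (L R r)) (L R r) ⟩
        cofactor R (xBasisRow zero) ⊕ (negP (L R r) ⊕ L R r) ≈⟨ ⊕-cong {p = cofactor R (xBasisRow zero)} ≈-refl (⊕-inverseˡ (L R r)) ⟩
        cofactor R (xBasisRow zero) ⊕ [] ≈⟨ ⊕-identityʳ _ ⟩
        cofactor R (xBasisRow zero) ∎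
        where
        R = A ∘ suc
        r = A zero
        asCofactor : charpoly (suc m) A ≈ cofactor R (λ j → xBasisRow zero j ⊕ negP [ r j ])
        asCofactor = DP.det-cong (suc m) {λ i j → entry (does (i Fin.≟ j)) (A i j)} {upd zero (λ j → xBasisRow zero j ⊕ negP [ r j ]) (pad [] (pencil R))}
          (λ { zero j → ≈-refl ; (suc i) j → ≈-refl })

      ext0 : (Fin m → Carrier) → Fin (suc m) → Carrier
      ext0 v zero    = 0#
      ext0 v (suc i) = v i

      rowCombination : (Fin m → Carrier) → (Fin m → Fin (suc m) → Carrier) → Fin (suc m) → Carrier
      rowCombination v R j = Σ𝔽.∑ (allFin m) (λ i → v i * R i j)

      -- Row `i` of `R` is `x e_(i+1)` minus row `i` of the pencil, and `cofactor R` kills pencil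
      -- rows because they are repeated. Taking a combination of the rows of `R` thus amounts to
      -- multiplying by `x`.
      L-rowCombination : ∀ R v → L R (rowCombination v R) ≈ x ⊗ L R (ext0 v)
      L-rowCombination R v = begin
        L R (rowCombination v R)
          ≈⟨ DP.lin-cong lin (λ j → ≈-trans (≈-sym (∑-constant (allFin m) (λ i → v i * R i j)))
               (ΣP.∑-cong (allFin m) (λ i → ≈-trans (≈-sym (constant-≈ (v i) (R i j))) (⊗-congʳ [ v i ] (recover i j))))) ⟩
        cofactor R (λ j → ΣP.∑ (allFin m) (λ i → [ v i ] ⊗ (xBasisRow (suc i) j ⊕ negP (pencil R i j))))
          ≈⟨ DP.lin-∑ lin (allFin m) (λ i → [ v i ]) (λ i j → xBasisRow (suc i) j ⊕ negP (pencil R i j)) ⟩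
        ΣP.∑ (allFin m) (λ i → [ v i ] ⊗ cofactor R (λ j → xBasisRow (suc i) j ⊕ negP (pencil R i j)))
          ≈⟨ ΣP.∑-cong (allFin m) (λ i → ⊗-congʳ [ v i ] (each i)) ⟩
        ΣP.∑ (allFin m) (λ i → [ v i ] ⊗ (x ⊗ cofactor R (basisRow (suc i))))
          ≈⟨ ΣP.∑-cong (allFin m) (λ i → ≈-trans (≈-sym (⊗-assoc [ v i ] x _)) (≈-trans (⊗-congˡ (cofactor R (basisRow (suc i))) (⊗-comm [ v i ] x)) (⊗-assoc x [ v i ] _))) ⟩
        ΣP.∑ (allFin m) (λ i → x ⊗ ([ v i ] ⊗ cofactor R (basisRow (suc i))))
          ≈⟨ ΣP.∑-*ˡ (allFin m) x _ ⟩
        x ⊗ ΣP.∑ (allFin m) (λ i → [ v i ] ⊗ cofactor R (basisRow (suc i)))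
          ≈⟨ ⊗-congʳ x (≈-sym (≈-trans (L-expand R (ext0 v)) (≈-trans (CommutativeRing.reflexive 𝔽[X] (ΣP.∑-allFin-suc m _))
               (⊕-cong (≈-trans (constant-⊗ 0# (cofactor R (basisRow zero)) ≈-refl) (scale-0 (cofactor R (basisRow zero)))) (≈-refl {ΣP.∑ (allFin m) (λ i → [ v i ] ⊗ cofactor R (basisRow (suc i)))}))))) ⟩
        x ⊗ L R (ext0 v) ∎
        where
        lin = cofactor-linear R
        recover : ∀ i j → [ R i j ] ≈ xBasisRow (suc i) j ⊕ negP (pencil R i j)
        recover i j with does (suc i Fin.≟ j)
        ... | false = mk λ { zero → sym (-‿involutive (R i j)) ; (suc k) → refl }
        ... | true  = mk λ { zero → sym (trans (+-identityˡ _) (trans (cong neg (+-identityˡ _)) (-‿involutive (R i j))))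
                           ; (suc zero) → sym (-‿inverseʳ 1#) ; (suc (suc k)) → refl }
        each : ∀ i → cofactor R (λ j → xBasisRow (suc i) j ⊕ negP (pencil R i j)) ≈ x ⊗ cofactor R (basisRow (suc i))
        each i = ≈-trans (DP.lin-+ lin (xBasisRow (suc i)) (λ j → negP (pencil R i j))) (≈-trans
          (⊕-cong (cofactor-xBasisRow R (suc i)) (≈-trans (DP.lin-neg lin (pencil R i)) (negP-cong (cofactor-pencilRow R i))))
          (⊕-identityʳ _))

      -- By `charpoly+L` the change is `L R` of the added row combination, and `L-rowCombination`
      -- exhibits its factor `x`: the constant term is untouched.
      charpoly-shear : ∀ A B v → (∀ i j → B (suc i) j ≡ A (suc i) j) → (∀ j → B zero j ≡ A zero j + rowCombination v (A ∘ suc) j) →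
        charpoly (suc m) A ≈ charpoly (suc m) B ⊕ (x ⊗ L (A ∘ suc) (ext0 v))
      charpoly-shear A B v rest first = ∙-cancelʳ (L R (A zero)) _ _ (begin
        charpoly (suc m) A ⊕ L R (A zero) ≈⟨ charpoly+L A ⟩
        cofactor R (xBasisRow zero) ≈⟨ charpoly+L B′ ⟨
        charpoly (suc m) B′ ⊕ L R (λ j → A zero j + rowCombination v R j)
          ≈⟨ ⊕-cong {p = charpoly (suc m) B′} ≈-refl (≈-trans (L-+ R (A zero) (rowCombination v R))
               (≈-trans (⊕-cong {p = L R (A zero)} ≈-refl (L-rowCombination R v)) (⊕-comm (L R (A zero)) _))) ⟩
        charpoly (suc m) B′ ⊕ ((x ⊗ L R (ext0 v)) ⊕ L R (A zero)) ≈⟨ ⊕-assoc (charpoly (suc m) B′) (x ⊗ L R (ext0 v)) (L R (A zero)) ⟨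
        (charpoly (suc m) B′ ⊕ (x ⊗ L R (ext0 v))) ⊕ L R (A zero) ≡⟨ cong (λ p → (p ⊕ (x ⊗ L R (ext0 v))) ⊕ L R (A zero)) (charpoly-cong (suc m) B≡B′) ⟨
        (charpoly (suc m) B ⊕ (x ⊗ L R (ext0 v))) ⊕ L R (A zero) ∎)
        where
        R = A ∘ suc
        B′ : Fin (suc m) → Fin (suc m) → Carrier
        B′ zero    j = A zero j + rowCombination v R j
        B′ (suc i) j = A (suc i) j
        B≡B′ : ∀ i j → B i j ≡ B′ i j
        B≡B′ zero    = first
        B≡B′ (suc i) = rest i

      -- Read off from `charpoly-shear`: `x ⊗ L R (ext0 v)` is a difference of two monic polynomials
      -- of degree `m + 1`, so the leading coefficients cancel.
      Vanish-L-ext0 : ∀ R v → Vanish (L R (ext0 v)) m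
      Vanish-L-ext0 R v k m≤k = trans (sym (coeff-x-⊗ (L R (ext0 v)) k)) (+-cancelˡ (coeff (charpoly (suc m) B) (suc k))
        (trans (sym (trans (at (charpoly-shear A B v (λ i j → refl) (λ j → refl)) (suc k)) (coeff-⊕ (charpoly (suc m) B) _ (suc k))))
          (trans (tops-agree (Monic-charpoly (suc m) A) (Monic-charpoly (suc m) B)) (sym (+-identityʳ _)))))
        where
        A B : Fin (suc m) → Fin (suc m) → Carrier
        A = pad 0# R
        B zero    j = 0# + rowCombination v R j
        B (suc i) j = R i j
        tops-agree : ∀ {p s} → Monic p (suc m) → Monic s (suc m) → coeff p (suc k) ≡ coeff s (suc k)
        tops-agree (monic l w) (monic l′ w′) with m ℕ.≟ k
        ... | yes refl = trans l (sym l′)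
        ... | no ne    = trans (w (suc k) (s≤s (ℕₚ.≤∧≢⇒< m≤k ne))) (sym (w′ (suc k) (s≤s (ℕₚ.≤∧≢⇒< m≤k ne))))

      -- The square block is bordered by the row `(0 , v)` and the column `- a`, and transposition
      -- exchanges the two. Dependence on the first column of the lower rows becomes dependence on
      -- the free first row, to which `Good` applies.
      L-transpose : ∀ a v (R : Fin m → Fin m → Carrier) →
        L (joinColumn a R) (ext0 v) ≈ L (joinColumn (neg ∘ v) (λ i j → R j i)) (ext0 (neg ∘ a))
      L-transpose a v R = ≈-trans (≈-sym (DP.det-transpose (suc m) M)) (DP.det-cong (suc m) {λ i j → M j i} {M′} λ
        { zero    zero    → ≈-refl
        ; zero    (suc i) → ≈-refl
        ; (suc j) zero    → ∷-cong (sym (-‿involutive (v j))) ≈-refl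
        ; (suc j) (suc i) → CommutativeRing.reflexive 𝔽[X] (cong (λ b → entry b (R i j)) (does-sym (suc i) (suc j))) })
        where
        M M′ : Fin (suc m) → Fin (suc m) → Poly
        M  = upd zero (λ j → [ ext0 v j ]) (pad [] (pencil (joinColumn a R)))
        M′ = upd zero (λ j → [ ext0 (neg ∘ a) j ]) (pad [] (pencil (joinColumn (neg ∘ v) (λ i j → R j i))))

      -- If R is good, then r ↦ charpoly (r ; R) is a bijection onto the monic polynomials of degree m + 1.
      Good : (Fin m → Fin (suc m) → Carrier) → Set
      Good R = ∀ w → L R w ≈ [] → ∀ j → w j ≡ 0#

      charpoly-injective : ∀ {A B} → Good (A ∘ suc) → (∀ i j → B (suc i) j ≡ A (suc i) j) → charpoly (suc m) A ≈ charpoly (suc m) B → ∀ j → A zero j ≡ B zero j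
      charpoly-injective {A} {B} good rest e j = x-y≡0⇒x≡y (good _ (L-difference R {A zero} {B zero} (∙-cancelˡ (charpoly (suc m) A) _ _ (begin
        charpoly (suc m) A ⊕ L R (A zero) ≈⟨ charpoly+L A ⟩
        cofactor R (xBasisRow zero) ≈⟨ charpoly+L B′ ⟨
        charpoly (suc m) B′ ⊕ L R (B zero) ≡⟨ cong (_⊕ L R (B zero)) (charpoly-cong (suc m) {B} {B′} (λ { zero j → refl ; (suc i) j → rest i j })) ⟨
        charpoly (suc m) B ⊕ L R (B zero) ≈⟨ ⊕-cong {q = L R (B zero)} (≈-sym e) ≈-refl ⟩
        charpoly (suc m) A ⊕ L R (B zero) ∎))) j)
        where
        R = A ∘ suc
        B′ : Fin (suc m) → Fin (suc m) → Carrier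
        B′ zero    = B zero
        B′ (suc i) = A (suc i)
        x-y≡0⇒x≡y : ∀ {y z} → y + neg z ≡ 0# → y ≡ z
        x-y≡0⇒x≡y {y} {z} eq = Groupₚ.x∙y⁻¹≈ε⇒x≈y y z eq

      -- Determinant of the linear map `L R` in terms of unit vectors and monomials. The monomials
      -- are in descending order, so that the shift `R₀` yields the identity and no sign appears.
      discriminant : (Fin m → Fin (suc m) → Carrier) → Carrier
      discriminant R = DF.det (suc m) (λ j k → coeff (cofactor R (basisRow j)) (m ∸ toℕ k))

      discriminant≢0⇒Good : ∀ R → discriminant R ≢ 0# → Good R
      discriminant≢0⇒Good R Δ≢0 w Lw≈0 j = no-zero-divisors Δ≢0 (trans (*-comm _ (w j)) (DF.det-injective (suc m) _ w vanishing j))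
        where
        vanishing : ∀ k → Σ𝔽.∑ (allFin (suc m)) (λ i → w i * coeff (cofactor R (basisRow i)) (m ∸ toℕ k)) ≡ 0#
        vanishing k = trans (Σ𝔽.∑-cong (allFin (suc m)) (λ i → sym (coeff-constant-⊗ (w i) (cofactor R (basisRow i)) (m ∸ toℕ k))))
          (trans (sym (coeff-∑ (allFin (suc m)) (λ i → [ w i ] ⊗ cofactor R (basisRow i)) (m ∸ toℕ k)))
            (at (≈-trans (≈-sym (L-expand R w)) Lw≈0) (m ∸ toℕ k)))

      open DiscriminantTerm m

      module _ (R : Fin m → Fin (suc m) → Carrier) where

        h : List T → Poly
        h = map (λ t → ⟦ t ⟧ (uncurry R))

        h-add : ∀ p s → h (addT p s) ≡ h p ⊕ h s
        h-add []      s       = refl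
        h-add (a ∷ p) []      = refl
        h-add (a ∷ p) (b ∷ s) = cong (_ ∷_) (h-add p s)

        h-mul : ∀ p s → h (mulT p s) ≡ h p ⊗ h s
        h-mul []      s = refl
        h-mul (a ∷ p) s = trans (h-add (map (a `*_) s) (`0 ∷ mulT p s))
          (cong₂ _⊕_ (trans (sym (map-∘ s)) (map-∘ s)) (cong (0# ∷_) (h-mul p s)))

        h-neg : ∀ p → h (negT p) ≡ negP (h p)
        h-neg p = trans (sym (map-∘ p)) (map-∘ p)

        h-coeff : ∀ p k → ⟦ coeffT p k ⟧ (uncurry R) ≡ coeff (h p) k
        h-coeff []      k       = refl
        h-coeff (a ∷ p) zero    = refl
        h-coeff (a ∷ p) (suc k) = h-coeff p k

        h-matrix : ∀ j i c → h (upd zero (rowT j) (pad [] pencilT) i c) ≡ upd zero (basisRow j) (pad [] (pencil R)) i c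
        h-matrix j zero c with does (j Fin.≟ c)
        ... | true  = refl
        ... | false = refl
        h-matrix j (suc i) c with does (suc i Fin.≟ c)
        ... | true  = refl
        ... | false = refl

        ⟦discriminantT⟧ : ⟦ discriminantT ⟧ (uncurry R) ≡ discriminant R
        ⟦discriminantT⟧ = trans
          (detWith-homo {_⊕_ = _`+_} {_`*_} {`-_} {`0} {`1} {_+_} {_*_} {neg} {0#} {1#}
            (λ t → ⟦ t ⟧ (uncurry R)) (λ _ _ → refl) (λ _ _ → refl) (λ _ → refl) refl refl (suc m) (λ j k → coeffT (cofactorT j) (m ∸ toℕ k)))
          (detWith-cong _+_ _*_ neg 0# 1# (suc m) (λ j k → trans (h-coeff (cofactorT j) (m ∸ toℕ k)) (cong (λ p → coeff p (m ∸ toℕ k))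
            (trans (detWith-homo {_⊕_ = addT} {mulT} {negT} {[]} {[ `1 ]} {_⊕_} {_⊗_} {negP} {[]} {[ 1# ]}
                h h-add h-mul h-neg refl refl (suc m) (upd zero (rowT j) (pad [] pencilT)))
              (detWith-cong _⊕_ _⊗_ negP [] [ 1# ] (suc m) (h-matrix j))))))

      -- For the shift R₀ the cofactors are the powers of x, so the discriminant is the determinant of the identity.
      R₀ : Fin m → Fin (suc m) → Carrier
      R₀ i j = if does (inject₁ i Fin.≟ j) then 1# else 0#

      -- Row `i` of the pencil is `x e_(i+1) - e_i` for the shift; adding it to the free first row
      -- changes nothing, so consecutive cofactors differ by a factor `x`.
      cofactor-step : ∀ i → cofactor R₀ (basisRow (inject₁ i)) ≈ 0# ∷ cofactor R₀ (basisRow (suc i))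
      cofactor-step i = begin
        b ≈⟨ ⊕-identityʳ b ⟨
        b ⊕ [] ≈⟨ ⊕-cong {p = b} ≈-refl (cofactor-pencilRow R₀ i) ⟨
        b ⊕ cofactor R₀ (pencil R₀ i) ≈⟨ DP.lin-+ lin (basisRow (inject₁ i)) (pencil R₀ i) ⟨
        cofactor R₀ (λ j → basisRow (inject₁ i) j ⊕ pencil R₀ i j) ≈⟨ DP.lin-cong lin pencil-R₀ ⟩
        cofactor R₀ (xBasisRow (suc i)) ≈⟨ cofactor-xBasisRow R₀ (suc i) ⟩
        x ⊗ cofactor R₀ (basisRow (suc i)) ≈⟨ x-⊗ _ ⟩
        0# ∷ cofactor R₀ (basisRow (suc i)) ∎
        where
        lin = cofactor-linear R₀
        b = cofactor R₀ (basisRow (inject₁ i))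
        pencil-R₀ : ∀ j → basisRow (inject₁ i) j ⊕ pencil R₀ i j ≈ xBasisRow (suc i) j
        pencil-R₀ j with does (inject₁ i Fin.≟ j) | does (suc i Fin.≟ j)
        ... | true  | true  = mk λ { zero → trans (cong (1# +_) (+-identityˡ _)) (-‿inverseʳ 1#) ; (suc k) → refl }
        ... | true  | false = mk λ { zero → -‿inverseʳ 1# ; (suc k) → refl }
        ... | false | true  = mk λ { zero → trans (+-identityˡ _) neg-0 ; (suc k) → refl }
        ... | false | false = mk λ { zero → neg-0 ; (suc k) → refl }

      Monic-cofactor-zero : ∀ R → Monic (cofactor R (basisRow zero)) m
      Monic-cofactor-zero R = Monic-cong (≈-sym (≈-trans (DP.∑-single (suc m) zero _ off) (⊗-identityˡ _))) (Monic-charpoly m (λ i c → R i (suc c)))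
        where
        off : ∀ j → j ≢ zero → DP.sg (toℕ j) (basisRow zero j ⊗ DP.det m (λ r c → pencil R r (punchIn j c))) ≈ []
        off zero    ne = contradiction refl ne
        off (suc j) ne = DP.sg-0 (toℕ (suc j))

      Monic-tail : ∀ {p d} → Monic (0# ∷ p) (suc d) → Monic p d
      Monic-tail (monic l v) = monic l (λ k le → v (suc k) (s≤s le))

      m∸i : ∀ (i : Fin m) → m ∸ toℕ (inject₁ i) ≡ suc (m ∸ suc (toℕ i))
      m∸i i = trans (cong (m ∸_) (Finₚ.toℕ-inject₁ i)) (ℕₚ.+-∸-assoc 1 (Finₚ.toℕ<n i))

      Monic-cofactor : ∀ j → Monic (cofactor R₀ (basisRow j)) (m ∸ toℕ j)
      Monic-cofactor = <-weakInduction _ (Monic-cofactor-zero R₀)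
        (λ i M → Monic-tail (subst (Monic _) (m∸i i) (Monic-cong (cofactor-step i) M)))

      -- Downward induction from the last index, where no coefficient lies below degree 0. It
      -- complements `Monic-cofactor`, which climbs from index 0, where the cofactor is a
      -- characteristic polynomial of size `m`.
      cofactor-low : ∀ j k → k < m ∸ toℕ j → coeff (cofactor R₀ (basisRow j)) k ≡ 0#
      cofactor-low = >-weakInduction _
        (λ k lt → contradiction (subst (k <_) (trans (cong (m ∸_) (Finₚ.toℕ-fromℕ m)) (ℕₚ.n∸n≡0 m)) lt) ℕₚ.n≮0) step
        where
        step : ∀ i → (∀ k → k < m ∸ suc (toℕ i) → coeff (cofactor R₀ (basisRow (suc i))) k ≡ 0#) →
               ∀ k → k < m ∸ toℕ (inject₁ i) → coeff (cofactor R₀ (basisRow (inject₁ i))) k ≡ 0#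
        step i low zero    lt = at (cofactor-step i) 0
        step i low (suc k) lt = trans (at (cofactor-step i) (suc k)) (low k (ℕₚ.≤-pred (subst (suc k <_) (m∸i i) lt)))

      discriminant-R₀ : discriminant R₀ ≡ 1#
      discriminant-R₀ = trans (DF.det-cong (suc m) isIdentity) (DF.det-identity (suc m))
        where
        isIdentity : ∀ j k → coeff (cofactor R₀ (basisRow j)) (m ∸ toℕ k) ≡ DF.identity j k
        isIdentity j k with j Fin.≟ k
        ... | yes refl = lead (Monic-cofactor j)
        ... | no j≢k with ℕₚ.<-cmp (m ∸ toℕ k) (m ∸ toℕ j)
        ...   | tri< lt _ _ = cofactor-low j _ lt
        ...   | tri> _ _ gt = vanish (Monic-cofactor j) _ gt
        ...   | tri≈ _ e _  = contradiction
          (Finₚ.toℕ-injective (sym (ℕₚ.∸-cancelˡ-≡ (ℕₚ.≤-pred (Finₚ.toℕ<n k)) (ℕₚ.≤-pred (Finₚ.toℕ<n j)) e))) j≢k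

-- Distribution of the characteristic polynomials of a matrix and of its shear.

module MatrixCounts where

  open import Data.Bool using (true; false; if_then_else_)
  open import Data.Fin as Fin using (Fin; zero; suc; toℕ)
  open import Data.Nat as ℕ using (ℕ; zero; suc; _≤_; _^_; ∣_-_∣; _≡ᵇ_)
  import Data.Nat.Properties as ℕₚ
  open import Data.Nat.Tactic.RingSolver using (solve-∀)
  open import Data.List using (List; []; _∷_; [_]; length)
  open import Data.Product using (uncurry)
  open import Data.Vec using (Vec; []; _∷_; lookup; tabulate; zipWith; toList)
  open import Data.Vec.Properties using (lookup∘tabulate; lookup-zipWith)
  open import Function using (_∘_)
  open import Relation.Binary.PropositionalEquality as ≡ using (_≡_; refl; sym; trans; cong; cong₂; subst)
  open import Relation.Nullary using (does; yes; no; contradiction)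
  open import Defs
  open Finite
  open Counting
  open Polynomials
  open Determinants using (upd)
  open Degrees
  open Factorization
  open PolynomialCounts
  open Asymptotics
  open PolynomialAsymptotics
  open SchwartzZippel
  open CharacteristicPolynomials

  open Enum using (list)

  ∑-joinColumn : {A : Set} (E : Enum A) (k c : ℕ) (g : Vec (Vec A (suc c)) k → ℕ) →
    ∑ (list (Vecs (Vecs E (suc c)) k)) g ≡ ∑ (list (Vecs E k)) (λ a → ∑ (list (Vecs (Vecs E c) k)) (λ R → g (zipWith _∷_ a R)))
  ∑-joinColumn E zero    c g = sym (ℕₚ.+-identityʳ _)
  ∑-joinColumn E (suc k) c g = begin
    ∑ (list (Vecs (Vecs E (suc c)) (suc k))) g
      ≡⟨ trans (∑-Vecs-suc (Vecs E (suc c)) k g) (∑-Vecs-suc E c _) ⟩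
    ∑ (list E) (λ y → ∑ (list (Vecs E c)) (λ r → ∑ (list (Vecs (Vecs E (suc c)) k)) (λ S → g ((y ∷ r) ∷ S))))
      ≡⟨ ∑-cong (list E) (λ y → ∑-cong (list (Vecs E c)) (λ r → ∑-joinColumn E k c (λ S → g ((y ∷ r) ∷ S)))) ⟩
    ∑ (list E) (λ y → ∑ (list (Vecs E c)) (λ r → ∑ (list (Vecs E k)) (λ a → ∑ (list (Vecs (Vecs E c) k)) (λ R → g ((y ∷ r) ∷ zipWith _∷_ a R)))))
      ≡⟨ ∑-cong (list E) (λ y → ∑-swap (list (Vecs E c)) (list (Vecs E k)) _) ⟩
    ∑ (list E) (λ y → ∑ (list (Vecs E k)) (λ a → ∑ (list (Vecs E c)) (λ r → ∑ (list (Vecs (Vecs E c) k)) (λ R → g ((y ∷ r) ∷ zipWith _∷_ a R)))))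
      ≡⟨ ∑-cong (list E) (λ y → ∑-cong (list (Vecs E k)) (λ a → sym (∑-Vecs-suc (Vecs E c) k (λ R → g (zipWith _∷_ (y ∷ a) R))))) ⟩
    ∑ (list E) (λ y → ∑ (list (Vecs E k)) (λ a → ∑ (list (Vecs (Vecs E c) (suc k))) (λ R → g (zipWith _∷_ (y ∷ a) R))))
      ≡⟨ ∑-Vecs-suc E k _ ⟨
    ∑ (list (Vecs E (suc k))) (λ a → ∑ (list (Vecs (Vecs E c) (suc k))) (λ R → g (zipWith _∷_ a R))) ∎
    where open ≡.≡-Reasoning

  mat-zipWith : {A : Set} {k c : ℕ} (a : Vec A k) (R : Vec (Vec A c) k) → ∀ i j → mat (zipWith _∷_ a R) i j ≡ joinColumn (lookup a) (mat R) i j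
  mat-zipWith a R i j = trans (cong (λ v → lookup v j) (lookup-zipWith _∷_ i a R)) (byColumn j)
    where
    byColumn : ∀ j → lookup (lookup a i ∷ lookup R i) j ≡ joinColumn (lookup a) (mat R) i j
    byColumn zero    = refl
    byColumn (suc j) = refl

  ∑-∣-∣ : {A : Set} (xs : List A) (f g h : A → ℕ) → (∀ y → ∣ f y - g y ∣ ≤ h y) → ∣ ∑ xs f - ∑ xs g ∣ ≤ ∑ xs h
  ∑-∣-∣ xs f g h le = ℕₚ.≤-trans (∣-∣-∑-≤ xs f g) (∑-mono xs le)

  ∣-∣-≤-both : ∀ {a b B} → a ≤ B → b ≤ B → ∣ a - b ∣ ≤ B
  ∣-∣-≤-both {a} {b} a≤B b≤B = ℕₚ.≤-trans (ℕₚ.∣m-n∣≤m⊔n a b) (ℕₚ.⊔-lub a≤B b≤B)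

  module MatrixCount (F : FiniteField) where
    open FiniteField F hiding (unique; complete)
    open FF F using (Poly; _⊕_; _⊗_; negP; det; charpoly; monics; _^P_; _∣?_; irreducible; multiplicity; invertible; factorCount; inT; inT□; regularSemisimple)
    open Poly F
    open Degree F
    open Factor F
    open Count F
    open Lines F
    open Pencil F
    open 𝔽 using (+-comm; +-assoc; +-identityˡ; +-identityʳ; *-assoc; -‿inverseʳ; -‿inverseˡ; distribʳ)
    open import Algebra.Properties.Ring 𝔽.ring using (-‿involutive)

    private Q = card

    infixl 6 _⊖_
    _⊖_ : ∀ {n} → Vec Carrier n → Vec Carrier n → Vec Carrier n
    u ⊖ v = tabulate (λ i → lookup u i + neg (lookup v i))

    lookup-⊖ : ∀ {n} (u v : Vec Carrier n) i → lookup (u ⊖ v) i ≡ lookup u i + neg (lookup v i)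
    lookup-⊖ u v = lookup∘tabulate (λ i → lookup u i + neg (lookup v i))

    neg-injective : ∀ {a b} → neg a ≡ neg b → a ≡ b
    neg-injective {a} {b} e = trans (sym (-‿involutive a)) (trans (cong neg e) (-‿involutive b))

    +-cancelʳ : ∀ c {a b} → a + c ≡ b + c → a ≡ b
    +-cancelʳ c {a} {b} e = +-cancelˡ c (trans (+-comm c a) (trans e (+-comm b c)))

    ∑-⊖ˡ : ∀ {n} (u : Vec Carrier n) (g : Vec Carrier n → ℕ) → ∑ (vecs n) (λ v → g (u ⊖ v)) ≡ ∑ (vecs n) g
    ∑-⊖ˡ {n} u g = ∑-injective (Vecs 𝔼 n) (Vecs 𝔼 n) refl (u ⊖_) inj g
      where
      inj : ∀ {v w} → u ⊖ v ≡ u ⊖ w → v ≡ w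
      inj {v} {w} e = lookup-injective (λ i → neg-injective (+-cancelˡ (lookup u i)
        (trans (sym (lookup-⊖ u v i)) (trans (cong (λ z → lookup z i) e) (lookup-⊖ u w i)))))

    ∑-⊖ʳ : ∀ {n} (u : Vec Carrier n) (g : Vec Carrier n → ℕ) → ∑ (vecs n) (λ v → g (v ⊖ u)) ≡ ∑ (vecs n) g
    ∑-⊖ʳ {n} u g = ∑-injective (Vecs 𝔼 n) (Vecs 𝔼 n) refl (_⊖ u) inj g
      where
      inj : ∀ {v w} → v ⊖ u ≡ w ⊖ u → v ≡ w
      inj {v} {w} e = lookup-injective (λ i → +-cancelʳ (neg (lookup u i))
        (trans (sym (lookup-⊖ v u i)) (trans (cong (λ z → lookup z i) e) (lookup-⊖ w u i))))

    length-Mats : ∀ a b → length (Mats a b) ≡ Q ^ (a ℕ.* b)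
    length-Mats a b = trans (size-Vecs (Vecs 𝔼 b) a) (trans (cong (_^ a) (size-Vecs 𝔼 b)) (trans (ℕₚ.^-*-assoc Q b a) (cong (Q ^_) (ℕₚ.*-comm b a))))

    lookup-coeffs : ∀ n p i → lookup (coeffs n p) i ≡ coeff p (toℕ i)
    lookup-coeffs (suc n) []      zero    = refl
    lookup-coeffs (suc n) []      (suc i) = lookup-coeffs n [] i
    lookup-coeffs (suc n) (a ∷ p) zero    = refl
    lookup-coeffs (suc n) (a ∷ p) (suc i) = lookup-coeffs n p i

    charCoeffs : ∀ {n} → Vec (Vec Carrier n) n → Vec Carrier n
    charCoeffs {n} t = coeffs n (charpoly n (mat t))

    mon-charCoeffs : ∀ {n} (t : Vec (Vec Carrier n) n) → mon (charCoeffs t) ≈ charpoly n (mat t)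
    mon-charCoeffs {n} t = mon-coeffs (Monic-charpoly n (mat t))

    module _ {m : ℕ} where

      n : ℕ
      n = suc m

      open DiscriminantTerm m using (discriminantT)

      bad : Vec (Vec Carrier n) m → ℕ
      bad R = isZero (⟦ discriminantT ⟧ (uncurry (mat R)))

      badTotal : ℕ
      badTotal = ∑ (Mats m n) bad

      badTotal-bound : Q ℕ.* badTotal ≤ suc (size discriminantT) ℕ.* Q ^ (m ℕ.* n)
      badTotal-bound = subst (λ l → Q ℕ.* badTotal ≤ suc (size discriminantT) ℕ.* l) (length-Mats m n)
        (zeros-bound discriminantT (R₀ {m}) (λ e → 0≢1 (trans (sym e) (trans (⟦discriminantT⟧ (R₀ {m})) (discriminant-R₀ {m})))))

      -- Good matrices give equality; for the few exceptional ones the trivial bound `B` is all that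
      -- is available.
      bad-≤ : ∀ R {X Y B} → (Good (mat R) → X ≡ Y) → X ≤ B → Y ≤ B → ∣ X - Y ∣ ≤ bad R ℕ.* B
      bad-≤ R {X} {Y} {B} good X≤B Y≤B with ⟦ discriminantT ⟧ (uncurry (mat R)) ≟ 0#
      ... | yes _ = ℕₚ.≤-trans (∣-∣-≤-both X≤B Y≤B) (ℕₚ.≤-reflexive (sym (ℕₚ.+-identityʳ B)))
      ... | no ne = ℕₚ.≤-reflexive (ℕₚ.m≡n⇒∣m-n∣≡0 (good (discriminant≢0⇒Good (mat R) (λ e → ne (trans (⟦discriminantT⟧ (mat R)) e)))))

      charCoeffs-injective : ∀ R → Good (mat R) → ∀ {r s} → charCoeffs {n} (r ∷ R) ≡ charCoeffs (s ∷ R) → r ≡ s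
      charCoeffs-injective R good {r} {s} e = lookup-injective (charpoly-injective {A = mat (r ∷ R)} {B = mat (s ∷ R)} good (λ i j → refl)
        (≈-trans (≈-sym (mon-charCoeffs (r ∷ R))) (subst (λ v → mon v ≈ charpoly n (mat (s ∷ R))) (sym e) (mon-charCoeffs (s ∷ R)))))

      ∑-vecs-≤ : ∀ {k B} (g : Vec Carrier k → ℕ) → (∀ v → g v ≤ B) → ∑ (vecs k) g ≤ Q ^ k ℕ.* B
      ∑-vecs-≤ {k} {B} g g≤B = ℕₚ.≤-trans (∑-mono (vecs k) g≤B) (ℕₚ.≤-reflexive (∑-vecs-const k B))

      ∑-vecs-≤1 : ∀ {k} (g : Vec Carrier k → ℕ) → (∀ v → g v ≤ 1) → ∑ (vecs k) g ≤ Q ^ k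
      ∑-vecs-≤1 {k} g g≤1 = ℕₚ.≤-trans (∑-vecs-≤ g g≤1) (ℕₚ.≤-reflexive (ℕₚ.*-identityʳ (Q ^ k)))

      ∑-Mats-const : ∀ a b c → ∑ (Mats a b) (λ _ → c) ≡ Q ^ (a ℕ.* b) ℕ.* c
      ∑-Mats-const a b c = trans (∑-const (Mats a b) c) (cong (ℕ._* c) (length-Mats a b))

      ∑-firstRow : (g : Vec (Vec Carrier n) n → ℕ) → ∑ (Mats n n) g ≡ ∑ (Mats m n) (λ R → ∑ (vecs n) (λ r → g (r ∷ R)))
      ∑-firstRow g = trans (∑-Vecs-suc (Vecs 𝔼 n) m g) (∑-swap (vecs n) (Mats m n) _)

      -- For good lower rows `R` the first row runs through all monic polynomials once, so the inner
      -- sum is `∑ (vecs n) g`; each bad `R` costs at most `Q ^ n`.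
      equidistribution : (g : Vec Carrier n → ℕ) → (∀ f → g f ≤ 1) →
        ∣ ∑ (Mats n n) (g ∘ charCoeffs) - Q ^ (m ℕ.* n) ℕ.* ∑ (vecs n) g ∣ ≤ badTotal ℕ.* Q ^ n
      equidistribution g g≤1 = begin
        ∣ ∑ (Mats n n) (g ∘ charCoeffs) - Q ^ (m ℕ.* n) ℕ.* ∑ (vecs n) g ∣
          ≡⟨ cong₂ ∣_-_∣ (∑-firstRow (g ∘ charCoeffs)) (sym (∑-Mats-const m n (∑ (vecs n) g))) ⟩
        ∣ ∑ (Mats m n) (λ R → ∑ (vecs n) (λ r → g (charCoeffs (r ∷ R)))) - ∑ (Mats m n) (λ _ → ∑ (vecs n) g) ∣
          ≤⟨ ∑-∣-∣ (Mats m n) _ _ _ (λ R → bad-≤ R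
               (λ good → ∑-injective (Vecs 𝔼 n) (Vecs 𝔼 n) refl (λ r → charCoeffs (r ∷ R)) (charCoeffs-injective R good) g)
               (∑-vecs-≤1 (λ r → g (charCoeffs (r ∷ R))) (λ r → g≤1 (charCoeffs (r ∷ R)))) (∑-vecs-≤1 g g≤1)) ⟩
        ∑ (Mats m n) (λ R → bad R ℕ.* Q ^ n) ≡⟨ ∑-*ʳ (Mats m n) (Q ^ n) bad ⟩
        badTotal ℕ.* Q ^ n ∎
        where open ℕₚ.≤-Reasoning

      -- Left multiplication by 1 + e₁ (0 , v).
      shear : Vec Carrier m → Vec (Vec Carrier n) n → Vec (Vec Carrier n) n
      shear v (r ∷ R) = tabulate (λ j → lookup r j + rowCombination (lookup v) (mat R) j) ∷ R

      -- The polynomial `ℓ` of degree below `m` with `charpoly (shear v t) = charpoly t - x ℓ`; it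
      -- depends on the lower rows of `t` only.
      lower : Vec Carrier m → Vec (Vec Carrier n) m → Vec Carrier m
      lower v R = coeffs m (L (mat R) (ext0 (lookup v)))

      -- Subtraction of `x l`, which leaves the constant coefficient in place.
      shift : Vec Carrier n → Vec Carrier m → Vec Carrier n
      shift (c ∷ w) l = c ∷ (w ⊖ l)

      lookup-shift-zero : ∀ f l → lookup (shift f l) zero ≡ lookup f zero
      lookup-shift-zero (c ∷ w) l = refl

      lookup-shift-suc : ∀ f l i → lookup (shift f l) (suc i) ≡ lookup f (suc i) + neg (lookup l i)
      lookup-shift-suc (c ∷ w) l i = lookup-⊖ w l i

      charCoeffs-shear : ∀ v r R → charCoeffs (shear v (r ∷ R)) ≡ shift (charCoeffs (r ∷ R)) (lower v R)
      charCoeffs-shear v r R = lookup-injective (λ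
        { zero → trans (lookup-coeffs n (charpoly n B) zero) (trans (sym (trans (at sheared 0) (trans (coeff-⊕ (charpoly n B) _ 0)
            (trans (cong (coeff (charpoly n B) 0 +_) (at (x-⊗ ℓ) 0)) (+-identityʳ _)))))
            (trans (sym (lookup-coeffs n (charpoly n A) zero)) (sym (lookup-shift-zero (charCoeffs (r ∷ R)) (lower v R)))))
        ; (suc i) → trans (lookup-coeffs n (charpoly n B) (suc i)) (trans (coefficient i)
            (sym (trans (lookup-shift-suc (charCoeffs (r ∷ R)) (lower v R) i)
              (cong₂ (λ y z → y + neg z) (lookup-coeffs n (charpoly n A) (suc i)) (lookup-coeffs m ℓ i))))) })
        where
        A B : Fin n → Fin n → Carrier
        A = mat (r ∷ R)
        B = mat (shear v (r ∷ R))
        ℓ = L (mat R) (ext0 (lookup v))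
        sheared : charpoly n A ≈ charpoly n B ⊕ (x ⊗ ℓ)
        sheared = charpoly-shear A B (lookup v) (λ i j → refl) (λ j → lookup∘tabulate (λ j → lookup r j + rowCombination (lookup v) (mat R) j) j)
        coefficient : ∀ (i : Fin m) → coeff (charpoly n B) (suc (toℕ i)) ≡ coeff (charpoly n A) (suc (toℕ i)) + neg (coeff ℓ (toℕ i))
        coefficient i = sym (trans (cong (_+ neg (coeff ℓ (toℕ i))) (trans (at sheared (suc (toℕ i))) (trans (coeff-⊕ (charpoly n B) _ (suc (toℕ i)))
          (cong (coeff (charpoly n B) (suc (toℕ i)) +_) (coeff-x-⊗ ℓ (toℕ i)))))) (trans (+-assoc _ _ _)
          (trans (cong (coeff (charpoly n B) (suc (toℕ i)) +_) (-‿inverseʳ _)) (+-identityʳ _))))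

      -- Indicator of the irreducible polynomials with nonzero constant term, that is, of the
      -- characteristic polynomials of regular elliptic elements. The factor `unit` excludes just
      -- the polynomial `x` in degree 1.
      cyclic : Vec Carrier n → ℕ
      cyclic f = unit (coeff (mon f) 0) ℕ.* 𝟙 (hasType n [ n ] (mon f))

      cyclic≤1 : ∀ f → cyclic f ≤ 1
      cyclic≤1 f = ℕₚ.*-mono-≤ (unit≤1 (coeff (mon f) 0)) (𝟙≤1 (hasType n [ n ] (mon f)))

      cyclic*-≤1 : ∀ f g → cyclic f ℕ.* cyclic g ≤ 1
      cyclic*-≤1 f g = ℕₚ.*-mono-≤ (cyclic≤1 f) (cyclic≤1 g)

      correlation : Vec Carrier m → ℕ
      correlation v = ∑ (Mats n n) (λ t → cyclic (charCoeffs t) ℕ.* cyclic (charCoeffs (shear v t)))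

      shifted : Vec Carrier m → ℕ
      shifted l = ∑ (vecs n) (λ f → cyclic f ℕ.* cyclic (shift f l))

      pairs : ℕ
      pairs = ∑ elements (λ c → cyclicRow F m c ℕ.* cyclicRow F m c)

      ∑-cyclic : ∀ c → ∑ (vecs m) (λ w → cyclic (c ∷ w)) ≡ cyclicRow F m c
      ∑-cyclic c = sym (begin
        unit c ℕ.* ∑ (vecs n) (λ f → constant c (mon f) ℕ.* factors n n (mon f))
          ≡⟨ cong (unit c ℕ.*_) (trans (∑-Vecs-suc 𝔼 m _) (trans (∑-cong elements (λ y → ∑-*ˡ (vecs m) (𝟙 (does (c ≟ y))) _))
               (∑-δ 𝔼 c (λ y → ∑ (vecs m) (λ w → factors n n (mon (y ∷ w))))))) ⟩
        unit c ℕ.* ∑ (vecs m) (λ w → factors n n (mon (c ∷ w)))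
          ≡⟨ cong (unit c ℕ.*_) (∑-cong (vecs m) (λ w → hasType-[n] m (Monic-mon (c ∷ w)))) ⟨
        unit c ℕ.* ∑ (vecs m) (λ w → 𝟙 (hasType n [ n ] (mon (c ∷ w)))) ≡⟨ ∑-*ˡ (vecs m) (unit c) _ ⟨
        ∑ (vecs m) (λ w → cyclic (c ∷ w)) ∎)
        where open ≡.≡-Reasoning

      -- For a fixed polynomial with constant term `c`, subtracting `x l` for all `l` reaches every
      -- monic polynomial with that constant term once. The two polynomials become independent
      -- except for the common constant term.
      ∑-shifted : ∑ (vecs m) shifted ≡ pairs
      ∑-shifted = begin
        ∑ (vecs m) (λ l → ∑ (vecs n) (λ f → cyclic f ℕ.* cyclic (shift f l))) ≡⟨ ∑-swap (vecs m) (vecs n) _ ⟩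
        ∑ (vecs n) (λ f → ∑ (vecs m) (λ l → cyclic f ℕ.* cyclic (shift f l))) ≡⟨ ∑-Vecs-suc 𝔼 m _ ⟩
        ∑ elements (λ c → ∑ (vecs m) (λ w → ∑ (vecs m) (λ l → cyclic (c ∷ w) ℕ.* cyclic (c ∷ (w ⊖ l)))))
          ≡⟨ ∑-cong elements (λ c → trans
               (∑-cong (vecs m) (λ w → trans (∑-*ˡ (vecs m) (cyclic (c ∷ w)) (λ l → cyclic (c ∷ (w ⊖ l))))
                 (cong (cyclic (c ∷ w) ℕ.*_) (trans (∑-⊖ˡ w (λ l → cyclic (c ∷ l))) (∑-cyclic c)))))
               (trans (∑-*ʳ (vecs m) (cyclicRow F m c) (λ w → cyclic (c ∷ w))) (cong (ℕ._* cyclicRow F m c) (∑-cyclic c)))) ⟩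
        pairs ∎
        where open ≡.≡-Reasoning

      -- For a good R the first row parametrises the characteristic polynomial f; for a good reflected matrix the
      -- first column of R then parametrises the difference between f and the characteristic polynomial of the shear.
      correlation-row : ∀ v R → ∣ ∑ (vecs n) (λ r → cyclic (charCoeffs (r ∷ R)) ℕ.* cyclic (charCoeffs (shear v (r ∷ R)))) - shifted (lower v R) ∣ ≤ bad R ℕ.* Q ^ n
      correlation-row v R = bad-≤ R
        (λ good → trans (∑-cong (vecs n) (λ r → cong (λ f → cyclic (charCoeffs (r ∷ R)) ℕ.* cyclic f) (charCoeffs-shear v r R)))
          (∑-injective (Vecs 𝔼 n) (Vecs 𝔼 n) refl (λ r → charCoeffs (r ∷ R)) (charCoeffs-injective R good) (λ f → cyclic f ℕ.* cyclic (shift f (lower v R)))))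
        (∑-vecs-≤1 _ (λ r → cyclic*-≤1 (charCoeffs (r ∷ R)) (charCoeffs (shear v (r ∷ R)))))
        (∑-vecs-≤1 _ (λ f → cyclic*-≤1 f (shift f (lower v R))))

      transposed : Vec (Vec Carrier m) m → Vec (Vec Carrier m) m
      transposed R = tab (λ i j → mat R j i)

      negated : Vec Carrier m → Vec Carrier m
      negated v = tabulate (neg ∘ lookup v)

      reflected : Vec Carrier m → Vec (Vec Carrier m) m → Vec (Vec Carrier n) m
      reflected v R = zipWith _∷_ (negated v) (transposed R)

      L-cong : ∀ {R S : Fin m → Fin n → Carrier} w → (∀ i j → R i j ≡ S i j) → L R w ≡ L S w
      L-cong {R} {S} w e = detWith-cong _⊕_ _⊗_ negP [] [ 1# ] n
        {upd zero (λ j → [ w j ]) (pad [] (pencil R))} {upd zero (λ j → [ w j ]) (pad [] (pencil S))} (λ { zero j → refl ; (suc i) j → cong (entry (does (suc i Fin.≟ j))) (e i j) })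

      lower-reflected : ∀ v a R → toList (lower v (zipWith _∷_ a R)) ≈ L (mat (reflected v R)) (ext0 (neg ∘ lookup a))
      lower-reflected v a R = ≈-trans (toList-coeffs m _ (Vanish-L-ext0 (mat (zipWith _∷_ a R)) (lookup v)))
        (≈-trans (reflexive (L-cong (ext0 (lookup v)) (mat-zipWith a R)))
        (≈-trans (L-transpose (lookup a) (lookup v) (mat R))
          (reflexive (L-cong (ext0 (neg ∘ lookup a)) (λ i j → sym (trans (mat-zipWith (negated v) (transposed R) i j) (entries i j)))))))
        where
        entries : ∀ i j → joinColumn (lookup (negated v)) (mat (transposed R)) i j ≡ joinColumn (neg ∘ lookup v) (λ i j → mat R j i) i j
        entries i zero    = lookup∘tabulate (neg ∘ lookup v) i
        entries i (suc j) = mat-tab (λ i j → mat R j i) i j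

      -- By `L-transpose`, `lower v` is `L` of the reflected matrix at the negated first column, so
      -- goodness of the reflected matrix makes it injective in `a`.
      lower-injective : ∀ v R → Good (mat (reflected v R)) → ∀ {a b} → lower v (zipWith _∷_ a R) ≡ lower v (zipWith _∷_ b R) → a ≡ b
      lower-injective v R good {a} {b} e = lookup-injective (λ i → neg-injective (+-cancelʳ (neg (neg (lookup b i)))
        (trans (good _ (L-difference (mat (reflected v R)) {ext0 (neg ∘ lookup a)} {ext0 (neg ∘ lookup b)}
          (≈-trans (≈-sym (lower-reflected v a R)) (subst (λ l → toList l ≈ L (mat (reflected v R)) (ext0 (neg ∘ lookup b))) (sym e) (lower-reflected v b R)))) (suc i))
          (sym (-‿inverseʳ (neg (lookup b i)))))))

      correlation-column : ∀ v R → ∣ ∑ (vecs m) (λ a → shifted (lower v (zipWith _∷_ a R))) - pairs ∣ ≤ bad (reflected v R) ℕ.* (Q ^ m ℕ.* Q ^ n)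
      correlation-column v R = bad-≤ (reflected v R)
        (λ good → trans (∑-injective (Vecs 𝔼 m) (Vecs 𝔼 m) refl (λ a → lower v (zipWith _∷_ a R)) (lower-injective v R good) shifted) ∑-shifted)
        (∑-vecs-≤ _ (λ a → shifted≤ (lower v (zipWith _∷_ a R)))) (subst (_≤ Q ^ m ℕ.* Q ^ n) ∑-shifted (∑-vecs-≤ shifted shifted≤))
        where
        shifted≤ : ∀ l → shifted l ≤ Q ^ n
        shifted≤ l = ∑-vecs-≤1 _ (λ f → cyclic*-≤1 f (shift f l))

      -- The second error term depends on `v` and can be of the order of the main term: for `m ≥ 1`
      -- and `v = 0` every reflected matrix has a zero first column and is bad. Only its sum over
      -- `v` is small.
      correlation-bound : ∀ v → ∣ correlation v - Q ^ (m ℕ.* m) ℕ.* pairs ∣ ≤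
        badTotal ℕ.* Q ^ n ℕ.+ ∑ (Mats m m) (λ R → bad (reflected v R)) ℕ.* (Q ^ m ℕ.* Q ^ n)
      correlation-bound v = begin
        ∣ correlation v - Q ^ (m ℕ.* m) ℕ.* pairs ∣
          ≤⟨ ℕₚ.∣-∣-triangle (correlation v) (∑ (Mats m n) (λ R → shifted (lower v R))) (Q ^ (m ℕ.* m) ℕ.* pairs) ⟩
        ∣ correlation v - ∑ (Mats m n) (λ R → shifted (lower v R)) ∣ ℕ.+ ∣ ∑ (Mats m n) (λ R → shifted (lower v R)) - Q ^ (m ℕ.* m) ℕ.* pairs ∣
          ≤⟨ ℕₚ.+-mono-≤ rows columns ⟩
        badTotal ℕ.* Q ^ n ℕ.+ ∑ (Mats m m) (λ R → bad (reflected v R)) ℕ.* (Q ^ m ℕ.* Q ^ n) ∎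
        where
        open ℕₚ.≤-Reasoning
        rows : ∣ correlation v - ∑ (Mats m n) (λ R → shifted (lower v R)) ∣ ≤ badTotal ℕ.* Q ^ n
        rows = ℕₚ.≤-trans (ℕₚ.≤-reflexive (cong (λ y → ∣ y - ∑ (Mats m n) (λ R → shifted (lower v R)) ∣) (∑-firstRow _)))
          (ℕₚ.≤-trans (∑-∣-∣ (Mats m n) _ _ _ (correlation-row v)) (ℕₚ.≤-reflexive (∑-*ʳ (Mats m n) (Q ^ n) bad)))
        columns : ∣ ∑ (Mats m n) (λ R → shifted (lower v R)) - Q ^ (m ℕ.* m) ℕ.* pairs ∣ ≤ ∑ (Mats m m) (λ R → bad (reflected v R)) ℕ.* (Q ^ m ℕ.* Q ^ n)
        columns = ℕₚ.≤-trans (ℕₚ.≤-reflexive (cong₂ ∣_-_∣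
            (trans (∑-joinColumn 𝔼 m m (λ R → shifted (lower v R))) (∑-swap (vecs m) (Mats m m) _)) (sym (∑-Mats-const m m pairs))))
          (ℕₚ.≤-trans (∑-∣-∣ (Mats m m) _ _ _ (correlation-column v)) (ℕₚ.≤-reflexive (∑-*ʳ (Mats m m) (Q ^ m ℕ.* Q ^ n) _)))

      -- As `v` and `R` vary, `reflected v R` runs through all matrices exactly once, so each
      -- exceptional matrix is met once in total.
      ∑-reflected : ∑ (vecs m) (λ v → ∑ (Mats m m) (λ R → bad (reflected v R))) ≡ badTotal
      ∑-reflected = begin
        ∑ (vecs m) (λ v → ∑ (Mats m m) (λ R → bad (zipWith _∷_ (negated v) (transposed R))))
          ≡⟨ ∑-cong (vecs m) (λ v → ∑-bijective (Vecs (Vecs 𝔼 m) m) transposed transposed transposed-involutive (λ R → bad (zipWith _∷_ (negated v) R))) ⟩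
        ∑ (vecs m) (λ v → ∑ (Mats m m) (λ R → bad (zipWith _∷_ (negated v) R)))
          ≡⟨ ∑-bijective (Vecs 𝔼 m) negated negated negated-involutive (λ a → ∑ (Mats m m) (λ R → bad (zipWith _∷_ a R))) ⟩
        ∑ (vecs m) (λ a → ∑ (Mats m m) (λ R → bad (zipWith _∷_ a R))) ≡⟨ ∑-joinColumn 𝔼 m m bad ⟨
        badTotal ∎
        where
        open ≡.≡-Reasoning
        transposed-involutive : ∀ R → transposed (transposed R) ≡ R
        transposed-involutive R = mat-injective (λ i j → trans (mat-tab (λ i j → mat (transposed R) j i) i j) (mat-tab (λ i j → mat R j i) j i))
        negated-involutive : ∀ v → negated (negated v) ≡ v
        negated-involutive v = lookup-injective (λ i → trans (lookup∘tabulate (neg ∘ lookup (negated v)) i)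
          (trans (cong neg (lookup∘tabulate (neg ∘ lookup v) i)) (-‿involutive (lookup v i))))

      ∑-correlation-bound : ∑ (vecs m) (λ v → ∣ correlation v - Q ^ (m ℕ.* m) ℕ.* pairs ∣) ≤ badTotal ℕ.* (2 ℕ.* (Q ^ m ℕ.* Q ^ n))
      ∑-correlation-bound = begin
        ∑ (vecs m) (λ v → ∣ correlation v - Q ^ (m ℕ.* m) ℕ.* pairs ∣) ≤⟨ ∑-mono (vecs m) correlation-bound ⟩
        ∑ (vecs m) (λ v → badTotal ℕ.* Q ^ n ℕ.+ ∑ (Mats m m) (λ R → bad (reflected v R)) ℕ.* (Q ^ m ℕ.* Q ^ n))
          ≡⟨ ∑-+ (vecs m) (λ _ → badTotal ℕ.* Q ^ n) _ ⟩
        ∑ (vecs m) (λ _ → badTotal ℕ.* Q ^ n) ℕ.+ ∑ (vecs m) (λ v → ∑ (Mats m m) (λ R → bad (reflected v R)) ℕ.* (Q ^ m ℕ.* Q ^ n))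
          ≡⟨ cong₂ ℕ._+_ (∑-vecs-const m _) (trans (∑-*ʳ (vecs m) (Q ^ m ℕ.* Q ^ n) (λ v → ∑ (Mats m m) (λ R → bad (reflected v R)))) (cong (ℕ._* (Q ^ m ℕ.* Q ^ n)) ∑-reflected)) ⟩
        Q ^ m ℕ.* (badTotal ℕ.* Q ^ n) ℕ.+ badTotal ℕ.* (Q ^ m ℕ.* Q ^ n) ≡⟨ rearrange (Q ^ m) badTotal (Q ^ n) ⟩
        badTotal ℕ.* (2 ℕ.* (Q ^ m ℕ.* Q ^ n)) ∎
        where
        open ℕₚ.≤-Reasoning
        rearrange : ∀ a b c → a ℕ.* (b ℕ.* c) ℕ.+ b ℕ.* (a ℕ.* c) ≡ b ℕ.* (2 ℕ.* (a ℕ.* c))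
        rearrange = solve-∀

      factorCount≡factors : ∀ A d → factorCount n A d ≡ factors n d (charpoly n A)
      factorCount≡factors A d = trans (sum-map≡∑ term (monics d)) (trans (cong (λ l → ∑ l term) (monics≡ d)) (trans (∑-map mon (vecs d) term)
        (∑-cong (vecs d) (λ v → trans (𝟙-if (irreducible d (mon v)) (multiplicity n (mon v) (charpoly n A)))
          (cong (𝟙 (irreducible d (mon v)) ℕ.*_) (countᵇ≡∑ (λ j → (mon v ^P j) ∣? charpoly n A) (oneTo n)))))))
        where
        term : Poly → ℕ
        term f = if irreducible d f then multiplicity n f (charpoly n A) else 0

      unit-sg : ∀ k y → unit (DF.sg k y) ≡ unit y
      unit-sg k y with isEven k
      ... | true  = refl
      ... | false with neg y ≟ 0# | y ≟ 0#
      ...   | yes _ | yes _ = refl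
      ...   | no _  | no _  = refl
      ...   | yes e | no ne = contradiction (neg-injective (trans e (sym neg-0))) ne
      ...   | no ne | yes e = contradiction (trans (cong neg e) neg-0) ne

      -- The constant term of the characteristic polynomial is the determinant up to sign, so
      -- invertibility too is visible in it.
      inT-characteristic : ∀ μ t → 𝟙 (inT n μ (mat t)) ≡ unit (coeff (mon (charCoeffs t)) 0) ℕ.* 𝟙 (hasType n μ (mon (charCoeffs t)))
      inT-characteristic μ t = trans (𝟙-∧ (invertible n (mat t)) _) (cong₂ ℕ._*_
        (trans (sym (unit-sg n (det n (mat t)))) (cong unit (sym (trans (at (mon-charCoeffs t) 0) (coeff₀-charpoly n (mat t))))))
        (cong 𝟙 (trans (all-cong (oneTo n) (λ d → cong (_≡ᵇ mult d μ) (factorCount≡factors (mat t) d))) (hasType-cong n μ (≈-sym (mon-charCoeffs t))))))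

      inT□-characteristic : ∀ μ t → 𝟙 (inT□ n μ (mat t)) ≡
        unit (coeff (mon (charCoeffs t)) 0) ℕ.* 𝟙 (hasType n μ (mon (charCoeffs t))) ℕ.* 𝟙 (squareFree n (mon (charCoeffs t)))
      inT□-characteristic μ t = trans (𝟙-∧ (inT n μ (mat t)) _) (cong₂ ℕ._*_ (inT-characteristic μ t) (cong 𝟙 (squareFree-cong n (≈-sym (mon-charCoeffs t)))))

-- The Cauchy-Schwarz inequality and an abstract mixing estimate.

module CauchySchwarz where

  open import Algebra.Bundles using (CommutativeRing)
  open import Data.Integer using (ℤ; +_; -[1+_]; _+_; _*_; -_; _-_; ∣_∣; _≤_; +≤+; 0ℤ; 1ℤ)
  open import Data.Integer.Properties
  open import Data.Integer.Tactic.RingSolver using (solve-∀)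
  import Data.Nat.Tactic.RingSolver as ℕSolver
  open import Data.List.Membership.Propositional.Properties using (∈-length)
  open import Data.List using (List; []; _∷_; length)
  open import Data.Nat as ℕ using (ℕ; zero; suc; z≤n; s≤s)
  import Data.Nat.Properties as ℕₚ
  open import Data.Product using (∃; _,_)
  open import Relation.Binary.PropositionalEquality using (_≡_; _≢_; refl; sym; trans; cong; cong₂; subst; module ≡-Reasoning)
  open import Relation.Nullary using (yes; no; contradiction)
  open Sums
  open Finite

  open Enum using (list; size)

  module ℤΣ where
    open Sum (CommutativeRing.commutativeSemiring +-*-commutativeRing) public
    open Reindex (CommutativeRing.commutativeSemiring +-*-commutativeRing) public

  open ℤΣ

  square-nonNegative : ∀ i → 0ℤ ≤ i * i
  square-nonNegative (+ n)    = subst (0ℤ ≤_) (pos-* n n) (+≤+ z≤n)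
  square-nonNegative -[1+ n ] = +≤+ z≤n

  ∑-mono-ℤ : {A : Set} (xs : List A) {f g : A → ℤ} → (∀ x → f x ≤ g x) → ∑ xs f ≤ ∑ xs g
  ∑-mono-ℤ []       e = ≤-refl
  ∑-mono-ℤ (x ∷ xs) e = +-mono-≤ (e x) (∑-mono-ℤ xs e)

  ∑-nonNegative : {A : Set} (xs : List A) {f : A → ℤ} → (∀ x → 0ℤ ≤ f x) → 0ℤ ≤ ∑ xs f
  ∑-nonNegative xs {f} e = subst (_≤ ∑ xs f) (∑-zero xs) (∑-mono-ℤ xs {λ _ → 0ℤ} {f} e)

  ∑-const-ℤ : {A : Set} (xs : List A) (c : ℤ) → ∑ xs (λ _ → c) ≡ + length xs * c
  ∑-const-ℤ []       c = refl
  ∑-const-ℤ (x ∷ xs) c = trans (cong (λ z → c + z) (∑-const-ℤ xs c)) (sym (trans (*-distribʳ-+ c 1ℤ (+ length xs)) (cong (_+ + length xs * c) (*-identityˡ c))))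

  ∑-pos : {A : Set} (xs : List A) (f : A → ℕ) → ∑ xs (λ x → + f x) ≡ + Counting.∑ xs f
  ∑-pos []       f = refl
  ∑-pos (x ∷ xs) f = cong (λ z → + f x + z) (∑-pos xs f)

  ∣∑∣≤ : {A : Set} (xs : List A) (f : A → ℤ) → ∣ ∑ xs f ∣ ℕ.≤ Counting.∑ xs (λ x → ∣ f x ∣)
  ∣∑∣≤ []       f = z≤n
  ∣∑∣≤ (x ∷ xs) f = ℕₚ.≤-trans (∣i+j∣≤∣i∣+∣j∣ (f x) (∑ xs f)) (ℕₚ.+-monoʳ-≤ ∣ f x ∣ (∣∑∣≤ xs f))

  ∑-nonzero : {A : Set} (xs : List A) (f : A → ℤ) → ∑ xs f ≢ 0ℤ → ∃ λ x → f x ≢ 0ℤ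
  ∑-nonzero []       f ne = contradiction refl ne
  ∑-nonzero (x ∷ xs) f ne with f x ≟ 0ℤ
  ... | no fx≢0 = x , fx≢0
  ... | yes e   = ∑-nonzero xs f (λ e′ → ne (cong₂ _+_ e e′))

  ∑-product : {A B : Set} (xs : List A) (ys : List B) (f : A → ℤ) (g : B → ℤ) → ∑ xs f * ∑ ys g ≡ ∑ xs (λ x → ∑ ys (λ y → f x * g y))
  ∑-product xs ys f g = trans (sym (∑-*ʳ xs (∑ ys g) f)) (∑-cong xs (λ x → sym (∑-*ˡ ys (f x) g)))

  -- Summing (a x − a y)² ≥ 0 over all pairs.
  cauchy-schwarz : {A : Set} (xs : List A) (a : A → ℤ) → ∑ xs a * ∑ xs a ≤ + length xs * ∑ xs (λ x → a x * a x)
  cauchy-schwarz {A} xs a = *-cancelˡ-≤-pos _ _ (+ 2) (begin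
    + 2 * (S * S)                        ≡⟨ +-identityˡ _ ⟨
    0ℤ + + 2 * (S * S)                   ≤⟨ +-monoˡ-≤ (+ 2 * (S * S)) (∑-nonNegative xs (λ x → ∑-nonNegative xs (λ y → square-nonNegative (a x - a y)))) ⟩
    ∑ xs (λ x → ∑ xs (δ x)) + + 2 * (S * S) ≡⟨ cong (λ z → ∑ xs (λ x → ∑ xs (δ x)) + z) doubled ⟩
    ∑ xs (λ x → ∑ xs (δ x)) + ∑ xs (λ x → ∑ xs (π x))
      ≡⟨ trans (∑-cong xs (λ x → ∑-+ xs (δ x) (π x))) (∑-+ xs (λ x → ∑ xs (δ x)) (λ x → ∑ xs (π x))) ⟨
    ∑ xs (λ x → ∑ xs (λ y → δ x y + π x y))
      ≡⟨ ∑-cong xs (λ x → ∑-cong xs (λ y → polarise (a x) (a y))) ⟩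
    ∑ xs (λ x → ∑ xs (λ y → a x * a x + a y * a y))
      ≡⟨ ∑-cong xs (λ x → trans (∑-+ xs (λ _ → a x * a x) (λ y → a y * a y)) (cong (_+ Q) (∑-const-ℤ xs (a x * a x)))) ⟩
    ∑ xs (λ x → N * (a x * a x) + Q)
      ≡⟨ trans (∑-+ xs (λ x → N * (a x * a x)) (λ _ → Q)) (cong₂ _+_ (∑-*ˡ xs N (λ x → a x * a x)) (∑-const-ℤ xs Q)) ⟩
    N * Q + N * Q ≡⟨ double (N * Q) ⟩
    + 2 * (N * Q) ∎)
    where
    open ≤-Reasoning
    S = ∑ xs a
    Q = ∑ xs (λ x → a x * a x)
    N = + length xs
    δ π : A → A → ℤ
    δ x y = (a x - a y) * (a x - a y)
    π x y = + 2 * (a x * a y)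
    polarise : ∀ u v → (u - v) * (u - v) + + 2 * (u * v) ≡ u * u + v * v
    polarise = solve-∀
    double : ∀ u → u + u ≡ + 2 * u
    double = solve-∀
    doubled : + 2 * (S * S) ≡ ∑ xs (λ x → ∑ xs (π x))
    doubled = trans (cong (+ 2 *_) (∑-product xs xs a a)) (trans (sym (∑-*ˡ xs (+ 2) (λ x → ∑ xs (λ y → a x * a y))))
      (∑-cong xs (λ x → sym (∑-*ˡ xs (+ 2) (λ y → a x * a y)))))

  -- The matrix correlation estimate in the abstract: V acts on M by D, compatibly with B = β t s.
  -- Replacing t by D v t, averaging over v and applying Cauchy-Schwarz over (t , s) removes τ;
  -- what remains after substituting B for s only involves the autocorrelations of φ.
  module Mixing {M V : Set} (EM : Enum M) (EV : Enum V) (D : V → M → M) (_⊖_ : V → V → V)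
    (∑-D : ∀ v (f : M → ℤ) → ∑ (list EM) (λ t → f (D v t)) ≡ ∑ (list EM) f)
    (D-⊖ : ∀ v w t → D (w ⊖ v) (D v t) ≡ D w t)
    (∑-⊖ : ∀ v (f : V → ℕ) → Counting.∑ (list EV) (λ w → f (w ⊖ v)) ≡ Counting.∑ (list EV) f)
    (v₀ : V) (β : M → M → M) (D-β : ∀ v t s → D v (β t s) ≡ β (D v t) s)
    (φ : M → ℤ) (τ ψ : M → ℕ) (τ≤1 : ∀ s → τ s ℕ.≤ 1) (ψ≤1 : ∀ t → ψ t ℕ.≤ 1)
    (β-injective : ∀ t s v → τ s ≢ 0 → ψ (D v (β t s)) ≢ 0 → ∀ {y z} → β t y ≡ β t z → y ≡ z)
    where

    private
      ms = list EM
      vs = list EV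

    E : ℤ
    E = ∑ ms (λ t → ∑ ms (λ s → φ t * (+ τ s * + ψ (β t s))))

    autocorrelation : V → ℤ
    autocorrelation v = ∑ ms (λ t → φ t * φ (D v t))

    X : M → M → ℤ
    X t B = ∑ vs (λ v → φ (D v t) * + ψ (D v B))

    averaged : + size EV * E ≡ ∑ ms (λ t → ∑ ms (λ s → + τ s * X t (β t s)))
    averaged = begin
      + size EV * E ≡⟨ ∑-const-ℤ vs E ⟨
      ∑ vs (λ _ → E) ≡⟨ ∑-cong vs (λ v → trans (sym (∑-D v (λ t → ∑ ms (λ s → φ t * (+ τ s * + ψ (β t s)))))) (∑-cong ms (λ t → ∑-cong ms (λ s → rearrange v t s)))) ⟩
      ∑ vs (λ v → ∑ ms (λ t → ∑ ms (λ s → + τ s * (φ (D v t) * + ψ (D v (β t s)))))) ≡⟨ ∑-swap vs ms (λ v t → ∑ ms (λ s → + τ s * (φ (D v t) * + ψ (D v (β t s))))) ⟩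
      ∑ ms (λ t → ∑ vs (λ v → ∑ ms (λ s → + τ s * (φ (D v t) * + ψ (D v (β t s)))))) ≡⟨ ∑-cong ms (λ t → ∑-swap vs ms (λ v s → + τ s * (φ (D v t) * + ψ (D v (β t s))))) ⟩
      ∑ ms (λ t → ∑ ms (λ s → ∑ vs (λ v → + τ s * (φ (D v t) * + ψ (D v (β t s)))))) ≡⟨ ∑-cong ms (λ t → ∑-cong ms (λ s → ∑-*ˡ vs (+ τ s) (λ v → φ (D v t) * + ψ (D v (β t s))))) ⟩
      ∑ ms (λ t → ∑ ms (λ s → + τ s * X t (β t s))) ∎
      where
      open ≡-Reasoning
      exchange : ∀ a b c → a * (b * c) ≡ b * (a * c)
      exchange = solve-∀
      rearrange : ∀ v t s → φ (D v t) * (+ τ s * + ψ (β (D v t) s)) ≡ + τ s * (φ (D v t) * + ψ (D v (β t s)))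
      rearrange v t s = trans (exchange (φ (D v t)) (+ τ s) (+ ψ (β (D v t) s))) (cong (λ B → + τ s * (φ (D v t) * + ψ B)) (sym (D-β v t s)))

    Y : M → M → ℤ
    Y t s = + τ s * X t (β t s)

    Y²≤X² : ∀ t s → Y t s * Y t s ≤ X t (β t s) * X t (β t s)
    Y²≤X² t s with τ s | τ≤1 s
    ... | zero        | _ = square-nonNegative (X t (β t s))
    ... | suc zero    | _ = ≤-reflexive (cong₂ _*_ (*-identityˡ (X t (β t s))) (*-identityˡ (X t (β t s))))
    ... | suc (suc _) | s≤s ()

    factorʳ≢0 : ∀ i j → i * j ≢ 0ℤ → j ≢ 0ℤ
    factorʳ≢0 i j ne e = ne (trans (cong (i *_) e) (*-zeroʳ i))

    factorˡ≢0 : ∀ i j → i * j ≢ 0ℤ → i ≢ 0ℤ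
    factorˡ≢0 i j ne e = ne (trans (cong (_* j) e) (*-zeroˡ j))

    -- Here `τ` is dropped and `B` becomes free, although `β t` may fail to be injective for
    -- singular `t`. If the left side is nonzero, a nonvanishing summand provides `s` and `v` with
    -- nonzero `τ s` and `ψ`, hence injectivity; otherwise the right side is nonnegative anyway.
    substituted : ∀ t → ∑ ms (λ s → Y t s * Y t s) ≤ ∑ ms (λ B → X t B * X t B)
    substituted t with ∑ ms (λ s → Y t s * Y t s) ≟ 0ℤ
    ... | yes e = subst (_≤ ∑ ms (λ B → X t B * X t B)) (sym e) (∑-nonNegative ms (λ B → square-nonNegative (X t B)))
    ... | no ne with ∑-nonzero ms (λ s → Y t s * Y t s) ne
    ...   | s , Y²≢0 with ∑-nonzero vs (λ v → φ (D v t) * + ψ (D v (β t s))) (factorʳ≢0 (+ τ s) (X t (β t s)) (factorˡ≢0 (Y t s) (Y t s) Y²≢0))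
    ...     | v , term≢0 = ≤-trans (∑-mono-ℤ ms {λ s → Y t s * Y t s} {λ s → X t (β t s) * X t (β t s)} (Y²≤X² t)) (≤-reflexive (∑-injective EM EM refl (β t)
      (β-injective t s v (λ e → factorˡ≢0 (+ τ s) (X t (β t s)) (factorˡ≢0 (Y t s) (Y t s) Y²≢0) (cong +_ e)) (λ e → factorʳ≢0 (φ (D v t)) (+ ψ (D v (β t s))) term≢0 (cong +_ e)))
      (λ B → X t B * X t B)))

    expanded : ∑ ms (λ t → ∑ ms (λ B → X t B * X t B)) ≡
      ∑ vs (λ v → ∑ vs (λ w → ∑ ms (λ t → φ (D v t) * φ (D w t)) * ∑ ms (λ B → + ψ (D v B) * + ψ (D w B))))
    expanded = begin
      ∑ ms (λ t → ∑ ms (λ B → X t B * X t B))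
        ≡⟨ ∑-cong ms (λ t → ∑-cong ms (λ B → trans (∑-product vs vs (λ v → φ (D v t) * + ψ (D v B)) (λ v → φ (D v t) * + ψ (D v B))) (∑-cong vs (λ v → ∑-cong vs (λ w →
             regroup (φ (D v t)) (+ ψ (D v B)) (φ (D w t)) (+ ψ (D w B))))))) ⟩
      ∑ ms (λ t → ∑ ms (λ B → ∑ vs (λ v → ∑ vs (λ w → φφ v w t * ψψ v w B))))
        ≡⟨ ∑-cong ms (λ t → trans (∑-swap ms vs (λ B v → ∑ vs (λ w → φφ v w t * ψψ v w B))) (∑-cong vs (λ v → ∑-swap ms vs (λ B w → φφ v w t * ψψ v w B)))) ⟩
      ∑ ms (λ t → ∑ vs (λ v → ∑ vs (λ w → ∑ ms (λ B → φφ v w t * ψψ v w B))))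
        ≡⟨ trans (∑-swap ms vs (λ t v → ∑ vs (λ w → ∑ ms (λ B → φφ v w t * ψψ v w B)))) (∑-cong vs (λ v → ∑-swap ms vs (λ t w → ∑ ms (λ B → φφ v w t * ψψ v w B)))) ⟩
      ∑ vs (λ v → ∑ vs (λ w → ∑ ms (λ t → ∑ ms (λ B → φφ v w t * ψψ v w B))))
        ≡⟨ ∑-cong vs (λ v → ∑-cong vs (λ w → sym (∑-product ms ms (φφ v w) (ψψ v w)))) ⟩
      ∑ vs (λ v → ∑ vs (λ w → ∑ ms (φφ v w) * ∑ ms (ψψ v w))) ∎
      where
      open ≡-Reasoning
      φφ ψψ : V → V → M → ℤ
      φφ v w t = φ (D v t) * φ (D w t)
      ψψ v w B = + ψ (D v B) * + ψ (D w B)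
      regroup : ∀ a b c d → a * b * (c * d) ≡ a * c * (b * d)
      regroup = solve-∀

    -- `D v t` replaces `t` as the summation variable, so only the difference `w ⊖ v` remains.
    autocorrelation-shift : ∀ v w → ∑ ms (λ t → φ (D v t) * φ (D w t)) ≡ autocorrelation (w ⊖ v)
    autocorrelation-shift v w = trans (∑-cong ms (λ t → cong (λ y → φ (D v t) * φ y) (sym (D-⊖ v w t)))) (∑-D v (λ t → φ t * φ (D (w ⊖ v) t)))

    -- A crude bound: all cancellation comes from `φ`.
    ψ-bound : ∀ v w → ∣ ∑ ms (λ B → + ψ (D v B) * + ψ (D w B)) ∣ ℕ.≤ size EM
    ψ-bound v w = ℕₚ.≤-trans (∣∑∣≤ ms (λ B → + ψ (D v B) * + ψ (D w B))) (ℕₚ.≤-trans (Counting.∑-mono ms (λ B → ℕₚ.≤-trans (ℕₚ.≤-reflexive (∣i*j∣≡∣i∣*∣j∣ (+ ψ (D v B)) (+ ψ (D w B))))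
      (ℕₚ.*-mono-≤ (ψ≤1 (D v B)) (ψ≤1 (D w B))))) (ℕₚ.≤-reflexive (Counting.∑-1 ms)))

    expanded-bound : ∣ ∑ vs (λ v → ∑ vs (λ w → ∑ ms (λ t → φ (D v t) * φ (D w t)) * ∑ ms (λ B → + ψ (D v B) * + ψ (D w B)))) ∣ ℕ.≤
      size EV ℕ.* (Counting.∑ vs (λ u → ∣ autocorrelation u ∣) ℕ.* size EM)
    expanded-bound = ℕₚ.≤-trans (∣∑∣≤ vs (λ v → ∑ vs (P v))) (ℕₚ.≤-trans (Counting.∑-mono vs (λ v → ℕₚ.≤-trans (∣∑∣≤ vs (P v)) (per v)))
      (ℕₚ.≤-reflexive (Counting.∑-const vs _)))
      where
      P : V → V → ℤ
      P v w = ∑ ms (λ t → φ (D v t) * φ (D w t)) * ∑ ms (λ B → + ψ (D v B) * + ψ (D w B))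
      per : ∀ v → Counting.∑ vs (λ w → ∣ ∑ ms (λ t → φ (D v t) * φ (D w t)) * ∑ ms (λ B → + ψ (D v B) * + ψ (D w B)) ∣) ℕ.≤
        Counting.∑ vs (λ u → ∣ autocorrelation u ∣) ℕ.* size EM
      per v = ℕₚ.≤-trans
        (Counting.∑-mono vs (λ w → ℕₚ.≤-trans (ℕₚ.≤-reflexive (∣i*j∣≡∣i∣*∣j∣ (∑ ms (λ t → φ (D v t) * φ (D w t))) (∑ ms (λ B → + ψ (D v B) * + ψ (D w B)))))
          (ℕₚ.*-mono-≤ (ℕₚ.≤-reflexive (cong ∣_∣ (autocorrelation-shift v w))) (ψ-bound v w))))
        (ℕₚ.≤-reflexive (trans (Counting.∑-*ʳ vs (size EM) (λ w → ∣ autocorrelation (w ⊖ v) ∣)) (cong (ℕ._* size EM) (∑-⊖ v (λ u → ∣ autocorrelation u ∣)))))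

    -- Cauchy-Schwarz over `t` and then over `s`, each time at the price of a factor `size EM`.
    squared : (+ size EV * E) * (+ size EV * E) ≤ + size EM * (+ size EM * ∑ ms (λ t → ∑ ms (λ B → X t B * X t B)))
    squared = begin
      (+ size EV * E) * (+ size EV * E) ≡⟨ cong₂ _*_ averaged averaged ⟩
      ∑ ms (λ t → ∑ ms (Y t)) * ∑ ms (λ t → ∑ ms (Y t)) ≤⟨ cauchy-schwarz ms (λ t → ∑ ms (Y t)) ⟩
      + size EM * ∑ ms (λ t → ∑ ms (Y t) * ∑ ms (Y t))
        ≤⟨ *-monoˡ-≤-nonNeg (+ size EM) (∑-mono-ℤ ms {λ t → ∑ ms (Y t) * ∑ ms (Y t)} {λ t → + size EM * ∑ ms (λ B → X t B * X t B)} (λ t → ≤-trans (cauchy-schwarz ms (Y t)) (*-monoˡ-≤-nonNeg (+ size EM) (substituted t)))) ⟩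
      + size EM * ∑ ms (λ t → + size EM * ∑ ms (λ B → X t B * X t B)) ≡⟨ cong (+ size EM *_) (∑-*ˡ ms (+ size EM) (λ t → ∑ ms (λ B → X t B * X t B))) ⟩
      + size EM * (+ size EM * ∑ ms (λ t → ∑ ms (λ B → X t B * X t B))) ∎
      where open ≤-Reasoning

    -- `squared` has `size EV` twice on the left, and on the right once after the sum over pairs
    -- `(v , w)` has collapsed to differences. One factor cancels, `v₀` showing that it is positive.
    mixing : size EV ℕ.* (∣ E ∣ ℕ.* ∣ E ∣) ℕ.≤ size EM ℕ.* (size EM ℕ.* (size EM ℕ.* Counting.∑ vs (λ u → ∣ autocorrelation u ∣)))
    mixing = ℕₚ.*-cancelˡ-≤ (size EV) {{ℕ.>-nonZero (∈-length (Enum.complete EV v₀))}} (begin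
      size EV ℕ.* (size EV ℕ.* (∣ E ∣ ℕ.* ∣ E ∣)) ≡⟨ trans (cong₂ ℕ._*_ abs abs) (regroup (size EV) ∣ E ∣) ⟨
      ∣ + size EV * E ∣ ℕ.* ∣ + size EV * E ∣ ≡⟨ ∣i*j∣≡∣i∣*∣j∣ (+ size EV * E) (+ size EV * E) ⟨
      ∣ (+ size EV * E) * (+ size EV * E) ∣ ≤⟨ ∣-∣-mono (square-nonNegative (+ size EV * E)) squared ⟩
      ∣ + size EM * (+ size EM * ∑ ms (λ t → ∑ ms (λ B → X t B * X t B))) ∣
        ≡⟨ trans (∣i*j∣≡∣i∣*∣j∣ (+ size EM) (+ size EM * ∑ ms (λ t → ∑ ms (λ B → X t B * X t B)))) (cong (size EM ℕ.*_) (trans (∣i*j∣≡∣i∣*∣j∣ (+ size EM) (∑ ms (λ t → ∑ ms (λ B → X t B * X t B)))) (cong (λ z → size EM ℕ.* ∣ z ∣) expanded))) ⟩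
      size EM ℕ.* (size EM ℕ.* ∣ ∑ vs (λ v → ∑ vs (λ w → ∑ ms (λ t → φ (D v t) * φ (D w t)) * ∑ ms (λ B → + ψ (D v B) * + ψ (D w B)))) ∣)
        ≤⟨ ℕₚ.*-monoʳ-≤ (size EM) (ℕₚ.*-monoʳ-≤ (size EM) expanded-bound) ⟩
      size EM ℕ.* (size EM ℕ.* (size EV ℕ.* (Counting.∑ vs (λ u → ∣ autocorrelation u ∣) ℕ.* size EM)))
        ≡⟨ pull (size EM) (size EV) (Counting.∑ vs (λ u → ∣ autocorrelation u ∣)) ⟩
      size EV ℕ.* (size EM ℕ.* (size EM ℕ.* (size EM ℕ.* Counting.∑ vs (λ u → ∣ autocorrelation u ∣)))) ∎)
      where
      open ℕₚ.≤-Reasoning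
      abs : ∣ + size EV * E ∣ ≡ size EV ℕ.* ∣ E ∣
      abs = ∣i*j∣≡∣i∣*∣j∣ (+ size EV) E
      regroup : ∀ a b → a ℕ.* b ℕ.* (a ℕ.* b) ≡ a ℕ.* (a ℕ.* (b ℕ.* b))
      regroup = ℕSolver.solve-∀
      pull : ∀ m v p → m ℕ.* (m ℕ.* (v ℕ.* (p ℕ.* m))) ≡ v ℕ.* (m ℕ.* (m ℕ.* (m ℕ.* p)))
      pull = ℕSolver.solve-∀
      ∣-∣-mono : ∀ {i j} → 0ℤ ≤ i → i ≤ j → ∣ i ∣ ℕ.≤ ∣ j ∣
      ∣-∣-mono (+≤+ z≤n) (+≤+ le) = le

-- Mixing for products of two elliptic matrices with a fixed invertible matrix.

module MatrixMixing where

  open import Data.Bool using (Bool; true; false)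
  open import Data.Fin as Fin using (Fin; zero; suc)
  open import Data.Integer as ℤ using (ℤ; +_; 1ℤ)
  import Data.Integer.Properties as ℤₚ
  import Data.Integer.Tactic.RingSolver as ℤSolver
  import Data.Nat.Tactic.RingSolver as ℕSolver
  open import Data.Nat as ℕ using (ℕ; zero; suc; _≤_; ∣_-_∣)
  import Data.Nat.Properties as ℕₚ
  open import Data.List using ([]; _∷_; length; allFin)
  open import Data.Product using (_,_)
  open import Data.Sum using (inj₁; inj₂)
  open import Data.Vec using (Vec; []; _∷_; lookup; tabulate)
  open import Data.Vec.Properties using (lookup∘tabulate)
  open import Function using (_∘_)
  open import Relation.Binary.PropositionalEquality as ≡ using (_≡_; _≢_; refl; sym; trans; cong; cong₂; subst)
  open import Relation.Nullary using (yes; no; contradiction)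
  open import Defs
  open Sums
  open Finite
  open Counting
  open Polynomials
  open Degrees
  open PolynomialCounts
  open SchwartzZippel
  open CharacteristicPolynomials
  open MatrixCounts
  open CauchySchwarz

  open Enum using (list)

  ∣+m-+n∣ : ∀ a b → ℤ.∣ + a ℤ.- + b ∣ ≡ ∣ a - b ∣
  ∣+m-+n∣ a b with ℕₚ.≤-total a b
  ... | inj₁ a≤b = trans (cong ℤ.∣_∣ (ℤₚ.m-n≡m⊖n a b)) (trans (ℤₚ.∣⊖∣-≤ a≤b) (sym (ℕₚ.m≤n⇒∣m-n∣≡n∸m a≤b)))
  ... | inj₂ b≤a = trans (cong ℤ.∣_∣ (trans (ℤₚ.m-n≡m⊖n a b) (ℤₚ.⊖-≥ b≤a))) (sym (ℕₚ.m≤n⇒∣n-m∣≡n∸m b≤a))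

  module MatrixAlgebra (F : FiniteField) where
    open FiniteField F hiding (unique; complete)
    open FF F using (det; _·_; I)
    open Poly F
    open Degree F using (𝔼)
    open Count F
    open Lines F
    open Pencil F using (module DF; module Σ𝔽; rowCombination)
    open MatrixCount F
    open 𝔽 using (+-comm; +-assoc; +-identityˡ; +-identityʳ; *-assoc; *-comm; -‿inverseʳ; distribʳ; distribˡ; *-identityˡ; *-identityʳ; zeroˡ; zeroʳ; ring)
    open import Algebra.Properties.Ring ring using (-‿distribˡ-*)
    open ≡.≡-Reasoning

    infixl 7 _⊙_
    _⊙_ : ∀ {n} → Vec (Vec Carrier n) n → Vec (Vec Carrier n) n → Vec (Vec Carrier n) n
    t ⊙ s = tab (mat t · mat s)

    𝕀 : ∀ {n} → Vec (Vec Carrier n) n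
    𝕀 = tab I

    mat-⊙ : ∀ {n} (t s : Vec (Vec Carrier n) n) i j → mat (t ⊙ s) i j ≡ Σ𝔽.∑ (allFin n) (λ l → mat t i l * mat s l j)
    mat-⊙ t s = mat-tab (mat t · mat s)

    ⊙-assoc : ∀ {n} (t s u : Vec (Vec Carrier n) n) → (t ⊙ s) ⊙ u ≡ t ⊙ (s ⊙ u)
    ⊙-assoc {n} t s u = mat-injective (λ i j → begin
      mat ((t ⊙ s) ⊙ u) i j ≡⟨ mat-⊙ (t ⊙ s) u i j ⟩
      Σ𝔽.∑ (allFin n) (λ l → mat (t ⊙ s) i l * mat u l j)
        ≡⟨ Σ𝔽.∑-cong (allFin n) (λ l → trans (cong (_* mat u l j) (mat-⊙ t s i l)) (sym (Σ𝔽.∑-*ʳ (allFin n) (mat u l j) _))) ⟩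
      Σ𝔽.∑ (allFin n) (λ l → Σ𝔽.∑ (allFin n) (λ k → (mat t i k * mat s k l) * mat u l j)) ≡⟨ Σ𝔽.∑-swap (allFin n) (allFin n) _ ⟩
      Σ𝔽.∑ (allFin n) (λ k → Σ𝔽.∑ (allFin n) (λ l → (mat t i k * mat s k l) * mat u l j))
        ≡⟨ Σ𝔽.∑-cong (allFin n) (λ k → trans (Σ𝔽.∑-cong (allFin n) (λ l → *-assoc (mat t i k) _ _))
             (trans (Σ𝔽.∑-*ˡ (allFin n) (mat t i k) _) (cong (mat t i k *_) (sym (mat-⊙ s u k j))))) ⟩
      Σ𝔽.∑ (allFin n) (λ k → mat t i k * mat (s ⊙ u) k j) ≡⟨ mat-⊙ t (s ⊙ u) i j ⟨
      mat (t ⊙ (s ⊙ u)) i j ∎)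

    mat-𝕀-≢ : ∀ {n} {i j : Fin n} → i ≢ j → mat 𝕀 i j ≡ 0#
    mat-𝕀-≢ {i = i} {j} ne = trans (mat-tab I i j) (DF.identity-off i j ne)

    mat-𝕀-≡ : ∀ {n} (i : Fin n) → mat 𝕀 i i ≡ 1#
    mat-𝕀-≡ i = trans (mat-tab I i i) (DF.identity-diag i)

    ⊙-identityˡ : ∀ {n} (t : Vec (Vec Carrier n) n) → 𝕀 ⊙ t ≡ t
    ⊙-identityˡ {n} t = mat-injective (λ i j → trans (mat-⊙ 𝕀 t i j)
      (trans (DF.∑-single n i _ (λ l ne → trans (cong (_* mat t l j) (mat-𝕀-≢ (ne ∘ sym))) (zeroˡ _)))
        (trans (cong (_* mat t i j) (mat-𝕀-≡ i)) (*-identityˡ _))))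

    ⊙-identityʳ : ∀ {n} (t : Vec (Vec Carrier n) n) → t ⊙ 𝕀 ≡ t
    ⊙-identityʳ {n} t = mat-injective (λ i j → trans (mat-⊙ t 𝕀 i j)
      (trans (DF.∑-single n j _ (λ l ne → trans (cong (mat t i l *_) (mat-𝕀-≢ ne)) (zeroʳ _)))
        (trans (cong (mat t i j *_) (mat-𝕀-≡ j)) (*-identityʳ _))))

    record Invertible {n : ℕ} (t : Vec (Vec Carrier n) n) : Set where
      field
        inverseOf : Vec (Vec Carrier n) n
        isLeft    : inverseOf ⊙ t ≡ 𝕀
        isRight   : t ⊙ inverseOf ≡ 𝕀
    open Invertible public

    Invertible-𝕀 : ∀ {n} → Invertible (𝕀 {n})
    Invertible-𝕀 = record { inverseOf = 𝕀 ; isLeft = ⊙-identityˡ 𝕀 ; isRight = ⊙-identityˡ 𝕀 }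

    ⊙-cancelˡ : ∀ {n} {t x y : Vec (Vec Carrier n) n} → Invertible t → t ⊙ x ≡ t ⊙ y → x ≡ y
    ⊙-cancelˡ {t = t} {x} {y} t⁻¹ e = trans (undo x) (trans (cong (inverseOf t⁻¹ ⊙_) e) (sym (undo y)))
      where
      undo : ∀ x → x ≡ inverseOf t⁻¹ ⊙ (t ⊙ x)
      undo x = trans (sym (⊙-identityˡ x)) (trans (cong (_⊙ x) (sym (isLeft t⁻¹))) (⊙-assoc (inverseOf t⁻¹) t x))

    ⊙-undoʳ : ∀ {n} {t : Vec (Vec Carrier n) n} (t⁻¹ : Invertible t) x → (x ⊙ t) ⊙ inverseOf t⁻¹ ≡ x
    ⊙-undoʳ {t = t} t⁻¹ x = trans (⊙-assoc x t (inverseOf t⁻¹)) (trans (cong (x ⊙_) (isRight t⁻¹)) (⊙-identityʳ x))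

    ⊙-cancelʳ : ∀ {n} {t x y : Vec (Vec Carrier n) n} → Invertible t → x ⊙ t ≡ y ⊙ t → x ≡ y
    ⊙-cancelʳ {x = x} {y} t⁻¹ e = trans (sym (⊙-undoʳ t⁻¹ x)) (trans (cong (_⊙ inverseOf t⁻¹) e) (⊙-undoʳ t⁻¹ y))

    Invertible-⊙ : ∀ {n} {t s : Vec (Vec Carrier n) n} → Invertible t → Invertible s → Invertible (t ⊙ s)
    Invertible-⊙ {t = t} {s} t⁻¹ s⁻¹ = record
      { inverseOf = inverseOf s⁻¹ ⊙ inverseOf t⁻¹
      ; isLeft  = trans (⊙-assoc (inverseOf s⁻¹) (inverseOf t⁻¹) (t ⊙ s)) (trans (cong (inverseOf s⁻¹ ⊙_)
          (trans (sym (⊙-assoc (inverseOf t⁻¹) t s)) (trans (cong (_⊙ s) (isLeft t⁻¹)) (⊙-identityˡ s)))) (isLeft s⁻¹))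
      ; isRight = trans (⊙-assoc t s (inverseOf s⁻¹ ⊙ inverseOf t⁻¹)) (trans (cong (t ⊙_)
          (trans (sym (⊙-assoc s (inverseOf s⁻¹) (inverseOf t⁻¹))) (trans (cong (_⊙ inverseOf t⁻¹) (isRight s⁻¹)) (⊙-identityˡ (inverseOf t⁻¹))))) (isRight t⁻¹))
      }

    Invertible-inverse : ∀ {n} {t : Vec (Vec Carrier n) n} (t⁻¹ : Invertible t) → Invertible (inverseOf t⁻¹)
    Invertible-inverse {t = t} t⁻¹ = record { inverseOf = t ; isLeft = isRight t⁻¹ ; isRight = isLeft t⁻¹ }

    ⊙-injectiveʳ : ∀ {n} (t : Vec (Vec Carrier n) n) → det n (mat t) ≢ 0# → ∀ {x y} → x ⊙ t ≡ y ⊙ t → x ≡ y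
    ⊙-injectiveʳ {n} t det≢0 {x} {y} e = mat-injective (λ i j → x-y≡0 (no-zero-divisors det≢0
      (trans (*-comm (det n (mat t)) _) (DF.det-injective n (mat t) (λ l → mat x i l + neg (mat y i l)) (λ c → vanishing i c) j))))
      where
      x-y≡0 : ∀ {a b} → a + neg b ≡ 0# → a ≡ b
      x-y≡0 {a} {b} e = +-cancelʳ (neg b) (trans e (sym (-‿inverseʳ b)))
      vanishing : ∀ i c → Σ𝔽.∑ (allFin n) (λ l → (mat x i l + neg (mat y i l)) * mat t l c) ≡ 0#
      vanishing i c = begin
        Σ𝔽.∑ (allFin n) (λ l → (mat x i l + neg (mat y i l)) * mat t l c)
          ≡⟨ Σ𝔽.∑-cong (allFin n) (λ l → trans (distribʳ (mat t l c) (mat x i l) _) (cong (λ y → (mat x i l * mat t l c) + y)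
               (trans (sym (-‿distribˡ-* (mat y i l) (mat t l c))) (neg-as-* _)))) ⟩
        Σ𝔽.∑ (allFin n) (λ l → (mat x i l * mat t l c) + (neg 1# * (mat y i l * mat t l c))) ≡⟨ Σ𝔽.∑-+ (allFin n) _ _ ⟩
        Σ𝔽.∑ (allFin n) (λ l → mat x i l * mat t l c) + Σ𝔽.∑ (allFin n) (λ l → neg 1# * (mat y i l * mat t l c))
          ≡⟨ cong₂ _+_ (trans (sym (mat-⊙ x t i c)) (trans (cong (λ u → mat u i c) e) (mat-⊙ y t i c)))
               (trans (Σ𝔽.∑-*ˡ (allFin n) (neg 1#) (λ l → mat y i l * mat t l c)) (sym (neg-as-* _))) ⟩
        Σ𝔽.∑ (allFin n) (λ l → mat y i l * mat t l c) + neg (Σ𝔽.∑ (allFin n) (λ l → mat y i l * mat t l c)) ≡⟨ -‿inverseʳ _ ⟩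
        0# ∎
        where
        neg-as-* : ∀ a → neg a ≡ neg 1# * a
        neg-as-* a = trans (cong neg (sym (*-identityˡ a))) (-‿distribˡ-* 1# a)

    -- Right multiplication by t is injective, hence surjective on the finite set of matrices.
    det≢0⇒Invertible : ∀ {n} (t : Vec (Vec Carrier n) n) → det n (mat t) ≢ 0# → Invertible t
    det≢0⇒Invertible {n} t det≢0 with injective⇒surjective (Vecs (Vecs 𝔼 n) n) (Vecs (Vecs 𝔼 n) n) refl (_⊙ t) (⊙-injectiveʳ t det≢0) 𝕀
    ... | s , s⊙t≡𝕀 = record { inverseOf = s ; isLeft = s⊙t≡𝕀 ; isRight = ⊙-injectiveʳ t det≢0
      (trans (⊙-assoc t s t) (trans (cong (t ⊙_) s⊙t≡𝕀) (trans (⊙-identityʳ t) (sym (⊙-identityˡ t))))) }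

    module _ {m : ℕ} where

      shear-zero : ∀ v (t : Vec (Vec Carrier (suc m)) (suc m)) j →
        mat (shear v t) zero j ≡ mat t zero j + rowCombination (lookup v) (λ i → mat t (suc i)) j
      shear-zero v (r ∷ R) j = lookup∘tabulate (λ j → lookup r j + rowCombination (lookup v) (mat R) j) j

      shear-suc : ∀ v (t : Vec (Vec Carrier (suc m)) (suc m)) i j → mat (shear v t) (suc i) j ≡ mat t (suc i) j
      shear-suc v (r ∷ R) i j = refl

      shear-injective : ∀ v {t s : Vec (Vec Carrier (suc m)) (suc m)} → shear v t ≡ shear v s → t ≡ s
      shear-injective v {t} {s} e = mat-injective λ
        { zero j → +-cancelʳ (rowCombination (lookup v) (λ i → mat t (suc i)) j)
            (trans (sym (shear-zero v t j)) (trans (cong (λ u → mat u zero j) e) (trans (shear-zero v s j)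
              (cong (λ y → mat s zero j + y) (Σ𝔽.∑-cong (allFin m) (λ i → cong (lookup v i *_) (sym (rest i j))))))))
        ; (suc i) j → rest i j }
        where
        rest : ∀ i j → mat t (suc i) j ≡ mat s (suc i) j
        rest i j = trans (sym (shear-suc v t i j)) (trans (cong (λ u → mat u (suc i) j) e) (shear-suc v s i j))

      shear-⊖ : ∀ v w (t : Vec (Vec Carrier (suc m)) (suc m)) → shear (w ⊖ v) (shear v t) ≡ shear w t
      shear-⊖ v w t = mat-injective λ
        { zero j → begin
            mat (shear (w ⊖ v) (shear v t)) zero j ≡⟨ shear-zero (w ⊖ v) (shear v t) j ⟩
            mat (shear v t) zero j + rowCombination (lookup (w ⊖ v)) (λ i → mat (shear v t) (suc i)) j
              ≡⟨ cong₂ _+_ (shear-zero v t j) (Σ𝔽.∑-cong (allFin m) (λ i → cong₂ _*_ (lookup-⊖ w v i) (shear-suc v t i j))) ⟩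
            (mat t zero j + rowCombination (lookup v) (λ i → mat t (suc i)) j) + Σ𝔽.∑ (allFin m) (λ i → (lookup w i + neg (lookup v i)) * mat t (suc i) j)
              ≡⟨ +-assoc _ _ _ ⟩
            mat t zero j + (rowCombination (lookup v) (λ i → mat t (suc i)) j + Σ𝔽.∑ (allFin m) (λ i → (lookup w i + neg (lookup v i)) * mat t (suc i) j))
              ≡⟨ cong (λ y → mat t zero j + y) (trans (sym (Σ𝔽.∑-+ (allFin m) _ _)) (Σ𝔽.∑-cong (allFin m) (λ i → combine (lookup v i) (lookup w i) (mat t (suc i) j)))) ⟩
            mat t zero j + rowCombination (lookup w) (λ i → mat t (suc i)) j ≡⟨ shear-zero w t j ⟨
            mat (shear w t) zero j ∎
        ; (suc i) j → trans (shear-suc (w ⊖ v) (shear v t) i j) (trans (shear-suc v t i j) (sym (shear-suc w t i j))) }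
        where
        combine : ∀ a b c → (a * c) + ((b + neg a) * c) ≡ b * c
        combine a b c = trans (sym (distribʳ c a (b + neg a))) (cong (_* c)
          (trans (cong (λ y → a + y) (+-comm b (neg a))) (trans (sym (+-assoc a (neg a) b)) (trans (cong (_+ b) (-‿inverseʳ a)) (+-identityˡ b)))))

      shear-⊙ : ∀ v (t s : Vec (Vec Carrier (suc m)) (suc m)) → shear v (t ⊙ s) ≡ shear v t ⊙ s
      shear-⊙ v t s = mat-injective λ
        { zero j → begin
            mat (shear v (t ⊙ s)) zero j ≡⟨ shear-zero v (t ⊙ s) j ⟩
            mat (t ⊙ s) zero j + Σ𝔽.∑ (allFin m) (λ i → lookup v i * mat (t ⊙ s) (suc i) j)
              ≡⟨ cong₂ _+_ (mat-⊙ t s zero j) (Σ𝔽.∑-cong (allFin m) (λ i → trans (cong (lookup v i *_) (mat-⊙ t s (suc i) j))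
                   (trans (sym (Σ𝔽.∑-*ˡ ls (lookup v i) _)) (Σ𝔽.∑-cong ls (λ l → sym (*-assoc (lookup v i) _ _)))))) ⟩
            Σ𝔽.∑ ls (λ l → mat t zero l * mat s l j) + Σ𝔽.∑ (allFin m) (λ i → Σ𝔽.∑ ls (λ l → (lookup v i * mat t (suc i) l) * mat s l j))
              ≡⟨ cong (λ y → Σ𝔽.∑ ls (λ l → mat t zero l * mat s l j) + y) (trans (Σ𝔽.∑-swap (allFin m) ls _) (Σ𝔽.∑-cong ls (λ l → Σ𝔽.∑-*ʳ (allFin m) (mat s l j) _))) ⟩
            Σ𝔽.∑ ls (λ l → mat t zero l * mat s l j) + Σ𝔽.∑ ls (λ l → rowCombination (lookup v) (λ i → mat t (suc i)) l * mat s l j)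
              ≡⟨ Σ𝔽.∑-+ ls _ _ ⟨
            Σ𝔽.∑ ls (λ l → (mat t zero l * mat s l j) + (rowCombination (lookup v) (λ i → mat t (suc i)) l * mat s l j))
              ≡⟨ Σ𝔽.∑-cong ls (λ l → trans (sym (distribʳ (mat s l j) _ _)) (cong (_* mat s l j) (sym (shear-zero v t l)))) ⟩
            Σ𝔽.∑ ls (λ l → mat (shear v t) zero l * mat s l j) ≡⟨ mat-⊙ (shear v t) s zero j ⟨
            mat (shear v t ⊙ s) zero j ∎
        ; (suc i) j → trans (shear-suc v (t ⊙ s) i j) (trans (mat-⊙ t s (suc i) j) (sym (trans (mat-⊙ (shear v t) s (suc i) j)
            (Σ𝔽.∑-cong ls (λ l → cong (_* mat s l j) (shear-suc v t i l)))))) }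
        where ls = allFin (suc m)

      T : Vec (Vec Carrier (suc m)) (suc m) → ℕ
      T t = cyclic (charCoeffs t)

      T≢0⇒Invertible : ∀ t → T t ≢ 0 → Invertible t
      T≢0⇒Invertible t ne = det≢0⇒Invertible t (λ e → ne (trans (sym (inT-characteristic (suc m ∷ []) t)) (inT-singular e)))
        where
        inT-singular : det (suc m) (mat t) ≡ 0# → 𝟙 (FF.inT F (suc m) (suc m ∷ []) (mat t)) ≡ 0
        inT-singular e with det (suc m) (mat t) ≟ 0#
        ... | yes _ = refl
        ... | no d  = contradiction e d

      Mₙ = Mats (suc m) (suc m)

      totalT : ℕ
      totalT = ∑ Mₙ T

      ∑-⊙ʳ : ∀ {s} → Invertible s → (f : Vec (Vec Carrier (suc m)) (suc m) → ℕ) → ∑ Mₙ (λ t → f (t ⊙ s)) ≡ ∑ Mₙ f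
      ∑-⊙ʳ s⁻¹ f = ∑-injective (Vecs (Vecs 𝔼 (suc m)) (suc m)) (Vecs (Vecs 𝔼 (suc m)) (suc m)) refl _ (⊙-cancelʳ s⁻¹) f

      -- `H` is the product of the factors after the second, and `χ` is membership in the target set
      -- of invertible matrices.
      module Product (χ : Vec (Vec Carrier (suc m)) (suc m) → Bool) (χ-det : ∀ t → χ t ≡ true → det (suc m) (mat t) ≢ 0#)
                     (H : Vec (Vec Carrier (suc m)) (suc m)) (H⁻¹ : Invertible H) where

        Mat′ = Vec (Vec Carrier (suc m)) (suc m)

        β : Mat′ → Mat′ → Mat′
        β t s = t ⊙ (s ⊙ H)

        φ : Mat′ → ℤ
        φ t = + (suc m ℕ.* T t) ℤ.- 1ℤ

        ψ : Mat′ → ℕ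
        ψ t = 𝟙 (χ t)

        ψ≢0 : ∀ t → ψ t ≢ 0 → det (suc m) (mat t) ≢ 0#
        ψ≢0 t ne with χ t in eq
        ... | true  = χ-det t eq
        ... | false = contradiction refl ne

        -- A sheared product in the target set is invertible; cancelling the invertible `s ⊙ H`
        -- makes `shear v t` invertible. Shearing the equation then permits cancellation on the
        -- left.
        β-injective : ∀ t s v → T s ≢ 0 → ψ (shear v (β t s)) ≢ 0 → ∀ {y z} → β t y ≡ β t z → y ≡ z
        β-injective t s v Ts≢0 ψ≢0′ {y} {z} e = ⊙-cancelʳ H⁻¹ (⊙-cancelˡ sheared⁻¹ (trans (sym (shear-⊙ v t (y ⊙ H))) (trans (cong (shear v) e) (shear-⊙ v t (z ⊙ H)))))
          where
          K⁻¹ : Invertible (s ⊙ H)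
          K⁻¹ = Invertible-⊙ (T≢0⇒Invertible s Ts≢0) H⁻¹
          product⁻¹ : Invertible (shear v t ⊙ (s ⊙ H))
          product⁻¹ = subst Invertible (shear-⊙ v t (s ⊙ H)) (det≢0⇒Invertible (shear v (β t s)) (ψ≢0 (shear v (β t s)) ψ≢0′))
          sheared⁻¹ : Invertible (shear v t)
          sheared⁻¹ = subst Invertible (⊙-undoʳ K⁻¹ (shear v t)) (Invertible-⊙ product⁻¹ (Invertible-inverse K⁻¹))

        open Mixing (Vecs (Vecs 𝔼 (suc m)) (suc m)) (Vecs 𝔼 m) shear _⊖_
          (λ v → ℤΣ.∑-injective (Vecs (Vecs 𝔼 (suc m)) (suc m)) (Vecs (Vecs 𝔼 (suc m)) (suc m)) refl (shear v) (shear-injective v))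
          shear-⊖ ∑-⊖ʳ (tabulate (λ _ → 0#)) β (λ v t s → shear-⊙ v t (s ⊙ H)) φ T ψ (λ s → cyclic≤1 (charCoeffs s)) (λ t → 𝟙≤1 (χ t)) β-injective public

        hits : ℕ
        hits = ∑ Mₙ (λ t → ∑ Mₙ (λ s → T t ℕ.* (T s ℕ.* ψ (β t s))))

        measure : ℕ
        measure = ∑ Mₙ ψ

        -- This is the contribution of the `1` in `φ`. For invertible `s ⊙ H` the product `β t s`
        -- runs through all matrices with `t`, so the inner sum is `measure` for every `s` that
        -- counts.
        ∑-main : ∑ Mₙ (λ t → ∑ Mₙ (λ s → T s ℕ.* ψ (β t s))) ≡ totalT ℕ.* measure
        ∑-main = trans (∑-swap Mₙ Mₙ _) (trans (∑-cong Mₙ (λ s → trans (∑-*ˡ Mₙ (T s) _) (each s))) (∑-*ʳ Mₙ measure T))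
          where
          each : ∀ s → T s ℕ.* ∑ Mₙ (λ t → ψ (β t s)) ≡ T s ℕ.* measure
          each s with T s ℕ.≟ 0
          ... | yes e = trans (cong (ℕ._* ∑ Mₙ (λ t → ψ (β t s))) e) (sym (cong (ℕ._* measure) e))
          ... | no ne = cong (T s ℕ.*_) (∑-⊙ʳ (Invertible-⊙ (T≢0⇒Invertible s ne) H⁻¹) ψ)

        ∣E∣ : ℤ.∣ E ∣ ≡ ∣ suc m ℕ.* hits - totalT ℕ.* measure ∣
        ∣E∣ = trans (cong ℤ.∣_∣ E≡) (∣+m-+n∣ (suc m ℕ.* hits) (totalT ℕ.* measure))
          where
          term₁ term₂ : Mat′ → Mat′ → ℕ
          term₁ t s = suc m ℕ.* (T t ℕ.* (T s ℕ.* ψ (β t s)))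
          term₂ t s = T s ℕ.* ψ (β t s)
          distribute : ∀ a b → (a ℤ.- 1ℤ) ℤ.* b ℤ.+ b ≡ a ℤ.* b
          distribute = ℤSolver.solve-∀
          each : ∀ t s → φ t ℤ.* (+ T s ℤ.* + ψ (β t s)) ℤ.+ + term₂ t s ≡ + term₁ t s
          each t s = trans (cong (λ y → φ t ℤ.* (+ T s ℤ.* + ψ (β t s)) ℤ.+ y) (ℤₚ.pos-* (T s) (ψ (β t s))))
            (trans (distribute (+ (suc m ℕ.* T t)) (+ T s ℤ.* + ψ (β t s))) (trans (cong (+ (suc m ℕ.* T t) ℤ.*_) (sym (ℤₚ.pos-* (T s) (ψ (β t s)))))
              (trans (sym (ℤₚ.pos-* (suc m ℕ.* T t) (T s ℕ.* ψ (β t s)))) (cong +_ (ℕₚ.*-assoc (suc m) (T t) _)))))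
          ∑∑-pos : ∀ (f : Mat′ → Mat′ → ℕ) → ℤΣ.∑ Mₙ (λ t → ℤΣ.∑ Mₙ (λ s → + f t s)) ≡ + ∑ Mₙ (λ t → ∑ Mₙ (f t))
          ∑∑-pos f = trans (ℤΣ.∑-cong Mₙ (λ t → ∑-pos Mₙ (f t))) (∑-pos Mₙ (λ t → ∑ Mₙ (f t)))
          sum≡ : E ℤ.+ + (totalT ℕ.* measure) ≡ + (suc m ℕ.* hits)
          sum≡ = begin
            E ℤ.+ + (totalT ℕ.* measure) ≡⟨ cong (λ y → E ℤ.+ y) (trans (cong +_ (sym ∑-main)) (sym (∑∑-pos term₂))) ⟩
            E ℤ.+ ℤΣ.∑ Mₙ (λ t → ℤΣ.∑ Mₙ (λ s → + term₂ t s))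
              ≡⟨ trans (ℤΣ.∑-cong Mₙ (λ t → ℤΣ.∑-+ Mₙ (λ s → φ t ℤ.* (+ T s ℤ.* + ψ (β t s))) (λ s → + term₂ t s)))
                   (ℤΣ.∑-+ Mₙ (λ t → ℤΣ.∑ Mₙ (λ s → φ t ℤ.* (+ T s ℤ.* + ψ (β t s)))) (λ t → ℤΣ.∑ Mₙ (λ s → + term₂ t s))) ⟨
            ℤΣ.∑ Mₙ (λ t → ℤΣ.∑ Mₙ (λ s → φ t ℤ.* (+ T s ℤ.* + ψ (β t s)) ℤ.+ + term₂ t s)) ≡⟨ ℤΣ.∑-cong Mₙ (λ t → ℤΣ.∑-cong Mₙ (each t)) ⟩
            ℤΣ.∑ Mₙ (λ t → ℤΣ.∑ Mₙ (λ s → + term₁ t s)) ≡⟨ ∑∑-pos term₁ ⟩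
            + ∑ Mₙ (λ t → ∑ Mₙ (term₁ t)) ≡⟨ cong +_ (trans (∑-cong Mₙ (λ t → ∑-*ˡ Mₙ (suc m) _)) (∑-*ˡ Mₙ (suc m) _)) ⟩
            + (suc m ℕ.* hits) ∎
          E≡ : E ≡ + (suc m ℕ.* hits) ℤ.- + (totalT ℕ.* measure)
          E≡ = trans (isolate E (+ (totalT ℕ.* measure))) (cong (ℤ._- + (totalT ℕ.* measure)) sum≡)
            where
            isolate : ∀ a b → a ≡ a ℤ.+ b ℤ.- b
            isolate = ℤSolver.solve-∀

        size-M = length Mₙ

        -- Expand the product of `n T - 1` at `t` and at its shear. Both linear terms have the same
        -- sum, as a shear permutes the matrices, so the total is
        -- `c - 2 w + s = (c - s) - 2 (w - s)`; this isolates one error for the correlation and one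
        -- for the number of elliptic elements.
        autocorrelation-≤ : ∀ u → ℤ.∣ autocorrelation u ∣ ≤ ∣ suc m ℕ.* suc m ℕ.* correlation u - size-M ∣ ℕ.+ 2 ℕ.* ∣ suc m ℕ.* totalT - size-M ∣
        autocorrelation-≤ u = ℕₚ.≤-trans (ℕₚ.≤-reflexive (cong ℤ.∣_∣ Φ≡)) (ℕₚ.≤-trans (ℤₚ.∣i-j∣≤∣i∣+∣j∣ (c ℤ.- s) ((w ℤ.- s) ℤ.+ (w ℤ.- s)))
          (ℕₚ.+-mono-≤ (ℕₚ.≤-reflexive (∣+m-+n∣ (suc m ℕ.* suc m ℕ.* correlation u) size-M))
            (ℕₚ.≤-trans (ℤₚ.∣i+j∣≤∣i∣+∣j∣ (w ℤ.- s) (w ℤ.- s)) (ℕₚ.≤-reflexive (trans (cong₂ ℕ._+_ ∣w-s∣ ∣w-s∣)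
              (cong (∣ suc m ℕ.* totalT - size-M ∣ ℕ.+_) (sym (ℕₚ.+-identityʳ _))))))))
          where
          c w s : ℤ
          c = + (suc m ℕ.* suc m ℕ.* correlation u)
          w = + (suc m ℕ.* totalT)
          s = + size-M
          ∣w-s∣ : ℤ.∣ w ℤ.- s ∣ ≡ ∣ suc m ℕ.* totalT - size-M ∣
          ∣w-s∣ = ∣+m-+n∣ (suc m ℕ.* totalT) size-M
          a b d : Mat′ → ℕ
          a t = suc m ℕ.* T t
          b t = suc m ℕ.* T (shear u t)
          d t = suc m ℕ.* suc m ℕ.* (T t ℕ.* T (shear u t))
          multiply : ∀ x y → (x ℤ.- 1ℤ) ℤ.* (y ℤ.- 1ℤ) ℤ.+ (x ℤ.+ y) ≡ x ℤ.* y ℤ.+ 1ℤ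
          multiply = ℤSolver.solve-∀
          regroup : ∀ n x y → n ℕ.* x ℕ.* (n ℕ.* y) ≡ n ℕ.* n ℕ.* (x ℕ.* y)
          regroup = ℕSolver.solve-∀
          each : ∀ t → φ t ℤ.* φ (shear u t) ℤ.+ (+ a t ℤ.+ + b t) ≡ + d t ℤ.+ 1ℤ
          each t = trans (multiply (+ a t) (+ b t)) (cong (ℤ._+ 1ℤ) (trans (sym (ℤₚ.pos-* (a t) (b t))) (cong +_ (regroup (suc m) (T t) (T (shear u t))))))
          ∑a : ℤΣ.∑ Mₙ (λ t → + a t) ≡ w
          ∑a = trans (∑-pos Mₙ a) (cong +_ (∑-*ˡ Mₙ (suc m) T))
          ∑b : ℤΣ.∑ Mₙ (λ t → + b t) ≡ w
          ∑b = trans (∑-pos Mₙ b) (cong +_ (trans (∑-*ˡ Mₙ (suc m) (T ∘ shear u)) (cong (suc m ℕ.*_)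
            (∑-injective (Vecs (Vecs 𝔼 (suc m)) (suc m)) (Vecs (Vecs 𝔼 (suc m)) (suc m)) refl (shear u) (shear-injective u) T))))
          ∑d : ℤΣ.∑ Mₙ (λ t → + d t) ≡ c
          ∑d = trans (∑-pos Mₙ d) (cong +_ (∑-*ˡ Mₙ (suc m ℕ.* suc m) _))
          total : autocorrelation u ℤ.+ (w ℤ.+ w) ≡ c ℤ.+ s
          total = begin
            autocorrelation u ℤ.+ (w ℤ.+ w)
              ≡⟨ cong (λ y → autocorrelation u ℤ.+ y) (trans (cong₂ ℤ._+_ (sym ∑a) (sym ∑b)) (sym (ℤΣ.∑-+ Mₙ (λ t → + a t) (λ t → + b t)))) ⟩
            autocorrelation u ℤ.+ ℤΣ.∑ Mₙ (λ t → + a t ℤ.+ + b t) ≡⟨ ℤΣ.∑-+ Mₙ (λ t → φ t ℤ.* φ (shear u t)) (λ t → + a t ℤ.+ + b t) ⟨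
            ℤΣ.∑ Mₙ (λ t → φ t ℤ.* φ (shear u t) ℤ.+ (+ a t ℤ.+ + b t)) ≡⟨ ℤΣ.∑-cong Mₙ each ⟩
            ℤΣ.∑ Mₙ (λ t → + d t ℤ.+ 1ℤ) ≡⟨ ℤΣ.∑-+ Mₙ (λ t → + d t) (λ _ → 1ℤ) ⟩
            ℤΣ.∑ Mₙ (λ t → + d t) ℤ.+ ℤΣ.∑ Mₙ (λ _ → 1ℤ) ≡⟨ cong₂ ℤ._+_ ∑d (trans (∑-const-ℤ Mₙ 1ℤ) (ℤₚ.*-identityʳ s)) ⟩
            c ℤ.+ s ∎
          Φ≡ : autocorrelation u ≡ (c ℤ.- s) ℤ.- ((w ℤ.- s) ℤ.+ (w ℤ.- s))
          Φ≡ = trans (isolate (autocorrelation u) w) (trans (cong (ℤ._- (w ℤ.+ w)) total) (arrange c s w))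
            where
            isolate : ∀ x y → x ≡ (x ℤ.+ (y ℤ.+ y)) ℤ.- (y ℤ.+ y)
            isolate = ℤSolver.solve-∀
            arrange : ∀ x y z → (x ℤ.+ y) ℤ.- (z ℤ.+ z) ≡ (x ℤ.- y) ℤ.- ((z ℤ.- y) ℤ.+ (z ℤ.- y))
            arrange = ℤSolver.solve-∀

-- Asymptotic size of the correlations and of the deviation.

module MatrixAsymptotics where

  open import Data.Bool using (Bool; true)
  open import Data.Fin using (suc)
  import Data.Integer as ℤ
  open import Data.Nat hiding (_≟_)
  open import Data.Nat.Properties hiding (_≟_)
  open import Data.Nat.Tactic.RingSolver using (solve-∀)
  open import Data.Vec using (Vec)
  open import Relation.Binary.PropositionalEquality using (_≡_; _≢_; refl; sym; trans; cong; cong₂)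
  open import Defs
  open Finite
  open Counting
  open Degrees
  open PolynomialCounts
  open Asymptotics
  open PolynomialAsymptotics
  open SchwartzZippel
  open CharacteristicPolynomials
  open MatrixCounts
  open MatrixMixing

  badTotal-O : ∀ m → (λ F → MatrixCount.badTotal F {m}) =O (m * suc m)
  badTotal-O m = bound (suc (size (DiscriminantTerm.discriminantT m))) (λ F → MatrixCount.badTotal-bound F {m})

  -- Transfers a count of polynomials to matrices: the error `badTotal * q ^ suc m` in
  -- `equidistribution` is a factor `q` below the number of all matrices.
  charCoeffsCount~ : ∀ m (c : ℕ) (X : ∀ F → Vec (FiniteField.Carrier F) (suc m) → ℕ) → (∀ F f → X F f ≤ 1) →
    (λ F → c * ∑ (Count.vecs F (suc m)) (X F)) ~[ suc m ] (λ F → q F ^ suc m) →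
    (λ F → c * ∑ (Lines.Mats F (suc m) (suc m)) (λ t → X F (MatrixCount.charCoeffs F t))) ~[ suc m * suc m ] (λ F → q F ^ (suc m * suc m))
  charCoeffsCount~ m c X X≤1 X~ = ~-trans
    (~-const* c (near (O-cong-exponent (+-comm (m * suc m) (suc m))
      (O-≤ (λ F → MatrixCount.equidistribution F (X F) (X≤1 F)) (O-* {Y = λ F → q F ^ suc m} (badTotal-O m) 1 (1*q^ (suc m)))))))
    (~-trans (~-reflexive (λ F → rearrange c (q F ^ (m * suc m)) (∑ (Count.vecs F (suc m)) (X F))))
      (~-trans (~-*ʳ {Y = λ F → q F ^ (m * suc m)} X~ 1 (1*q^ (m * suc m))) (~-reflexive (λ F → sym (^-distribˡ-+-* (q F) (suc m) (m * suc m))))))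
    where
    rearrange : ∀ a b c → a * (b * c) ≡ a * c * b
    rearrange = solve-∀

  totalT~ : ∀ m → (λ F → suc m * MatrixAlgebra.totalT F {m}) ~[ suc m * suc m ] (λ F → q F ^ (suc m * suc m))
  totalT~ m = charCoeffsCount~ m (suc m) (λ F → MatrixCount.cyclic F) (λ F → MatrixCount.cyclic≤1 F)
    (~-trans (~-reflexive (λ F → cong (suc m *_) (trans (∑-Vecs-suc (Degree.𝔼 F) m (MatrixCount.cyclic F))
      (∑-cong (FiniteField.elements F) (MatrixCount.∑-cyclic F))))) (∑-cyclicRow~ m))

  correlationDeviation : ℕ → Family
  correlationDeviation m F = ∑ (Count.vecs F m) (λ u → ∣ suc m * suc m * MatrixCount.correlation F u - q F ^ (suc m * suc m) ∣)

  -- Two errors meet: the exceptional matrices, small after summation over the shears, and the error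
  -- in the number of pairs with equal constant terms, the same for each of the `q ^ m` shears.
  correlationDeviation-O : ∀ m → correlationDeviation m =O (m + suc m * suc m)
  correlationDeviation-O m = O-≤ estimate (O-+
    (O-cong-exponent (exponent₁ m) (O-≤ (λ F → ≤-refl)
      (O-const* (suc m * suc m) (O-* {Y = λ F → 2 * (q F ^ m * q F ^ suc m)} (badTotal-O m) 2
        (λ F → ≤-reflexive (cong (2 *_) (sym (^-distribˡ-+-* (q F) m (suc m)))))))))
    (O-cong-exponent (exponent₂ m) (O-* {Y = λ F → q F ^ m} (difference pairs~) 1 (1*q^ m))))
    where
    exponent₁ : ∀ m → m * suc m + (m + suc m) ≡ m + suc m * suc m
    exponent₁ = solve-∀
    exponent₂ : ∀ m → suc m + m + m * m + m ≡ m + suc m * suc m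
    exponent₂ = solve-∀
    exponent₃ : ∀ m → suc m + m + m * m ≡ suc m * suc m
    exponent₃ = solve-∀
    pairs~ : (λ F → suc m * suc m * MatrixCount.pairs F {m} * q F ^ (m * m)) ~[ suc m + m + m * m ] (λ F → q F ^ (suc m * suc m))
    pairs~ = ~-trans (~-*ʳ {Y = λ F → q F ^ (m * m)} (∑-cyclicRow²~ m) 1 (1*q^ (m * m)))
      (~-reflexive (λ F → trans (sym (^-distribˡ-+-* (q F) (suc m + m) (m * m))) (cong (q F ^_) (exponent₃ m))))
    estimate : ∀ F → correlationDeviation m F ≤
      suc m * suc m * (MatrixCount.badTotal F {m} * (2 * (q F ^ m * q F ^ suc m)))
      + ∣ suc m * suc m * MatrixCount.pairs F {m} * q F ^ (m * m) - q F ^ (suc m * suc m) ∣ * q F ^ m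
    estimate F = begin
      ∑ (vecs m) (λ u → ∣ nn * correlation u - Q ^ nn ∣)
        ≤⟨ ∑-mono (vecs m) (λ u → ∣-∣-triangle (nn * correlation u) (nn * (Q ^ (m * m) * pairs)) (Q ^ nn)) ⟩
      ∑ (vecs m) (λ u → ∣ nn * correlation u - nn * (Q ^ (m * m) * pairs) ∣ + ∣ nn * (Q ^ (m * m) * pairs) - Q ^ nn ∣)
        ≡⟨ trans (∑-+ (vecs m) _ (λ _ → ∣ nn * (Q ^ (m * m) * pairs) - Q ^ nn ∣)) (cong₂ _+_
             (trans (∑-cong (vecs m) (λ u → sym (*-distribˡ-∣-∣ nn (correlation u) (Q ^ (m * m) * pairs)))) (∑-*ˡ (vecs m) nn _))
             (trans (∑-vecs-const m _) (trans (*-comm (Q ^ m) _) (cong (λ x → ∣ x - Q ^ nn ∣ * Q ^ m) (rearrange nn (Q ^ (m * m)) pairs))))) ⟩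
      nn * ∑ (vecs m) (λ u → ∣ correlation u - Q ^ (m * m) * pairs ∣) + ∣ nn * pairs * Q ^ (m * m) - Q ^ nn ∣ * Q ^ m
        ≤⟨ +-monoˡ-≤ _ (*-monoʳ-≤ nn (MatrixCount.∑-correlation-bound F {m})) ⟩
      nn * (badTotal * (2 * (Q ^ m * Q ^ suc m))) + ∣ nn * pairs * Q ^ (m * m) - Q ^ nn ∣ * Q ^ m ∎
      where
      open ≤-Reasoning
      open Count F using (vecs; ∑-vecs-const)
      open MatrixCount F hiding (badTotal; pairs; ∑-correlation-bound)
      badTotal = MatrixCount.badTotal F {m}
      pairs = MatrixCount.pairs F {m}
      Q = q F
      nn = suc m * suc m
      rearrange : ∀ a b c → a * (b * c) ≡ a * c * b
      rearrange = solve-∀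

  autocorrelationBound : ℕ → Family
  autocorrelationBound m F = correlationDeviation m F + 2 * (∣ suc m * MatrixAlgebra.totalT F {m} - q F ^ (suc m * suc m) ∣ * q F ^ m)

  autocorrelationBound-O : ∀ m → autocorrelationBound m =O (m + suc m * suc m)
  autocorrelationBound-O m = O-+ (correlationDeviation-O m)
    (O-const* 2 (O-cong-exponent (+-comm (suc m * suc m) m) (O-* {Y = λ F → q F ^ m} (difference (totalT~ m)) 1 (1*q^ m))))

  -- Stated for variables with equations, so that sizes of enumerations are replaced by powers of
  -- `q` through matching. The cancelled factor `P` is the number of shears.
  square-bound-arithmetic : ∀ {V Q P S M e e′ Σ B : ℕ} (C : ℕ) → 1 ≤ P → V ≡ P → S ≡ M → e ≡ e′ →
    V * (e * e) ≤ S * (S * (S * Σ)) → Σ ≤ B → Q * B ≤ C * (P * M) → Q * (e′ * e′) ≤ C * (M * (M * (M * M)))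
  square-bound-arithmetic {Q = Q} {P} {M = M} {e} {Σ = Σ} C 1≤P refl refl refl mixed Σ≤B B≤ = *-cancelˡ-≤ P {{>-nonZero 1≤P}} (begin
    P * (Q * (e * e))       ≡⟨ commute P Q (e * e) ⟩
    Q * (P * (e * e))       ≤⟨ *-monoʳ-≤ Q mixed ⟩
    Q * (M * (M * (M * Σ))) ≡⟨ commute₃ Q M Σ ⟩
    M * (M * (M * (Q * Σ))) ≤⟨ *-monoʳ-≤ M (*-monoʳ-≤ M (*-monoʳ-≤ M (≤-trans (*-monoʳ-≤ Q Σ≤B) B≤))) ⟩
    M * (M * (M * (C * (P * M)))) ≡⟨ collect M C P ⟩
    P * (C * (M * (M * (M * M)))) ∎)
    where
    open ≤-Reasoning
    commute : ∀ a b c → a * (b * c) ≡ b * (a * c)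
    commute = solve-∀
    commute₃ : ∀ a b c → a * (b * (b * (b * c))) ≡ b * (b * (b * (a * c)))
    commute₃ = solve-∀
    collect : ∀ m c p → m * (m * (m * (c * (p * m)))) ≡ p * (c * (m * (m * (m * m))))
    collect = solve-∀

  module _ (m : ℕ) (F : FiniteField) (χ : Vec (Vec (FiniteField.Carrier F) (suc m)) (suc m) → Bool)
           (χ-det : ∀ t → χ t ≡ true → FF.det F (suc m) (mat t) ≢ FiniteField.0# F)
           (H : Vec (Vec (FiniteField.Carrier F) (suc m)) (suc m)) (H⁻¹ : MatrixAlgebra.Invertible F H) where

    open Count F using (vecs; ∑-vecs-const)
    open MatrixCount F using (length-Mats; correlation)
    open MatrixAlgebra F using (totalT; module Product)
    open Product χ χ-det H H⁻¹

    deviation : ℕ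
    deviation = ∣ suc m * hits - totalT {m} * measure ∣

    ∑-autocorrelation-bound : ∑ (vecs m) (λ u → ℤ.∣ autocorrelation u ∣) ≤ autocorrelationBound m F
    ∑-autocorrelation-bound = ≤-trans (∑-mono (vecs m) each)
      (≤-reflexive (trans (∑-+ (vecs m) (λ u → ∣ suc m * suc m * correlation u - M ∣) (λ _ → 2 * δ)) (cong (correlationDeviation m F +_)
        (trans (∑-vecs-const m (2 * δ)) (swap (q F ^ m) δ)))))
      where
      M = q F ^ (suc m * suc m)
      δ = ∣ suc m * totalT {m} - M ∣
      swap : ∀ a b → a * (2 * b) ≡ 2 * (b * a)
      swap = solve-∀
      resize : ∀ {x} y z {s s′} → s ≡ s′ → x ≤ ∣ y - s ∣ + 2 * ∣ z - s ∣ → x ≤ ∣ y - s′ ∣ + 2 * ∣ z - s′ ∣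
      resize y z refl le = le
      each : ∀ u → ℤ.∣ autocorrelation u ∣ ≤ ∣ suc m * suc m * correlation u - M ∣ + 2 * δ
      each u = resize (suc m * suc m * correlation u) (suc m * totalT {m}) (length-Mats (suc m) (suc m)) (autocorrelation-≤ u)

    -- The trivial bound for the squared deviation is of the order of the fourth power of the number
    -- of matrices; the factor `q` on the left is the whole saving, `q^(-1/2)` for the deviation
    -- itself.
    deviation-bound : ∀ C → q F * autocorrelationBound m F ≤ C * q F ^ (m + suc m * suc m) →
      q F * (deviation * deviation) ≤ C * (q F ^ (suc m * suc m) * (q F ^ (suc m * suc m) * (q F ^ (suc m * suc m) * q F ^ (suc m * suc m))))
    deviation-bound C bounded = square-bound-arithmetic {Q = q F} C (q^-positive F m) (size-Vecs (Degree.𝔼 F) m) (length-Mats (suc m) (suc m)) ∣E∣ mixing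
      ∑-autocorrelation-bound (≤-trans bounded (≤-reflexive (cong (C *_) (^-distribˡ-+-* (q F) m (suc m * suc m)))))

-- Sums over tuples of regular elliptic elements.

module Tuples where

  open import Data.Bool using (Bool; true; false)
  open import Data.Fin as Fin using (Fin; zero; suc)
  open import Data.Nat as ℕ using (ℕ; zero; suc; _≤_; z≤n; _^_; ∣_-_∣)
  import Data.Nat.Properties as ℕₚ
  open import Data.Nat.Tactic.RingSolver using (solve-∀)
  open import Data.List using (List; []; _∷_; [_]; map; filterᵇ; length; foldr; allFin)
  open import Data.List.Properties using (map-tabulate)
  open import Data.Vec as Vec using (Vec; []; _∷_; lookup)
  open import Data.Vec.Functional using () renaming (_∷_ to _∷ᶠ_)
  open import Function using (_∘_; id)
  open import Relation.Binary.PropositionalEquality as ≡ using (_≡_; refl; sym; trans; cong; cong₂)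
  open import Relation.Nullary using (yes; no)
  open import Defs
  open Finite
  open Counting
  open Degrees
  open Asymptotics using (∣-∣-∑-≤)
  open SchwartzZippel
  open CharacteristicPolynomials
  open MatrixCounts
  open MatrixMixing

  open Enum using (list)

  -- Functions are compared pointwise, so sums over lists of functions are moved to enumerated vectors.
  Represents : {A B : Set} → List A → Enum B → (B → A) → (A → A → Set) → Set
  Represents {A} xs E h _~_ = ∀ (f : A → ℕ) → (∀ {a b} → a ~ b → f a ≡ f b) → ∑ xs f ≡ ∑ (list E) (f ∘ h)

  ∑-allFuns-suc : {A : Set} (k : ℕ) (xs : List A) (f : (Fin (suc k) → A) → ℕ) →
    ∑ (allFuns (suc k) xs) f ≡ ∑ xs (λ x → ∑ (allFuns k xs) (λ u → f (x ∷ᶠ u)))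
  ∑-allFuns-suc k xs f = trans (∑-concatMap (λ x → map (x ∷ᶠ_) (allFuns k xs)) xs f) (∑-cong xs (λ x → ∑-map (x ∷ᶠ_) (allFuns k xs) f))

  allFuns-represents : {A B : Set} {xs : List A} {E : Enum B} {h : B → A} {_~_ : A → A → Set} → (∀ {a} → a ~ a) →
    Represents xs E h _~_ → ∀ k → Represents (allFuns k xs) (Vecs E k) (λ v i → h (lookup v i)) (λ u w → ∀ i → u i ~ w i)
  allFuns-represents ~-refl rep zero    f f-cong = cong (ℕ._+ 0) (f-cong (λ ()))
  allFuns-represents {A} {B} {xs} {E} {h} {_~_} ~-refl rep (suc k) f f-cong = begin
    ∑ (allFuns (suc k) xs) f ≡⟨ ∑-allFuns-suc k xs f ⟩
    ∑ xs (λ x → ∑ (allFuns k xs) (λ u → f (x ∷ᶠ u)))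
      ≡⟨ ∑-cong xs (λ x → allFuns-represents {h = h} {_~_} ~-refl rep k (λ u → f (x ∷ᶠ u)) (λ e → f-cong (λ { zero → ~-refl ; (suc i) → e i }))) ⟩
    ∑ xs (λ x → ∑ (list (Vecs E k)) (λ v → f (x ∷ᶠ (λ i → h (lookup v i)))))
      ≡⟨ rep (λ x → ∑ (list (Vecs E k)) (λ v → f (x ∷ᶠ (λ i → h (lookup v i)))))
           (λ e → ∑-cong (list (Vecs E k)) (λ v → f-cong (λ { zero → e ; (suc i) → ~-refl }))) ⟩
    ∑ (list E) (λ b → ∑ (list (Vecs E k)) (λ v → f (h b ∷ᶠ (λ i → h (lookup v i)))))
      ≡⟨ ∑-cong (list E) (λ b → ∑-cong (list (Vecs E k)) (λ v → f-cong (λ { zero → ~-refl ; (suc i) → ~-refl }))) ⟩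
    ∑ (list E) (λ b → ∑ (list (Vecs E k)) (λ v → f (λ i → h (lookup (b ∷ v) i)))) ≡⟨ ∑-Vecs-suc E k _ ⟨
    ∑ (list (Vecs E (suc k))) (λ v → f (λ i → h (lookup v i))) ∎
    where open ≡.≡-Reasoning

  ∑-filterᵇ : {A : Set} (p : A → Bool) (xs : List A) (f : A → ℕ) → ∑ (filterᵇ p xs) f ≡ ∑ xs (λ x → 𝟙 (p x) ℕ.* f x)
  ∑-filterᵇ p []       f = refl
  ∑-filterᵇ p (x ∷ xs) f with p x
  ... | true  = cong₂ ℕ._+_ (sym (ℕₚ.+-identityʳ (f x))) (∑-filterᵇ p xs f)
  ... | false = ∑-filterᵇ p xs f

  module Tuple (F : FiniteField) where
    open FiniteField F hiding (unique; complete)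
    open FF F using (Mat; det; charpoly; _·_; I; inT; inT□; allMats; elliptic; prodTuple; tuples; irreducible; multiplicity; monics)
    open Degree F using (𝔼)
    open Lines F using (Mats)
    open Pencil F using (module Σ𝔽; charpoly-cong)
    open MatrixCount F using (cyclic; charCoeffs; inT-characteristic)
    open MatrixAlgebra F

    infix 4 _≗₂_
    _≗₂_ : ∀ {n} → Mat n → Mat n → Set
    A ≗₂ B = ∀ i j → A i j ≡ B i j

    det-cong₂ : ∀ n {A B : Mat n} → A ≗₂ B → det n A ≡ det n B
    det-cong₂ n = detWith-cong _+_ _*_ neg 0# 1# n

    inT-cong : ∀ n μ {A B : Mat n} → A ≗₂ B → inT n μ A ≡ inT n μ B
    inT-cong n μ e rewrite det-cong₂ n e | charpoly-cong n e = refl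

    inT□-cong : ∀ n μ {A B : Mat n} → A ≗₂ B → inT□ n μ A ≡ inT□ n μ B
    inT□-cong n μ e rewrite det-cong₂ n e | charpoly-cong n e = refl

    ·-cong : ∀ {n} {A A′ B B′ : Mat n} → A ≗₂ A′ → B ≗₂ B′ → (A · B) ≗₂ (A′ · B′)
    ·-cong {n} e f i j = Σ𝔽.∑-cong (allFin n) (λ l → cong₂ _*_ (e i l) (f l j))

    allMats-represented : ∀ n → Represents (allMats n) (Vecs (Vecs 𝔼 n) n) mat _≗₂_
    allMats-represented n = allFuns-represents (λ _ → refl) (allFuns-represents {_~_ = _≡_} refl (λ f _ → refl) n) n

    prodTuple-∷ : ∀ {n k} (x : Mat n) (u : Fin k → Mat n) → prodTuple (x ∷ᶠ u) ≡ x · prodTuple u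
    prodTuple-∷ {n} {k} x u = cong (x ·_) (trans (cong (foldr step I) (sym (map-tabulate id suc))) (shifted (allFin k)))
      where
      step : Fin (suc k) → Mat n → Mat n
      step i acc = (x ∷ᶠ u) i · acc
      shifted : ∀ is → foldr step I (map suc is) ≡ foldr (λ i acc → u i · acc) I is
      shifted []       = refl
      shifted (i ∷ is) = cong (u i ·_) (shifted is)

    module _ {m : ℕ} where

      n : ℕ
      n = suc m

      -- The sum of `g (t₁ ⋯ t_k)` over all `k`-tuples from `T`, nested so that the last factor is
      -- summed innermost.
      chain : ℕ → (Vec (Vec Carrier n) n → ℕ) → ℕ
      chain zero    g = g 𝕀
      chain (suc k) g = ∑ Mₙ (λ t → T t ℕ.* chain k (λ P → g (t ⊙ P)))

      chain-cong : ∀ k {g h} → (∀ P → g P ≡ h P) → chain k g ≡ chain k h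
      chain-cong zero    e = e 𝕀
      chain-cong (suc k) e = ∑-cong Mₙ (λ t → cong (T t ℕ.*_) (chain-cong k (λ P → e (t ⊙ P))))

      ∑-elliptic : ∀ (f : Mat n → ℕ) → (∀ {A B} → A ≗₂ B → f A ≡ f B) → ∑ (elliptic n) f ≡ ∑ Mₙ (λ t → T t ℕ.* f (mat t))
      ∑-elliptic f f-cong = trans (∑-filterᵇ (inT n [ n ]) (allMats n) f)
        (trans (allMats-represented n (λ A → 𝟙 (inT n [ n ] A) ℕ.* f A) (λ e → cong₂ (λ b y → 𝟙 b ℕ.* y) (inT-cong n [ n ] e) (f-cong e)))
          (∑-cong Mₙ (λ t → cong (ℕ._* f (mat t)) (inT-characteristic [ n ] t))))

      ∑-tuples : ∀ k (G : Mat n → ℕ) → (∀ {A B} → A ≗₂ B → G A ≡ G B) → ∑ (tuples n k) (λ u → G (prodTuple u)) ≡ chain k (G ∘ mat)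
      ∑-tuples zero    G G-cong = trans (ℕₚ.+-identityʳ _) (G-cong (λ i j → sym (mat-tab I i j)))
      ∑-tuples (suc k) G G-cong = begin
        ∑ (tuples n (suc k)) (λ u → G (prodTuple u)) ≡⟨ ∑-allFuns-suc k (elliptic n) (λ u → G (prodTuple u)) ⟩
        ∑ (elliptic n) (λ x → ∑ (tuples n k) (λ u → G (prodTuple (x ∷ᶠ u))))
          ≡⟨ ∑-cong (elliptic n) (λ x → trans (∑-cong (tuples n k) (λ u → cong G (prodTuple-∷ x u)))
               (∑-tuples k (λ P → G (x · P)) (λ e → G-cong (·-cong {A = x} (λ i j → refl) e)))) ⟩
        ∑ (elliptic n) (λ x → chain k (λ P → G (x · mat P)))
          ≡⟨ ∑-elliptic _ (λ e → chain-cong k (λ P → G-cong (·-cong e (λ i j → refl)))) ⟩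
        ∑ Mₙ (λ t → T t ℕ.* chain k (λ P → G (mat t · mat P)))
          ≡⟨ ∑-cong Mₙ (λ t → cong (T t ℕ.*_) (chain-cong k (λ P → G-cong (λ i j → sym (mat-⊙ t P i j))))) ⟩
        chain (suc k) (G ∘ mat) ∎
        where open ≡.≡-Reasoning

      chain-const : ∀ k c → chain k (λ _ → c) ≡ totalT {m} ^ k ℕ.* c
      chain-const zero    c = sym (ℕₚ.+-identityʳ c)
      chain-const (suc k) c = trans (∑-cong Mₙ (λ t → cong (T t ℕ.*_) (chain-const k c))) (trans (∑-*ʳ Mₙ _ T) (sym (ℕₚ.*-assoc (totalT {m}) (totalT {m} ^ k) c)))

      length-tuples : ∀ k → length (tuples n k) ≡ totalT {m} ^ k
      length-tuples k = trans (sym (∑-1 (tuples n k))) (trans (∑-tuples k (λ _ → 1) (λ _ → refl)) (trans (chain-const k 1) (ℕₚ.*-identityʳ _)))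

      -- Linearity of `chain k`. Weighted sums are used so that it covers moving a summation inside
      -- and, with a single summand, a scalar factor.
      ∑-chain : {A : Set} (xs : List A) (c : A → ℕ) (g : A → Vec (Vec Carrier n) n → ℕ) → ∀ k →
        ∑ xs (λ x → c x ℕ.* chain k (g x)) ≡ chain k (λ P → ∑ xs (λ x → c x ℕ.* g x P))
      ∑-chain xs c g zero    = refl
      ∑-chain xs c g (suc k) = begin
        ∑ xs (λ x → c x ℕ.* ∑ Mₙ (λ t → T t ℕ.* chain k (λ P → g x (t ⊙ P))))
          ≡⟨ ∑-cong xs (λ x → trans (sym (∑-*ˡ Mₙ (c x) _)) (∑-cong Mₙ (λ t → exchange (c x) (T t) _))) ⟩
        ∑ xs (λ x → ∑ Mₙ (λ t → T t ℕ.* (c x ℕ.* chain k (λ P → g x (t ⊙ P))))) ≡⟨ ∑-swap xs Mₙ _ ⟩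
        ∑ Mₙ (λ t → ∑ xs (λ x → T t ℕ.* (c x ℕ.* chain k (λ P → g x (t ⊙ P)))))
          ≡⟨ ∑-cong Mₙ (λ t → trans (∑-*ˡ xs (T t) _) (cong (T t ℕ.*_) (∑-chain xs c (λ x P → g x (t ⊙ P)) k))) ⟩
        chain (suc k) (λ P → ∑ xs (λ x → c x ℕ.* g x P)) ∎
        where
        open ≡.≡-Reasoning
        exchange : ∀ a b y → a ℕ.* (b ℕ.* y) ≡ b ℕ.* (a ℕ.* y)
        exchange = solve-∀

      chain-scale : ∀ k c g → chain k (λ P → c ℕ.* g P) ≡ c ℕ.* chain k g
      chain-scale k c g = trans (chain-cong k (λ P → sym (ℕₚ.+-identityʳ (c ℕ.* g P)))) (trans (sym (∑-chain [ c ] id (λ _ → g) k)) (ℕₚ.+-identityʳ _))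

      -- Isolates the first two factors, to which mixing applies, and puts the sum over the
      -- remaining product `P` outside.
      chain-pair : ∀ k g → chain (suc (suc k)) g ≡ chain k (λ P → ∑ Mₙ (λ t → ∑ Mₙ (λ s → T t ℕ.* (T s ℕ.* g (t ⊙ (s ⊙ P))))))
      chain-pair k g = begin
        ∑ Mₙ (λ t → T t ℕ.* ∑ Mₙ (λ s → T s ℕ.* chain k (λ P → g (t ⊙ (s ⊙ P)))))
          ≡⟨ ∑-cong Mₙ (λ t → cong (T t ℕ.*_) (∑-chain Mₙ T (λ s P → g (t ⊙ (s ⊙ P))) k)) ⟩
        ∑ Mₙ (λ t → T t ℕ.* chain k (λ P → ∑ Mₙ (λ s → T s ℕ.* g (t ⊙ (s ⊙ P))))) ≡⟨ ∑-chain Mₙ T _ k ⟩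
        chain k (λ P → ∑ Mₙ (λ t → T t ℕ.* ∑ Mₙ (λ s → T s ℕ.* g (t ⊙ (s ⊙ P)))))
          ≡⟨ chain-cong k (λ P → ∑-cong Mₙ (λ t → sym (∑-*ˡ Mₙ (T t) _))) ⟩
        chain k (λ P → ∑ Mₙ (λ t → ∑ Mₙ (λ s → T t ℕ.* (T s ℕ.* g (t ⊙ (s ⊙ P)))))) ∎
        where open ≡.≡-Reasoning

      -- A bound uniform over invertible `P` survives averaging: products of elements of `T` stay
      -- invertible, and terms with `T t = 0` vanish.
      chain-deviation : ∀ K c e k (f : Vec (Vec Carrier n) n → ℕ) → (∀ P → Invertible P → K ℕ.* ∣ f P - c ∣ ≤ e) →
        K ℕ.* ∣ chain k f - totalT {m} ^ k ℕ.* c ∣ ≤ totalT {m} ^ k ℕ.* e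
      chain-deviation K c e zero    f bounded = ℕₚ.≤-trans (ℕₚ.≤-reflexive (cong (λ y → K ℕ.* ∣ f 𝕀 - y ∣) (ℕₚ.+-identityʳ c)))
        (ℕₚ.≤-trans (bounded 𝕀 Invertible-𝕀) (ℕₚ.≤-reflexive (sym (ℕₚ.+-identityʳ e))))
      chain-deviation K c e (suc k) f bounded = begin
        K ℕ.* ∣ ∑ Mₙ (λ t → T t ℕ.* chain k (λ P → f (t ⊙ P))) - totalT ℕ.* totalT ^ k ℕ.* c ∣
          ≡⟨ cong (λ y → K ℕ.* ∣ ∑ Mₙ (λ t → T t ℕ.* chain k (λ P → f (t ⊙ P))) - y ∣) (trans (ℕₚ.*-assoc (totalT {m}) (totalT {m} ^ k) c) (sym (∑-*ʳ Mₙ (totalT {m} ^ k ℕ.* c) T))) ⟩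
        K ℕ.* ∣ ∑ Mₙ (λ t → T t ℕ.* chain k (λ P → f (t ⊙ P))) - ∑ Mₙ (λ t → T t ℕ.* (totalT {m} ^ k ℕ.* c)) ∣
          ≤⟨ ℕₚ.*-monoʳ-≤ K (∣-∣-∑-≤ Mₙ _ _) ⟩
        K ℕ.* ∑ Mₙ (λ t → ∣ T t ℕ.* chain k (λ P → f (t ⊙ P)) - T t ℕ.* (totalT {m} ^ k ℕ.* c) ∣) ≡⟨ ∑-*ˡ Mₙ K _ ⟨
        ∑ Mₙ (λ t → K ℕ.* ∣ T t ℕ.* chain k (λ P → f (t ⊙ P)) - T t ℕ.* (totalT {m} ^ k ℕ.* c) ∣) ≤⟨ ∑-mono Mₙ each ⟩
        ∑ Mₙ (λ t → T t ℕ.* (totalT {m} ^ k ℕ.* e)) ≡⟨ trans (∑-*ʳ Mₙ (totalT {m} ^ k ℕ.* e) T) (sym (ℕₚ.*-assoc (totalT {m}) (totalT {m} ^ k) e)) ⟩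
        totalT {m} ℕ.* totalT {m} ^ k ℕ.* e ∎
        where
        open ℕₚ.≤-Reasoning
        exchange : ∀ a b y → a ℕ.* (b ℕ.* y) ≡ b ℕ.* (a ℕ.* y)
        exchange = solve-∀
        each : ∀ t → K ℕ.* ∣ T t ℕ.* chain k (λ P → f (t ⊙ P)) - T t ℕ.* (totalT {m} ^ k ℕ.* c) ∣ ≤ T t ℕ.* (totalT {m} ^ k ℕ.* e)
        each t = ℕₚ.≤-trans (ℕₚ.≤-reflexive (trans (cong (K ℕ.*_) (sym (ℕₚ.*-distribˡ-∣-∣ (T t) (chain k (λ P → f (t ⊙ P))) (totalT {m} ^ k ℕ.* c)))) (exchange K (T t) _))) inner
          where
          inner : T t ℕ.* (K ℕ.* ∣ chain k (λ P → f (t ⊙ P)) - totalT {m} ^ k ℕ.* c ∣) ≤ T t ℕ.* (totalT {m} ^ k ℕ.* e)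
          inner with T t ℕ.≟ 0
          ... | yes z = ℕₚ.≤-trans (ℕₚ.≤-reflexive (cong (ℕ._* (K ℕ.* ∣ chain k (λ P → f (t ⊙ P)) - totalT {m} ^ k ℕ.* c ∣)) z)) z≤n
          ... | no ne = ℕₚ.*-monoʳ-≤ (T t) (chain-deviation K c e k (λ P → f (t ⊙ P)) (λ P P⁻¹ → bounded (t ⊙ P) (Invertible-⊙ (T≢0⇒Invertible t ne) P⁻¹)))

-- From estimates in natural numbers to limits of rationals.

module Limits where

  open import Data.Bool using (Bool; true)
  open import Data.Integer as ℤ using (+_)
  import Data.Integer.Properties as ℤₚ
  import Data.Integer.Tactic.RingSolver as ℤSolver
  open import Data.Nat hiding (_≟_)
  open import Data.Nat.Properties hiding (_≟_)
  open import Data.Nat.Tactic.RingSolver using (solve-∀)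
  open import Data.Nat.ListAction using (sum)
  open import Data.List using (length)
  open import Data.List.Relation.Unary.All using (All)
  open import Data.Product using (∃; _,_)
  open import Data.Rational as ℚ using (ℚ; mkℚ; toℚᵘ; fromℚᵘ)
  import Data.Rational.Properties as ℚₚ
  open import Data.Rational.Unnormalised as ℚᵘ using (mkℚᵘ; *<*)
  import Data.Rational.Unnormalised.Properties as ℚᵘₚ
  open import Data.Vec using (Vec)
  open import Relation.Binary.PropositionalEquality using (_≡_; _≢_; refl; sym; trans; cong; cong₂; subst)
  open import Relation.Nullary using (¬_; yes; no; contradiction)
  open import Defs
  open Finite
  open Counting
  open Polynomials
  open Degrees
  open PolynomialCounts
  open Asymptotics
  open PolynomialAsymptotics
  open SchwartzZippel
  open MatrixCounts
  open MatrixMixing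
  open MatrixAsymptotics
  open Tuples

  -- Clearing denominators, `∣a / b - 1 / z∣` is `∣z a - b∣ / (b z)`, hence below `1 / (suc d * z)`.
  -- That is at most `ε`, whose denominator is `suc d` and whose numerator is at least 1.
  frac-close : ∀ a b z c d {ε} → toℚᵘ ε ≡ mkℚᵘ (+ suc c) d → 1 ≤ b → 1 ≤ z → suc d * ∣ z * a - b ∣ < b → ℚ.∣ frac a b ℚ.- frac 1 z ∣ ℚ.< ε
  frac-close a (suc b) (suc z) c d ε≡ 1≤b 1≤z close = ℚₚ.toℚᵘ-cancel-< (ℚᵘₚ.<-respˡ-≃ (ℚᵘₚ.≃-sym unnormalised) (subst (ℚᵘ.∣ P ℚᵘ.- R ∣ ℚᵘ.<_) (sym ε≡) (*<* (toℤ (ℤ.+<+ main)))))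
    where
    P = mkℚᵘ (+ a) b
    R = mkℚᵘ (+ 1) z
    unnormalised : toℚᵘ ℚ.∣ frac a (suc b) ℚ.- frac 1 (suc z) ∣ ℚᵘ.≃ ℚᵘ.∣ P ℚᵘ.- R ∣
    unnormalised = ℚᵘₚ.≃-trans (ℚₚ.toℚᵘ-homo-∣-∣ (fromℚᵘ P ℚ.- fromℚᵘ R)) (ℚᵘₚ.∣-∣-cong (ℚᵘₚ.≃-trans (ℚₚ.toℚᵘ-homo-+ (fromℚᵘ P) (ℚ.- fromℚᵘ R))
      (ℚᵘₚ.+-cong (ℚₚ.toℚᵘ-fromℚᵘ P) (ℚᵘₚ.≃-trans (ℚₚ.toℚᵘ-homo‿- (fromℚᵘ R)) (ℚᵘₚ.-‿cong (ℚₚ.toℚᵘ-fromℚᵘ R))))))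
    x = ∣ suc z * a - suc b ∣
    numerator : ℤ.∣ (+ a) ℤ.* (+ suc z) ℤ.+ (ℤ.- (+ 1)) ℤ.* (+ suc b) ∣ ≡ x
    numerator = trans (cong ℤ.∣_∣ (trans (rearrange (+ a) (+ suc z) (+ suc b)) (cong (ℤ._- (+ suc b)) (sym (ℤₚ.pos-* (suc z) a))))) (∣+m-+n∣ (suc z * a) (suc b))
      where
      rearrange : ∀ i j k → i ℤ.* j ℤ.+ (ℤ.- (+ 1)) ℤ.* k ≡ j ℤ.* i ℤ.- k
      rearrange = ℤSolver.solve-∀
    main : x * suc d < suc c * (suc b * suc z)
    main = ≤-trans (s≤s (≤-reflexive (*-comm x (suc d)))) (≤-trans close (≤-trans (m≤m*n (suc b) (suc z)) (m≤n*m (suc b * suc z) (suc c))))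
    toℤ : + (x * suc d) ℤ.< + (suc c * (suc b * suc z)) →
      (+ ℤ.∣ (+ a) ℤ.* (+ suc z) ℤ.+ (ℤ.- (+ 1)) ℤ.* (+ suc b) ∣) ℤ.* (+ suc d) ℤ.< (+ suc c) ℤ.* (+ (suc b * suc z))
    toℤ lt = subst (ℤ._< (+ suc c) ℤ.* (+ (suc b * suc z))) (trans (ℤₚ.pos-* x (suc d)) (cong (λ y → + y ℤ.* (+ suc d)) (sym numerator)))
      (subst (+ (x * suc d) ℤ.<_) (ℤₚ.pos-* (suc c) (suc b * suc z)) lt)

  square-cancel-≤ : ∀ x y → x * x ≤ y * y → x ≤ y
  square-cancel-≤ x y le with x ≤? y
  ... | yes x≤y = x≤y
  ... | no x≰y  = contradiction le (<⇒≱ (*-mono-< (≰⇒> x≰y) (≰⇒> x≰y)))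

  scaled-bound : ∀ {Q C K x M} → 1 ≤ Q → Q * x ≤ C * M → C * K ≤ Q → K * x ≤ M
  scaled-bound {Q} {C} {K} {x} {M} 1≤Q le CK≤Q = *-cancelˡ-≤ Q {{>-nonZero 1≤Q}} (begin
    Q * (K * x) ≡⟨ exchange Q K x ⟩
    K * (Q * x) ≤⟨ *-monoʳ-≤ K le ⟩
    K * (C * M) ≡⟨ regroup K C M ⟩
    C * K * M   ≤⟨ *-monoˡ-≤ M CK≤Q ⟩
    Q * M       ∎)
    where
    open ≤-Reasoning
    exchange : ∀ a b c → a * (b * c) ≡ b * (a * c)
    exchange = solve-∀
    regroup : ∀ a b c → a * (b * c) ≡ b * a * c
    regroup = solve-∀

  -- The deviation is known only through its square, so relative precision `1 / K` requires `q` of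
  -- order `K * K`.
  scaled-square-bound : ∀ {Q C K e M} → 1 ≤ Q → Q * (e * e) ≤ C * (M * (M * (M * M))) → C * (K * K) ≤ Q → K * e ≤ M * M
  scaled-square-bound {Q} {C} {K} {e} {M} 1≤Q le CKK≤Q = square-cancel-≤ (K * e) (M * M) (begin
    K * e * (K * e)       ≡⟨ regroup K e ⟩
    K * K * (e * e)       ≤⟨ scaled-bound {Q} {C} {K * K} 1≤Q le CKK≤Q ⟩
    M * (M * (M * M))     ≡⟨ regroup′ M ⟩
    M * M * (M * M)       ∎)
    where
    open ≤-Reasoning
    regroup : ∀ a b → a * b * (a * b) ≡ a * a * (b * b)
    regroup = solve-∀
    regroup′ : ∀ a → a * (a * (a * a)) ≡ a * a * (a * a)
    regroup′ = solve-∀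

  -- K bounds the relative errors of the three asymptotic equalities n a ≈ p τ x, z x ≈ M and n τ ≈ M.
  assemble : ∀ n z D K a p τ x M → 1 ≤ n → (1 ≤ τ → 1 ≤ p) → 1 ≤ M → K ≡ (4 * n * z + 4) * D + 2 →
    K * ∣ n * a - p * (τ * x) ∣ ≤ p * (M * M) → K * ∣ z * x - M ∣ ≤ M → K * ∣ n * τ - M ∣ ≤ M →
    D * ∣ z * a - τ * (τ * p) ∣ < τ * (τ * p)
  assemble n z D K a p τ x M 1≤n 1≤p 1≤M K≡ hits measure total = ≰⇒> tooLarge
    where
    open ≤-Reasoning
    δ = ∣ n * τ - M ∣
    δ′ = ∣ z * x - M ∣
    -- The summand 2 in `K` is used here: the error in `n τ ≈ M` is at most half of `M`.
    M≤2nτ : M ≤ 2 * (n * τ)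
    M≤2nτ = +-cancelʳ-≤ M M (2 * (n * τ)) (begin
      M + M                 ≡⟨ cong (λ w → M + w) (sym (+-identityʳ M)) ⟩
      2 * M                 ≤⟨ *-monoʳ-≤ 2 (≤-trans (m≤∣m-n∣+n M (n * τ)) (≤-reflexive (cong (_+ n * τ) (∣-∣-comm M (n * τ))))) ⟩
      2 * (δ + n * τ)       ≡⟨ *-distribˡ-+ 2 δ (n * τ) ⟩
      2 * δ + 2 * (n * τ)   ≤⟨ +-monoˡ-≤ (2 * (n * τ)) (≤-trans (*-monoˡ-≤ δ (≤-trans (m≤n+m 2 ((4 * n * z + 4) * D)) (≤-reflexive (sym K≡)))) total) ⟩
      M + 2 * (n * τ)       ≡⟨ +-comm M _ ⟩
      2 * (n * τ) + M       ∎)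
    1≤τ : 1 ≤ τ
    1≤τ = n≢0⇒n>0 (λ τ≡0 → 1+n≰n (≤-trans 1≤M (≤-trans M≤2nτ (≤-reflexive (trans (cong (λ t → 2 * (n * t)) τ≡0) (cong (2 *_) (*-zeroʳ n)))))))
    target = τ * (τ * p)
    1≤target : 1 ≤ target
    1≤target = *-mono-≤ 1≤τ (*-mono-≤ 1≤τ (1≤p 1≤τ))
    y = ∣ z * a - target ∣
    measure-total : K * ∣ z * x - n * τ ∣ ≤ 2 * M
    measure-total = begin
      K * ∣ z * x - n * τ ∣ ≤⟨ *-monoʳ-≤ K (∣-∣-triangle (z * x) M (n * τ)) ⟩
      K * (δ′ + ∣ M - n * τ ∣) ≡⟨ trans (*-distribˡ-+ K δ′ _) (cong (λ w → K * δ′ + K * w) (∣-∣-comm M (n * τ))) ⟩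
      K * δ′ + K * δ        ≤⟨ +-mono-≤ measure total ⟩
      M + M                 ≡⟨ cong (λ w → M + w) (sym (+-identityʳ M)) ⟩
      2 * M                 ∎
    scaled : K * ∣ n * (z * a) - n * target ∣ ≤ z * (p * (M * M)) + p * τ * (2 * M)
    scaled = begin
      K * ∣ n * (z * a) - n * target ∣
        ≤⟨ *-monoʳ-≤ K (∣-∣-triangle (n * (z * a)) (z * (p * (τ * x))) (n * target)) ⟩
      K * (∣ n * (z * a) - z * (p * (τ * x)) ∣ + ∣ z * (p * (τ * x)) - n * target ∣)
        ≡⟨ cong (K *_) (cong₂ _+_
             (trans (cong (λ w → ∣ w - z * (p * (τ * x)) ∣) (exchange n z a)) (sym (*-distribˡ-∣-∣ z (n * a) (p * (τ * x)))))
             (trans (cong₂ ∣_-_∣ (factor z p τ x) (factor′ n τ p)) (sym (*-distribˡ-∣-∣ (p * τ) (z * x) (n * τ))))) ⟩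
      K * (z * ∣ n * a - p * (τ * x) ∣ + p * τ * ∣ z * x - n * τ ∣) ≡⟨ distribute K z ∣ n * a - p * (τ * x) ∣ (p * τ) ∣ z * x - n * τ ∣ ⟩
      z * (K * ∣ n * a - p * (τ * x) ∣) + p * τ * (K * ∣ z * x - n * τ ∣) ≤⟨ +-mono-≤ (*-monoʳ-≤ z hits) (*-monoʳ-≤ (p * τ) measure-total) ⟩
      z * (p * (M * M)) + p * τ * (2 * M) ∎
      where
      exchange : ∀ a b c → a * (b * c) ≡ b * (a * c)
      exchange = solve-∀
      factor : ∀ z p t x → z * (p * (t * x)) ≡ p * t * (z * x)
      factor = solve-∀
      factor′ : ∀ n t p → n * (t * (t * p)) ≡ p * t * (n * t)
      factor′ = solve-∀
      distribute : ∀ k z u w v → k * (z * u + w * v) ≡ z * (k * u) + w * (k * v)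
      distribute = solve-∀
    -- Origin of `4 * n * z + 4`: after `M ≤ 2 n τ` the term `z p M²` becomes `4 n² z p τ²` and
    -- `2 p τ M` becomes `4 n p τ²`; a factor `n` is then cancelled.
    relative : K * y ≤ (4 * n * z + 4) * target
    relative = *-cancelˡ-≤ n {{>-nonZero 1≤n}} (begin
      n * (K * y)                         ≡⟨ exchange n K y ⟩
      K * (n * y)                         ≡⟨ cong (K *_) (*-distribˡ-∣-∣ n (z * a) target) ⟩
      K * ∣ n * (z * a) - n * target ∣    ≤⟨ scaled ⟩
      z * (p * (M * M)) + p * τ * (2 * M) ≤⟨ +-mono-≤ (*-monoʳ-≤ z (*-monoʳ-≤ p (*-mono-≤ M≤2nτ M≤2nτ))) (*-monoʳ-≤ (p * τ) (*-monoʳ-≤ 2 M≤2nτ)) ⟩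
      z * (p * (2 * (n * τ) * (2 * (n * τ)))) + p * τ * (2 * (2 * (n * τ))) ≡⟨ collect z p n τ ⟩
      n * ((4 * n * z + 4) * target)      ∎)
      where
      exchange : ∀ a b c → a * (b * c) ≡ b * (a * c)
      exchange = solve-∀
      collect : ∀ z p n t → z * (p * (2 * (n * t) * (2 * (n * t)))) + p * t * (2 * (2 * (n * t))) ≡ n * ((4 * n * z + 4) * (t * (t * p)))
      collect = solve-∀
    -- Otherwise `(B D + 2) y ≤ B * target ≤ B D y` forces `y = 0`, and then `target` would be 0.
    tooLarge : ¬ target ≤ D * y
    tooLarge le = 1+n≰n (≤-trans 1≤target (≤-trans le (≤-reflexive (trans (cong (D *_) y≡0) (*-zeroʳ D)))))
      where
      B = 4 * n * z + 4
      y≡0 : y ≡ 0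
      y≡0 = n≤0⇒n≡0 (*-cancelˡ-≤ 2 (+-cancelˡ-≤ (B * (D * y)) (2 * y) 0 (begin
        B * (D * y) + 2 * y   ≡⟨ expand B D y ⟨
        (B * D + 2) * y       ≡⟨ cong (_* y) (sym K≡) ⟩
        K * y                 ≤⟨ relative ⟩
        B * target            ≤⟨ *-monoʳ-≤ B le ⟩
        B * (D * y)           ≡⟨ +-identityʳ _ ⟨
        B * (D * y) + 0       ∎)))
        where
        expand : ∀ b d y → (b * d + 2) * y ≡ b * (d * y) + 2 * y
        expand = solve-∀

  cycleType~ : ∀ m μ → All (1 ≤_) μ → sum μ ≡ suc m →
    (λ F → z μ * ∑ (Lines.Mats F (suc m) (suc m)) (λ t → 𝟙 (FF.inT F (suc m) μ (mat t)))) ~[ suc m * suc m ] (λ F → q F ^ (suc m * suc m))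
  cycleType~ m μ pos sum≡ = ~-trans
    (~-reflexive (λ F → cong (z μ *_) (∑-cong (Lines.Mats F (suc m) (suc m)) (MatrixCount.inT-characteristic F μ))))
    (charCoeffsCount~ m (z μ) (λ F f → Count.unit F (Poly.coeff F (Degree.mon F f) 0) * 𝟙 (Count.hasType F (suc m) μ (Degree.mon F f)))
      (λ F f → *-mono-≤ (Count.unit≤1 F _) (𝟙≤1 _)) (unitTypes~ m μ pos sum≡))

  squareFreeCycleType~ : ∀ m μ → All (1 ≤_) μ → sum μ ≡ suc m →
    (λ F → z μ * ∑ (Lines.Mats F (suc m) (suc m)) (λ t → 𝟙 (FF.inT□ F (suc m) μ (mat t)))) ~[ suc m * suc m ] (λ F → q F ^ (suc m * suc m))
  squareFreeCycleType~ m μ pos sum≡ = ~-trans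
    (~-reflexive (λ F → cong (z μ *_) (∑-cong (Lines.Mats F (suc m) (suc m)) (MatrixCount.inT□-characteristic F μ))))
    (charCoeffsCount~ m (z μ) (λ F f → Count.unit F (Poly.coeff F (Degree.mon F f) 0) * 𝟙 (Count.hasType F (suc m) μ (Degree.mon F f))
        * 𝟙 (Count.squareFree F (suc m) (Degree.mon F f)))
      (λ F f → *-mono-≤ (*-mono-≤ (Count.unit≤1 F _) (𝟙≤1 _)) (𝟙≤1 _)) (unitSquareFreeTypes~ m μ pos sum≡))

  inT⇒det≢0 : ∀ F n μ A → FF.inT F n μ A ≡ true → FF.det F n A ≢ FiniteField.0# F
  inT⇒det≢0 F n μ A e det≡0 with FiniteField._≟_ F (FF.det F n A) (FiniteField.0# F)
  ... | no ne = ne det≡0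
  ... | yes _ with () ← e

  inT□⇒inT : ∀ F n μ A → FF.inT□ F n μ A ≡ true → FF.inT F n μ A ≡ true
  inT□⇒inT F n μ A e with FF.inT F n μ A
  ... | true = refl

  module _ (m k : ℕ) (ζ : ℕ) (1≤ζ : 1 ≤ ζ)
           (χ : ∀ F → FF.Mat F (suc m) → Bool)
           (χ-cong : ∀ F {A B : FF.Mat F (suc m)} → (∀ i j → A i j ≡ B i j) → χ F A ≡ χ F B)
           (χ-det : ∀ F A → χ F A ≡ true → FF.det F (suc m) A ≢ FiniteField.0# F)
           (measure~ : (λ F → ζ * ∑ (Lines.Mats F (suc m) (suc m)) (λ t → 𝟙 (χ F (mat t)))) ~[ suc m * suc m ] (λ F → q F ^ (suc m * suc m))) where

    private
      n = suc m
      N = n * n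

    tupleCount : Family
    tupleCount F = countᵇ (λ u → χ F (FF.prodTuple F u)) (FF.tuples F n (suc (suc k)))

    tupleTotal : Family
    tupleTotal F = length (FF.tuples F n (suc (suc k)))

    measureOf totalOf : Family
    measureOf F = ∑ (Lines.Mats F n n) (λ t → 𝟙 (χ F (mat t)))
    totalOf F = MatrixAlgebra.totalT F {m}

    -- The tuple count is a `chain` whose last `k` factors form the matrix `H` of the mixing
    -- estimate; as that estimate is uniform in `H`, averaging over these factors preserves it.
    tupleCount-deviation : ∀ K F C → q F * autocorrelationBound m F ≤ C * q F ^ (m + N) → C * (K * K) ≤ q F →
      K * ∣ n * tupleCount F - totalOf F ^ k * (totalOf F * measureOf F) ∣ ≤ totalOf F ^ k * (q F ^ N * q F ^ N)
    tupleCount-deviation K F C bounded large = subst (λ y → K * ∣ y - totalOf F ^ k * (totalOf F * measureOf F) ∣ ≤ totalOf F ^ k * (q F ^ N * q F ^ N)) asChain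
      (chain-deviation K (totalOf F * measureOf F) (q F ^ N * q F ^ N) k (λ P → n * hitsOf P) each)
      where
      open MatrixAlgebra F
      open Tuple F using (chain; chain-deviation; chain-scale; chain-pair; ∑-tuples)
      hitsOf : Vec (Vec (FiniteField.Carrier F) n) n → ℕ
      hitsOf P = ∑ Mₙ (λ t → ∑ Mₙ (λ s → T t * (T s * 𝟙 (χ F (mat (t ⊙ (s ⊙ P)))))))
      asChain : chain k (λ P → n * hitsOf P) ≡ n * tupleCount F
      asChain = trans (chain-scale k n hitsOf) (cong (n *_) (sym (trans (countᵇ≡∑ _ (FF.tuples F n (suc (suc k))))
        (trans (∑-tuples (suc (suc k)) (λ A → 𝟙 (χ F A)) (λ e → cong 𝟙 (χ-cong F e))) (chain-pair k (λ P → 𝟙 (χ F (mat P))))))))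
      each : ∀ P → Invertible P → K * ∣ n * hitsOf P - totalOf F * measureOf F ∣ ≤ q F ^ N * q F ^ N
      each P P⁻¹ = scaled-square-bound {q F} {C} {K} {M = q F ^ N} (q-positive F)
        (deviation-bound m F (λ t → χ F (mat t)) (λ t → χ-det F (mat t)) P P⁻¹ C bounded) large

    limit : LimitAsQ→∞ (λ F → frac (tupleCount F) (tupleTotal F)) (frac 1 ζ)
    -- For `ε ≤ 0` the hypothesis is contradictory; a positive `ε` is at least `1 / suc d`.
    limit (mkℚ (+ zero) d _)      0<ε = contradiction (ℚₚ.drop-*<* 0<ε) (λ { (ℤ.+<+ ()) })
    limit (mkℚ ℤ.-[1+ c ] d _)    0<ε = contradiction (ℚₚ.drop-*<* 0<ε) (λ ())
    limit ε@(mkℚ (+ suc c) d _)   0<ε = threshold (autocorrelationBound-O m) (totalT~ m) measure~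
      where
      -- The precision that `assemble` demands for a relative error below `1 / suc d`.
      K = (4 * n * ζ + 4) * suc d + 2
      threshold : autocorrelationBound m =O (m + N) → (λ F → n * totalOf F) ~[ N ] (λ F → q F ^ N) → (λ F → ζ * measureOf F) ~[ N ] (λ F → q F ^ N) →
        ∃ λ Q → ∀ F → Q ≤ q F → ℚ.∣ frac (tupleCount F) (tupleTotal F) ℚ.- frac 1 ζ ∣ ℚ.< ε
      -- Three thresholds are added: quadratic in `K` for the mixing error, linear for the number of
      -- elliptic elements and for the size of the target set.
      threshold (bound C₁ b₁) (near (bound C₂ b₂)) (near (bound C₃ b₃)) = C₁ * (K * K) + (C₂ * K + C₃ * K) , close
        where
        close : ∀ F → C₁ * (K * K) + (C₂ * K + C₃ * K) ≤ q F → ℚ.∣ frac (tupleCount F) (tupleTotal F) ℚ.- frac 1 ζ ∣ ℚ.< ε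
        close F large = frac-close (tupleCount F) (tupleTotal F) ζ c d refl
          (≤-trans (s≤s z≤n) main) 1≤ζ main
          where
          p = totalOf F ^ k
          core : suc d * ∣ ζ * tupleCount F - totalOf F * (totalOf F * p) ∣ < totalOf F * (totalOf F * p)
          core = assemble n ζ (suc d) K (tupleCount F) p (totalOf F) (measureOf F) (q F ^ N) (s≤s z≤n) (λ 1≤τ → m^n>0 (totalOf F) {{>-nonZero 1≤τ}} k) (q^-positive F N) refl
            (tupleCount-deviation K F C₁ (b₁ F) (≤-trans (m≤m+n _ _) large))
            (scaled-bound {q F} {C₃} {K} (q-positive F) (b₃ F) (≤-trans (m≤n+m _ (C₂ * K)) (≤-trans (m≤n+m _ (C₁ * (K * K))) large)))
            (scaled-bound {q F} {C₂} {K} (q-positive F) (b₂ F) (≤-trans (m≤m+n _ (C₃ * K)) (≤-trans (m≤n+m _ (C₁ * (K * K))) large)))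
          main : suc d * ∣ ζ * tupleCount F - tupleTotal F ∣ < tupleTotal F
          main = subst (λ t → suc d * ∣ ζ * tupleCount F - t ∣ < t) (sym (Tuple.length-tuples F (suc (suc k)))) core

-- Elements of a given cycle type, and the regular semisimple ones among them, as target sets.

open import Defs
open import Data.Nat using (ℕ; suc; _≤_; s≤s)
open import Data.List using (List)
open import Data.Product using (_×_; _,_)
open PolynomialAsymptotics using (z-positive)
open Limits
open Tuples using (module Tuple)

theorem1p7 : (n k : ℕ) → 1 ≤ n → 2 ≤ k → (μ : List ℕ) → IsPartition n μ →
    LimitAsQ→∞ (λ F → FF.p F k n μ) (frac 1 (z μ)) × LimitAsQ→∞ (λ F → FF.p□ F k n μ) (frac 1 (z μ))
theorem1p7 (suc m) (suc (suc k)) (s≤s _) (s≤s (s≤s _)) μ (sum≡ , positive , _) =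
  limit m k (z μ) (z-positive μ positive) (λ F → FF.inT F (suc m) μ) (λ F → Tuple.inT-cong F (suc m) μ)
    (λ F → inT⇒det≢0 F (suc m) μ) (cycleType~ m μ positive sum≡) ,
  limit m k (z μ) (z-positive μ positive) (λ F → FF.inT□ F (suc m) μ) (λ F → Tuple.inT□-cong F (suc m) μ)
    (λ F A e → inT⇒det≢0 F (suc m) μ A (inT□⇒inT F (suc m) μ A e)) (squareFreeCycleType~ m μ positive sum≡)
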